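{- Let $1>\varepsilon'>\delta>\delta'$ be a decreasing sequence of positive real numbers with each term being sufficiently small in terms of the previous one. Then there is a constant $c_\delta>0$, depending only on $\delta$, such that the following holds. Let $A\subset\mathbb{Z}$ be a finite, non-empty set, and suppose there exists some $\Gamma\subseteq A\times A$ such that $|\Gamma|\ge(1-\delta')|A|^2$ and $|A+_\Gamma A|\le(4+\delta)|A|$. Then one of the following must hold. (1) There exists a $1$-dimensional progression $P\subseteq\mathbb{Z}$ with $|P|\ge c_\delta|A|$ such that $\frac{|A\cap P|}{|P|}\ge\frac12-\varepsilon'$. (2) There exists a proper $2$-dimensional progression $Q\subseteq\mathbb{Z}$ with $|Q|\ge c_\delta|A|$ such that $\frac{|A\cap Q|}{|Q|}\ge1-\varepsilon'$.
   Context: For $\Gamma\subseteq A\times A$, the restricted sumset is $A+_\Gamma A=\{a_1+a_2:(a_1,a_2)\in\Gamma\}$. For $d\in\mathbb{N}$, a $d$-dimensional progression is a set of the form $P=\{a_0+l_1a_1+\dots+l_da_d: 1\le l_i\le L_i,\ l_i \in \mathbb{Z}\ (1\le i\le d)\}$ with $a_0,\dots,a_d\in\mathbb{Z}$ and $L_1,\dots,L_d\in\mathbb{N}$ (positive integers); it is proper if $|P|=L_1L_2\cdots L_d$. "Each term sufficiently small in terms of the previous one" means that each term is at most some positive threshold depending only on the previous term. -}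

module Defs where

import Algebra.Properties.Monoid.Sum as MonoidSum
open import Data.Fin.Base using (Fin)
open import Data.Integer.Base as ℤ using (ℤ; +_; 1ℤ)
import Data.Integer.Properties as ℤ
open import Data.List.Base using (List; _∷_; length; map; filter; deduplicate; cartesianProduct)
import Data.List.Membership.DecPropositional ℤ._≟_ as ∈ℤ
import Data.List.Membership.Propositional as List
open import Data.List.Relation.Unary.Unique.Propositional using (Unique)
import Data.List.Relation.Unary.Unique.Propositional.Properties as Unique
import Data.List.Relation.Unary.Unique.DecPropositional.Properties ℤ._≟_ as Uniqueℤ
open import Data.Nat.Base as ℕ using (ℕ)
import Data.Nat.Properties as ℕ
open import Data.Product.Base using (_×_; _,_; ∃-syntax; Σ-syntax)
open import Data.Rational.Base as ℚ using (ℚ; 0ℚ; 1ℚ; ½)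
import Data.Rational.Properties as ℚ
import Data.Rational.Solver as ℚ
open import Function.Base using (_$_)
open import Function.Bundles using (Equivalence; _⇔_)
open import Level using (0ℓ)
open import Relation.Binary.Bundles using (Setoid)
open import Relation.Binary.PropositionalEquality.Core using (_≡_; refl; sym; trans; cong; cong₂; subst)

------------------------------------------------------------------------
-- Real numbers: Cauchy sequences of rationals

private
  half-pos : ∀ {ε} → 0ℚ ℚ.< ε → 0ℚ ℚ.< ½ ℚ.* ε
  half-pos {ε} ε>0 = subst (ℚ._< ½ ℚ.* ε) (ℚ.*-zeroʳ ½) (ℚ.*-monoʳ-<-pos ½ ε>0)

  halves : ∀ ε → ½ ℚ.* ε ℚ.+ ½ ℚ.* ε ≡ ε
  halves ε = trans (sym (ℚ.*-distribʳ-+ ε ½ ½)) (ℚ.*-identityˡ ε)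

record ℝ : Set where
  constructor mkℝ
  field
    seq    : ℕ → ℚ
    cauchy : ∀ ε → 0ℚ ℚ.< ε →
             ∃[ N ] ∀ m n → N ℕ.≤ m → N ℕ.≤ n → ℚ.∣ seq m ℚ.- seq n ∣ ℚ.≤ ε

open ℝ

infix  4 _≤_ _≥_ _<_ _>_ _≈_
infixl 6 _+_ _-_
infixl 7 _*_
infix  8 -_

fromℚ : ℚ → ℝ
fromℚ q = mkℝ (λ _ → q) λ ε ε>0 → 0 , λ _ _ _ _ →
  subst (ℚ._≤ ε) (cong ℚ.∣_∣ (sym (ℚ.+-inverseʳ q))) (ℚ.<⇒≤ ε>0)

fromℕ : ℕ → ℝ
fromℕ n = fromℚ (+ n ℚ./ 1)

_+_ : ℝ → ℝ → ℝ
x + y = mkℝ (λ n → seq x n ℚ.+ seq y n) λ ε ε>0 →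
  let N₁ , p = cauchy x (½ ℚ.* ε) (half-pos ε>0)
      N₂ , q = cauchy y (½ ℚ.* ε) (half-pos ε>0)
  in N₁ ℕ.⊔ N₂ , λ m n N≤m N≤n → let open ℚ.≤-Reasoning in begin
    ℚ.∣ (seq x m ℚ.+ seq y m) ℚ.- (seq x n ℚ.+ seq y n) ∣
      ≡⟨ cong ℚ.∣_∣ (rearrange (seq x m) (seq y m) (seq x n) (seq y n)) ⟩
    ℚ.∣ (seq x m ℚ.- seq x n) ℚ.+ (seq y m ℚ.- seq y n) ∣
      ≤⟨ ℚ.∣p+q∣≤∣p∣+∣q∣ (seq x m ℚ.- seq x n) (seq y m ℚ.- seq y n) ⟩
    ℚ.∣ seq x m ℚ.- seq x n ∣ ℚ.+ ℚ.∣ seq y m ℚ.- seq y n ∣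
      ≤⟨ ℚ.+-mono-≤
           (p m n (ℕ.m⊔n≤o⇒m≤o N₁ N₂ N≤m) (ℕ.m⊔n≤o⇒m≤o N₁ N₂ N≤n))
           (q m n (ℕ.m⊔n≤o⇒n≤o N₁ N₂ N≤m) (ℕ.m⊔n≤o⇒n≤o N₁ N₂ N≤n)) ⟩
    ½ ℚ.* ε ℚ.+ ½ ℚ.* ε
      ≡⟨ halves ε ⟩
    ε ∎
  where
  open ℚ.+-*-Solver
  rearrange : ∀ a b c d → (a ℚ.+ b) ℚ.- (c ℚ.+ d) ≡ (a ℚ.- c) ℚ.+ (b ℚ.- d)
  rearrange = solve 4 (λ a b c d → (a :+ b) :- (c :+ d) := (a :- c) :+ (b :- d)) refl

-_ : ℝ → ℝ
- x = mkℝ (λ n → ℚ.- seq x n) λ ε ε>0 →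
  let N , p = cauchy x ε ε>0
  in N , λ m n N≤m N≤n → subst (ℚ._≤ ε)
       (trans (sym (ℚ.∣-p∣≡∣p∣ (seq x m ℚ.- seq x n)))
              (cong ℚ.∣_∣ (ℚ.neg-distrib-+ (seq x m) (ℚ.- seq x n))))
       (p m n N≤m N≤n)

_-_ : ℝ → ℝ → ℝ
x - y = x + (- y)

private
  eventually-bounded : ∀ x → ∃[ B ] (0ℚ ℚ.< B × ∃[ N ] ∀ n → N ℕ.≤ n → ℚ.∣ seq x n ∣ ℚ.≤ B)
  eventually-bounded x =
    let N , p = cauchy x 1ℚ (ℚ.positive⁻¹ 1ℚ)
    in 1ℚ ℚ.+ ℚ.∣ seq x N ∣
     , ℚ.+-mono-<-≤ (ℚ.positive⁻¹ 1ℚ) (ℚ.0≤∣p∣ (seq x N))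
     , N
     , λ n N≤n → let open ℚ.≤-Reasoning in begin
       ℚ.∣ seq x n ∣
         ≡⟨ cong ℚ.∣_∣ (insert (seq x n) (seq x N)) ⟩
       ℚ.∣ (seq x n ℚ.- seq x N) ℚ.+ seq x N ∣
         ≤⟨ ℚ.∣p+q∣≤∣p∣+∣q∣ (seq x n ℚ.- seq x N) (seq x N) ⟩
       ℚ.∣ seq x n ℚ.- seq x N ∣ ℚ.+ ℚ.∣ seq x N ∣
         ≤⟨ ℚ.+-monoˡ-≤ ℚ.∣ seq x N ∣ (p n N N≤n ℕ.≤-refl) ⟩
       1ℚ ℚ.+ ℚ.∣ seq x N ∣ ∎
    where
    open ℚ.+-*-Solver
    insert : ∀ a b → a ≡ (a ℚ.- b) ℚ.+ b
    insert = solve 2 (λ a b → a := (a :- b) :+ b) refl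

  *-mono-≤ : ∀ {a b c d} → 0ℚ ℚ.≤ c → 0ℚ ℚ.≤ b → a ℚ.≤ b → c ℚ.≤ d → a ℚ.* c ℚ.≤ b ℚ.* d
  *-mono-≤ {b = b} {c = c} 0≤c 0≤b a≤b c≤d = ℚ.≤-trans
    (ℚ.*-monoʳ-≤-nonNeg c {{ℚ.nonNegative 0≤c}} a≤b)
    (ℚ.*-monoˡ-≤-nonNeg b {{ℚ.nonNegative 0≤b}} c≤d)

_*_ : ℝ → ℝ → ℝ
x * y = mkℝ (λ n → seq x n ℚ.* seq y n) λ ε ε>0 →
  let X , X>0 , N₁ , boundX = eventually-bounded x
      Y , Y>0 , N₂ , boundY = eventually-bounded y
      K>0 = ℚ.+-mono-< X>0 Y>0
      instance
        K-pos : ℚ.Positive (X ℚ.+ Y)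
        K-pos = ℚ.positive K>0
        K-nz : ℚ.NonZero (X ℚ.+ Y)
        K-nz = ℚ.pos⇒nonZero (X ℚ.+ Y)
        1/K-pos : ℚ.Positive (ℚ.1/ (X ℚ.+ Y))
        1/K-pos = ℚ.1/pos⇒pos (X ℚ.+ Y)
      η = ℚ.1/ (X ℚ.+ Y) ℚ.* ε
      η>0 = subst (ℚ._< η) (ℚ.*-zeroʳ (ℚ.1/ (X ℚ.+ Y)))
              (ℚ.*-monoʳ-<-pos (ℚ.1/ (X ℚ.+ Y)) ε>0)
      N₃ , p = cauchy x η η>0
      N₄ , q = cauchy y η η>0
      M₁ = N₁ ℕ.⊔ N₂
      M₂ = N₃ ℕ.⊔ N₄
  in M₁ ℕ.⊔ M₂ , λ m n N≤m N≤n →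
    let M₁≤m = ℕ.m⊔n≤o⇒m≤o M₁ M₂ N≤m
        M₁≤n = ℕ.m⊔n≤o⇒m≤o M₁ M₂ N≤n
        M₂≤m = ℕ.m⊔n≤o⇒n≤o M₁ M₂ N≤m
        M₂≤n = ℕ.m⊔n≤o⇒n≤o M₁ M₂ N≤n
        a = seq x m ; b = seq y m ; c = seq x n ; d = seq y n
        open ℚ.≤-Reasoning
    in begin
    ℚ.∣ a ℚ.* b ℚ.- c ℚ.* d ∣
      ≡⟨ cong ℚ.∣_∣ (split a b c d) ⟩
    ℚ.∣ a ℚ.* (b ℚ.- d) ℚ.+ d ℚ.* (a ℚ.- c) ∣
      ≤⟨ ℚ.∣p+q∣≤∣p∣+∣q∣ (a ℚ.* (b ℚ.- d)) (d ℚ.* (a ℚ.- c)) ⟩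
    ℚ.∣ a ℚ.* (b ℚ.- d) ∣ ℚ.+ ℚ.∣ d ℚ.* (a ℚ.- c) ∣
      ≡⟨ cong₂ ℚ._+_ (ℚ.∣p*q∣≡∣p∣*∣q∣ a (b ℚ.- d)) (ℚ.∣p*q∣≡∣p∣*∣q∣ d (a ℚ.- c)) ⟩
    ℚ.∣ a ∣ ℚ.* ℚ.∣ b ℚ.- d ∣ ℚ.+ ℚ.∣ d ∣ ℚ.* ℚ.∣ a ℚ.- c ∣
      ≤⟨ ℚ.+-mono-≤
           (*-mono-≤ (ℚ.0≤∣p∣ (b ℚ.- d)) (ℚ.<⇒≤ X>0)
             (boundX m (ℕ.m⊔n≤o⇒m≤o N₁ N₂ M₁≤m))
             (q m n (ℕ.m⊔n≤o⇒n≤o N₃ N₄ M₂≤m) (ℕ.m⊔n≤o⇒n≤o N₃ N₄ M₂≤n)))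
           (*-mono-≤ (ℚ.0≤∣p∣ (a ℚ.- c)) (ℚ.<⇒≤ Y>0)
             (boundY n (ℕ.m⊔n≤o⇒n≤o N₁ N₂ M₁≤n))
             (p m n (ℕ.m⊔n≤o⇒m≤o N₃ N₄ M₂≤m) (ℕ.m⊔n≤o⇒m≤o N₃ N₄ M₂≤n))) ⟩
    X ℚ.* η ℚ.+ Y ℚ.* η
      ≡⟨ sym (ℚ.*-distribʳ-+ η X Y) ⟩
    (X ℚ.+ Y) ℚ.* (ℚ.1/ (X ℚ.+ Y) ℚ.* ε)
      ≡⟨ sym (ℚ.*-assoc (X ℚ.+ Y) (ℚ.1/ (X ℚ.+ Y)) ε) ⟩
    (X ℚ.+ Y) ℚ.* ℚ.1/ (X ℚ.+ Y) ℚ.* ε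
      ≡⟨ cong (ℚ._* ε) (ℚ.*-inverseʳ (X ℚ.+ Y)) ⟩
    1ℚ ℚ.* ε
      ≡⟨ ℚ.*-identityˡ ε ⟩
    ε ∎
  where
  open ℚ.+-*-Solver
  split : ∀ a b c d → a ℚ.* b ℚ.- c ℚ.* d ≡ a ℚ.* (b ℚ.- d) ℚ.+ d ℚ.* (a ℚ.- c)
  split = solve 4 (λ a b c d → a :* b :- c :* d := a :* (b :- d) :+ d :* (a :- c)) refl

_≤_ _≥_ _<_ _>_ _≈_ : ℝ → ℝ → Set
x ≤ y = ∀ ε → 0ℚ ℚ.< ε → ∃[ N ] ∀ n → N ℕ.≤ n → seq x n ℚ.≤ seq y n ℚ.+ ε
x ≥ y = y ≤ x
x < y = ∃[ ε ] (0ℚ ℚ.< ε × ∃[ N ] ∀ n → N ℕ.≤ n → seq x n ℚ.+ ε ℚ.≤ seq y n)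
x > y = y < x
x ≈ y = x ≤ y × y ≤ x

≤-refl : ∀ x → x ≤ x
≤-refl x ε ε>0 = 0 , λ n _ →
  subst (ℚ._≤ seq x n ℚ.+ ε) (ℚ.+-identityʳ (seq x n)) (ℚ.+-monoʳ-≤ (seq x n) (ℚ.<⇒≤ ε>0))

≤-trans : ∀ x y z → x ≤ y → y ≤ z → x ≤ z
≤-trans x y z x≤y y≤z ε ε>0 =
  let N₁ , p = x≤y (½ ℚ.* ε) (half-pos ε>0)
      N₂ , q = y≤z (½ ℚ.* ε) (half-pos ε>0)
  in N₁ ℕ.⊔ N₂ , λ n N≤n → let open ℚ.≤-Reasoning in begin
    seq x n
      ≤⟨ p n (ℕ.m⊔n≤o⇒m≤o N₁ N₂ N≤n) ⟩
    seq y n ℚ.+ ½ ℚ.* ε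
      ≤⟨ ℚ.+-monoˡ-≤ (½ ℚ.* ε) (q n (ℕ.m⊔n≤o⇒n≤o N₁ N₂ N≤n)) ⟩
    seq z n ℚ.+ ½ ℚ.* ε ℚ.+ ½ ℚ.* ε
      ≡⟨ trans (ℚ.+-assoc (seq z n) (½ ℚ.* ε) (½ ℚ.* ε)) (cong (seq z n ℚ.+_) (halves ε)) ⟩
    seq z n ℚ.+ ε ∎

record ℝ⁺ : Set where
  constructor mkℝ⁺
  field
    value    : ℝ
    positive : value > fromℕ 0

open ℝ⁺ public using (value)

-- Bundling the equality lets "a positive constant depending only on δ" be a
-- function ℝ⁺-setoid ⟶ₛ ℝ⁺-setoid, i.e. one that depends on the real number δ
-- and not on the Cauchy sequence representing it.
ℝ⁺-setoid : Setoid 0ℓ 0ℓ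
ℝ⁺-setoid = record
  { Carrier       = ℝ⁺
  ; _≈_           = λ x y → value x ≈ value y
  ; isEquivalence = record
    { refl  = λ {x} → ≤-refl (value x) , ≤-refl (value x)
    ; sym   = λ (p , q) → q , p
    ; trans = λ {x} {y} {z} (p , q) (r , s) →
        ≤-trans (value x) (value y) (value z) p r , ≤-trans (value z) (value y) (value x) s q
    }
  }

------------------------------------------------------------------------
-- Finite sets: duplicate-free lists, so that cardinality is length

record FinSet (X : Set) : Set where
  constructor mkFinSet
  field
    elements : List X
    unique   : Unique elements

open FinSet

infix 4 _∈_ _⊆_
infixr 7 _∩_
infixr 2 _⊗_

_∈_ : {X : Set} → X → FinSet X → Set
x ∈ A = x List.∈ elements A

_⊆_ : {X : Set} → FinSet X → FinSet X → Set
A ⊆ B = ∀ {x} → x ∈ A → x ∈ B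

∣_∣ : {X : Set} → FinSet X → ℕ
∣ A ∣ = length (elements A)

Nonempty : {X : Set} → FinSet X → Set
Nonempty A = ∃[ x ] x ∈ A

_⊗_ : {X Y : Set} → FinSet X → FinSet Y → FinSet (X × Y)
A ⊗ B = mkFinSet (cartesianProduct (elements A) (elements B))
                 (Unique.cartesianProduct⁺ (unique A) (unique B))

_∩_ : FinSet ℤ → FinSet ℤ → FinSet ℤ
A ∩ B = mkFinSet (filter (∈ℤ._∈? elements B) (elements A))
                 (Unique.filter⁺ (∈ℤ._∈? elements B) (unique A))

-- For Γ ⊆ A ⊗ A this is the restricted sumset A +_Γ A, which depends on A
-- only through Γ.
sumsetAlong : FinSet (ℤ × ℤ) → FinSet ℤ
sumsetAlong Γ = mkFinSet (deduplicate ℤ._≟_ sums) (Uniqueℤ.deduplicate-! sums)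
  where
  sums : List ℤ
  sums = map (λ (a₁ , a₂) → a₁ ℤ.+ a₂) (elements Γ)

------------------------------------------------------------------------
-- Progressions

open MonoidSum ℤ.+-0-monoid using () renaming (sum to ∑)
open MonoidSum ℕ.*-1-monoid using () renaming (sum to ∏)

record Progression (d : ℕ) : Set where
  field
    set       : FinSet ℤ
    base      : ℤ
    step      : Fin d → ℤ
    len       : Fin d → ℕ
    len≥1     : ∀ i → 1 ℕ.≤ len i
    members   : ∀ x → x ∈ set ⇔
                  (Σ[ l ∈ (Fin d → ℤ) ]
                     (∀ i → 1ℤ ℤ.≤ l i × l i ℤ.≤ + len i)
                   × x ≡ base ℤ.+ ∑ (λ i → l i ℤ.* step i))

open Progression
open Progression public using (set)

-- The steps are allowed to be dependent (or zero), so ∣ set P ∣ can be smaller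
-- than the product of the lengths.
Proper : ∀ {d} → Progression d → Set
Proper P = ∣ set P ∣ ≡ ∏ (len P)

∣set∣-nonZero : ∀ {d} (P : Progression d) → ℕ.NonZero ∣ set P ∣
∣set∣-nonZero P = nonZero (elements (set P)) $ Equivalence.from
  (members P (base P ℤ.+ ∑ (λ i → 1ℤ ℤ.* step P i)))
  ((λ _ → 1ℤ) , (λ i → ℤ.≤-refl , ℤ.+≤+ (len≥1 P i)) , refl)
  where
  nonZero : ∀ {x : ℤ} xs → x List.∈ xs → ℕ.NonZero (length xs)
  nonZero (_ ∷ _) _ = _

density : ∀ {d} → FinSet ℤ → Progression d → ℚ
density A P = ℚ._/_ (+ ∣ A ∩ set P ∣) ∣ set P ∣ {{∣set∣-nonZero P}}

-- The set D = A +_Γ A contains almost all of a + A for almost all a ∈ A.  Replace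
-- (X, Y) = (A, A) by (X ∪ (A + e), Y ∩ (A − e)) as long as this enlarges X for some
-- popular e.  When the process stabilises, a translate U ⊆ A + A of X satisfies
-- |U| ≤ (4 + ξ) |A|, contains almost all of almost every a + A, and is almost
-- invariant under a positive proportion of the differences of A.  Cut ℤ into
-- windows of length M, the largest of these almost periods.  On average
-- |U ∩ 2J| ≤ (4 + ξ) |A ∩ J|, so some window J, folded modulo M, gives S ⊆ ℤ/M with
-- S + S almost contained in a set D of size at most (2 + ζ) |S|.
--
-- In ℤ/M apply Dyson's e-transform to the pair (S, S).  If it gets stuck, S is
-- almost contained in a set with many periods, of size at most (2 + ξ) |S|, and S
-- fills half of a coset of the subgroup of periods: a 1-dimensional progression.
-- Otherwise it ends in a pair (X, Z) with S ⊆ X and Z tiny, and the differences of Z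
-- are almost periods of X.  Along a geodesic for the iterated sumsets of the almost
-- periods one finds a subgroup H and a direction v such that H + {0, v, …, L v} are
-- almost periods, of comparable number, and lattice reduction turns them into a box
-- {i a + j b}.  Smooth S over the box and repeat: either S fills half of a coset
-- again, or the smoothed set is hardly larger than S, and then S nearly fills some
-- translate of the box: a proper 2-dimensional progression.
--
-- All this works once δ ≤ 1 / C(k), where 1 / (k + 2) ≤ ε′.  The threshold for δ is
-- the supremum over k of min (ε′ − 1 / (k + 2), 1 / (2 C(k) + k + 1)), a Lipschitz
-- function of the real number ε′; the index k is one where it is attained.

module Submission where

open import Data.Bool.Base using (Bool; true; false; not; _∧_; _∨_; if_then_else_)
open import Data.Empty using (⊥; ⊥-elim)
open import Data.List.Base using (List; []; _∷_)
open import Data.Product.Base using (_×_; _,_; proj₁; proj₂; Σ-syntax; ∃-syntax)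
open import Data.Sum.Base using (_⊎_; inj₁; inj₂; [_,_]′)
open import Data.Unit.Base using (⊤; tt)
open import Relation.Binary.PropositionalEquality
open import Relation.Nullary using (¬_; yes; no)

-- Linear arithmetic

module Lin where

  open import Data.Bool.Base using (T)
  open import Data.Bool.Properties using (T-∧)
  open import Data.Nat.Base
  open import Data.Nat.Properties
  open import Function.Bundles using (Equivalence)
  open import Algebra.Properties.CommutativeSemigroup +-commutativeSemigroup
    using (x∙yz≈y∙xz) renaming (interchange to +-interchange)
  open import Algebra.Properties.CommutativeSemigroup *-commutativeSemigroup
    using () renaming (x∙yz≈y∙xz to *-swap)

  infixl 6 _:+_
  infixl 7 _:*_
  infix 4 _:≤_

  data Expr : Set where
    con       : ℕ → Expr
    var       : ℕ → Expr
    _:+_ _:*_ : Expr → Expr → Expr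

  Env = List ℕ

  lookupEnv : Env → ℕ → ℕ
  lookupEnv []      _       = 0
  lookupEnv (x ∷ _) zero    = x
  lookupEnv (_ ∷ ρ) (suc i) = lookupEnv ρ i

  eval : Env → Expr → ℕ
  eval ρ (con n)  = n
  eval ρ (var i)  = lookupEnv ρ i
  eval ρ (e :+ f) = eval ρ e + eval ρ f
  eval ρ (e :* f) = eval ρ e * eval ρ f

  private
    Mono = List ℕ
    Poly = List (ℕ × Mono)

    evalM : Env → Mono → ℕ
    evalM ρ []      = 1
    evalM ρ (i ∷ m) = lookupEnv ρ i * evalM ρ m

    evalP : Env → Poly → ℕ
    evalP ρ []            = 0
    evalP ρ ((c , m) ∷ p) = c * evalM ρ m + evalP ρ p

    insert : ℕ → Mono → Mono
    insert i []      = i ∷ []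
    insert i (j ∷ m) = if i ≤ᵇ j then i ∷ j ∷ m else j ∷ insert i m

    _*M_ : Mono → Mono → Mono
    []      *M n = n
    (i ∷ m) *M n = insert i (m *M n)

    eqM : Mono → Mono → Bool
    eqM []      []      = true
    eqM (i ∷ m) (j ∷ n) = (i ≡ᵇ j) ∧ eqM m n
    eqM _       _       = false

    add : ℕ → Mono → Poly → Poly
    add c m []            = (c , m) ∷ []
    add c m ((d , n) ∷ p) = if eqM m n then (c + d , n) ∷ p else (d , n) ∷ add c m p

    _+P_ : Poly → Poly → Poly
    []            +P q = q
    ((c , m) ∷ p) +P q = add c m (p +P q)

    scale : ℕ → Mono → Poly → Poly
    scale c m []            = []
    scale c m ((d , n) ∷ p) = add (c * d) (m *M n) (scale c m p)

    _*P_ : Poly → Poly → Poly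
    []            *P q = []
    ((c , m) ∷ p) *P q = scale c m q +P (p *P q)

    norm : Expr → Poly
    norm (con n)  = (n , []) ∷ []
    norm (var i)  = (1 , i ∷ []) ∷ []
    norm (e :+ f) = norm e +P norm f
    norm (e :* f) = norm e *P norm f

    take : Mono → Poly → ℕ × Poly
    take m []            = 0 , []
    take m ((d , n) ∷ q) = if eqM m n then (d , q) else (let e , q′ = take m q in e , (d , n) ∷ q′)

    _⊑_ : Poly → Poly → Bool
    []            ⊑ q = true
    ((c , m) ∷ p) ⊑ q = let d , q′ = take m q in (c ≤ᵇ d) ∧ (p ⊑ q′)

    ∧-T : ∀ {a b} → T (a ∧ b) → T a × T b
    ∧-T = Equivalence.to T-∧

    eqM-sound : ∀ ρ m n → T (eqM m n) → evalM ρ m ≡ evalM ρ n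
    eqM-sound ρ []      []      _ = refl
    eqM-sound ρ (i ∷ m) (j ∷ n) t =
      let p , q = ∧-T t in cong₂ _*_ (cong (lookupEnv ρ) (≡ᵇ⇒≡ i j p)) (eqM-sound ρ m n q)

    insert-sound : ∀ ρ i m → evalM ρ (insert i m) ≡ lookupEnv ρ i * evalM ρ m
    insert-sound ρ i []      = refl
    insert-sound ρ i (j ∷ m) with i ≤ᵇ j
    ... | true  = refl
    ... | false = trans (cong (lookupEnv ρ j *_) (insert-sound ρ i m))
                        (*-swap (lookupEnv ρ j) (lookupEnv ρ i) (evalM ρ m))

    *M-sound : ∀ ρ m n → evalM ρ (m *M n) ≡ evalM ρ m * evalM ρ n
    *M-sound ρ []      n = sym (*-identityˡ _)
    *M-sound ρ (i ∷ m) n = trans (insert-sound ρ i (m *M n))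
      (trans (cong (lookupEnv ρ i *_) (*M-sound ρ m n)) (sym (*-assoc (lookupEnv ρ i) _ _)))

    add-sound : ∀ ρ c m p → evalP ρ (add c m p) ≡ c * evalM ρ m + evalP ρ p
    add-sound ρ c m []            = refl
    add-sound ρ c m ((d , n) ∷ p) with eqM m n in eq
    ... | false = trans (cong (d * evalM ρ n +_) (add-sound ρ c m p))
                        (x∙yz≈y∙xz (d * evalM ρ n) (c * evalM ρ m) (evalP ρ p))
    ... | true  = trans (cong (_+ evalP ρ p) (trans (*-distribʳ-+ (evalM ρ n) c d)
                    (cong (λ x → c * x + d * evalM ρ n) (sym (eqM-sound ρ m n (subst T (sym eq) tt))))))
                  (+-assoc (c * evalM ρ m) _ _)

    +P-sound : ∀ ρ p q → evalP ρ (p +P q) ≡ evalP ρ p + evalP ρ q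
    +P-sound ρ []            q = refl
    +P-sound ρ ((c , m) ∷ p) q = trans (add-sound ρ c m (p +P q))
      (trans (cong (c * evalM ρ m +_) (+P-sound ρ p q)) (sym (+-assoc (c * evalM ρ m) _ _)))

    scale-sound : ∀ ρ c m p → evalP ρ (scale c m p) ≡ c * evalM ρ m * evalP ρ p
    scale-sound ρ c m []            = sym (*-zeroʳ (c * evalM ρ m))
    scale-sound ρ c m ((d , n) ∷ p) = trans (add-sound ρ (c * d) (m *M n) (scale c m p))
      (trans (cong₂ _+_ (trans (cong (c * d *_) (*M-sound ρ m n)) ([m*n]*[o*p]≡[m*o]*[n*p] c d _ _))
                        (scale-sound ρ c m p))
             (sym (*-distribˡ-+ (c * evalM ρ m) (d * evalM ρ n) (evalP ρ p))))

    *P-sound : ∀ ρ p q → evalP ρ (p *P q) ≡ evalP ρ p * evalP ρ q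
    *P-sound ρ []            q = refl
    *P-sound ρ ((c , m) ∷ p) q = trans (+P-sound ρ (scale c m q) (p *P q))
      (trans (cong₂ _+_ (scale-sound ρ c m q) (*P-sound ρ p q))
             (sym (*-distribʳ-+ (evalP ρ q) (c * evalM ρ m) (evalP ρ p))))

    norm-sound : ∀ ρ e → evalP ρ (norm e) ≡ eval ρ e
    norm-sound ρ (con n)  = trans (+-identityʳ _) (*-identityʳ n)
    norm-sound ρ (var i)  = trans (+-identityʳ _) (trans (*-identityˡ _) (*-identityʳ _))
    norm-sound ρ (e :+ f) = trans (+P-sound ρ (norm e) (norm f)) (cong₂ _+_ (norm-sound ρ e) (norm-sound ρ f))
    norm-sound ρ (e :* f) = trans (*P-sound ρ (norm e) (norm f)) (cong₂ _*_ (norm-sound ρ e) (norm-sound ρ f))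

    take-sound : ∀ ρ m q → evalP ρ q ≡ proj₁ (take m q) * evalM ρ m + evalP ρ (proj₂ (take m q))
    take-sound ρ m []            = refl
    take-sound ρ m ((d , n) ∷ q) with eqM m n in eq
    ... | true  = cong (λ x → d * x + evalP ρ q) (sym (eqM-sound ρ m n (subst T (sym eq) tt)))
    ... | false = trans (cong (d * evalM ρ n +_) (take-sound ρ m q))
                        (x∙yz≈y∙xz (d * evalM ρ n) (proj₁ (take m q) * evalM ρ m) (evalP ρ (proj₂ (take m q))))

    ⊑-sound : ∀ ρ p q → T (p ⊑ q) → evalP ρ p ≤ evalP ρ q
    ⊑-sound ρ []            q t = z≤n
    ⊑-sound ρ ((c , m) ∷ p) q t =
      let t₁ , t₂ = ∧-T t in
      subst (c * evalM ρ m + evalP ρ p ≤_) (sym (take-sound ρ m q))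
        (+-mono-≤ (*-monoˡ-≤ (evalM ρ m) (≤ᵇ⇒≤ c _ t₁)) (⊑-sound ρ p _ t₂))

  data Ineq : Set where
    _:≤_ : Expr → Expr → Ineq

  ⟦_⟧≤ : Ineq → Env → Set
  ⟦ l :≤ r ⟧≤ ρ = eval ρ l ≤ eval ρ r

  Hyps : List Ineq → Env → Set
  Hyps []       ρ = ⊤
  Hyps (h ∷ hs) ρ = ⟦ h ⟧≤ ρ × Hyps hs ρ

  private
    lhs rhs : List Expr → List Ineq → Expr
    lhs (c ∷ cs) ((l :≤ r) ∷ hs) = c :* l :+ lhs cs hs
    lhs _        _               = con 0
    rhs (c ∷ cs) ((l :≤ r) ∷ hs) = c :* r :+ rhs cs hs
    rhs _        _               = con 0

    lhs≤rhs : ∀ ρ cs hs → Hyps hs ρ → eval ρ (lhs cs hs) ≤ eval ρ (rhs cs hs)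
    lhs≤rhs ρ []       hs              _       = z≤n
    lhs≤rhs ρ (c ∷ cs) []              _       = z≤n
    lhs≤rhs ρ (c ∷ cs) ((l :≤ r) ∷ hs) (h , H) =
      +-mono-≤ (*-monoʳ-≤ (eval ρ c) h) (lhs≤rhs ρ cs hs H)

  abstract
    -- A Farkas certificate: (k + 1) (b − a) = Σᵢ cᵢ (rᵢ − lᵢ) + (a polynomial with
    -- coefficients in ℕ), with the subtractions moved to the other side.
    farkas : ∀ (ρ : Env) (hs : List Ineq) (a b : Expr) (k : ℕ) (cs : List Expr) →
             {T ((norm (con (suc k) :* a :+ rhs cs hs)) ⊑ (norm (con (suc k) :* b :+ lhs cs hs)))} →
             Hyps hs ρ → eval ρ a ≤ eval ρ b
    farkas ρ hs a b k cs {t} H = *-cancelˡ-≤ (suc k)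
      (+-cancelʳ-≤ (eval ρ (rhs cs hs)) _ _
        (≤-trans (subst₂ _≤_ (norm-sound ρ (con (suc k) :* a :+ rhs cs hs))
                             (norm-sound ρ (con (suc k) :* b :+ lhs cs hs))
                    (⊑-sound ρ (norm (con (suc k) :* a :+ rhs cs hs)) (norm (con (suc k) :* b :+ lhs cs hs)) t))
                 (+-monoʳ-≤ (suc k * eval ρ b) (lhs≤rhs ρ cs hs H))))

    ring-≡ : ∀ (ρ : Env) (a b : Expr) → {T (norm a ⊑ norm b)} → {T (norm b ⊑ norm a)} → eval ρ a ≡ eval ρ b
    ring-≡ ρ a b {p} {q} = ≤-antisym
      (subst₂ _≤_ (norm-sound ρ a) (norm-sound ρ b) (⊑-sound ρ (norm a) (norm b) p))
      (subst₂ _≤_ (norm-sound ρ b) (norm-sound ρ a) (⊑-sound ρ (norm b) (norm a) q))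

  pattern x0 = var 0
  pattern x1 = var 1
  pattern x2 = var 2
  pattern x3 = var 3
  pattern x4 = var 4
  pattern x5 = var 5
  pattern x6 = var 6
  pattern x7 = var 7
  pattern x8 = var 8
  pattern x9 = var 9

module Sum where

  open Lin public
  open import Data.Bool.Base using (T)
  open import Data.Nat.Base public
  open import Data.Nat.Properties public

  ⟦_⟧ : Bool → ℕ
  ⟦ true  ⟧ = 1
  ⟦ false ⟧ = 0

  ⟦⟧≤1 : ∀ b → ⟦ b ⟧ ≤ 1
  ⟦⟧≤1 true  = ≤-refl
  ⟦⟧≤1 false = z≤n

  ⟦⟧-mono : ∀ {a b} → (a ≡ true → b ≡ true) → ⟦ a ⟧ ≤ ⟦ b ⟧
  ⟦⟧-mono {false} f = z≤n
  ⟦⟧-mono {true} {b} f rewrite f refl = ≤-refl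

  ⟦⟧-true : ∀ {b} → 0 < ⟦ b ⟧ → b ≡ true
  ⟦⟧-true {true} _ = refl

  ∑ : ℕ → (ℕ → ℕ) → ℕ
  ∑ zero    f = 0
  ∑ (suc n) f = f n + ∑ n f

  ∑-cong : ∀ n {f g} → (∀ i → i < n → f i ≡ g i) → ∑ n f ≡ ∑ n g
  ∑-cong zero    h = refl
  ∑-cong (suc n) h = cong₂ _+_ (h n ≤-refl) (∑-cong n (λ i i<n → h i (m≤n⇒m≤1+n i<n)))

  ∑-mono : ∀ n {f g} → (∀ i → i < n → f i ≤ g i) → ∑ n f ≤ ∑ n g
  ∑-mono zero    h = z≤n
  ∑-mono (suc n) h = +-mono-≤ (h n ≤-refl) (∑-mono n (λ i i<n → h i (m≤n⇒m≤1+n i<n)))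

  ∑-+ : ∀ n f g → ∑ n (λ i → f i + g i) ≡ ∑ n f + ∑ n g
  ∑-+ zero    f g = refl
  ∑-+ (suc n) f g rewrite ∑-+ n f g = (ring-≡ (f n ∷ g n ∷ ∑ n f ∷ ∑ n g ∷ []) (x0 :+ x1 :+ (x2 :+ x3)) (x0 :+ x2 :+ (x1 :+ x3)))

  ∑-*ˡ : ∀ n c f → ∑ n (λ i → c * f i) ≡ c * ∑ n f
  ∑-*ˡ zero    c f = sym (*-zeroʳ c)
  ∑-*ˡ (suc n) c f rewrite ∑-*ˡ n c f = sym (*-distribˡ-+ c (f n) (∑ n f))

  ∑-const : ∀ n c → ∑ n (λ _ → c) ≡ n * c
  ∑-const zero    c = refl
  ∑-const (suc n) c = cong (c +_) (∑-const n c)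

  ∑-zero : ∀ n → ∑ n (λ _ → 0) ≡ 0
  ∑-zero zero    = refl
  ∑-zero (suc n) = ∑-zero n

  ∑-swap : ∀ m n (f : ℕ → ℕ → ℕ) → ∑ m (λ i → ∑ n (λ j → f i j)) ≡ ∑ n (λ j → ∑ m (λ i → f i j))
  ∑-swap zero    n f = sym (∑-zero n)
  ∑-swap (suc m) n f = trans (cong (∑ n (f m) +_) (∑-swap m n f)) (sym (∑-+ n (f m) _))

  ∑-point : ∀ n f i → i < n → f i ≤ ∑ n f
  ∑-point (suc n) f i i<1+n with i ≟ n
  ... | yes refl = m≤m+n _ _

  ... | no  i≢n  = ≤-trans (∑-point n f i (≤∧≢⇒< (s≤s⁻¹ i<1+n) i≢n)) (m≤n+m _ _)

  ∑-< : ∀ n {f g} → ∑ n f < ∑ n g → ∃[ i ] i < n × f i < g i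
  ∑-< (suc n) {f} {g} h with f n <? g n
  ... | yes p = n , ≤-refl , p

  ... | no ¬p = let i , i<n , q = ∑-< n {f} {g} (+-cancelˡ-< (f n) _ _ (<-≤-trans h (+-monoˡ-≤ _ (≮⇒≥ ¬p))))
                in i , m≤n⇒m≤1+n i<n , q

  ∑-split : ∀ m n f → ∑ (m + n) f ≡ ∑ m f + ∑ n (λ i → f (m + i))
  ∑-split m zero    f = trans (cong (λ k → ∑ k f) (+-identityʳ m)) (sym (+-identityʳ _))
  ∑-split m (suc n) f rewrite +-suc m n | ∑-split m n f =
    (ring-≡ (f (m + n) ∷ ∑ m f ∷ ∑ n (λ i → f (m + i)) ∷ []) (x0 :+ (x1 :+ x2)) (x1 :+ (x0 :+ x2)))

  ∑-blocks : ∀ k M f → ∑ (k * M) f ≡ ∑ k (λ j → ∑ M (λ r → f (j * M + r)))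
  ∑-blocks zero    M f = refl
  ∑-blocks (suc k) M f = trans (cong (λ n → ∑ n f) (+-comm M (k * M)))
    (trans (∑-split (k * M) M f) (trans (+-comm (∑ (k * M) f) _)
      (cong (∑ M (λ r → f (k * M + r)) +_) (∑-blocks k M f))))

  ∑-monoˡ : ∀ {m n} f → m ≤ n → ∑ m f ≤ ∑ n f
  ∑-monoˡ {m} {n} f m≤n with k , refl ← m≤n⇒∃[o]m+o≡n m≤n =
    ≤-trans (m≤m+n _ _) (≤-reflexive (sym (∑-split m k f)))

  δ-eq : ∀ i → (i ≡ᵇ i) ≡ true
  δ-eq zero    = refl
  δ-eq (suc i) = δ-eq i

  δ-≡ : ∀ {i j} → (i ≡ᵇ j) ≡ true → i ≡ j
  δ-≡ {i} {j} p = ≡ᵇ⇒≡ i j (subst T (sym p) tt)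

  δ-≢ : ∀ {i j} → i ≢ j → (i ≡ᵇ j) ≡ false
  δ-≢ {i} {j} i≢j with i ≡ᵇ j in eq
  ... | false = refl
  ... | true  = ⊥-elim (i≢j (δ-≡ eq))

  ∑-δ0 : ∀ n j → n ≤ j → ∀ (f : ℕ → ℕ) → ∑ n (λ i → ⟦ i ≡ᵇ j ⟧ * f i) ≡ 0
  ∑-δ0 zero    j _   f = refl
  ∑-δ0 (suc n) j n<j f rewrite δ-≢ (<⇒≢ n<j) = ∑-δ0 n j (<⇒≤ n<j) f

  ∑-δ : ∀ n j → j < n → ∀ (f : ℕ → ℕ) → ∑ n (λ i → ⟦ i ≡ᵇ j ⟧ * f i) ≡ f j
  ∑-δ (suc n) j j<1+n f with n ≟ j
  ... | yes refl rewrite δ-eq n = trans (cong (λ z → f n + 0 + z) (∑-δ0 n n ≤-refl f)) (ring-≡ (f n ∷ []) (x0 :+ con 0 :+ con 0) (x0))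

  ... | no  n≢j rewrite δ-≢ n≢j = ∑-δ n j (≤∧≢⇒< (s≤s⁻¹ j<1+n) (λ e → n≢j (sym e))) f

  -- Reindexing along a bijection of [0,n), by double counting the pairs (i, π i).
  ∑-bij : ∀ n (π ρ : ℕ → ℕ) → (∀ i → i < n → π i < n) → (∀ i → i < n → ρ i < n) →
          (∀ i → i < n → ρ (π i) ≡ i) → (∀ i → i < n → π (ρ i) ≡ i) →
          ∀ (f : ℕ → ℕ) → ∑ n (λ i → f (π i)) ≡ ∑ n f
  ∑-bij n π ρ π< ρ< ρπ πρ f = trans (∑-cong n (λ i i<n → sym (∑-δ n (π i) (π< i i<n) f)))
    (trans (∑-swap n n (λ i j → ⟦ j ≡ᵇ π i ⟧ * f j)) (∑-cong n (λ j j<n →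
      trans (∑-cong n (λ i i<n → cong (λ b → ⟦ b ⟧ * f j) (flip i j i<n j<n)))
            (∑-δ n (ρ j) (ρ< j j<n) (λ _ → f j)))))
    where
    flip : ∀ i j → i < n → j < n → (j ≡ᵇ π i) ≡ (i ≡ᵇ ρ j)
    flip i j i<n j<n with j ≡ᵇ π i in p | i ≡ᵇ ρ j in q
    ... | true  | true  = refl
    ... | false | false = refl
    ... | true  | false = trans (sym (δ-eq i)) (trans (cong (i ≡ᵇ_) (trans (sym (ρπ i i<n)) (cong ρ (sym (δ-≡ p))))) q)
    ... | false | true  = trans (sym p) (trans (cong (j ≡ᵇ_) (trans (cong π (δ-≡ q)) (πρ j j<n))) (δ-eq j))

  ∑-exists : ∀ n f → 0 < ∑ n f → ∃[ i ] i < n × 0 < f i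
  ∑-exists n f h = ∑-< n (≤-<-trans (≤-reflexive (∑-zero n)) h)

  ∑-atmost1 : ∀ n (b : ℕ → Bool) → (∀ i j → i < n → j < n → b i ≡ true → b j ≡ true → i ≡ j) →
              ∑ n (λ i → ⟦ b i ⟧) ≤ 1
  ∑-atmost1 zero    b u = z≤n
  ∑-atmost1 (suc n) b u with b n in eq
  ... | false = ∑-atmost1 n b (λ i j i<n j<n → u i j (m≤n⇒m≤1+n i<n) (m≤n⇒m≤1+n j<n))
  ... | true  = s≤s (≤-trans (∑-mono n {g = λ _ → 0} none) (≤-reflexive (∑-zero n)))
    where
    none : ∀ i → i < n → ⟦ b i ⟧ ≤ 0
    none i i<n with b i in q
    ... | false = z≤n
    ... | true  = ⊥-elim (<⇒≢ i<n (u i n (m≤n⇒m≤1+n i<n) ≤-refl q eq))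

  ∧-intro : ∀ {a b} → a ≡ true → b ≡ true → a ∧ b ≡ true
  ∧-intro refl refl = refl

  ∧-elimˡ : ∀ {a b} → a ∧ b ≡ true → a ≡ true
  ∧-elimˡ {true} _ = refl

  ∧-elimʳ : ∀ {a b} → a ∧ b ≡ true → b ≡ true
  ∧-elimʳ {true} p = p

  true≢false : ∀ {b : Bool} {A : Set} → b ≡ true → b ≡ false → A
  true≢false refl ()

  bool : ∀ (b : Bool) → (b ≡ true) ⊎ (b ≡ false)
  bool true  = inj₁ refl
  bool false = inj₂ refl

  abstract
    ≤ᵇ-true : ∀ {m n} → (m ≤ᵇ n) ≡ true → m ≤ n
    ≤ᵇ-true {m} {n} p = ≤ᵇ⇒≤ m n (subst Data.Bool.Base.T (sym p) tt)

  ≤ᵇ-intro : ∀ {m n} → m ≤ n → (m ≤ᵇ n) ≡ true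
  ≤ᵇ-intro {m} {n} p with m ≤ᵇ n | ≤⇒≤ᵇ p
  ... | true | _ = refl

  ≤ᵇ-false : ∀ {m n} → (m ≤ᵇ n) ≡ false → n < m
  ≤ᵇ-false {m} {n} p = ≰⇒> (λ q → true≢false (≤ᵇ-intro q) p)

  ⟦∧⟧ : ∀ a b → ⟦ a ∧ b ⟧ ≡ ⟦ a ⟧ * ⟦ b ⟧
  ⟦∧⟧ true  b = sym (+-identityʳ _)
  ⟦∧⟧ false b = refl

  ⟦⟧-split : ∀ a b → ⟦ a ⟧ ≡ ⟦ a ∧ b ⟧ + ⟦ a ∧ not b ⟧
  ⟦⟧-split true  true  = refl
  ⟦⟧-split true  false = refl
  ⟦⟧-split false b     = refl

  ⟦⟧-cover : ∀ a b c → (a ≡ true → b ≡ false → c ≡ true) → ⟦ a ⟧ ≤ ⟦ b ⟧ + ⟦ c ⟧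
  ⟦⟧-cover false b     c h = z≤n
  ⟦⟧-cover true  true  c h = s≤s z≤n
  ⟦⟧-cover true  false c h rewrite h refl refl = ≤-refl

  ∧-false : ∀ {a b} → a ∧ b ≡ false → a ≡ true → b ≡ false
  ∧-false p refl = p

  not-false : ∀ {b} → not b ≡ false → b ≡ true
  not-false {true} _ = refl

  not-true : ∀ {b} → not b ≡ true → b ≡ false
  not-true {false} _ = refl

  ∧-not : ∀ {a b} → a ≡ true → b ≡ false → a ∧ not b ≡ true
  ∧-not refl refl = refl

  ∧-notʳ : ∀ {a b} → a ∧ not b ≡ true → b ≡ false
  ∧-notʳ {true} {false} _ = refl

  ∨-elim : ∀ {a b} → a ∨ b ≡ true → (a ≡ true) ⊎ (b ≡ true)
  ∨-elim {true}  p = inj₁ refl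
  ∨-elim {false} p = inj₂ p

  ∨-introʳ : ∀ a {b} → b ≡ true → a ∨ b ≡ true
  ∨-introʳ true  _ = refl
  ∨-introʳ false p = p

  ∨-introˡ : ∀ {a} b → a ≡ true → a ∨ b ≡ true
  ∨-introˡ b refl = refl

  ∨-falseˡ : ∀ {a b} → a ∨ b ≡ false → a ≡ false
  ∨-falseˡ {false} _ = refl

  ∨-falseʳ : ∀ {a b} → a ∨ b ≡ false → b ≡ false
  ∨-falseʳ {false} p = p

  iff-≡ : ∀ {a b} → (a ≡ true → b ≡ true) → (b ≡ true → a ≡ true) → a ≡ b
  iff-≡ {true}  {b}     f g = sym (f refl)
  iff-≡ {false} {false} f g = refl
  iff-≡ {false} {true}  f g = g refl

  abstract
    anyN : ℕ → (ℕ → Bool) → Bool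
    anyN zero    f = false
    anyN (suc n) f = f n ∨ anyN n f

    anyN-intro : ∀ n f i → i < n → f i ≡ true → anyN n f ≡ true
    anyN-intro (suc n) f i i<1+n p with m≤n⇒m<n∨m≡n (s≤s⁻¹ i<1+n)
    ... | inj₁ i<n  = ∨-introʳ (f n) (anyN-intro n f i i<n p)
    ... | inj₂ refl = ∨-introˡ _ p

    anyN-elim : ∀ n f → anyN n f ≡ true → ∃[ i ] i < n × f i ≡ true
    anyN-elim (suc n) f p with ∨-elim {f n} p
    ... | inj₁ q = n , ≤-refl , q
    ... | inj₂ q = let i , i<n , r = anyN-elim n f q in i , m≤n⇒m≤1+n i<n , r

  crossing : ∀ n (f : ℕ → Bool) → f 0 ≡ true → f n ≡ false → ∃[ a ] a < n × f a ≡ true × f (suc a) ≡ false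
  crossing zero    f p q = true≢false p q
  crossing (suc n) f p q with bool (f n)
  ... | inj₁ r = n , ≤-refl , r , q
  ... | inj₂ r = let a , a<n , u , v = crossing n f p r in a , m≤n⇒m≤1+n a<n , u , v

  least : ∀ (Q : ℕ → Bool) n → Q n ≡ true → ∃[ d ] d ≤ n × Q d ≡ true × (∀ e → e < d → Q e ≡ false)
  least Q n p with bool (anyN n Q)
  ... | inj₂ none = n , ≤-refl , p , λ e e<n → not-true⇒false (λ q → true≢false (anyN-intro n Q e e<n q) none)
    where
    not-true⇒false : ∀ {b} → (b ≡ true → ⊥) → b ≡ false
    not-true⇒false {true}  f = ⊥-elim (f refl)
    not-true⇒false {false} f = refl
  ... | inj₁ some = let e , e<n , q = anyN-elim n Q some in rec n e e<n q
    where
    rec : ∀ n e → e < n → Q e ≡ true → ∃[ d ] d ≤ n × Q d ≡ true × (∀ e → e < d → Q e ≡ false)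
    rec (suc n) e e<n q with bool (anyN e Q)
    ... | inj₁ some = let e′ , e′<e , q′ = anyN-elim e Q some
                          d , d≤ , r , m = rec n e′ (<-≤-trans e′<e (s≤s⁻¹ e<n)) q′ in d , m≤n⇒m≤1+n d≤ , r , m
    ... | inj₂ none = e , <⇒≤ e<n , q , λ e′ e′<e → case e′ e′<e (bool (Q e′))
      where
      case : ∀ e′ → e′ < e → (Q e′ ≡ true) ⊎ (Q e′ ≡ false) → Q e′ ≡ false
      case e′ e′<e (inj₁ q′) = true≢false (anyN-intro e Q e′ e′<e q′) none
      case e′ e′<e (inj₂ q′) = q′

-- Finite abelian groups

module Grp where

  open Sum
  open import Data.Bool.Base using (T)
  open import Data.Bool.Properties using (T-∧)
  open import Function.Base using (_∘_)
  open import Function.Bundles using (Equivalence)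

  record FinAb : Set₁ where
    infixl 6 _⊕_
    infix  8 ⊖_
    field
      Carrier : Set
      _⊕_     : Carrier → Carrier → Carrier
      ⊖_      : Carrier → Carrier
      𝟘       : Carrier
      assoc   : ∀ x y z → (x ⊕ y) ⊕ z ≡ x ⊕ (y ⊕ z)
      comm    : ∀ x y → x ⊕ y ≡ y ⊕ x
      idˡ     : ∀ x → 𝟘 ⊕ x ≡ x
      invˡ    : ∀ x → ⊖ x ⊕ x ≡ 𝟘
      size    : ℕ
      enum    : ℕ → Carrier
      index   : Carrier → ℕ
      index<  : ∀ x → index x < size
      enum-index : ∀ x → enum (index x) ≡ x
      index-enum : ∀ i → i < size → index (enum i) ≡ i

    infixl 6 _⊝_
    _⊝_ : Carrier → Carrier → Carrier
    x ⊝ y = x ⊕ (⊖ y)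

  data GExpr : Set where
    gv        : ℕ → GExpr
    g0        : GExpr
    _⊞_ _⊟_   : GExpr → GExpr → GExpr
    ⊟_        : GExpr → GExpr
  infixl 6 _⊞_ _⊟_
  infix 8 ⊟_

  private
    insertS : ℕ → List ℕ → List ℕ
    insertS i []      = i ∷ []
    insertS i (j ∷ m) = if i ≤ᵇ j then i ∷ j ∷ m else j ∷ insertS i m

    mergeS : List ℕ → List ℕ → List ℕ
    mergeS []      n = n
    mergeS (i ∷ m) n = insertS i (mergeS m n)

    eqL : List ℕ → List ℕ → Bool
    eqL []      []      = true
    eqL (i ∷ m) (j ∷ n) = (i ≡ᵇ j) ∧ eqL m n
    eqL _       _       = false

    pos neg : GExpr → List ℕ
    pos (gv i)  = i ∷ []
    pos g0      = []
    pos (e ⊞ f) = mergeS (pos e) (pos f)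
    pos (e ⊟ f) = mergeS (pos e) (neg f)
    pos (⊟ e)   = neg e
    neg (gv i)  = []
    neg g0      = []
    neg (e ⊞ f) = mergeS (neg e) (neg f)
    neg (e ⊟ f) = mergeS (neg e) (pos f)
    neg (⊟ e)   = pos e

  module Counting (G : FinAb) where
    open FinAb G public

    private
      lookupG : List Carrier → ℕ → Carrier
      lookupG []      _       = 𝟘
      lookupG (x ∷ _) zero    = x
      lookupG (_ ∷ ρ) (suc i) = lookupG ρ i

    ⟦_⟧G : GExpr → List Carrier → Carrier
    ⟦ gv i  ⟧G ρ = lookupG ρ i
    ⟦ g0    ⟧G ρ = 𝟘
    ⟦ e ⊞ f ⟧G ρ = ⟦ e ⟧G ρ ⊕ ⟦ f ⟧G ρ
    ⟦ e ⊟ f ⟧G ρ = ⟦ e ⟧G ρ ⊝ ⟦ f ⟧G ρ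
    ⟦ ⊟ e   ⟧G ρ = ⊖ ⟦ e ⟧G ρ

    idʳ : ∀ x → x ⊕ 𝟘 ≡ x
    idʳ x = trans (comm x 𝟘) (idˡ x)

    private
      sumG : List Carrier → List ℕ → Carrier
      sumG ρ []      = 𝟘
      sumG ρ (i ∷ m) = lookupG ρ i ⊕ sumG ρ m

      swapG : ∀ x y z → x ⊕ (y ⊕ z) ≡ y ⊕ (x ⊕ z)
      swapG x y z = trans (sym (assoc x y z)) (trans (cong (_⊕ z) (comm x y)) (assoc y x z))

      interG : ∀ a b c d → (a ⊕ b) ⊕ (c ⊕ d) ≡ (a ⊕ c) ⊕ (b ⊕ d)
      interG a b c d = trans (assoc a b _) (trans (cong (a ⊕_) (swapG b c d)) (sym (assoc a c _)))

      insert-sum : ∀ ρ i m → sumG ρ (insertS i m) ≡ lookupG ρ i ⊕ sumG ρ m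
      insert-sum ρ i []      = refl
      insert-sum ρ i (j ∷ m) with i ≤ᵇ j
      ... | true  = refl
      ... | false = trans (cong (lookupG ρ j ⊕_) (insert-sum ρ i m)) (swapG _ _ _)

      merge-sum : ∀ ρ m n → sumG ρ (mergeS m n) ≡ sumG ρ m ⊕ sumG ρ n
      merge-sum ρ []      n = sym (idˡ _)
      merge-sum ρ (i ∷ m) n = trans (insert-sum ρ i (mergeS m n))
        (trans (cong (lookupG ρ i ⊕_) (merge-sum ρ m n)) (sym (assoc _ _ _)))

      cancelʳ : ∀ {a b} c → a ⊕ c ≡ b ⊕ c → a ≡ b
      cancelʳ {a} {b} c p = trans (sym (undo a)) (trans (cong (_⊝ c) p) (undo b))
        where
        undo : ∀ x → (x ⊕ c) ⊝ c ≡ x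
        undo x = trans (assoc x c (⊖ c)) (trans (cong (x ⊕_) (trans (comm c (⊖ c)) (invˡ c))) (idʳ x))

      norm-sum : ∀ ρ e → ⟦ e ⟧G ρ ⊕ sumG ρ (neg e) ≡ sumG ρ (pos e)
      norm-sum ρ (gv i)  = refl
      norm-sum ρ g0      = idˡ 𝟘
      norm-sum ρ (e ⊞ f) = trans (cong (⟦ e ⊞ f ⟧G ρ ⊕_) (merge-sum ρ (neg e) (neg f)))
        (trans (interG _ _ _ _) (trans (cong₂ _⊕_ (norm-sum ρ e) (norm-sum ρ f)) (sym (merge-sum ρ (pos e) (pos f)))))
      norm-sum ρ (e ⊟ f) = trans (cong (⟦ e ⊟ f ⟧G ρ ⊕_) (merge-sum ρ (neg e) (pos f)))
        (trans (interG _ _ _ _) (trans (cong₂ _⊕_ (norm-sum ρ e) (norm-neg ρ f)) (sym (merge-sum ρ (pos e) (neg f)))))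
        where
        norm-neg : ∀ ρ f → ⊖ ⟦ f ⟧G ρ ⊕ sumG ρ (pos f) ≡ sumG ρ (neg f)
        norm-neg ρ f = trans (cong (⊖ ⟦ f ⟧G ρ ⊕_) (sym (norm-sum ρ f)))
          (trans (sym (assoc _ _ _)) (trans (cong (_⊕ sumG ρ (neg f)) (invˡ _)) (idˡ _)))
      norm-sum ρ (⊟ e)   = trans (cong (⊖ ⟦ e ⟧G ρ ⊕_) (sym (norm-sum ρ e)))
          (trans (sym (assoc _ _ _)) (trans (cong (_⊕ sumG ρ (neg e)) (invˡ _)) (idˡ _)))

      eqL-sound : ∀ m n → T (eqL m n) → m ≡ n
      eqL-sound []      []      _ = refl
      eqL-sound (i ∷ m) (j ∷ n) t =
        let p , q = Equivalence.to T-∧ t in cong₂ _∷_ (≡ᵇ⇒≡ i j p) (eqL-sound m n q)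

    abstract
      -- Decides equations in the free abelian group on the listed elements.
      group-≡ : ∀ (ρ : List Carrier) (e f : GExpr) →
                {T (eqL (mergeS (pos e) (neg f)) (mergeS (pos f) (neg e)))} → ⟦ e ⟧G ρ ≡ ⟦ f ⟧G ρ
      group-≡ ρ e f {t} = cancelʳ (sumG ρ (neg e) ⊕ sumG ρ (neg f))
        (trans (trans (sym (assoc _ _ _)) (trans (cong (_⊕ sumG ρ (neg f)) (norm-sum ρ e)) (sym (merge-sum ρ (pos e) (neg f)))))
        (trans (cong (sumG ρ) (eqL-sound (mergeS (pos e) (neg f)) (mergeS (pos f) (neg e)) t))
        (trans (merge-sum ρ (pos f) (neg e)) (trans (cong (_⊕ sumG ρ (neg e)) (sym (norm-sum ρ f)))
        (trans (assoc _ _ _) (cong (⟦ f ⟧G ρ ⊕_) (comm _ _)))))))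

    Subset : Set
    Subset = Carrier → Bool

    abstract
      Σ : (Carrier → ℕ) → ℕ
      Σ f = ∑ size (f ∘ enum)

      # : Subset → ℕ
      # S = Σ (λ x → ⟦ S x ⟧)

      Σ-∑ : ∀ f → Σ f ≡ ∑ size (f ∘ enum)
      Σ-∑ f = refl

      #-Σ : ∀ S → # S ≡ Σ (λ x → ⟦ S x ⟧)
      #-Σ S = refl

      Σ-cong : ∀ {f g} → (∀ x → f x ≡ g x) → Σ f ≡ Σ g
      Σ-cong h = ∑-cong size (λ i _ → h (enum i))

      Σ-mono : ∀ {f g} → (∀ x → f x ≤ g x) → Σ f ≤ Σ g
      Σ-mono h = ∑-mono size (λ i _ → h (enum i))

      Σ-+ : ∀ f g → Σ (λ x → f x + g x) ≡ Σ f + Σ g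
      Σ-+ f g = ∑-+ size (f ∘ enum) (g ∘ enum)

      Σ-*ˡ : ∀ c f → Σ (λ x → c * f x) ≡ c * Σ f
      Σ-*ˡ c f = ∑-*ˡ size c (f ∘ enum)

      Σ-*ʳ : ∀ c f → Σ (λ x → f x * c) ≡ Σ f * c
      Σ-*ʳ c f = trans (Σ-cong (λ x → *-comm (f x) c)) (trans (Σ-*ˡ c f) (*-comm c (Σ f)))

      Σ-swap : ∀ (f : Carrier → Carrier → ℕ) → Σ (λ x → Σ (λ y → f x y)) ≡ Σ (λ y → Σ (λ x → f x y))
      Σ-swap f = ∑-swap size size (λ i j → f (enum i) (enum j))

      Σ-∑-swap : ∀ n (f : Carrier → ℕ → ℕ) → Σ (λ x → ∑ n (f x)) ≡ ∑ n (λ i → Σ (λ x → f x i))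
      Σ-∑-swap n f = ∑-swap size n (λ i j → f (enum i) j)

      Σ-zero : Σ (λ _ → 0) ≡ 0
      Σ-zero = ∑-zero size

      Σ-point : ∀ f x → f x ≤ Σ f
      Σ-point f x = subst (λ y → f y ≤ Σ f) (enum-index x) (∑-point size (f ∘ enum) (index x) (index< x))

      Σ-< : ∀ {f g} → Σ f < Σ g → ∃[ x ] f x < g x
      Σ-< {f} {g} h = let i , _ , q = ∑-< size {f ∘ enum} {g ∘ enum} h in enum i , q

      Σ-bij : ∀ (π ρ : Carrier → Carrier) → (∀ x → ρ (π x) ≡ x) → (∀ x → π (ρ x) ≡ x) →
              ∀ f → Σ (λ x → f (π x)) ≡ Σ f
      Σ-bij π ρ ρπ πρ f = trans
        (Σ-cong (λ x → cong f (sym (enum-index (π x)))))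
        (∑-bij size (λ i → index (π (enum i))) (λ i → index (ρ (enum i)))
          (λ i _ → index< _) (λ i _ → index< _)
          (λ i i< → trans (cong (index ∘ ρ) (enum-index _)) (trans (cong index (ρπ (enum i))) (index-enum i i<)))
          (λ i i< → trans (cong (index ∘ π) (enum-index _)) (trans (cong index (πρ (enum i))) (index-enum i i<)))
          (f ∘ enum))

      Σ-shift : ∀ t f → Σ (λ x → f (x ⊕ t)) ≡ Σ f
      Σ-shift t = Σ-bij (_⊕ t) (_⊝ t)
        (λ x → group-≡ (x ∷ t ∷ []) (gv 0 ⊞ gv 1 ⊟ gv 1) (gv 0))
        (λ x → group-≡ (x ∷ t ∷ []) (gv 0 ⊟ gv 1 ⊞ gv 1) (gv 0))

      Σ-shiftˡ : ∀ t f → Σ (λ x → f (t ⊕ x)) ≡ Σ f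
      Σ-shiftˡ t f = trans (Σ-cong (λ x → cong f (comm t x))) (Σ-shift t f)

      search : (P : Subset) → (∃[ x ] P x ≡ true) ⊎ (∀ x → P x ≡ false)
      search P with # P in eq
      ... | suc _ = let x , q = Σ-< {λ _ → 0} {λ x → ⟦ P x ⟧}
                                  (≤-<-trans (≤-reflexive Σ-zero) (subst (0 <_) (sym eq) z<s))
                    in inj₁ (x , ⟦⟧-true q)
      ... | zero  = inj₂ none
        where
        none : ∀ x → P x ≡ false
        none x with P x in p
        ... | false = refl
        ... | true  = ⊥-elim (1+n≰n (≤-trans (subst (_≤ # P) (cong ⟦_⟧ p) (Σ-point (λ x → ⟦ P x ⟧) x)) (≤-reflexive eq)))

      all : Subset → Bool
      all P with search (not ∘ P)
      ... | inj₁ _ = false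
      ... | inj₂ _ = true

      any : Subset → Bool
      any P with search P
      ... | inj₁ _ = true
      ... | inj₂ _ = false

      all-elim : ∀ P → all P ≡ true → ∀ x → P x ≡ true
      all-elim P h x with search (not ∘ P)
      ... | inj₂ f with P x | f x
      ...   | true | _ = refl

      all-intro : ∀ P → (∀ x → P x ≡ true) → all P ≡ true
      all-intro P h with search (not ∘ P)
      ... | inj₂ _ = refl
      ... | inj₁ (x , q) rewrite h x with () ← q

      any-intro : ∀ P x → P x ≡ true → any P ≡ true
      any-intro P x h with search P
      ... | inj₁ _ = refl
      ... | inj₂ f with () ← trans (sym h) (f x)

      any-elim : ∀ P → any P ≡ true → ∃[ x ] P x ≡ true
      any-elim P h with search P
      ... | inj₁ p = p

      #-mono : ∀ {S T : Subset} → (∀ x → S x ≡ true → T x ≡ true) → # S ≤ # T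
      #-mono h = Σ-mono (λ x → ⟦⟧-mono (h x))

      #-shift : ∀ t S → # (λ x → S (x ⊕ t)) ≡ # S
      #-shift t S = Σ-shift t (λ x → ⟦ S x ⟧)

      #>0 : ∀ S x → S x ≡ true → 0 < # S
      #>0 S x h = ≤-trans (≤-reflexive (cong ⟦_⟧ (sym h))) (Σ-point (λ x → ⟦ S x ⟧) x)

      #-witness : ∀ S → 0 < # S → ∃[ x ] S x ≡ true
      #-witness S h = let x , q = Σ-< {λ _ → 0} {λ x → ⟦ S x ⟧} (≤-<-trans (≤-reflexive Σ-zero) h) in x , ⟦⟧-true q

open Grp using (FinAb)

module Conv (G : FinAb) where

  open Sum
  open Grp
  open Counting G public

  out : Carrier → Subset → Subset → ℕ
  out y X D = # (λ x → X x ∧ not (D (y ⊕ x)))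

  r : Subset → Subset → Carrier → ℕ
  r Y X t = # (λ y → Y y ∧ X (y ⊕ t))

  ν : Subset → Carrier → ℕ
  ν X t = # (λ x → X x ∧ not (X (x ⊕ t)))

  #-split : ∀ (X P : Subset) → # X ≡ # (λ x → X x ∧ P x) + # (λ x → X x ∧ not (P x))
  #-split X P = trans (#-Σ X) (trans (Σ-cong (λ x → ⟦⟧-split (X x) (P x)))
    (trans (Σ-+ _ _) (sym (cong₂ _+_ (#-Σ _) (#-Σ _)))))

  #-cover : ∀ {X Y Z : Subset} → (∀ x → X x ≡ true → Y x ≡ false → Z x ≡ true) → # X ≤ # Y + # Z
  #-cover {X} {Y} {Z} h = subst₂ _≤_ (sym (#-Σ X)) (trans (Σ-+ _ _) (sym (cong₂ _+_ (#-Σ Y) (#-Σ Z))))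
    (Σ-mono (λ x → ⟦⟧-cover (X x) (Y x) (Z x) (h x)))

  #-cover₃ : ∀ {X Y Z W : Subset} → (∀ x → X x ≡ true → Y x ≡ false → Z x ≡ false → W x ≡ true) →
             # X ≤ # Y + (# Z + # W)
  #-cover₃ {X} {Y} {Z} {W} h = ≤-trans (#-cover {X} {Y} {λ x → X x ∧ not (Y x)} keep)
    (+-monoʳ-≤ (# Y) (#-cover {λ x → X x ∧ not (Y x)} {Z} {W} (λ x p q → h x (∧-elimˡ p) (not-true (∧-elimʳ p)) q)))
    where
    keep : ∀ x → X x ≡ true → Y x ≡ false → X x ∧ not (Y x) ≡ true
    keep x p q rewrite p | q = refl

  #-cong : ∀ {S T : Subset} → (∀ x → S x ≡ T x) → # S ≡ # T
  #-cong {S} {T} h = trans (#-Σ S) (trans (Σ-cong (λ x → cong ⟦_⟧ (h x))) (sym (#-Σ T)))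

  #-subst : ∀ {S T : Subset} t → (∀ x → S x ≡ true → T (x ⊕ t) ≡ true) → # S ≤ # T
  #-subst {S} {T} t h = ≤-trans (#-mono h) (≤-reflexive (#-shift t T))

  ⊕-swapʳ : ∀ a b c → (a ⊕ b) ⊕ c ≡ (a ⊕ c) ⊕ b
  ⊕-swapʳ a b c = (group-≡ (a ∷ b ∷ c ∷ []) ((gv 0 ⊞ gv 1) ⊞ gv 2) ((gv 0 ⊞ gv 2) ⊞ gv 1))

  out-bound : ∀ y X D → # X ≤ # D + out y X D
  out-bound y X D = ≤-trans (#-cover {X} {λ x → D (x ⊕ y)} {λ x → X x ∧ not (D (y ⊕ x))}
      (λ x p q → ∧-not p (trans (cong D (comm y x)) q)))
    (+-monoˡ-≤ _ (≤-reflexive (#-shift y D)))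

  out-monoˡ : ∀ y {X X′ : Subset} D → (∀ x → X x ≡ true → X′ x ≡ true) → out y X D ≤ out y X′ D
  out-monoˡ y D h = #-mono (λ x p → ∧-intro (h x (∧-elimˡ p)) (∧-elimʳ p))

  Σ-r : ∀ Y X → Σ (r Y X) ≡ # Y * # X
  Σ-r Y X = trans (Σ-cong (λ t → #-Σ (λ y → Y y ∧ X (y ⊕ t)))) (trans (Σ-swap _)
    (trans (Σ-cong (λ y → trans (Σ-cong (λ t → ⟦∧⟧ (Y y) (X (y ⊕ t))))
      (trans (Σ-*ˡ ⟦ Y y ⟧ _) (cong (⟦ Y y ⟧ *_) (trans (Σ-shiftˡ y (λ x → ⟦ X x ⟧)) (sym (#-Σ X)))))))
    (trans (Σ-*ʳ (# X) _) (cong (_* # X) (sym (#-Σ Y))))))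

  r≤#ˡ : ∀ Y X t → r Y X t ≤ # Y
  r≤#ˡ Y X t = #-mono (λ x → ∧-elimˡ)

  Dif : Subset → Subset → Subset
  Dif Y X t = any (λ y → Y y ∧ X (y ⊕ t))

  r-Dif : ∀ Y X t → Dif Y X t ≡ false → r Y X t ≡ 0
  r-Dif Y X t h with r Y X t in eq
  ... | zero  = refl
  ... | suc _ = let y , q = #-witness (λ y → Y y ∧ X (y ⊕ t)) (subst (0 <_) (sym eq) z<s)
                in true≢false (any-intro _ y q) h

  -- Ruzsa's triangle inequality: every difference y₁ − y₂ is (y₁ + x) − (y₂ + x)
  -- for almost all x ∈ X.
  Dif-bound : ∀ (Y₁ Y₂ X D : Subset) e₁ e₂ →
              (∀ y → Y₁ y ≡ true → out y X D ≤ e₁) → (∀ y → Y₂ y ≡ true → out y X D ≤ e₂) →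
              # X * # (Dif Y₂ Y₁) ≤ # D * # D + (e₁ + e₂) * # (Dif Y₂ Y₁)
  Dif-bound Y₁ Y₂ X D e₁ e₂ h₁ h₂ = begin
    # X * # Δ                                ≡⟨ trans (cong (# X *_) (#-Σ Δ)) (sym (Σ-*ˡ (# X) (λ t → ⟦ Δ t ⟧))) ⟩
    Σ (λ t → # X * ⟦ Δ t ⟧)                  ≤⟨ Σ-mono pointwise ⟩
    Σ (λ t → r D D t + (e₁ + e₂) * ⟦ Δ t ⟧)  ≡⟨ Σ-+ _ _ ⟩
    Σ (r D D) + Σ (λ t → (e₁ + e₂) * ⟦ Δ t ⟧) ≡⟨ cong₂ _+_ (Σ-r D D) (trans (Σ-*ˡ (e₁ + e₂) _) (cong ((e₁ + e₂) *_) (sym (#-Σ Δ)))) ⟩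
    # D * # D + (e₁ + e₂) * # Δ              ∎
    where
    open ≤-Reasoning
    Δ = Dif Y₂ Y₁
    pointwise : ∀ t → # X * ⟦ Δ t ⟧ ≤ r D D t + (e₁ + e₂) * ⟦ Δ t ⟧
    pointwise t with Δ t in eq
    ... | false = ≤-trans (≤-reflexive (*-zeroʳ (# X))) z≤n
    ... | true  =
      let y , p = any-elim _ eq
          bound : # X ≤ # (λ x → D (x ⊕ y) ∧ D (x ⊕ y ⊕ t)) + (out y X D + out (y ⊕ t) X D)
          bound = #-cover₃ {X} {λ x → D (x ⊕ y) ∧ D (x ⊕ y ⊕ t)} {λ x → X x ∧ not (D (y ⊕ x))} {λ x → X x ∧ not (D (y ⊕ t ⊕ x))}
            (λ x a b c → ∧-not a (trans (cong D (trans (⊕-swapʳ y t x) (cong (_⊕ t) (comm y x))))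
              (∧-false b (trans (cong D (comm x y)) (not-false (∧-false c a))))))
      in begin
      # X * 1 ≡⟨ *-identityʳ (# X) ⟩
      # X     ≤⟨ bound ⟩
      # (λ x → D (x ⊕ y) ∧ D (x ⊕ y ⊕ t)) + (out y X D + out (y ⊕ t) X D)
        ≤⟨ +-mono-≤ (≤-reflexive (#-shift y (λ d → D d ∧ D (d ⊕ t))))
                    (+-mono-≤ (h₂ y (∧-elimˡ p)) (h₁ (y ⊕ t) (∧-elimʳ p))) ⟩
      r D D t + (e₂ + e₁) ≡⟨ cong (r D D t +_) (trans (+-comm e₂ e₁) (sym (*-identityʳ (e₁ + e₂)))) ⟩
      r D D t + (e₁ + e₂) * 1 ∎

-- Dyson's e-transform

module Chain (G : FinAb) where

  open Sum
  open Grp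
  open Conv G

  average : ∀ (Z : Subset) (f : Carrier → ℕ) c → Σ (λ z → ⟦ Z z ⟧ * f z) ≤ # Z * c → 0 < # Z →
            ∃[ z ] Z z ≡ true × f z ≤ c
  average Z f c h Z>0 = let z , p = Σ-< {λ z → ⟦ Z z ⟧ * f z} {λ z → ⟦ Z z ⟧ * suc c} lt in pick z p
    where
    lt : Σ (λ z → ⟦ Z z ⟧ * f z) < Σ (λ z → ⟦ Z z ⟧ * suc c)
    lt = subst (Σ (λ z → ⟦ Z z ⟧ * f z) <_) (sym (trans (Σ-*ʳ (suc c) (λ z → ⟦ Z z ⟧)) (cong (_* suc c) (sym (#-Σ Z)))))
      ((farkas (# Z ∷ c ∷ Σ (λ z → ⟦ Z z ⟧ * f z) ∷ []) ((x2 :≤ x0 :* x1) ∷ (con 1 :+ con 0 :≤ x0) ∷ []) (con 1 :+ x2) (x0 :* (con 1 :+ x1)) 0 (con 1 ∷ con 1 ∷ []) (h , Z>0 , tt)))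
    pick : ∀ z → ⟦ Z z ⟧ * f z < ⟦ Z z ⟧ * suc c → ∃[ z ] Z z ≡ true × f z ≤ c
    pick z p with Z z in eq
    ... | true = z , eq , s≤s⁻¹ (subst₂ _<_ (*-identityˡ (f z)) (*-identityˡ (suc c)) p)

  #-incl-excl : ∀ (X Y : Subset) → # (λ x → X x ∨ Y x) + # (λ x → X x ∧ Y x) ≡ # X + # Y
  #-incl-excl X Y = trans (cong₂ _+_ (#-Σ _) (#-Σ _)) (trans (sym (Σ-+ _ _))
    (trans (Σ-cong (λ x → bits (X x) (Y x))) (trans (Σ-+ _ _) (sym (cong₂ _+_ (#-Σ X) (#-Σ Y))))))
    where
    bits : ∀ a b → ⟦ a ∨ b ⟧ + ⟦ a ∧ b ⟧ ≡ ⟦ a ⟧ + ⟦ b ⟧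
    bits true  true  = refl
    bits true  false = refl
    bits false true  = refl
    bits false false = refl

  r-neg : ∀ Z t → r Z Z (⊖ t) ≡ r Z Z t
  r-neg Z t = trans (sym (#-shift t _)) (#-cong (λ x → trans (cong (Z (x ⊕ t) ∧_) (cong Z ((group-≡ (x ∷ t ∷ []) (gv 0 ⊞ gv 1 ⊞ (⊟ gv 1)) (gv 0))))) (∧-comm (Z (x ⊕ t)) (Z x))))
    where open import Data.Bool.Properties using (∧-comm)

  eqᵇ : Bool → Bool → Bool
  eqᵇ true  b = b
  eqᵇ false b = not b

  eqᵇ-≡ : ∀ {a b} → eqᵇ a b ≡ true → a ≡ b
  eqᵇ-≡ {true}  {true}  _ = refl
  eqᵇ-≡ {false} {false} _ = refl

  ≡-eqᵇ : ∀ {a b} → a ≡ b → eqᵇ a b ≡ true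
  ≡-eqᵇ {true}  refl = refl
  ≡-eqᵇ {false} refl = refl

  Stab : Subset → Subset
  Stab W t = all (λ x → eqᵇ (W x) (W (x ⊕ t)))

  record Subgroup (H : Subset) : Set where
    field
      has-0 : H 𝟘 ≡ true
      has-+ : ∀ {s t} → H s ≡ true → H t ≡ true → H (s ⊕ t) ≡ true
      has-neg : ∀ {t} → H t ≡ true → H (⊖ t) ≡ true

  Stab-elim : ∀ W {t} → Stab W t ≡ true → ∀ x → W (x ⊕ t) ≡ W x
  Stab-elim W p x = sym (eqᵇ-≡ (all-elim _ p x))

  Stab-intro : ∀ W {t} → (∀ x → W (x ⊕ t) ≡ W x) → Stab W t ≡ true
  Stab-intro W f = all-intro _ (λ x → ≡-eqᵇ (sym (f x)))

  Stab-subgroup : ∀ W → Subgroup (Stab W)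
  Stab-subgroup W = record
    { has-0 = Stab-intro W (λ x → cong W (idʳ x))
    ; has-+ = λ {s} {t} p q → Stab-intro W (λ x → trans (cong W (sym (assoc x s t))) (trans (Stab-elim W q (x ⊕ s)) (Stab-elim W p x)))
    ; has-neg = λ {t} p → Stab-intro W (λ x → trans (sym (Stab-elim W p (x ⊝ t))) (cong W ((group-≡ (x ∷ t ∷ []) (gv 0 ⊟ gv 1 ⊞ gv 1) (gv 0)))))
    }

  module DysonChain (S D : Subset) (α B h′ E₀ : ℕ)
    (rows : ∀ s → S s ≡ true → out s S D ≤ E₀) where

    h : ℕ
    h = suc h′

    record Pair (k : ℕ) : Set where
      field
        X Z  : Subset
        S⊆X  : ∀ x → S x ≡ true → X x ≡ true
        Z⊆S  : ∀ x → Z x ≡ true → S x ≡ true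
        size-sum : # X + # Z ≡ 2 * # S
        rowX : ∀ x → X x ≡ true → out x Z D ≤ k
        rowZ : ∀ z → Z z ≡ true → out z X D ≤ k

    start : Pair E₀
    start = record { X = S ; Z = S ; S⊆X = λ _ p → p ; Z⊆S = λ _ p → p
                   ; size-sum = (ring-≡ (# S ∷ []) (x0 :+ x0) (con 2 :* x0)) ; rowX = rows ; rowZ = rows }

    module Transform {k} (P : Pair k) (t : Carrier) where
      open Pair P

      X′ Z′ : Subset
      X′ x = X x ∨ Z (x ⊝ t)
      Z′ z = Z z ∧ X (z ⊕ t)

      undo : ∀ x → x ⊕ t ⊝ t ≡ x
      undo x = (group-≡ (x ∷ t ∷ []) (gv 0 ⊞ gv 1 ⊟ gv 1) (gv 0))

      meet : # (λ x → X x ∧ Z (x ⊝ t)) ≡ # Z′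
      meet = trans (sym (#-shift t (λ x → X x ∧ Z (x ⊝ t))))
        (#-cong (λ z → trans (∧-comm (X (z ⊕ t)) _) (cong (λ w → Z w ∧ X (z ⊕ t)) (undo z))))
        where open import Data.Bool.Properties using (∧-comm)

      sum′ : # X′ + # Z′ ≡ # X + # Z
      sum′ = trans (cong (# X′ +_) (sym meet)) (trans (#-incl-excl X (λ x → Z (x ⊝ t))) (cong (# X +_) (#-shift (⊖ t) Z)))

      rowX′ : ∀ x → X′ x ≡ true → out x Z′ D ≤ k
      rowX′ x p with ∨-elim {X x} p
      ... | inj₁ q = ≤-trans (out-monoˡ x D (λ _ → ∧-elimˡ)) (rowX x q)
      ... | inj₂ q = ≤-trans (#-subst t λ z w → ∧-intro (∧-elimʳ {Z z} (∧-elimˡ {Z z ∧ X (z ⊕ t)} w))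
                       (trans (cong (λ u → not (D u)) ((group-≡ (x ∷ z ∷ t ∷ []) ((gv 0 ⊟ gv 2) ⊞ (gv 1 ⊞ gv 2)) (gv 0 ⊞ gv 1)))) (∧-elimʳ {Z z ∧ X (z ⊕ t)} w)))
                       (rowZ (x ⊝ t) q)

      rowZ′ : ∀ z → Z′ z ≡ true → out z X′ D ≤ k + k
      rowZ′ z p = ≤-trans (#-cover split) (+-mono-≤ (rowZ z (∧-elimˡ p)) (≤-trans (#-subst (⊖ t) shifted) (rowX (z ⊕ t) (∧-elimʳ p))))
        where
        split : ∀ x → X′ x ∧ not (D (z ⊕ x)) ≡ true → X x ∧ not (D (z ⊕ x)) ≡ false →
                Z (x ⊝ t) ∧ not (D (z ⊕ x)) ≡ true
        split x u v with ∨-elim {X x} (∧-elimˡ u)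
        ... | inj₁ q = true≢false (∧-intro q (∧-elimʳ {X′ x} u)) v
        ... | inj₂ q = ∧-intro q (∧-elimʳ {X′ x} u)
        shifted : ∀ x → Z (x ⊝ t) ∧ not (D (z ⊕ x)) ≡ true → Z (x ⊝ t) ∧ not (D (z ⊕ t ⊕ (x ⊝ t))) ≡ true
        shifted x u = ∧-intro (∧-elimˡ u) (trans (cong (λ w → not (D w)) ((group-≡ (x ∷ z ∷ t ∷ []) (gv 1 ⊞ gv 2 ⊞ (gv 0 ⊟ gv 2)) (gv 1 ⊞ gv 0)))) (∧-elimʳ {Z (x ⊝ t)} u))

      transform : Pair (k + k)
      transform = record
        { X = X′ ; Z = Z′
        ; S⊆X = λ x p → ∨-introˡ (Z (x ⊝ t)) (S⊆X x p)
        ; Z⊆S = λ z p → Z⊆S z (∧-elimˡ p)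
        ; size-sum = trans sum′ size-sum
        ; rowX = λ x p → ≤-trans (rowX′ x p) (m≤m+n k k)
        ; rowZ = rowZ′ }

    record Small (K : ℕ) : Set where
      field
        pair  : Pair K
        small : B * # (Pair.Z pair) ≤ α
        large : α < h * (B * # (Pair.Z pair))

    record Gap (K : ℕ) : Set where
      field
        pair  : Pair K
        large : α < B * # (Pair.Z pair)
        gap   : ∀ t → # (Pair.Z pair) ≤ h * r (Pair.Z pair) (Pair.X pair) t →
                h * # (Pair.Z pair) < h * r (Pair.Z pair) (Pair.X pair) t + # (Pair.Z pair)

    weaken : ∀ {k K} → k ≤ K → Pair k → Pair K
    weaken k≤K P = record
      { X = X ; Z = Z ; S⊆X = S⊆X ; Z⊆S = Z⊆S ; size-sum = size-sum
      ; rowX = λ x p → ≤-trans (rowX x p) k≤K ; rowZ = λ z p → ≤-trans (rowZ z p) k≤K }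
      where open Pair P

    run : ∀ f {k} (P : Pair k) → α < B * # (Pair.Z P) →
          h * (B * (2 * # S)) < h * (B * # (Pair.X P)) + f * α →
          Small (2 ^ f * k) ⊎ Gap (2 ^ f * k)
    run zero    P big fuel = ⊥-elim (<-irrefl refl (<-≤-trans fuel
      (≤-trans (≤-reflexive (+-identityʳ _)) (*-monoʳ-≤ h (*-monoʳ-≤ B (≤-trans (m≤m+n _ _) (≤-reflexive (Pair.size-sum P))))))))
    run (suc f) {k} P big fuel
      with search (λ t → (# (Pair.Z P) ≤ᵇ h * r (Pair.Z P) (Pair.X P) t)
                       ∧ (h * r (Pair.Z P) (Pair.X P) t + # (Pair.Z P) ≤ᵇ h * # (Pair.Z P)))
    ... | inj₂ none = inj₂ record { pair = weaken grow P ; large = big ; gap = λ t p → ≤ᵇ-false (∧-false (none t) (≤ᵇ-intro p)) }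
      where
      grow : k ≤ 2 ^ suc f * k
      grow = m≤n*m k (2 ^ suc f) ⦃ m^n≢0 2 (suc f) ⦄
    ... | inj₁ (t , p) with B * # (Transform.Z′ P t) ≤? α
    ...   | yes small = inj₁ record { pair = weaken grow (Transform.transform P t) ; small = small
                                    ; large = <-≤-trans big shrink }
      where
      shrink : B * # (Pair.Z P) ≤ h * (B * # (Transform.Z′ P t))
      shrink = ≤-trans (*-monoʳ-≤ B (≤ᵇ-true (∧-elimˡ p))) (≤-reflexive ((ring-≡ (B ∷ h ∷ # (Transform.Z′ P t) ∷ []) (x0 :* (x1 :* x2)) (x1 :* (x0 :* x2)))))
      grow : k + k ≤ 2 ^ suc f * k
      grow = ≤-trans (≤-reflexive ((ring-≡ (k ∷ []) (x0 :+ x0) (con 2 :* x0)))) (*-monoˡ-≤ k (m≤m*n 2 (2 ^ f) ⦃ m^n≢0 2 f ⦄))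
    ...   | no ¬small = weaken-result (run f (Transform.transform P t) (≰⇒> ¬small) fuel′)
      where
      X′ = Transform.X′ P t
      Z′ = Transform.Z′ P t
      gain : h * # (Pair.X P) + # (Pair.Z P) ≤ h * # X′
      gain = (farkas (# (Pair.X P) ∷ # (Pair.Z P) ∷ # X′ ∷ # Z′ ∷ h ∷ []) ((x0 :+ x1 :≤ x2 :+ x3) ∷ (x4 :* x3 :+ x1 :≤ x4 :* x1) ∷ []) (x4 :* x0 :+ x1) (x4 :* x2) 0 (x4 ∷ con 1 ∷ []) (≤-reflexive (sym (Transform.sum′ P t)) , ≤ᵇ-true (∧-elimʳ {# (Pair.Z P) ≤ᵇ h * r (Pair.Z P) (Pair.X P) t} p) , tt))
      fuel′ : h * (B * (2 * # S)) < h * (B * # X′) + f * α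
      fuel′ = (farkas (h * (B * (2 * # S)) ∷ h ∷ B ∷ # (Pair.X P) ∷ # (Pair.Z P) ∷ # X′ ∷ f * α ∷ α ∷ []) ((con 1 :+ x0 :≤ x1 :* (x2 :* x3) :+ (x7 :+ x6)) ∷ (x1 :* x3 :+ x4 :≤ x1 :* x5) ∷ (con 1 :+ x7 :≤ x2 :* x4) ∷ []) (con 1 :+ x0) (x1 :* (x2 :* x5) :+ x6) 0 (con 1 ∷ x2 ∷ con 1 ∷ []) (fuel , gain , big , tt))
      eq : 2 ^ f * (k + k) ≡ 2 ^ suc f * k
      eq = (ring-≡ (k ∷ 2 ^ f ∷ []) (x1 :* (x0 :+ x0)) (con 2 :* x1 :* x0))
      weaken-result : Small (2 ^ f * (k + k)) ⊎ Gap (2 ^ f * (k + k)) → Small (2 ^ suc f * k) ⊎ Gap (2 ^ suc f * k)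
      weaken-result = subst (λ n → Small n ⊎ Gap n) eq

module Gap (G : FinAb) where

  open Sum
  open Grp
  open Conv G
  open Chain G

  record Periodic (S D : Subset) (α B h′ K : ℕ) : Set where
    field
      W H      : Subset
      H-group  : Subgroup H
      W-inv    : ∀ t → H t ≡ true → ∀ w → W (w ⊕ t) ≡ W w
      S∖W-size : suc h′ * # (λ s → S s ∧ not (W s)) ≤ 18 * (B * α)
      W-size   : h′ * # W ≤ suc h′ * (# D + K)
      H-size   : α ≤ 2 * (B * # H)

  module GapCase (S D : Subset) (α B h′ E₀ : ℕ) (rows : ∀ s → S s ≡ true → out s S D ≤ E₀) (K : ℕ)
    (P : DysonChain.Gap S D α B h′ E₀ rows K)
    (S-big : α ≤ 2 * # S) (D-small : # D ≤ 3 * α) (h-big : 144 * B ≤ suc h′) (K-small : 8 * (B * (suc h′ * K)) ≤ α)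
    where
    open DysonChain S D α B h′ E₀ rows
    open Gap P
    open Pair pair

    S≤X : # S ≤ # X
    S≤X = #-mono S⊆X

    B>0 : 0 < B
    B>0 = n≢0⇒n>0 λ e → n≮0 (subst (λ b → α < b * # Z) e large)

    Z>0 : 0 < # Z
    Z>0 = n≢0⇒n>0 λ e → n≮0 (subst (α <_) (trans (cong (B *_) e) (*-zeroʳ B)) large)

    K-α : 8 * K ≤ α
    K-α = (farkas (B ∷ h ∷ K ∷ α ∷ []) ((con 8 :* (x0 :* (x1 :* x2)) :≤ x3) ∷ (con 1 :* con 1 :* x2 :≤ x0 :* x1 :* x2) ∷ []) (con 8 :* x2) (x3) 0 (con 1 ∷ con 8 ∷ []) (K-small , *-mono-≤ (*-mono-≤ B>0 (s≤s z≤n)) (≤-refl {K}) , tt))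

    K-Z : 4 * K ≤ # Z
    K-Z = *-cancelˡ-≤ (2 * B) ⦃ >-nonZero (*-mono-≤ (s≤s {0} {1} z≤n) B>0) ⦄ ((farkas (B ∷ h ∷ K ∷ α ∷ # Z ∷ []) ((con 8 :* (x0 :* (x1 :* x2)) :≤ x3) ∷ (con 1 :+ x3 :≤ x0 :* x4) ∷ (x0 :* x2 :* con 1 :≤ x0 :* x2 :* x1) ∷ []) (con 2 :* x0 :* (con 4 :* x2)) (con 2 :* x0 :* x4) 0 (con 1 ∷ con 1 ∷ con 8 ∷ []) (K-small , large , *-monoʳ-≤ (B * K) (s≤s {0} {h′} z≤n) , tt)))

    Z⊆X : ∀ z → Z z ≡ true → X z ≡ true
    Z⊆X z p = S⊆X z (Z⊆S z p)

    D² : # D * # D ≤ 9 * (α * α)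
    D² = ≤-trans (*-mono-≤ D-small D-small) (≤-reflexive ((ring-≡ (α ∷ []) (con 3 :* x0 :* (con 3 :* x0)) (con 9 :* (x0 :* x0)))))

    module _ (α>0 : 0 < α) where
      ZZ : # (Dif Z Z) ≤ 36 * α
      ZZ = *-cancelˡ-≤ α ⦃ >-nonZero α>0 ⦄ ((farkas (α ∷ K ∷ # X ∷ # S ∷ # (Dif Z Z) ∷ # D * # D ∷ []) ((x2 :* x4 :≤ x5 :+ (x1 :+ x1) :* x4) ∷ (x5 :≤ con 9 :* (x0 :* x0)) ∷ (x0 :≤ con 2 :* x3) ∷ (x3 :≤ x2) ∷ (con 8 :* x1 :≤ x0) ∷ []) (x0 :* x4) (x0 :* (con 36 :* x0)) 0 (con 4 ∷ con 4 ∷ con 2 :* x4 ∷ con 4 :* x4 ∷ x4 ∷ []) (Dif-bound Z Z X D K K rowZ rowZ , D² , S-big , S≤X , K-α , tt)))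

      XZ : # (Dif Z X) ≤ 18 * (B * α)
      XZ = *-cancelˡ-≤ α ⦃ >-nonZero α>0 ⦄ ((farkas (α ∷ B ∷ K ∷ # Z ∷ # (Dif Z X) ∷ # D * # D ∷ []) ((x3 :* x4 :≤ x5 :+ (x2 :+ x2) :* x4) ∷ (x5 :≤ con 9 :* (x0 :* x0)) ∷ (con 4 :* x2 :≤ x3) ∷ (con 1 :+ x0 :≤ x1 :* x3) ∷ []) (x0 :* x4) (x0 :* (con 18 :* (x1 :* x0))) 0 (con 2 :* x1 ∷ con 2 :* x1 ∷ x1 :* x4 ∷ x4 ∷ []) (Dif-bound X Z Z D K K rowX (λ z p → ≤-trans (out-monoˡ z D Z⊆X) (rowZ z p)) , D² , K-Z , large , tt)))

      E Pop : Subset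
      E t   = suc (h * # Z) ≤ᵇ h * r Z X t + # Z
      Pop t = 2 * # Z ≤ᵇ h * r Z Z t

      E-intro : ∀ t → # Z ≤ h * r Z X t → E t ≡ true
      E-intro t p = ≤ᵇ-intro (gap t p)

      -- Away from E the representation function is tiny, so translating a point
      -- of E by a popular difference of Z cannot leave E.
      E-closed : ∀ e t → E e ≡ true → Pop t ≡ true → E (e ⊕ t) ≡ true
      E-closed e t p q = E-intro (e ⊕ t) ((farkas (# Z ∷ h ∷ r Z Z t ∷ r Z X (e ⊕ t) ∷ r Z X e ∷ # (λ z → Z z ∧ not (X (z ⊕ e))) ∷ []) ((con 1 :+ x1 :* x0 :≤ x1 :* x4 :+ x0) ∷ (con 2 :* x0 :≤ x1 :* x2) ∷ (x2 :≤ x3 :+ x5) ∷ (x4 :+ x5 :≤ x0) ∷ []) (x0) (x1 :* x3) 0 (con 1 ∷ con 1 ∷ x1 ∷ x1 ∷ []) (≤ᵇ-true p , ≤ᵇ-true q , cover , ≤-reflexive (sym (#-split Z (λ z → X (z ⊕ e)))) , tt)))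
        where
        cover : r Z Z t ≤ r Z X (e ⊕ t) + # (λ z → Z z ∧ not (X (z ⊕ e)))
        cover = ≤-trans (#-cover {λ z → Z z ∧ Z (z ⊕ t)} {λ z → Z z ∧ X (z ⊕ (e ⊕ t))} {λ z → Z (z ⊕ t) ∧ not (X (z ⊕ t ⊕ e))}
            (λ z u v → ∧-not (∧-elimʳ u) (trans (cong X ((group-≡ (z ∷ e ∷ t ∷ []) (gv 0 ⊞ gv 2 ⊞ gv 1) (gv 0 ⊞ (gv 1 ⊞ gv 2))))) (∧-false v (∧-elimˡ u)))))
          (+-monoʳ-≤ _ (≤-reflexive (#-shift t (λ z → Z z ∧ not (X (z ⊕ e))))))

      Pop-neg : ∀ t → Pop t ≡ true → Pop (⊖ t) ≡ true
      Pop-neg t p = trans (cong (λ n → 2 * # Z ≤ᵇ h * n) (r-neg Z t)) p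

      H : Subset
      H = Stab E

      Pop⊆H : ∀ t → Pop t ≡ true → H t ≡ true
      Pop⊆H t p = Stab-intro E (λ x → iff-≡
        (λ q → subst (λ u → E u ≡ true) ((group-≡ (x ∷ t ∷ []) (gv 0 ⊞ gv 1 ⊞ (⊟ gv 1)) (gv 0))) (E-closed (x ⊕ t) (⊖ t) q (Pop-neg t p)))
        (λ q → E-closed x t q p))

      Pop-size : # Z ≤ 2 * # Pop
      Pop-size = *-cancelˡ-≤ h (*-cancelˡ-≤ (# Z) ⦃ >-nonZero Z>0 ⦄ ((farkas (# Z ∷ h ∷ B ∷ α ∷ # Pop ∷ # (Dif Z Z) ∷ []) ((x1 :* (x0 :* x0) :≤ x1 :* x0 :* x4 :+ con 2 :* x0 :* x5) ∷ (x5 :≤ con 36 :* x3) ∷ (con 1 :+ x3 :≤ x2 :* x0) ∷ (con 144 :* x2 :≤ x1) ∷ []) (x0 :* (x1 :* x0)) (x0 :* (x1 :* (con 2 :* x4))) 0 (con 2 ∷ con 4 :* x0 ∷ con 144 :* x0 ∷ x0 :* x0 ∷ []) (total , ZZ , large , h-big , tt))))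
        where
        pointwise : ∀ t → h * r Z Z t ≤ h * # Z * ⟦ Pop t ⟧ + 2 * # Z * ⟦ Dif Z Z t ⟧
        pointwise t with bool (Pop t) | bool (Dif Z Z t)
        ... | inj₁ p | _ rewrite p = ≤-trans (*-monoʳ-≤ h (r≤#ˡ Z Z t)) (≤-trans (≤-reflexive (sym (*-identityʳ _))) (m≤m+n _ _))
        ... | inj₂ p | inj₁ q rewrite q = ≤-trans (<⇒≤ (≤ᵇ-false {2 * # Z} p)) (≤-trans (≤-reflexive (sym (*-identityʳ (2 * # Z)))) (m≤n+m (2 * # Z * 1) (h * # Z * ⟦ Pop t ⟧)))
        ... | inj₂ p | inj₂ q rewrite r-Dif Z Z t q | *-zeroʳ h = z≤n
        total : h * (# Z * # Z) ≤ h * # Z * # Pop + 2 * # Z * # (Dif Z Z)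
        total = subst₂ _≤_ (trans (Σ-*ˡ h _) (cong (h *_) (Σ-r Z Z)))
          (trans (Σ-+ _ _) (cong₂ _+_ (trans (Σ-*ˡ (h * # Z) _) (cong (h * # Z *_) (sym (#-Σ Pop)))) (trans (Σ-*ˡ (2 * # Z) _) (cong (2 * # Z *_) (sym (#-Σ (Dif Z Z)))))))
          (Σ-mono pointwise)

      base : ∃[ z ] Z z ≡ true × h * # (λ x → X x ∧ not (E (x ⊝ z))) ≤ 18 * (B * α)
      base = average Z (λ z → h * # (λ x → X x ∧ not (E (x ⊝ z)))) (18 * (B * α)) (≤-trans (≤-reflexive swap) (≤-trans (Σ-mono pointwise)
          (≤-trans (≤-reflexive (trans (Σ-*ˡ (# Z) _) (cong (# Z *_) (sym (#-Σ (Dif Z X)))))) (*-monoʳ-≤ (# Z) XZ)))) Z>0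
        where
        pointwise : ∀ t → ⟦ not (E t) ⟧ * (h * r Z X t) ≤ # Z * ⟦ Dif Z X t ⟧
        pointwise t with bool (E t) | bool (Dif Z X t)
        ... | inj₁ p | _ rewrite p = z≤n
        ... | inj₂ p | inj₁ q rewrite p | q = ≤-trans (≤-reflexive (+-identityʳ _)) (≤-trans (<⇒≤ (≰⇒> (λ u → true≢false (E-intro t u) p))) (≤-reflexive (sym (*-identityʳ _))))
        ... | inj₂ p | inj₂ q rewrite p | r-Dif Z X t q | *-zeroʳ h = z≤n
        swap : Σ (λ z → ⟦ Z z ⟧ * (h * # (λ x → X x ∧ not (E (x ⊝ z))))) ≡ Σ (λ t → ⟦ not (E t) ⟧ * (h * r Z X t))
        swap = trans (Σ-cong (λ z → trans (cong (λ n → ⟦ Z z ⟧ * (h * n)) (trans (sym (#-shift z _)) (#-Σ _)))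
                 (trans (cong (⟦ Z z ⟧ *_) (sym (Σ-*ˡ h _))) (sym (Σ-*ˡ ⟦ Z z ⟧ _)))))
               (trans (Σ-swap _) (Σ-cong (λ t → trans (Σ-cong (λ z → term z t)) (trans (Σ-*ˡ ⟦ not (E t) ⟧ _) (cong (⟦ not (E t) ⟧ *_) (trans (Σ-*ˡ h _) (cong (h *_) (sym (#-Σ _)))))))))
          where
          bits : ∀ a b c → ⟦ a ⟧ * (h * ⟦ b ∧ c ⟧) ≡ ⟦ c ⟧ * (h * ⟦ a ∧ b ⟧)
          bits true  true  c = (ring-≡ (h ∷ ⟦ c ⟧ ∷ []) (con 1 :* (x0 :* x1)) (x1 :* (x0 :* con 1)))
          bits true  false c = (ring-≡ (h ∷ ⟦ c ⟧ ∷ []) (con 1 :* (x0 :* con 0)) (x1 :* (x0 :* con 0)))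
          bits false b     c = (ring-≡ (h ∷ ⟦ c ⟧ ∷ []) (con 0) (x1 :* (x0 :* con 0)))
          term : ∀ z t → ⟦ Z z ⟧ * (h * ⟦ X (t ⊕ z) ∧ not (E (t ⊕ z ⊝ z)) ⟧) ≡ ⟦ not (E t) ⟧ * (h * ⟦ Z z ∧ X (z ⊕ t) ⟧)
          term z t = trans (cong₂ (λ u v → ⟦ Z z ⟧ * (h * ⟦ X u ∧ not (E v) ⟧)) (comm t z) ((group-≡ (t ∷ z ∷ []) (gv 0 ⊞ gv 1 ⊟ gv 1) (gv 0)))) (bits (Z z) (X (z ⊕ t)) (not (E t)))

      z₀ = proj₁ base

      E-size : h′ * # E ≤ h * # X
      E-size = *-cancelˡ-≤ (# Z) ⦃ >-nonZero Z>0 ⦄ (≤-trans (≤-reflexive ((ring-≡ (# Z ∷ h′ ∷ # E ∷ []) (x0 :* (x1 :* x2)) (x1 :* x0 :* x2))))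
        (subst₂ _≤_ (trans (Σ-*ˡ (h′ * # Z) _) (cong (h′ * # Z *_) (sym (#-Σ E))))
          (trans (Σ-*ˡ h _) (trans (cong (h *_) (Σ-r Z X)) ((ring-≡ (# Z ∷ h ∷ # X ∷ []) (x1 :* (x0 :* x2)) (x0 :* (x1 :* x2))))))
          (Σ-mono pointwise)))
        where
        pointwise : ∀ t → h′ * # Z * ⟦ E t ⟧ ≤ h * r Z X t
        pointwise t with bool (E t)
        ... | inj₂ p rewrite p | *-zeroʳ (h′ * # Z) = z≤n
        ... | inj₁ p rewrite p = (farkas (# Z ∷ h′ ∷ h * r Z X t ∷ []) ((con 1 :+ (con 1 :+ x1) :* x0 :≤ x2 :+ x0) ∷ []) (x1 :* x0 :* con 1) (x2) 0 (con 1 ∷ []) (≤ᵇ-true {suc (h * # Z)} p , tt))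

      result : Periodic S D α B h′ K
      result = record
        { W = λ w → E (w ⊝ z₀) ; H = H ; H-group = Stab-subgroup E
        ; W-inv = λ t p w → trans (cong E ((group-≡ (w ∷ t ∷ z₀ ∷ []) (gv 0 ⊞ gv 1 ⊟ gv 2) (gv 0 ⊟ gv 2 ⊞ gv 1)))) (Stab-elim E p (w ⊝ z₀))
        ; S∖W-size = ≤-trans (*-monoʳ-≤ h (#-mono (λ s p → ∧-intro (S⊆X s (∧-elimˡ p)) (∧-elimʳ p)))) (proj₂ (proj₂ base))
        ; W-size = ≤-trans (≤-reflexive (cong (h′ *_) (#-shift (⊖ z₀) E))) (≤-trans E-size (*-monoʳ-≤ h
            (≤-trans (out-bound z₀ X D) (+-monoʳ-≤ (# D) (rowZ z₀ (proj₁ (proj₂ base)))))))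
        ; H-size = (farkas (α ∷ B ∷ # Z ∷ # Pop ∷ # H ∷ []) ((con 1 :+ x0 :≤ x1 :* x2) ∷ (x2 :≤ con 2 :* x3) ∷ (x3 :≤ x4) ∷ []) (x0) (con 2 :* (x1 :* x4)) 0 (con 1 ∷ x1 ∷ con 2 :* x1 ∷ []) (large , Pop-size , #-mono Pop⊆H , tt)) }

-- Iterated sumsets

module Iter (G : FinAb) where

  open Sum
  open Grp
  open Conv G
  open Chain G

  eqG : Carrier → Carrier → Bool
  eqG x y = index x ≡ᵇ index y

  eqG-refl : ∀ x → eqG x x ≡ true
  eqG-refl x = δ-eq (index x)

  eqG-≡ : ∀ {x y} → eqG x y ≡ true → x ≡ y
  eqG-≡ {x} {y} p = trans (sym (enum-index x)) (trans (cong enum (δ-≡ p)) (enum-index y))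

  mul : ℕ → Carrier → Carrier
  mul zero    g = 𝟘
  mul (suc a) g = mul a g ⊕ g

  mul-+ : ∀ a b g → mul (a + b) g ≡ mul a g ⊕ mul b g
  mul-+ zero    b g = sym (idˡ _)
  mul-+ (suc a) b g = trans (cong (_⊕ g) (mul-+ a b g)) ((group-≡ (mul a g ∷ mul b g ∷ g ∷ []) (gv 0 ⊞ gv 1 ⊞ gv 2) (gv 0 ⊞ gv 2 ⊞ gv 1)))

  mul-∸ : ∀ {a b} g → b ≤ a → mul a g ⊝ mul b g ≡ mul (a ∸ b) g
  mul-∸ {a} {b} g b≤a = trans (cong (λ c → mul c g ⊝ mul b g) (sym (m∸n+n≡m b≤a)))
    (trans (cong (_⊝ mul b g) (mul-+ (a ∸ b) b g)) ((group-≡ (mul (a ∸ b) g ∷ mul b g ∷ []) (gv 0 ⊞ gv 1 ⊟ gv 1) (gv 0))))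

  disjoint-family : ∀ n (T : ℕ → Subset) (Ω : Subset) c →
    (∀ i → i < n → ∀ x → T i x ≡ true → Ω x ≡ true) →
    (∀ i j → i < n → j < n → ∀ x → T i x ≡ true → T j x ≡ true → i ≡ j) →
    (∀ i → i < n → c ≤ # (T i)) → n * c ≤ # Ω
  disjoint-family n T Ω c inside disj big = begin
    n * c                              ≡⟨ sym (∑-const n c) ⟩
    ∑ n (λ _ → c)                      ≤⟨ ∑-mono n big ⟩
    ∑ n (λ i → # (T i))                ≡⟨ ∑-cong n (λ i _ → #-Σ (T i)) ⟩
    ∑ n (λ i → Σ (λ x → ⟦ T i x ⟧))    ≡⟨ sym (Σ-∑-swap n (λ x i → ⟦ T i x ⟧)) ⟩
    Σ (λ x → ∑ n (λ i → ⟦ T i x ⟧))    ≤⟨ Σ-mono pointwise ⟩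
    Σ (λ x → ⟦ Ω x ⟧)                  ≡⟨ sym (#-Σ Ω) ⟩
    # Ω                                ∎
    where
    open ≤-Reasoning
    pointwise : ∀ x → ∑ n (λ i → ⟦ T i x ⟧) ≤ ⟦ Ω x ⟧
    pointwise x with bool (Ω x)
    ... | inj₁ p rewrite p = ∑-atmost1 n (λ i → T i x) (λ i j i<n j<n → disj i j i<n j<n x)
    ... | inj₂ p = ≤-trans (∑-mono n {g = λ _ → 0} none) (≤-trans (≤-reflexive (∑-zero n)) z≤n)
      where
      none : ∀ i → i < n → ⟦ T i x ⟧ ≤ 0
      none i i<n with bool (T i x)
      ... | inj₁ q = true≢false (inside i i<n x q) p
      ... | inj₂ q rewrite q = z≤n

  module Iterate (W : Subset) (W-0 : W 𝟘 ≡ true) (W-neg : ∀ x → W x ≡ true → W (⊖ x) ≡ true) where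

    abstract
      It : ℕ → Subset
      It zero    x = eqG x 𝟘
      It (suc n) x = any (λ y → It n y ∧ W (x ⊝ y))

      It-zero : It 0 𝟘 ≡ true
      It-zero = eqG-refl 𝟘

      It-zero⁻ : ∀ {x} → It 0 x ≡ true → x ≡ 𝟘
      It-zero⁻ = eqG-≡

      It-suc⁻ : ∀ {n x} → It (suc n) x ≡ true → ∃[ y ] It n y ≡ true × W (x ⊝ y) ≡ true
      It-suc⁻ p = let y , q = any-elim _ p in y , ∧-elimˡ q , ∧-elimʳ q

      It-step : ∀ {n x w} → It n x ≡ true → W w ≡ true → It (suc n) (x ⊕ w) ≡ true
      It-step {x = x} {w} p q = any-intro _ x (∧-intro p (trans (cong W ((group-≡ (x ∷ w ∷ []) (gv 0 ⊞ gv 1 ⊟ gv 0) (gv 1)))) q))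

    It-cast : ∀ {n x y} → x ≡ y → It n x ≡ true → It n y ≡ true
    It-cast refl p = p

    It-one : ∀ {x} → W x ≡ true → It 1 x ≡ true
    It-one {x} p = It-cast (idˡ x) (It-step It-zero p)

    It-suc : ∀ {n x} → It n x ≡ true → It (suc n) x ≡ true
    It-suc {x = x} p = It-cast (idʳ x) (It-step p W-0)

    It-+ : ∀ {m n x y} → It m x ≡ true → It n y ≡ true → It (m + n) (x ⊕ y) ≡ true
    It-+ {m} {zero} {x} {y} p q rewrite +-identityʳ m = It-cast (trans (sym (idʳ x)) (cong (x ⊕_) (sym (It-zero⁻ q)))) p
    It-+ {m} {suc n} {x} {y} p q rewrite +-suc m n = let z , u , w = It-suc⁻ q in
      It-cast ((group-≡ (x ∷ y ∷ z ∷ []) (gv 0 ⊞ gv 2 ⊞ (gv 1 ⊟ gv 2)) (gv 0 ⊞ gv 1))) (It-step (It-+ p u) w)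

    It-mono : ∀ {m n x} → m ≤ n → It m x ≡ true → It n x ≡ true
    It-mono {m} {n} m≤n p with k , refl ← m≤n⇒∃[o]m+o≡n m≤n = grow k
      where
      grow : ∀ k → It (m + k) _ ≡ true
      grow zero    rewrite +-identityʳ m = p
      grow (suc k) rewrite +-suc m k = It-suc (grow k)

    It-0 : ∀ n → It n 𝟘 ≡ true
    It-0 n = It-mono z≤n It-zero

    It-neg : ∀ {n x} → It n x ≡ true → It n (⊖ x) ≡ true
    It-neg {zero} {x} p = It-cast (trans (sym ((group-≡ ([]) (⊟ g0) (g0)))) (cong ⊖_ (sym (It-zero⁻ p)))) It-zero
    It-neg {suc n} {x} p = let y , q , w = It-suc⁻ p in
      It-cast ((group-≡ (x ∷ y ∷ []) (⊟ gv 1 ⊞ (⊟ (gv 0 ⊟ gv 1))) (⊟ gv 0))) (It-step (It-neg q) (W-neg _ w))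

    It-diff : ∀ {m n x y} → It m x ≡ true → It n y ≡ true → It (m + n) (x ⊝ y) ≡ true
    It-diff p q = It-+ p (It-neg q)

    It-mul : ∀ {k g} → It k g ≡ true → ∀ a → It (a * k) (mul a g) ≡ true
    It-mul p zero    = It-zero
    It-mul {k} p (suc a) = It-mono (≤-reflexive (+-comm (a * k) k)) (It-+ (It-mul p a) p)

    stable : ∀ n → (∀ x → It (suc n) x ≡ true → It n x ≡ true) → Subgroup (It n)
    stable n h = record { has-0 = It-0 n ; has-+ = λ p q → down n (It-+ p q) ; has-neg = It-neg }
      where
      down : ∀ k {x} → It (n + k) x ≡ true → It n x ≡ true
      down zero    p rewrite +-identityʳ n = p
      down (suc k) {x} p rewrite +-suc n k = let y , q , w = It-suc⁻ p in
        h x (It-cast ((group-≡ (x ∷ y ∷ []) (gv 1 ⊞ (gv 0 ⊟ gv 1)) (gv 0))) (It-step (down k q) w))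

    record Path (n : ℕ) (x : Carrier) : Set where
      field
        p    : ℕ → Carrier
        p-0  : p 0 ≡ 𝟘
        p-n  : p n ≡ x
        step : ∀ i → i < n → W (p (suc i) ⊝ p i) ≡ true

      p-diff : ∀ i k → i + k ≤ n → It k (p (i + k) ⊝ p i) ≡ true
      p-diff i zero    h rewrite +-identityʳ i = It-cast (sym ((group-≡ (p i ∷ []) (gv 0 ⊟ gv 0) (g0)))) It-zero
      p-diff i (suc k) h rewrite +-suc i k = It-cast ((group-≡ (p (suc (i + k)) ∷ p (i + k) ∷ p i ∷ []) (gv 1 ⊟ gv 2 ⊞ (gv 0 ⊟ gv 1)) (gv 0 ⊟ gv 2)))
        (It-step (p-diff i k (<⇒≤ h)) (step (i + k) h))

      p-It : ∀ k → k ≤ n → It k (p k) ≡ true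
      p-It k k≤n = It-cast (trans (cong (p k ⊝_) p-0) ((group-≡ (p k ∷ []) (gv 0 ⊟ g0) (gv 0)))) (p-diff 0 k k≤n)

    path : ∀ n {x} → It n x ≡ true → Path n x
    path zero    {x} q = record { p = λ _ → 𝟘 ; p-0 = refl ; p-n = sym (It-zero⁻ q) ; step = λ _ () }
    path (suc n) {x} q = record
      { p = p′ ; p-0 = trans (p′-≤ 0 z≤n) (Path.p-0 P) ; p-n = p′-> ; step = step′ }
      where
      open import Data.Bool.Base using (if_then_else_)
      y = proj₁ (It-suc⁻ q)
      P = path n (proj₁ (proj₂ (It-suc⁻ q)))
      p′ : ℕ → Carrier
      p′ i = if i ≤ᵇ n then Path.p P i else x
      p′-≤ : ∀ i → i ≤ n → p′ i ≡ Path.p P i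
      p′-≤ i h rewrite ≤ᵇ-intro h = refl
      p′-> : p′ (suc n) ≡ x
      p′-> with bool (suc n ≤ᵇ n)
      ... | inj₁ e = ⊥-elim (1+n≰n {n} (≤ᵇ-true {suc n} {n} e))
      ... | inj₂ e rewrite e = refl
      step′ : ∀ i → i < suc n → W (p′ (suc i) ⊝ p′ i) ≡ true
      step′ i (s≤s i≤n) with m≤n⇒m<n∨m≡n i≤n
      ... | inj₁ i<n  rewrite p′-≤ (suc i) i<n | p′-≤ i i≤n = Path.step P i i<n
      ... | inj₂ refl = trans (cong W (cong₂ _⊝_ p′-> (trans (p′-≤ n ≤-refl) (Path.p-n P)))) (proj₂ (proj₂ (It-suc⁻ q)))

module Thin (G : FinAb) where

  open Sum
  open Grp
  open Conv G
  open Chain G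
  open Iter G
  open import Data.Nat.DivMod
  open import Relation.Binary.Definitions using (tri<; tri≈; tri>)

  module Separated (W : Subset) (W-0 : W 𝟘 ≡ true) (W-neg : ∀ x → W x ≡ true → W (⊖ x) ≡ true)
    (R′ : ℕ) (far : Carrier)
    (P : Iterate.Path W W-0 W-neg (suc R′) far) (far∉ : Iterate.It W W-0 W-neg R′ far ≡ false) where

    open Iterate W W-0 W-neg
    open Path P

    R : ℕ
    R = suc R′

    geodesic : ∀ i k c → i + k ≤ R → It c (p (i + k) ⊝ p i) ≡ true → k ≤ c
    geodesic i k c h q with k ≤? c
    ... | yes k≤c = k≤c
    ... | no  k≰c = true≢false (It-mono short (It-cast (trans sum p-n) (It-+ (It-+ (p-It i (≤-trans (m≤m+n i k) h)) q)
          (subst (λ n → It (R ∸ (i + k)) (p n ⊝ p (i + k)) ≡ true) (m+[n∸m]≡n h) (p-diff (i + k) (R ∸ (i + k)) (≤-reflexive (m+[n∸m]≡n h))))))) far∉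
      where
      sum : p i ⊕ (p (i + k) ⊝ p i) ⊕ (p R ⊝ p (i + k)) ≡ p R
      sum = (group-≡ (p i ∷ p (i + k) ∷ p R ∷ []) (gv 0 ⊞ (gv 1 ⊟ gv 0) ⊞ (gv 2 ⊟ gv 1)) (gv 2))
      short : i + c + (R ∸ (i + k)) ≤ R′
      short = (farkas (i ∷ k ∷ c ∷ R ∸ (i + k) ∷ R′ ∷ []) ((x0 :+ x1 :+ x3 :≤ con 1 :+ x4) ∷ (con 1 :+ x2 :≤ x1) ∷ []) (x0 :+ x2 :+ x3) (x4) 0 (con 1 ∷ con 1 ∷ []) (≤-reflexive (m+[n∸m]≡n h) , ≰⇒> k≰c , tt))

    W>0 : 0 < # W
    W>0 = #>0 W 𝟘 W-0

    packing : ∀ k → 2 * k + 1 ≤ R → R * # (It k) ≤ 2 * (2 * k + 1) * # (It R)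
    packing k k≤R = (farkas (n ∷ k ∷ R ∷ # (It k) ∷ # (It R) ∷ []) ((x0 :* x3 :≤ x4) ∷ (con 1 :+ x2 :≤ (con 1 :+ x0) :* (con 2 :* x1 :+ con 1)) ∷ (con 1 :+ con 0 :≤ x0) ∷ []) (x2 :* x3) (con 2 :* (con 2 :* x1 :+ con 1) :* x4) 0 (con 2 :* (con 2 :* x1 :+ con 1) ∷ x3 ∷ con 2 :* (x1 :* x3) ∷ []) (packed , R< , n>0 , tt))
      where
      q : ℕ
      q = 2 * k + 1
      instance
        q≢0 : NonZero q
        q≢0 = >-nonZero (m≤n+m 1 (2 * k))
      n : ℕ
      n = R / q
      n>0 : 0 < n
      n>0 = m≥n⇒m/n>0 k≤R
      R< : R < (1 + n) * q
      R< = subst (_< (1 + n) * q) (sym (m≡m%n+[m/n]*n R q)) (+-monoˡ-< (n * q) (m%n<n R q))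
      nq≤R : n * q ≤ R
      nq≤R = m/n*n≤m R q
      T : ℕ → Subset
      T i y = It k (y ⊝ p (i * q))
      sep : ∀ i j → i < j → j < n → ∀ x → T i x ≡ true → T j x ≡ true → ⊥
      sep i j i<j j<n x u v = 1+n≰n {2 * k} (≤-trans ((farkas (i ∷ j ∷ q ∷ (j ∸ i) * q ∷ k ∷ []) ((x1 :* x2 :≤ x0 :* x2 :+ x3) ∷ (con 1 :+ x0 :≤ x1) ∷ (con 2 :* x4 :+ con 1 :≤ x2) ∷ []) (con 1 :+ con 2 :* x4) (x3) 0 (con 1 ∷ x2 ∷ con 1 ∷ []) (≤-reflexive eq , i<j , ≤-refl {q} , tt)))
        (≤-trans (geodesic (i * q) ((j ∸ i) * q) (k + k) (≤-trans (≤-reflexive (sym eq)) (≤-trans (*-monoˡ-≤ q (<⇒≤ j<n)) nq≤R))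
           (It-cast (trans ((group-≡ (x ∷ p (i * q) ∷ p (j * q) ∷ []) ((gv 0 ⊟ gv 1) ⊟ (gv 0 ⊟ gv 2)) (gv 2 ⊟ gv 1))) (cong (λ m → p m ⊝ p (i * q)) eq)) (It-diff u v))) (≤-reflexive ((ring-≡ (k ∷ []) (x0 :+ x0) (con 2 :* x0))))))
        where
        eq : j * q ≡ i * q + (j ∸ i) * q
        eq = trans (cong (_* q) (sym (m+[n∸m]≡n (<⇒≤ i<j)))) (*-distribʳ-+ q i (j ∸ i))
      packed : n * # (It k) ≤ # (It R)
      packed = disjoint-family n T (It R) (# (It k))
        (λ i i<n x u → It-mono ((farkas (i ∷ k ∷ n ∷ R ∷ q ∷ []) ((x2 :* x4 :≤ x3) ∷ (con 1 :+ x0 :≤ x2) ∷ (con 2 :* x1 :+ con 1 :≤ x4) ∷ []) (x1 :+ x0 :* x4) (x3) 1 (con 2 ∷ con 2 :* x4 ∷ con 1 ∷ []) (nq≤R , i<n , ≤-refl {q} , tt)))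
          (It-cast ((group-≡ (x ∷ p (i * q) ∷ []) (gv 0 ⊟ gv 1 ⊞ gv 1) (gv 0))) (It-+ u (p-It (i * q) (≤-trans (*-monoˡ-≤ q (<⇒≤ i<n)) nq≤R)))))
        disj
        (λ i _ → ≤-reflexive (sym (#-shift (⊖ p (i * q)) (It k))))
        where
        disj : ∀ i j → i < n → j < n → ∀ x → T i x ≡ true → T j x ≡ true → i ≡ j
        disj i j i<n j<n x u v with <-cmp i j
        ... | tri< i<j _ _ = ⊥-elim (sep i j i<j j<n x u v)
        ... | tri≈ _ e _   = e
        ... | tri> _ _ j<i = ⊥-elim (sep j i j<i i<n x v u)

  module Geodesic (W : Subset) (W-0 : W 𝟘 ≡ true) (W-neg : ∀ x → W x ≡ true → W (⊖ x) ≡ true)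
    (R′ : ℕ) (far : Carrier)
    (P : Iterate.Path W W-0 W-neg (suc R′) far) (far∉ : Iterate.It W W-0 W-neg R′ far ≡ false)
    (growth : # (Iterate.It W W-0 W-neg (suc R′)) ≤ 2 * (suc R′ * # W)) where

    open Iterate W W-0 W-neg
    open Path P
    open Separated W W-0 W-neg R′ far P far∉ public

    thin : ∀ k → 1 ≤ k → 2 * k + 1 ≤ R → # (It k) ≤ 12 * k * # W
    thin k k≥1 k≤R = *-cancelˡ-≤ R ((farkas (k ∷ # W ∷ R ∷ # (It k) ∷ # (It R) ∷ []) ((x2 :* x3 :≤ con 2 :* (con 2 :* x0 :+ con 1) :* x4) ∷ (x4 :≤ con 2 :* (x2 :* x1)) ∷ (con 1 :≤ x0) ∷ []) (x2 :* x3) (x2 :* (con 12 :* x0 :* x1)) 0 (con 1 ∷ con 2 :* (con 2 :* x0 :+ con 1) ∷ con 4 :* (x2 :* x1) ∷ []) (packing k k≤R , growth , k≥1 , tt)))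

    -- A point y close to many of the n consecutive 4-step displacements of the
    -- geodesic: since sums of such displacements are again geodesic, the
    -- multiples of y escape linearly.
    module Direction (m′ n : ℕ) (n-def : n ≡ 60 * suc m′) (4n≤R : n * 4 ≤ R) (11≤R : 11 ≤ R) where
      m : ℕ
      m = suc m′

      seg : ℕ → Carrier
      seg i = p (suc i * 4) ⊝ p (i * 4)

      seg∈ : ∀ i → i < n → It 4 (seg i) ≡ true
      seg∈ i i<n = subst (λ j → It 4 (p j ⊝ p (i * 4)) ≡ true) (+-comm (i * 4) 4)
        (p-diff (i * 4) 4 (≤-trans (≤-reflexive (+-comm (i * 4) 4)) (≤-trans (*-monoˡ-≤ 4 i<n) 4n≤R)))

      near : Carrier → ℕ
      near y = ∑ n (λ i → ⟦ W (y ⊝ seg i) ⟧)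

      near-total : Σ near ≡ n * # W
      near-total = trans (Σ-∑-swap n _) (trans (∑-cong n (λ i _ → trans (sym (#-Σ _)) (#-shift (⊖ seg i) W))) (∑-const n (# W)))

      near-It : ∀ y → 0 < near y → It 5 y ≡ true
      near-It y h = let i , i<n , q = ∑-exists n _ h in
        It-cast ((group-≡ (y ∷ seg i ∷ []) (gv 1 ⊞ (gv 0 ⊟ gv 1)) (gv 0))) (It-+ (seg∈ i i<n) (It-one (⟦⟧-true q)))

      abstract
        dir : ∃[ y ] m ≤ near y
        dir = let y , h = Σ-< {λ y → ⟦ It 5 y ⟧ * m′} {near} lt in y , pick y h
          where
          lt : Σ (λ y → ⟦ It 5 y ⟧ * m′) < Σ near
          lt = subst₂ _<_ (trans (cong (_* m′) (#-Σ (It 5))) (sym (Σ-*ʳ m′ _))) (sym near-total)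
            ((farkas (# (It 5) ∷ # W ∷ m′ ∷ n ∷ []) ((x0 :≤ con 12 :* con 5 :* x1) ∷ (con 1 :+ con 0 :≤ x1) ∷ (con 60 :* (con 1 :+ x2) :≤ x3) ∷ []) (con 1 :+ x0 :* x2) (x3 :* x1) 0 (x2 ∷ con 60 ∷ x1 ∷ []) (thin 5 (s≤s z≤n) 11≤R , W>0 , ≤-reflexive (sym n-def) , tt)))
          pick : ∀ y → ⟦ It 5 y ⟧ * m′ < near y → m ≤ near y
          pick y h with bool (It 5 y)
          ... | inj₁ q rewrite q = subst (_< near y) (+-identityʳ m′) h
          ... | inj₂ q = true≢false (near-It y (≤-<-trans z≤n h)) q

      g : Carrier
      g = proj₁ dir

      g∈ : It 5 g ≡ true
      g∈ = near-It g (≤-trans (s≤s z≤n) (proj₂ dir))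

      select : ∀ k → k ≤ n → ∀ a → a ≤ ∑ k (λ i → ⟦ W (g ⊝ seg i) ⟧) →
               ∃[ b ] ∃[ s ] ∃[ u ] a + b ≡ k × s ⊕ u ≡ p (k * 4) × It a (mul a g ⊝ s) ≡ true × It (b * 4) u ≡ true
      select zero    _   zero    _ = 0 , 𝟘 , 𝟘 , refl , trans (idˡ 𝟘) (sym p-0) , It-cast (sym ((group-≡ ([]) (g0 ⊟ g0) (g0)))) It-zero , It-zero
      select (suc k) k<n a h with a ≤? ∑ k (λ i → ⟦ W (g ⊝ seg i) ⟧)
      ... | yes a≤ = let b , s , u , e , f , x , y = select k (<⇒≤ k<n) a a≤ in
        suc b , s , u ⊕ seg k , trans (+-suc a b) (cong suc e)
        , trans ((group-≡ (s ∷ u ∷ p (suc k * 4) ∷ p (k * 4) ∷ []) (gv 0 ⊞ (gv 1 ⊞ (gv 2 ⊟ gv 3))) (gv 0 ⊞ gv 1 ⊞ (gv 2 ⊟ gv 3)))) (advance (s ⊕ u) f)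
        , x , It-mono (≤-reflexive (+-comm (b * 4) 4)) (It-+ y (seg∈ k k<n))
        where
        advance : ∀ z → z ≡ p (k * 4) → z ⊕ seg k ≡ p (suc k * 4)
        advance z e = trans (cong (_⊕ seg k) e) ((group-≡ (p (suc k * 4) ∷ p (k * 4) ∷ []) (gv 1 ⊞ (gv 0 ⊟ gv 1)) (gv 0)))
      ... | no a≰ = take a (bool (W (g ⊝ seg k))) h a≰
        where
        advance : ∀ z → z ≡ p (k * 4) → z ⊕ seg k ≡ p (suc k * 4)
        advance z e = trans (cong (_⊕ seg k) e) ((group-≡ (p (suc k * 4) ∷ p (k * 4) ∷ []) (gv 1 ⊞ (gv 0 ⊟ gv 1)) (gv 0)))
        take : ∀ a → (W (g ⊝ seg k) ≡ true) ⊎ (W (g ⊝ seg k) ≡ false) →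
               a ≤ ⟦ W (g ⊝ seg k) ⟧ + ∑ k (λ i → ⟦ W (g ⊝ seg i) ⟧) → ¬ (a ≤ ∑ k (λ i → ⟦ W (g ⊝ seg i) ⟧)) →
               ∃[ b ] ∃[ s ] ∃[ u ] a + b ≡ suc k × s ⊕ u ≡ p (suc k * 4) × It a (mul a g ⊝ s) ≡ true × It (b * 4) u ≡ true
        take a       (inj₂ q) h a≰ = ⊥-elim (a≰ (subst (λ c → a ≤ ⟦ c ⟧ + ∑ k (λ i → ⟦ W (g ⊝ seg i) ⟧)) q h))
        take zero    (inj₁ q) h a≰ = ⊥-elim (a≰ z≤n)
        take (suc a) (inj₁ q) h a≰ =
          let b , s , u , e , f , x , y = select k (<⇒≤ k<n) a (s≤s⁻¹ (subst (λ c → suc a ≤ ⟦ c ⟧ + ∑ k (λ i → ⟦ W (g ⊝ seg i) ⟧)) q h)) in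
          b , s ⊕ seg k , u , cong suc e
          , trans ((group-≡ (s ∷ u ∷ p (suc k * 4) ∷ p (k * 4) ∷ []) (gv 0 ⊞ (gv 2 ⊟ gv 3) ⊞ gv 1) (gv 0 ⊞ gv 1 ⊞ (gv 2 ⊟ gv 3)))) (advance (s ⊕ u) f)
          , It-cast ((group-≡ (mul a g ∷ s ∷ g ∷ seg k ∷ []) (gv 0 ⊟ gv 1 ⊞ (gv 2 ⊟ gv 3)) (gv 0 ⊞ gv 2 ⊟ (gv 1 ⊞ gv 3)))) (It-step x q) , y

      escape : ∀ a c → a ≤ m → It c (mul a g) ≡ true → 3 * a ≤ c
      escape a c a≤m q = let b , s , u , e , f , x , y = select n ≤-refl a (≤-trans a≤m (proj₂ dir)) in
        let far-sum = geodesic 0 (n * 4) (c + a + b * 4) 4n≤R (It-cast (trans (trans ((group-≡ (mul a g ∷ s ∷ u ∷ []) (gv 0 ⊟ (gv 0 ⊟ gv 1) ⊞ gv 2) (gv 1 ⊞ gv 2))) f)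
                        (trans ((group-≡ (p (n * 4) ∷ []) (gv 0) (gv 0 ⊟ g0))) (cong (p (n * 4) ⊝_) (sym p-0)))) (It-+ (It-diff q x) y))
        in (farkas (a ∷ b ∷ c ∷ n ∷ []) ((x3 :* con 4 :≤ x2 :+ x0 :+ x1 :* con 4) ∷ (x0 :+ x1 :≤ x3) ∷ []) (con 3 :* x0) (x2) 0 (con 1 ∷ con 4 ∷ []) (far-sum , ≤-reflexive e , tt))

module Star (G : FinAb) where

  open Sum
  open Grp
  open Conv G
  open Iter G
  open Thin G
  open import Relation.Binary.Definitions using (tri<; tri≈; tri>)

  module Covering (W : Subset) (W-0 : W 𝟘 ≡ true) (W-neg : ∀ x → W x ≡ true → W (⊖ x) ≡ true)
    (R′ : ℕ) (far : Carrier)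
    (P : Iterate.Path W W-0 W-neg (suc R′) far) (far∉ : Iterate.It W W-0 W-neg R′ far ≡ false)
    (growth : # (Iterate.It W W-0 W-neg (suc R′)) ≤ 2 * (suc R′ * # W))
    (m′ n : ℕ) (n-def : n ≡ 60 * suc m′) (4n≤R : n * 4 ≤ suc R′) (1439≤R : 1439 ≤ suc R′) (72≤m : 72 ≤ suc m′) where

    open Iterate W W-0 W-neg
    open Geodesic W W-0 W-neg R′ far P far∉ growth
    open Direction m′ n n-def 4n≤R (≤-trans (≤ᵇ-true {11} {1439} refl) 1439≤R)

    private
      Rep : Carrier → Bool
      Rep u = anyN 72 (λ a → anyN 72 (λ b → It 362 (u ⊕ mul a g ⊝ mul b g)))

      -- Otherwise 121 · 72 disjoint translates of W would fit into a set of size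
      -- at most 12 · 719 · #W.
      no-escape : ∀ u → Path 363 u → Rep u ≡ false → ⊥
      no-escape u Q none = <⇒≱ ((farkas (# W ∷ # (It 719) ∷ []) ((con 1 :+ con 0 :≤ x0) ∷ (x1 :≤ con 12 :* con 719 :* x0) ∷ []) (con 1 :+ x1) (con 121 :* (con 72 :* x0)) 0 (con 1 ∷ con 1 ∷ []) (W>0 , thin 719 (s≤s z≤n) 1439≤R , tt))) packed
        where
        module Q = Path Q
        q : ℕ → Carrier
        q i = Q.p (3 * suc i)
        q≤ : ∀ i → i < 121 → 3 * suc i ≤ 363
        q≤ i i< = *-monoʳ-≤ 3 i<
        row : ∀ i a → Subset
        row i a y = W (y ⊝ q i ⊝ mul a g)
        T : ℕ → Subset
        T i y = anyN 72 (λ a → row i a y)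
        T-big : ∀ i → i < 121 → 72 * # W ≤ # (T i)
        T-big i _ = disjoint-family 72 (row i) (T i) (# W)
          (λ a a< x p → anyN-intro 72 (λ a → row i a x) a a< p) disj
          (λ a _ → ≤-reflexive (sym (trans (#-shift (⊖ q i) (λ y → W (y ⊝ mul a g)))
             (#-shift (⊖ mul a g) W))))
          where
          sep : ∀ a b → a < b → b < 72 → ∀ x → row i a x ≡ true → row i b x ≡ true → ⊥
          sep a b a<b b< x p r = 1+n≰n {2} (≤-trans
            ((farkas (a ∷ b ∷ b ∸ a ∷ []) ((x1 :≤ x0 :+ x2) ∷ (con 1 :+ x0 :≤ x1) ∷ []) (con 3) (con 3 :* x2) 0 (con 3 ∷ con 3 ∷ []) (≤-reflexive (sym (m+[n∸m]≡n (<⇒≤ a<b))) , a<b , tt)))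
            (escape (b ∸ a) 2 (≤-trans (m∸n≤m b a) (≤-trans (<⇒≤ b<) 72≤m))
              (It-cast (trans ((group-≡ (x ∷ q i ∷ mul a g ∷ mul b g ∷ []) ((gv 0 ⊟ gv 1 ⊟ gv 2) ⊟ (gv 0 ⊟ gv 1 ⊟ gv 3)) (gv 3 ⊟ gv 2))) (mul-∸ g (<⇒≤ a<b)))
                (It-diff (It-one p) (It-one r)))))
          disj : ∀ a b → a < 72 → b < 72 → ∀ x → row i a x ≡ true → row i b x ≡ true → a ≡ b
          disj a b a< b< x p r with <-cmp a b
          ... | tri< a<b _ _ = ⊥-elim (sep a b a<b b< x p r)
          ... | tri≈ _ e _   = e
          ... | tri> _ _ b<a = ⊥-elim (sep b a b<a a< x r p)
        sep : ∀ i j → j < i → i < 121 → ∀ x → T i x ≡ true → T j x ≡ true → ⊥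
        sep i j j<i i< x s t =
          let a , a< , p = anyN-elim 72 (λ a → row i a x) s
              b , b< , r = anyN-elim 72 (λ b → row j b x) t
              k = 363 ∸ 3 * suc i
              rest = Q.p-diff (3 * suc i) k (≤-reflexive (m+[n∸m]≡n (q≤ i i<)))
              close = It-+ (It-diff (It-one r) (It-one p)) (Q.p-It (3 * suc j) (q≤ j (<-trans j<i i<)))
              all′ = It-+ close (subst (λ N → It k (Q.p N ⊝ q i) ≡ true) (m+[n∸m]≡n (q≤ i i<)) rest)
          in true≢false (anyN-intro 72 _ a a< (anyN-intro 72 _ b b< (It-mono
               ((farkas (i ∷ j ∷ k ∷ []) ((con 3 :* (con 1 :+ x0) :+ x2 :≤ con 363) ∷ (con 1 :+ x1 :≤ x0) ∷ []) (con 2 :+ con 3 :* (con 1 :+ x1) :+ x2) (con 362) 0 (con 1 ∷ con 3 ∷ []) (≤-reflexive (m+[n∸m]≡n (q≤ i i<)) , j<i , tt)))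
               (It-cast (trans ((group-≡ (x ∷ q i ∷ q j ∷ mul a g ∷ mul b g ∷ Q.p 363 ∷ []) ((gv 0 ⊟ gv 2 ⊟ gv 4) ⊟ (gv 0 ⊟ gv 1 ⊟ gv 3) ⊞ gv 2 ⊞ (gv 5 ⊟ gv 1)) (gv 5 ⊞ gv 3 ⊟ gv 4)))
                  (cong (λ z → z ⊕ mul a g ⊝ mul b g) Q.p-n)) all′)))) none
        packed : 121 * (72 * # W) ≤ # (It 719)
        packed = disjoint-family 121 T (It 719) (72 * # W) inside disj T-big
          where
          inside : ∀ i → i < 121 → ∀ x → T i x ≡ true → It 719 x ≡ true
          inside i i< x s = let a , a< , p = anyN-elim 72 (λ a → row i a x) s in
            It-mono ((farkas (a ∷ i ∷ []) ((con 1 :+ x0 :≤ con 72) ∷ (con 1 :+ x1 :≤ con 121) ∷ []) (con 1 :+ con 3 :* (con 1 :+ x1) :+ x0 :* con 5) (con 719) 0 (con 5 ∷ con 3 ∷ []) (a< , i< , tt)))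
              (It-cast ((group-≡ (x ∷ q i ∷ mul a g ∷ []) (gv 0 ⊟ gv 1 ⊟ gv 2 ⊞ gv 1 ⊞ gv 2) (gv 0)))
                (It-+ (It-+ (It-one p) (Q.p-It (3 * suc i) (q≤ i i<))) (It-mul g∈ a)))
          disj : ∀ i j → i < 121 → j < 121 → ∀ x → T i x ≡ true → T j x ≡ true → i ≡ j
          disj i j i< j< x s t with <-cmp i j
          ... | tri< i<j _ _ = ⊥-elim (sep j i i<j j< x t s)
          ... | tri≈ _ e _   = e
          ... | tri> _ _ j<i = ⊥-elim (sep i j j<i i< x s t)

    star : ∀ u → It 363 u ≡ true → ∃[ a ] ∃[ b ] a ≤ 71 × b ≤ 71 × It 362 (u ⊕ mul a g ⊝ mul b g) ≡ true
    star u u∈ with bool (Rep u)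
    ... | inj₂ none = ⊥-elim (no-escape u (path 363 u∈) none)
    ... | inj₁ p    = let a , a< , q = anyN-elim 72 _ p ; b , b< , r = anyN-elim 72 _ q in a , b , s≤s⁻¹ a< , s≤s⁻¹ b< , r

    represent : ∀ k t → It (k + 362) t ≡ true →
                ∃[ a ] ∃[ b ] a ≤ k * 71 × b ≤ k * 71 × It 362 (t ⊕ mul a g ⊝ mul b g) ≡ true
    represent zero    t p = 0 , 0 , z≤n , z≤n , It-cast ((group-≡ (t ∷ []) (gv 0) (gv 0 ⊞ g0 ⊟ g0))) p
    represent (suc k) t p =
      let y , q , w = It-suc⁻ p
          a , b , a≤ , b≤ , r = represent k y q
          a′ , b′ , a′≤ , b′≤ , r′ = star _ (It-step r w)
      in a + a′ , b + b′ , ≤-trans (+-mono-≤ a≤ a′≤) (≤-reflexive (+-comm (k * 71) 71)) , ≤-trans (+-mono-≤ b≤ b′≤) (≤-reflexive (+-comm (k * 71) 71))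
         , It-cast (trans ((group-≡ (t ∷ y ∷ mul a g ∷ mul b g ∷ mul a′ g ∷ mul b′ g ∷ []) (gv 1 ⊞ gv 2 ⊟ gv 3 ⊞ (gv 0 ⊟ gv 1) ⊞ gv 4 ⊟ gv 5) (gv 0 ⊞ (gv 2 ⊞ gv 4) ⊟ (gv 3 ⊞ gv 5))))
             (sym (cong₂ (λ u v → t ⊕ u ⊝ v) (mul-+ a a′ g) (mul-+ b b′ g)))) r′

module Flux (G : FinAb) where

  open Sum
  open Grp
  open Conv G
  open Chain G
  open Iter G
  open Thin G
  open Star G

  module Transfer (W : Subset) (W-0 : W 𝟘 ≡ true) (W-neg : ∀ x → W x ≡ true → W (⊖ x) ≡ true)
    (R′ : ℕ) (far : Carrier)
    (P : Iterate.Path W W-0 W-neg (suc R′) far) (far∉ : Iterate.It W W-0 W-neg R′ far ≡ false)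
    (growth : # (Iterate.It W W-0 W-neg (suc R′)) ≤ 2 * (suc R′ * # W))
    (m′ n : ℕ) (n-def : n ≡ 60 * suc m′) (4n≤R : n * 4 ≤ suc R′) (big≤R : 258469 ≤ suc R′)
    (Ka : ℕ) (10≤Ka : 10 ≤ Ka) (Ka≤m : Ka * 200 + 1100 ≤ suc m′) where

    open Iterate W W-0 W-neg
    open Geodesic W W-0 W-neg R′ far P far∉ growth
    private
      72≤m : 72 ≤ suc m′
      72≤m = ≤-trans (≤ᵇ-true {72} {1100} refl) (≤-trans (m≤n+m 1100 (Ka * 200)) Ka≤m)
      1439≤R : 1439 ≤ suc R′
      1439≤R = ≤-trans (≤ᵇ-true {1439} {258469} refl) big≤R
    open Direction m′ n n-def 4n≤R (≤-trans (≤ᵇ-true {11} {1439} refl) 1439≤R) public using (g; g∈)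
    open Direction m′ n n-def 4n≤R (≤-trans (≤ᵇ-true {11} {1439} refl) 1439≤R) using (m; escape)
    open Covering W W-0 W-neg R′ far P far∉ growth m′ n n-def 4n≤R 1439≤R 72≤m using (represent) public

    -- A half-line in the direction g, thickened to the width of the local group.
    Half : Subset
    Half y = anyN (suc m) (λ a → It 362 (y ⊝ mul a g))

    Half-intro : ∀ y a → a ≤ m → It 362 (y ⊝ mul a g) ≡ true → Half y ≡ true
    Half-intro y a a≤m p = anyN-intro (suc m) _ a (s≤s a≤m) p

    Half-elim : ∀ y → Half y ≡ true → ∃[ a ] a ≤ m × It 362 (y ⊝ mul a g) ≡ true
    Half-elim y p = let a , a< , q = anyN-elim (suc m) _ p in a , s≤s⁻¹ a< , q

    height : ∀ y a K → a ≤ m → It K y ≡ true → It 362 (y ⊝ mul a g) ≡ true → 3 * a ≤ K + 362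
    height y a K a≤m p q = escape a (K + 362) a≤m (It-cast ((group-≡ (y ∷ mul a g ∷ []) (gv 0 ⊟ (gv 0 ⊟ gv 1)) (gv 1))) (It-diff p q))

    private
      half-shift : ∀ t Kt y K → Kt ≤ Ka → It Kt t ≡ true → It K y ≡ true → K ≤ Ka * 359 + 362 →
                   Half y ≡ true → (Half (y ⊝ t) ≡ true) ⊎ (It (Kt * 355 + 362) y ≡ true)
      half-shift t Kt y K Kt≤ t∈ y∈ K≤ p =
        let a , a≤m , q = Half-elim y p
            c , d , c≤ , d≤ , s = represent Kt (y ⊝ mul a g ⊝ t) (It-mono (≤-reflexive (+-comm 362 Kt)) (It-diff q t∈))
        in move a a≤m q c d c≤ d≤ s
        where
        move : ∀ a → a ≤ m → It 362 (y ⊝ mul a g) ≡ true → ∀ c d → c ≤ Kt * 71 → d ≤ Kt * 71 →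
               It 362 (y ⊝ mul a g ⊝ t ⊕ mul c g ⊝ mul d g) ≡ true → (Half (y ⊝ t) ≡ true) ⊎ (It (Kt * 355 + 362) y ≡ true)
        move a a≤m q c d c≤ d≤ s with c ≤? a
        ... | yes c≤a = inj₁ (Half-intro (y ⊝ t) (a ∸ c + d)
              (*-cancelˡ-≤ 3 ((farkas (a ∷ d ∷ a ∸ c ∷ K ∷ Kt ∷ Ka ∷ m ∷ []) ((con 3 :* x0 :≤ x3 :+ con 362) ∷ (x2 :≤ x0) ∷ (x1 :≤ x4 :* con 71) ∷ (x4 :≤ x5) ∷ (x3 :≤ x5 :* con 359 :+ con 362) ∷ (x5 :* con 200 :+ con 1100 :≤ x6) ∷ []) (con 3 :* (x2 :+ x1)) (con 3 :* x6) 49 (con 50 ∷ con 150 ∷ con 150 ∷ con 10650 ∷ con 50 ∷ con 143 ∷ []) (height y a K a≤m y∈ q , m∸n≤m a c , d≤ , Kt≤ , K≤ , Ka≤m , tt))))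
              (It-cast (trans ((group-≡ (y ∷ t ∷ mul a g ∷ mul c g ∷ mul d g ∷ []) (gv 0 ⊟ gv 2 ⊟ gv 1 ⊞ gv 3 ⊟ gv 4) (gv 0 ⊟ gv 1 ⊟ (gv 2 ⊟ gv 3 ⊞ gv 4))))
                 (cong (y ⊝ t ⊝_) (trans (cong (_⊕ mul d g) (mul-∸ g c≤a)) (sym (mul-+ (a ∸ c) d g))))) s))
        ... | no c≰a = inj₂ (It-mono ((farkas (a ∷ c ∷ Kt ∷ []) ((con 1 :+ x0 :≤ x1) ∷ (x1 :≤ x2 :* con 71) ∷ []) (con 362 :+ x0 :* con 5) (x2 :* con 355 :+ con 362) 0 (con 5 ∷ con 5 ∷ []) (≰⇒> c≰a , c≤ , tt)))
              (It-cast ((group-≡ (y ∷ mul a g ∷ []) (gv 0 ⊟ gv 1 ⊞ gv 1) (gv 0))) (It-+ q (It-mul g∈ a))))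

    half-inv : ∀ t Kt y → Kt ≤ Ka → It Kt t ≡ true → It (Ka * 358 + 362) y ≡ true →
               It (Kt * 356 + 362) y ≡ false → Half y ≡ Half (y ⊝ t)
    half-inv t Kt y Kt≤ t∈ y∈ y∉ = iff-≡ to from
      where
      to : Half y ≡ true → Half (y ⊝ t) ≡ true
      to p = [ (λ q → q) , (λ q → true≢false (It-mono ((farkas (Kt ∷ []) ([]) (x0 :* con 355 :+ con 362) (x0 :* con 356 :+ con 362) 0 ([]) (tt))) q) y∉) ]′
        (half-shift t Kt y (Ka * 358 + 362) Kt≤ t∈ y∈ ((farkas (Ka ∷ []) ([]) (x0 :* con 358 :+ con 362) (x0 :* con 359 :+ con 362) 0 ([]) (tt))) p)
      from : Half (y ⊝ t) ≡ true → Half y ≡ true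
      from p = [ (λ q → trans (cong Half ((group-≡ (y ∷ t ∷ []) (gv 0) (gv 0 ⊟ gv 1 ⊟ (⊟ gv 1))))) q)
               , (λ q → true≢false (It-mono ((farkas (Kt ∷ []) ([]) (x0 :* con 355 :+ con 362 :+ x0) (x0 :* con 356 :+ con 362) 0 ([]) (tt)))
                        (It-cast ((group-≡ (y ∷ t ∷ []) (gv 0 ⊟ gv 1 ⊞ gv 1) (gv 0))) (It-+ q t∈))) y∉) ]′
        (half-shift (⊖ t) Kt (y ⊝ t) (Ka * 358 + 362 + Kt) Kt≤ (It-neg t∈) (It-diff y∈ t∈)
          ((farkas (Ka ∷ Kt ∷ []) ((x1 :≤ x0) ∷ []) (x0 :* con 358 :+ con 362 :+ x1) (x0 :* con 359 :+ con 362) 0 (con 1 ∷ []) (Kt≤ , tt))) p)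

    abstract
      Zone : Subset
      Zone = It (Ka * 357 + 362)

      -- A − level t is the net number of points of the half-line crossing its end
      -- under translation by t; it is additive in t.
      level : Carrier → ℕ
      level t = # (λ y → Zone y ∧ Half (y ⊝ t))

      A : ℕ
      A = level 𝟘

      A-def : level 𝟘 ≡ A
      A-def = refl

      level-+ : ∀ s t → It Ka s ≡ true → It Ka t ≡ true → A + level (s ⊕ t) ≡ level s + level t
      level-+ s t s∈ t∈ = begin
        A + level (s ⊕ t)
          ≡⟨ cong₂ _+_ (#-cong (λ y → cong (λ z → Zone y ∧ Half z) ((group-≡ (y ∷ []) (gv 0 ⊟ g0) (gv 0)))))
                       (trans (sym (#-shift s _)) (#-cong (λ y → cong (λ z → Zone (y ⊕ s) ∧ Half z) ((group-≡ (y ∷ s ∷ t ∷ []) (gv 0 ⊞ gv 1 ⊟ (gv 1 ⊞ gv 2)) (gv 0 ⊟ gv 2)))))) ⟩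
        # (λ y → Zone y ∧ Half y) + # (λ y → Zone (y ⊕ s) ∧ Half (y ⊝ t))
          ≡⟨ trans (cong₂ _+_ (#-Σ _) (#-Σ _)) (trans (sym (Σ-+ _ _)) (trans (Σ-cong pointwise) (trans (Σ-+ _ _) (sym (cong₂ _+_ (#-Σ _) (#-Σ _)))))) ⟩
        # (λ y → Zone (y ⊕ s) ∧ Half y) + # (λ y → Zone y ∧ Half (y ⊝ t))
          ≡⟨ cong (_+ level t) (sym (trans (sym (#-shift s _)) (#-cong (λ y → cong (λ z → Zone (y ⊕ s) ∧ Half z) ((group-≡ (y ∷ s ∷ []) (gv 0 ⊞ gv 1 ⊟ gv 1) (gv 0))))))) ⟩
        level s + level t ∎
        where
        open ≡-Reasoning
        edge : ∀ y → Zone y ≡ true ⊎ Zone (y ⊕ s) ≡ true → Zone y ≡ false ⊎ Zone (y ⊕ s) ≡ false → Half y ≡ Half (y ⊝ t)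
        edge y some miss = half-inv t Ka y ≤-refl t∈ (inner some) (outer (bool _) miss)
          where
          inner : Zone y ≡ true ⊎ Zone (y ⊕ s) ≡ true → It (Ka * 358 + 362) y ≡ true
          inner (inj₁ p) = It-mono ((farkas (Ka ∷ []) ([]) (x0 :* con 357 :+ con 362) (x0 :* con 358 :+ con 362) 0 ([]) (tt))) p
          inner (inj₂ p) = It-mono ((farkas (Ka ∷ []) ([]) (x0 :* con 357 :+ con 362 :+ x0) (x0 :* con 358 :+ con 362) 0 ([]) (tt))) (It-cast ((group-≡ (y ∷ s ∷ []) (gv 0 ⊞ gv 1 ⊟ gv 1) (gv 0))) (It-diff p s∈))
          outer : (It (Ka * 356 + 362) y ≡ true) ⊎ (It (Ka * 356 + 362) y ≡ false) → Zone y ≡ false ⊎ Zone (y ⊕ s) ≡ false → It (Ka * 356 + 362) y ≡ false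
          outer (inj₂ q) _        = q
          outer (inj₁ q) (inj₁ z) = true≢false (It-mono ((farkas (Ka ∷ []) ([]) (x0 :* con 356 :+ con 362) (x0 :* con 357 :+ con 362) 0 ([]) (tt))) q) z
          outer (inj₁ q) (inj₂ z) = true≢false (It-mono ((farkas (Ka ∷ []) ([]) (x0 :* con 356 :+ con 362 :+ x0) (x0 :* con 357 :+ con 362) 0 ([]) (tt))) (It-+ q s∈)) z
        pointwise : ∀ y → ⟦ Zone y ∧ Half y ⟧ + ⟦ Zone (y ⊕ s) ∧ Half (y ⊝ t) ⟧ ≡ ⟦ Zone (y ⊕ s) ∧ Half y ⟧ + ⟦ Zone y ∧ Half (y ⊝ t) ⟧
        pointwise y = bits (Zone y) (Zone (y ⊕ s)) refl refl
          where
          bits : ∀ a b → Zone y ≡ a → Zone (y ⊕ s) ≡ b → ⟦ a ∧ Half y ⟧ + ⟦ b ∧ Half (y ⊝ t) ⟧ ≡ ⟦ b ∧ Half y ⟧ + ⟦ a ∧ Half (y ⊝ t) ⟧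
          bits true  true  p q = refl
          bits false false p q = refl
          bits true  false p q = trans (+-identityʳ ⟦ Half y ⟧) (cong ⟦_⟧ (edge y (inj₁ p) (inj₂ q)))
          bits false true  p q = trans (cong ⟦_⟧ (sym (edge y (inj₂ q) (inj₁ p)))) (sym (+-identityʳ ⟦ Half y ⟧))

      level-bound : ∀ Kt t → Kt ≤ Ka → It Kt t ≡ true →
                    level t ≤ A + # (It (Kt * 356 + 362)) × A ≤ level t + # (It (Kt * 356 + 362))
      level-bound Kt t Kt≤ t∈ = #-cover (λ y p q → near y (∧-elimˡ p) (λ e → true≢false (∧-intro (∧-elimˡ p) (trans (undo y) (trans e (∧-elimʳ {Zone y} p)))) q))
                              , #-cover (λ y p q → near y (∧-elimˡ p) (λ e → true≢false (∧-intro (∧-elimˡ p) (trans (sym e) (trans (sym (undo y)) (∧-elimʳ {Zone y} p)))) q))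
        where
        undo : ∀ y → Half (y ⊝ 𝟘) ≡ Half y
        undo y = cong Half ((group-≡ (y ∷ []) (gv 0 ⊟ g0) (gv 0)))
        near : ∀ y → Zone y ≡ true → (Half y ≡ Half (y ⊝ t) → ⊥) → It (Kt * 356 + 362) y ≡ true
        near y z h with bool (It (Kt * 356 + 362) y)
        ... | inj₁ p = p
        ... | inj₂ p = ⊥-elim (h (half-inv t Kt y Kt≤ t∈ (It-mono ((farkas (Ka ∷ []) ([]) (x0 :* con 357 :+ con 362) (x0 :* con 358 :+ con 362) 0 ([]) (tt))) z) p))

      nD : ℕ
      nD = # (λ y → (Zone y ∧ Half y) ∧ not (Half (y ⊝ g)))

      level-g : level g + nD ≡ A
      level-g = sym (trans (#-cong (λ y → cong (λ z → Zone y ∧ Half z) ((group-≡ (y ∷ []) (gv 0 ⊟ g0) (gv 0)))))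
        (trans (#-split _ (λ y → Half (y ⊝ g))) (cong (_+ nD) (#-cong (λ y → iff-≡ (λ p → ∧-intro (∧-elimˡ {Zone y} (∧-elimˡ p)) (∧-elimʳ {Zone y ∧ Half y} p))
          (λ p → ∧-intro (∧-intro (∧-elimˡ p) (back y (∧-elimˡ p) (∧-elimʳ {Zone y} p))) (∧-elimʳ {Zone y} p)))))))
        where
        back : ∀ y → Zone y ≡ true → Half (y ⊝ g) ≡ true → Half y ≡ true
        back y z p = let a , a≤m , q = Half-elim _ p in
          Half-intro y (suc a) (*-cancelˡ-≤ 3 ((farkas (a ∷ Ka ∷ m ∷ []) ((con 3 :* x0 :≤ x1 :* con 357 :+ con 362 :+ con 5 :+ con 362) ∷ (x1 :* con 200 :+ con 1100 :≤ x2) ∷ []) (con 3 :* (con 1 :+ x0)) (con 3 :* x2) 199 (con 200 ∷ con 357 ∷ []) (height (y ⊝ g) a (Ka * 357 + 362 + 5) a≤m (It-diff z g∈) q , Ka≤m , tt))))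
            (It-cast ((group-≡ (y ∷ g ∷ mul a g ∷ []) (gv 0 ⊟ gv 1 ⊟ gv 2) (gv 0 ⊟ (gv 2 ⊞ gv 1)))) q)

      W≤nD : ∀ N → N ≡ 362 → # W ≤ N * nD
      W≤nD N N≡ = begin
        # W                                        ≡⟨ #-Σ W ⟩
        Σ (λ y → ⟦ W y ⟧)                           ≤⟨ Σ-mono pointwise ⟩
        Σ (λ y → ∑ N (λ a → ⟦ row a y ⟧))         ≡⟨ Σ-∑-swap N _ ⟩
        ∑ N (λ a → Σ (λ y → ⟦ row a y ⟧))         ≡⟨ ∑-cong N (λ a _ → sym (#-Σ (row a))) ⟩
        ∑ N (λ a → # (row a))                    ≤⟨ ∑-mono N small ⟩
        ∑ N (λ _ → nD)                           ≡⟨ ∑-const N nD ⟩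
        N * nD ∎
        where
        open ≤-Reasoning
        row : ℕ → Subset
        row a y = W y ∧ (Half (y ⊝ mul a g) ∧ not (Half (y ⊝ mul a g ⊝ g)))
        small : ∀ a → a < N → # (row a) ≤ nD
        small a a< = #-subst (⊖ mul a g) (λ y p → ∧-intro (∧-intro
            (It-mono ((farkas (a ∷ Ka ∷ N ∷ []) ((con 1 :+ x0 :≤ x2) ∷ (x2 :≤ con 362) ∷ (con 10 :≤ x1) ∷ []) (con 1 :+ x0 :* con 5) (x1 :* con 357 :+ con 362) 4 (con 25 ∷ con 25 ∷ con 722 ∷ []) (a< , ≤-reflexive N≡ , 10≤Ka , tt))) (It-diff (It-one (∧-elimˡ p)) (It-mul g∈ a)))
            (∧-elimˡ (∧-elimʳ {W y} p))) (∧-elimʳ {Half (y ⊝ mul a g)} (∧-elimʳ {W y} p)))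
        far-false : ∀ y → W y ≡ true → Half (y ⊝ mul N g) ≡ false
        far-false y w with bool (Half (y ⊝ mul N g))
        ... | inj₂ p = p
        ... | inj₁ p =
          let a , a≤m , q = Half-elim _ p
              h₁ = height (y ⊝ mul N g) a (1 + N * 5) a≤m (It-diff (It-one w) (It-mul g∈ N)) q
              h₂ = height y (a + N) 1 ((farkas (a ∷ Ka ∷ m ∷ N ∷ []) ((x3 :≤ con 362) ∷ (con 3 :* x0 :≤ con 1 :+ x3 :* con 5 :+ con 362) ∷ (x1 :* con 200 :+ con 1100 :≤ x2) ∷ []) (x0 :+ x3) (x2) 3299 (con 8800 ∷ con 1100 ∷ con 3259 ∷ []) (≤-reflexive N≡ , h₁ , Ka≤m , tt))) (It-one w)
                     (It-cast (trans ((group-≡ (y ∷ mul N g ∷ mul a g ∷ []) (gv 0 ⊟ gv 1 ⊟ gv 2) (gv 0 ⊟ (gv 2 ⊞ gv 1)))) (cong (y ⊝_) (sym (mul-+ a N g)))) q)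
          in ⊥-elim (1+n≰n {363} ((farkas (a ∷ N ∷ []) ((con 362 :≤ x1) ∷ (con 3 :* (x0 :+ x1) :≤ con 1 :+ con 362) ∷ []) (con 364) (con 363) 722 (con 3 ∷ con 1 ∷ []) (≤-reflexive (sym N≡) , h₂ , tt))))
        pointwise : ∀ y → ⟦ W y ⟧ ≤ ∑ N (λ a → ⟦ row a y ⟧)
        pointwise y with bool (W y)
        ... | inj₂ w rewrite w = z≤n
        ... | inj₁ w =
          let a , a< , p , q = crossing N (λ a → Half (y ⊝ mul a g))
                (Half-intro _ 0 z≤n (It-cast ((group-≡ (y ∷ []) (gv 0) (gv 0 ⊟ g0 ⊟ g0))) (It-mono (s≤s z≤n) (It-one w)))) (far-false y w)
          in ≤-trans (≤-trans (⟦⟧≤1 (W y)) (≤-reflexive (sym (cong ⟦_⟧ (∧-intro w (∧-not p (trans (cong Half ((group-≡ (y ∷ g ∷ mul a g ∷ []) (gv 0 ⊟ gv 2 ⊟ gv 1) (gv 0 ⊟ (gv 2 ⊞ gv 1))))) q)))))))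
               (∑-point N (λ a → ⟦ row a y ⟧) a a<)

module Coset (G : FinAb) where

  open Sum
  open Grp
  open Conv G
  open Chain G
  import Relation.Nullary
  open Iter G
  open Thin G
  open Star G
  open Flux G
  open import Data.Nat.DivMod

  record CosetProgression (W : Subset) (Near : Subset) (C : ℕ) : Set where
    field
      H       : Subset
      H-group : Subgroup H
      v       : Carrier
      L′      : ℕ
      H-near  : ∀ t → H t ≡ true → Near t ≡ true
      v-near  : ∀ l → l ≤ L′ → Near (mul l v) ≡ true
      v-free  : ∀ l → 0 < l → l ≤ L′ → H (mul l v) ≡ false
      W-size  : # W ≤ C * (suc L′ * # H)

  module Extract (W : Subset) (W-0 : W 𝟘 ≡ true) (W-neg : ∀ x → W x ≡ true → W (⊖ x) ≡ true)
    (R′ : ℕ) (far : Carrier)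
    (P : Iterate.Path W W-0 W-neg (suc R′) far) (far∉ : Iterate.It W W-0 W-neg R′ far ≡ false)
    (growth : # (Iterate.It W W-0 W-neg (suc R′)) ≤ 2 * (suc R′ * # W))
    (m′ n : ℕ) (n-def : n ≡ 60 * suc m′) (4n≤R : n * 4 ≤ suc R′) (big≤R : 258469 ≤ suc R′)
    (β K₁ Ka : ℕ) (β-big : 561392496 ≤ β) (K₁-big : (β + 1) * 5 + 362 ≤ K₁) (Ka-big : K₁ * 712 ≤ Ka)
    (Ka≤m : Ka * 200 + 1100 ≤ suc m′) where

    open Iterate W W-0 W-neg
    private
      abstract
        K₁≥ : 362 ≤ K₁
        K₁≥ = ≤-trans (m≤n+m 362 _) K₁-big
        10≤Ka : 10 ≤ Ka
        10≤Ka = (farkas (K₁ ∷ Ka ∷ []) ((con 362 :≤ x0) ∷ (x0 :* con 712 :≤ x1) ∷ []) (con 10) (x1) 128871 (con 3560 ∷ con 5 ∷ []) (K₁≥ , Ka-big , tt))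
    open Geodesic W W-0 W-neg R′ far P far∉ growth using (thin; W>0)
    open Transfer W W-0 W-neg R′ far P far∉ growth m′ n n-def 4n≤R big≤R Ka 10≤Ka Ka≤m

    private
      abstract
        κ : ℕ
        κ = 362
        κ-def : κ ≡ 362
        κ-def = refl

    nD>0 : 0 < nD
    nD>0 = n≢0⇒n>0 λ e → n≮0 (<-≤-trans W>0 (≤-trans (W≤nD κ κ-def) (≤-reflexive (trans (cong (κ *_) e) (*-zeroʳ κ)))))

    abstract
      level-small : ∀ t → It 362 t ≡ true → level t ≤ A + β * nD × A ≤ level t + β * nD
      level-small t p = let u , v = level-bound κ t ((farkas (κ ∷ K₁ ∷ Ka ∷ []) ((x0 :≤ con 362) ∷ (con 362 :≤ x1) ∷ (x1 :* con 712 :≤ x2) ∷ []) (x0) (x2) 711 (con 712 ∷ con 712 ∷ con 1 ∷ []) (≤-reflexive κ-def , K₁≥ , Ka-big , tt))) (It-mono (≤-reflexive (sym κ-def)) p) in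
        ≤-trans u (+-monoʳ-≤ A sz) , ≤-trans v (+-monoʳ-≤ (level t) sz)
        where
        sz : # (It (κ * 356 + 362)) ≤ β * nD
        sz = (farkas (# (It (κ * 356 + 362)) ∷ # W ∷ nD ∷ β ∷ κ ∷ []) ((x0 :≤ con 12 :* (x4 :* con 356 :+ con 362) :* x1) ∷ (x1 :≤ x4 :* x2) ∷ (x4 :≤ con 362) ∷ (con 561392496 :≤ x3) ∷ []) (x0) (x3 :* x2) 0 (con 1 ∷ con 1550808 ∷ con 4272 :* x1 :+ con 1550808 :* x2 ∷ x2 ∷ []) (thin (κ * 356 + 362) (≤-trans (≤ᵇ-true {1} {362} refl) (m≤n+m 362 (κ * 356))) ((farkas (κ ∷ suc R′ ∷ []) ((x0 :≤ con 362) ∷ (con 258469 :≤ x1) ∷ []) (con 2 :* (x0 :* con 356 :+ con 362) :+ con 1) (x1) 0 (con 712 ∷ con 1 ∷ []) (≤-reflexive κ-def , big≤R , tt))) , W≤nD κ κ-def , ≤-reflexive κ-def , β-big , tt))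

    abstract
      level-mul : ∀ a → a * 5 ≤ Ka → level (mul a g) + a * nD ≡ A
      level-mul zero    h = trans (+-identityʳ _) A-def
      level-mul (suc a) h = (≤-antisym (farkas (A ∷ level (mul a g) ∷ level (mul a g ⊕ g) ∷ level g ∷ a ∷ nD ∷ []) ((x0 :+ x2 :≤ x1 :+ x3) ∷ (x3 :+ x5 :≤ x0) ∷ (x1 :+ x4 :* x5 :≤ x0) ∷ []) (x2 :+ (x5 :+ x4 :* x5)) (x0) 0 (con 1 ∷ con 1 ∷ con 1 ∷ []) (≤-reflexive (level-+ (mul a g) g (It-mono (≤-trans (m≤n+m (a * 5) 5) h) (It-mul g∈ a)) (It-mono (≤-trans (m≤m+n 5 (a * 5)) h) g∈)) , ≤-reflexive level-g , ≤-reflexive (level-mul a (≤-trans (m≤n+m (a * 5) 5) h)) , tt)) (farkas (A ∷ level (mul a g) ∷ level (mul a g ⊕ g) ∷ level g ∷ a ∷ nD ∷ []) ((x1 :+ x3 :≤ x0 :+ x2) ∷ (x0 :≤ x3 :+ x5) ∷ (x0 :≤ x1 :+ x4 :* x5) ∷ []) (x0) (x2 :+ (x5 :+ x4 :* x5)) 0 (con 1 ∷ con 1 ∷ con 1 ∷ []) (≤-reflexive (sym (level-+ (mul a g) g (It-mono (≤-trans (m≤n+m (a * 5) 5) h) (It-mul g∈ a)) (It-mono (≤-trans (m≤m+n 5 (a * 5)) h) g∈))) , ≤-reflexive (sym level-g) , ≤-reflexive (sym (level-mul a (≤-trans (m≤n+m (a * 5) 5) h))) , tt)))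

      trap : ∀ t → It (K₁ + K₁) t ≡ true → level t ≤ A + nD → A ≤ level t + nD → It K₁ t ≡ true
      trap t t∈ t≤ ≤t =
        let a , b , a≤ , b≤ , u∈ = represent (K₁ + K₁) t (It-mono (m≤m+n _ 362) t∈) in go a b a≤ b≤ u∈
        where
        go : ∀ a b → a ≤ (K₁ + K₁) * 71 → b ≤ (K₁ + K₁) * 71 → It 362 (t ⊕ mul a g ⊝ mul b g) ≡ true → It K₁ t ≡ true
        go a b a≤ b≤ u∈ = finish (b ≤? a)
          where
          u : Carrier
          u = t ⊕ mul a g ⊝ mul b g
          wide : ∀ c → c ≤ (K₁ + K₁) * 71 → c * 5 ≤ Ka
          wide c c≤ = (farkas (c ∷ K₁ ∷ Ka ∷ []) ((x0 :≤ (x1 :+ x1) :* con 71) ∷ (x1 :* con 712 :≤ x2) ∷ []) (x0 :* con 5) (x2) 355 (con 1780 ∷ con 355 ∷ []) (c≤ , Ka-big , tt))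
          mul∈ : ∀ c → c ≤ (K₁ + K₁) * 71 → It Ka (mul c g) ≡ true
          mul∈ c c≤ = It-mono (wide c c≤) (It-mul g∈ c)
          t∈Ka : It Ka t ≡ true
          t∈Ka = It-mono ((farkas (K₁ ∷ Ka ∷ []) ((x0 :* con 712 :≤ x1) ∷ []) (x0 :+ x0) (x1) 355 (con 1 ∷ []) (Ka-big , tt))) t∈
          u∈Ka : It Ka u ≡ true
          u∈Ka = It-mono ((farkas (K₁ ∷ Ka ∷ []) ((con 362 :≤ x0) ∷ (x0 :* con 712 :≤ x1) ∷ []) (con 362) (x1) 711 (con 712 ∷ con 1 ∷ []) (K₁≥ , Ka-big , tt))) u∈
          e₁ : A + level (t ⊕ mul a g) ≡ level t + level (mul a g)
          e₁ = level-+ t (mul a g) t∈Ka (mul∈ a a≤)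
          e₂ : A + level (t ⊕ mul a g) ≡ level u + level (mul b g)
          e₂ = trans (cong (λ z → A + level z) ((group-≡ (t ∷ mul a g ∷ mul b g ∷ []) (gv 0 ⊞ gv 1) (gv 0 ⊞ gv 1 ⊟ gv 2 ⊞ gv 2)))) (level-+ u (mul b g) u∈Ka (mul∈ b b≤))
          balance : level t + b * nD ≡ level u + a * nD
          balance = (≤-antisym (farkas (A ∷ level (t ⊕ mul a g) ∷ level t ∷ level u ∷ level (mul a g) ∷ level (mul b g) ∷ a * nD ∷ b * nD ∷ []) ((x2 :+ x4 :≤ x0 :+ x1) ∷ (x0 :+ x1 :≤ x3 :+ x5) ∷ (x0 :≤ x4 :+ x6) ∷ (x5 :+ x7 :≤ x0) ∷ []) (x2 :+ x7) (x3 :+ x6) 0 (con 1 ∷ con 1 ∷ con 1 ∷ con 1 ∷ []) (≤-reflexive (sym e₁) , ≤-reflexive e₂ , ≤-reflexive (sym (level-mul a (wide a a≤))) , ≤-reflexive (level-mul b (wide b b≤)) , tt)) (farkas (A ∷ level (t ⊕ mul a g) ∷ level t ∷ level u ∷ level (mul a g) ∷ level (mul b g) ∷ a * nD ∷ b * nD ∷ []) ((x0 :+ x1 :≤ x2 :+ x4) ∷ (x3 :+ x5 :≤ x0 :+ x1) ∷ (x4 :+ x6 :≤ x0) ∷ (x0 :≤ x5 :+ x7) ∷ []) (x3 :+ x6) (x2 :+ x7) 0 (con 1 ∷ con 1 ∷ con 1 ∷ con 1 ∷ []) (≤-reflexive e₁ , ≤-reflexive (sym e₂) , ≤-reflexive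 (level-mul a (wide a a≤)) , ≤-reflexive (sym (level-mul b (wide b b≤))) , tt)))
          instance
            nD≢0 : NonZero nD
            nD≢0 = >-nonZero nD>0
          b≤a+ : b ≤ a + (β + 1)
          b≤a+ = *-cancelʳ-≤ b _ nD ((farkas (A ∷ level t ∷ level u ∷ a ∷ b ∷ nD ∷ β ∷ []) ((x1 :+ x4 :* x5 :≤ x2 :+ x3 :* x5) ∷ (x2 :≤ x0 :+ x6 :* x5) ∷ (x0 :≤ x1 :+ x5) ∷ []) (x4 :* x5) ((x3 :+ (x6 :+ con 1)) :* x5) 0 (con 1 ∷ con 1 ∷ con 1 ∷ []) (≤-reflexive balance , proj₁ (level-small u u∈) , ≤t , tt)))
          a≤b+ : a ≤ b + (β + 1)
          a≤b+ = *-cancelʳ-≤ a _ nD ((farkas (A ∷ level t ∷ level u ∷ a ∷ b ∷ nD ∷ β ∷ []) ((x2 :+ x3 :* x5 :≤ x1 :+ x4 :* x5) ∷ (x0 :≤ x2 :+ x6 :* x5) ∷ (x1 :≤ x0 :+ x5) ∷ []) (x3 :* x5) ((x4 :+ (x6 :+ con 1)) :* x5) 0 (con 1 ∷ con 1 ∷ con 1 ∷ []) (≤-reflexive (sym balance) , proj₂ (level-small u u∈) , t≤ , tt)))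
          finish : Relation.Nullary.Dec (b ≤ a) → It K₁ t ≡ true
          finish (yes b≤a) = It-mono ((farkas (a ∷ b ∷ a ∸ b ∷ β ∷ K₁ ∷ []) ((x2 :+ x1 :≤ x0) ∷ (x0 :≤ x1 :+ (x3 :+ con 1)) ∷ ((x3 :+ con 1) :* con 5 :+ con 362 :≤ x4) ∷ []) (con 362 :+ x2 :* con 5) (x4) 0 (con 5 ∷ con 5 ∷ con 1 ∷ []) (≤-reflexive (m∸n+n≡m b≤a) , a≤b+ , K₁-big , tt)))
            (It-cast (trans (cong (u ⊝_) (sym (mul-∸ g b≤a))) ((group-≡ (t ∷ mul a g ∷ mul b g ∷ []) (gv 0 ⊞ gv 1 ⊟ gv 2 ⊟ (gv 1 ⊟ gv 2)) (gv 0)))) (It-diff u∈ (It-mul g∈ (a ∸ b))))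
          finish (no b≰a) = It-mono ((farkas (a ∷ b ∷ b ∸ a ∷ β ∷ K₁ ∷ []) ((x2 :+ x0 :≤ x1) ∷ (x1 :≤ x0 :+ (x3 :+ con 1)) ∷ ((x3 :+ con 1) :* con 5 :+ con 362 :≤ x4) ∷ []) (con 362 :+ x2 :* con 5) (x4) 0 (con 5 ∷ con 5 ∷ con 1 ∷ []) (≤-reflexive (m∸n+n≡m (<⇒≤ (≰⇒> b≰a))) , b≤a+ , K₁-big , tt)))
            (It-cast (trans (cong (u ⊕_) (sym (mul-∸ g (<⇒≤ (≰⇒> b≰a))))) ((group-≡ (t ∷ mul a g ∷ mul b g ∷ []) (gv 0 ⊞ gv 1 ⊟ gv 2 ⊞ (gv 2 ⊟ gv 1)) (gv 0)))) (It-+ u∈ (It-mul g∈ (b ∸ a))))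

    private
      Value : ℕ → Bool
      Value d = any (λ t → It K₁ t ∧ (level t + suc d ≡ᵇ A))

    abstract
      minimal : ∃[ d ] d ≤ nD ∸ 1 × Value d ≡ true × (∀ e → e < d → Value e ≡ false)
      minimal = least Value (nD ∸ 1) (any-intro _ g (∧-intro (It-mono (≤-trans (≤ᵇ-true {5} {362} refl) K₁≥) g∈)
        (trans (cong (λ k → level g + k ≡ᵇ A) (m+[n∸m]≡n nD>0)) (trans (cong (_≡ᵇ A) level-g) (δ-eq A)))))

    d : ℕ
    d = suc (proj₁ minimal)

    d≤nD : d ≤ nD
    d≤nD = ≤-trans (s≤s (proj₁ (proj₂ minimal))) (≤-reflexive (m+[n∸m]≡n nD>0))

    abstract
      generator : ∃[ v ] It K₁ v ≡ true × level v + d ≡ A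
      generator = let v , p = any-elim _ (proj₁ (proj₂ (proj₂ minimal))) in v , ∧-elimˡ p , δ-≡ (∧-elimʳ {It K₁ v} p)

      no-smaller : ∀ t e → It K₁ t ≡ true → level t + e ≡ A → e < d → e ≡ 0
      no-smaller t zero    p q h = refl
      no-smaller t (suc e) p q h = true≢false (any-intro _ t (∧-intro p (trans (cong (_≡ᵇ A) q) (δ-eq A))))
        (proj₂ (proj₂ (proj₂ minimal)) e (s≤s⁻¹ h))

    v : Carrier
    v = proj₁ generator

    L : ℕ
    L = nD / d

    H : Subset
    H t = It K₁ t ∧ (level t ≡ᵇ A)

    private
      K₁≤Ka : K₁ ≤ Ka
      K₁≤Ka = ≤-trans (m≤m*n K₁ 712) Ka-big

      in-Ka : ∀ {t} → It K₁ t ≡ true → It Ka t ≡ true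
      in-Ka = It-mono K₁≤Ka

    v-multiple : ∀ l → l ≤ L → It K₁ (mul l v) ≡ true × level (mul l v) + l * d ≡ A
    v-multiple zero    h = It-0 K₁ , trans (+-identityʳ _) A-def
    v-multiple (suc l) h = trap _ (It-+ p (proj₁ (proj₂ generator))) (≤-trans (≤-trans (m≤m+n _ _) (≤-reflexive eq)) (m≤m+n A nD))
        (≤-trans (≤-reflexive (sym eq)) (+-monoʳ-≤ (level (mul l v ⊕ v)) (≤-trans (*-monoˡ-≤ d h) (m/n*n≤m nD d)))) , eq
      where
      p : It K₁ (mul l v) ≡ true
      p = proj₁ (v-multiple l (<⇒≤ h))
      q : level (mul l v) + l * d ≡ A
      q = proj₂ (v-multiple l (<⇒≤ h))
      eq : level (mul l v ⊕ v) + suc l * d ≡ A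
      eq = (≤-antisym (farkas (A ∷ level (mul l v) ∷ level (mul l v ⊕ v) ∷ level v ∷ l ∷ d ∷ []) ((x0 :+ x2 :≤ x1 :+ x3) ∷ (x1 :+ x4 :* x5 :≤ x0) ∷ (x3 :+ x5 :≤ x0) ∷ []) (x2 :+ (x5 :+ x4 :* x5)) (x0) 0 (con 1 ∷ con 1 ∷ con 1 ∷ []) (≤-reflexive (level-+ (mul l v) v (in-Ka p) (in-Ka (proj₁ (proj₂ generator)))) , ≤-reflexive q , ≤-reflexive (proj₂ (proj₂ generator)) , tt)) (farkas (A ∷ level (mul l v) ∷ level (mul l v ⊕ v) ∷ level v ∷ l ∷ d ∷ []) ((x1 :+ x3 :≤ x0 :+ x2) ∷ (x0 :≤ x1 :+ x4 :* x5) ∷ (x0 :≤ x3 :+ x5) ∷ []) (x0) (x2 :+ (x5 :+ x4 :* x5)) 0 (con 1 ∷ con 1 ∷ con 1 ∷ []) (≤-reflexive (sym (level-+ (mul l v) v (in-Ka p) (in-Ka (proj₁ (proj₂ generator))))) , ≤-reflexive (sym q) , ≤-reflexive (sym (proj₂ (proj₂ generator))) , tt)))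

    H-group : Subgroup H
    H-group = record
      { has-0 = ∧-intro (It-0 K₁) (trans (cong (_≡ᵇ A) A-def) (δ-eq A))
      ; has-+ = λ {s} {t} p q → let e = zero-sum s t (∧-elimˡ p) (∧-elimˡ q) (δ-≡ (∧-elimʳ {It K₁ s} p)) (δ-≡ (∧-elimʳ {It K₁ t} q)) in
          ∧-intro (trap _ (It-+ (∧-elimˡ p) (∧-elimˡ q)) (≤-trans (≤-reflexive e) (m≤m+n A nD)) (≤-trans (≤-reflexive (sym e)) (m≤m+n _ nD)))
                  (trans (cong (_≡ᵇ A) e) (δ-eq A))
      ; has-neg = λ {t} p → ∧-intro (It-neg (∧-elimˡ p)) (trans (cong (_≡ᵇ A) (zero-neg t (∧-elimˡ p) (δ-≡ (∧-elimʳ {It K₁ t} p)))) (δ-eq A)) }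
      where
      zero-sum : ∀ s t → It K₁ s ≡ true → It K₁ t ≡ true → level s ≡ A → level t ≡ A → level (s ⊕ t) ≡ A
      zero-sum s t p q e f = (≤-antisym (farkas (A ∷ level s ∷ level t ∷ level (s ⊕ t) ∷ []) ((x0 :+ x3 :≤ x1 :+ x2) ∷ (x1 :≤ x0) ∷ (x2 :≤ x0) ∷ []) (x3) (x0) 0 (con 1 ∷ con 1 ∷ con 1 ∷ []) (≤-reflexive (level-+ s t (in-Ka p) (in-Ka q)) , ≤-reflexive e , ≤-reflexive f , tt)) (farkas (A ∷ level s ∷ level t ∷ level (s ⊕ t) ∷ []) ((x1 :+ x2 :≤ x0 :+ x3) ∷ (x0 :≤ x1) ∷ (x0 :≤ x2) ∷ []) (x0) (x3) 0 (con 1 ∷ con 1 ∷ con 1 ∷ []) (≤-reflexive (sym (level-+ s t (in-Ka p) (in-Ka q))) , ≤-reflexive (sym e) , ≤-reflexive (sym f) , tt)))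
      zero-neg : ∀ t → It K₁ t ≡ true → level t ≡ A → level (⊖ t) ≡ A
      zero-neg t p e = (≤-antisym (farkas (A ∷ level t ∷ level (⊖ t) ∷ level (t ⊝ t) ∷ []) ((x1 :+ x2 :≤ x0 :+ x3) ∷ (x0 :≤ x1) ∷ (x3 :≤ x0) ∷ []) (x2) (x0) 0 (con 1 ∷ con 1 ∷ con 1 ∷ []) (≤-reflexive (sym (level-+ t (⊖ t) (in-Ka p) (in-Ka (It-neg p)))) , ≤-reflexive (sym e) , ≤-reflexive (trans (cong level ((group-≡ (t ∷ []) (gv 0 ⊟ gv 0) (g0)))) A-def) , tt)) (farkas (A ∷ level t ∷ level (⊖ t) ∷ level (t ⊝ t) ∷ []) ((x0 :+ x3 :≤ x1 :+ x2) ∷ (x1 :≤ x0) ∷ (x0 :≤ x3) ∷ []) (x0) (x2) 0 (con 1 ∷ con 1 ∷ con 1 ∷ []) (≤-reflexive (level-+ t (⊖ t) (in-Ka p) (in-Ka (It-neg p))) , ≤-reflexive e , ≤-reflexive (sym (trans (cong level ((group-≡ (t ∷ []) (gv 0 ⊟ gv 0) (g0)))) A-def)) , tt)))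

    v-free : ∀ l → 0 < l → l ≤ L → H (mul l v) ≡ false
    v-free l l>0 l≤L with bool (H (mul l v))
    ... | inj₂ p = p
    ... | inj₁ p = ⊥-elim (1+n≰n {0} ((farkas (level (mul l v) ∷ A ∷ l ∷ d ∷ []) ((x0 :+ x2 :* x3 :≤ x1) ∷ (x1 :≤ x0) ∷ (con 1 :≤ x2) ∷ (con 1 :≤ x3) ∷ []) (con 1) (con 0) 0 (con 1 ∷ con 1 ∷ x3 ∷ con 1 ∷ []) (≤-reflexive (proj₂ (v-multiple l l≤L)) , ≤-reflexive (sym (δ-≡ (∧-elimʳ {It K₁ (mul l v)} p))) , l>0 , s≤s {0} {proj₁ minimal} z≤n , tt))))

    close : ∀ s t → W s ≡ true → W t ≡ true → level s ≤ level t → level t < level s + d → H (s ⊝ t) ≡ true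
    close s t p q s≤t t< = ∧-intro inK (trans (cong (_≡ᵇ A) (trans (sym (+-identityʳ _)) (trans (cong (level (s ⊝ t) +_) (sym e≡0)) eq))) (δ-eq A))
      where
      one : ∀ {x} → W x ≡ true → It Ka x ≡ true
      one w = in-Ka (It-mono (≤-trans (≤ᵇ-true {1} {362} refl) K₁≥) (It-one w))
      e : ℕ
      e = level t ∸ level s
      eq : level (s ⊝ t) + e ≡ A
      eq = (≤-antisym (farkas (A ∷ level s ∷ level t ∷ level (⊖ t) ∷ level (s ⊝ t) ∷ e ∷ level (t ⊝ t) ∷ []) ((x0 :+ x4 :≤ x1 :+ x3) ∷ (x2 :+ x3 :≤ x0 :+ x6) ∷ (x6 :≤ x0) ∷ (x5 :+ x1 :≤ x2) ∷ []) (x4 :+ x5) (x0) 0 (con 1 ∷ con 1 ∷ con 1 ∷ con 1 ∷ []) (≤-reflexive (level-+ s (⊖ t) (one p) (It-neg (one q))) , ≤-reflexive (sym (level-+ t (⊖ t) (one q) (It-neg (one q)))) , ≤-reflexive (trans (cong level ((group-≡ (t ∷ []) (gv 0 ⊟ gv 0) (g0)))) A-def) , ≤-reflexive (m∸n+n≡m s≤t) , tt)) (farkas (A ∷ level s ∷ level t ∷ level (⊖ t) ∷ level (s ⊝ t) ∷ e ∷ level (t ⊝ t) ∷ []) ((x1 :+ x3 :≤ x0 :+ x4) ∷ (x0 :+ x6 :≤ x2 :+ x3) ∷ (x0 :≤ x6) ∷ (x2 :≤ x5 :+ x1) ∷ []) (x0) (x4 :+ x5) 0 (con 1 ∷ con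 1 ∷ con 1 ∷ con 1 ∷ []) (≤-reflexive (sym (level-+ s (⊖ t) (one p) (It-neg (one q)))) , ≤-reflexive (level-+ t (⊖ t) (one q) (It-neg (one q))) , ≤-reflexive (sym (trans (cong level ((group-≡ (t ∷ []) (gv 0 ⊟ gv 0) (g0)))) A-def)) , ≤-reflexive (sym (m∸n+n≡m s≤t)) , tt)))
      e<d : e < d
      e<d = +-cancelˡ-< (level s) e d (≤-<-trans (≤-reflexive (m+[n∸m]≡n s≤t)) t<)
      inK : It K₁ (s ⊝ t) ≡ true
      inK = trap _ (It-mono ((farkas (K₁ ∷ []) ((con 362 :≤ x0) ∷ []) (con 1 :+ con 1) (x0 :+ x0) 180 (con 1 ∷ []) (K₁≥ , tt))) (It-diff (It-one p) (It-one q)))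
        (≤-trans (≤-trans (m≤m+n _ e) (≤-reflexive eq)) (m≤m+n A nD))
        (≤-trans (≤-reflexive (sym eq)) (+-monoʳ-≤ (level (s ⊝ t)) (≤-trans (<⇒≤ e<d) d≤nD)))
      e≡0 : e ≡ 0
      e≡0 = no-smaller _ e inK eq e<d

    W-size : # W ≤ 2 * β * (suc L * # H)
    W-size = begin
      # W                                             ≡⟨ #-Σ W ⟩
      Σ (λ t → ⟦ W t ⟧)                                ≤⟨ Σ-mono pointwise ⟩
      Σ (λ t → ∑ N (λ i → ⟦ bin i t ⟧))                ≡⟨ Σ-∑-swap N _ ⟩
      ∑ N (λ i → Σ (λ t → ⟦ bin i t ⟧))                ≡⟨ ∑-cong N (λ i _ → sym (#-Σ (bin i))) ⟩
      ∑ N (λ i → # (bin i))                           ≤⟨ ∑-mono N (λ i _ → small i) ⟩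
      ∑ N (λ _ → # H)                                 ≡⟨ ∑-const N (# H) ⟩
      N * # H                                         ≤⟨ *-monoˡ-≤ (# H) N≤ ⟩
      2 * β * suc L * # H                             ≡⟨ *-assoc (2 * β) (suc L) (# H) ⟩
      2 * β * (suc L * # H)                           ∎
      where
      open ≤-Reasoning
      T N : ℕ
      T = 2 * β * nD
      N = suc (T / d)
      f : Carrier → ℕ
      f t = A + β * nD ∸ level t
      bin : ℕ → Subset
      bin i t = W t ∧ (f t / d ≡ᵇ i)
      W-small : ∀ t → W t ≡ true → level t ≤ A + β * nD × A ≤ level t + β * nD
      W-small t w = level-small t (It-mono (≤ᵇ-true {1} {362} refl) (It-one w))
      f-eq : ∀ t → W t ≡ true → f t + level t ≡ A + β * nD
      f-eq t w = m∸n+n≡m (proj₁ (W-small t w))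
      pointwise : ∀ t → ⟦ W t ⟧ ≤ ∑ N (λ i → ⟦ bin i t ⟧)
      pointwise t with bool (W t)
      ... | inj₂ w rewrite w = z≤n
      ... | inj₁ w = ≤-trans (≤-trans (⟦⟧≤1 (W t)) (≤-reflexive (sym (cong ⟦_⟧ (∧-intro w (δ-eq (f t / d)))))))
            (∑-point N (λ i → ⟦ bin i t ⟧) (f t / d) (s≤s (/-monoˡ-≤ d ((farkas (A ∷ level t ∷ f t ∷ β ∷ nD ∷ []) ((x2 :+ x1 :≤ x0 :+ x3 :* x4) ∷ (x0 :≤ x1 :+ x3 :* x4) ∷ []) (x2) (con 2 :* x3 :* x4) 0 (con 1 ∷ con 1 ∷ []) (≤-reflexive (f-eq t w) , proj₂ (W-small t w) , tt))))))
      N≤ : N ≤ 2 * β * suc L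
      N≤ = *-cancelʳ-< d (T / d) (2 * β * suc L) (≤-<-trans (m/n*n≤m T d)
        ((farkas (β ∷ d ∷ L ∷ nD ∷ nD % d ∷ []) ((x3 :≤ x4 :+ x2 :* x1) ∷ (con 1 :+ x4 :≤ x1) ∷ (con 561392496 :≤ x0) ∷ []) (con 1 :+ con 2 :* x0 :* x3) (con 2 :* x0 :* (con 1 :+ x2) :* x1) 561392495 (con 1122784992 :* x0 ∷ con 1122784992 :* x0 ∷ con 1 ∷ []) (≤-reflexive (m≡m%n+[m/n]*n nD d) , m%n<n nD d , β-big , tt))))
      near : ∀ s t → W s ≡ true → W t ≡ true → f s / d ≡ f t / d → level t < level s + d
      near s t p q e = (farkas (A ∷ level s ∷ level t ∷ f s ∷ f t ∷ f s / d ∷ f s % d ∷ f t % d ∷ f t / d ∷ d ∷ β * nD ∷ []) ((x0 :+ var 10 :≤ x3 :+ x1) ∷ (x4 :+ x2 :≤ x0 :+ var 10) ∷ (x3 :≤ x6 :+ x5 :* x9) ∷ (x7 :+ x8 :* x9 :≤ x4) ∷ (con 1 :+ x6 :≤ x9) ∷ (x5 :≤ x8) ∷ []) (con 1 :+ x2) (x1 :+ x9) 0 (con 1 ∷ con 1 ∷ con 1 ∷ con 1 ∷ con 1 ∷ x9 ∷ []) (≤-reflexive (sym (f-eq s p)) , ≤-reflexive (f-eq t q) , ≤-reflexive (m≡m%n+[m/n]*n (f s) d) , ≤-reflexive (sym (m≡m%n+[m/n]*n (f t) d)) , m%n<n (f s) d , ≤-reflexive e , tt))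
      small : ∀ i → # (bin i) ≤ # H
      small i = [ (λ (t₀ , p) → #-subst (⊖ t₀) (λ t q → in-H t t₀ q p)) , (λ none → ≤-trans (#-mono {T = λ _ → false} (λ x q → true≢false q (none x))) (empty (# H))) ]′ (search (bin i))
        where
        empty : ∀ k → # (λ _ → false) ≤ k
        empty k = ≤-trans (≤-reflexive (trans (#-Σ _) Σ-zero)) z≤n
        in-H : ∀ t t₀ → bin i t ≡ true → bin i t₀ ≡ true → H (t ⊝ t₀) ≡ true
        in-H t t₀ q p with ≤-total (level t) (level t₀)
        ... | inj₁ h = close t t₀ (∧-elimˡ q) (∧-elimˡ p) h (near t t₀ (∧-elimˡ q) (∧-elimˡ p) (trans (δ-≡ (∧-elimʳ {W t} q)) (sym (δ-≡ (∧-elimʳ {W t₀} p)))))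
        ... | inj₂ h = subst (λ x → H x ≡ true) ((group-≡ (t ∷ t₀ ∷ []) (⊟ (gv 1 ⊟ gv 0)) (gv 0 ⊟ gv 1)))
            (Subgroup.has-neg H-group (close t₀ t (∧-elimˡ p) (∧-elimˡ q) h (near t₀ t (∧-elimˡ p) (∧-elimˡ q) (trans (δ-≡ (∧-elimʳ {W t₀} p)) (sym (δ-≡ (∧-elimʳ {W t} q)))))))

    coset-progression : CosetProgression W (It K₁) (2 * β)
    coset-progression = record
      { H = H ; H-group = H-group ; v = v ; L′ = L ; H-near = λ t → ∧-elimˡ
      ; v-near = λ l l≤ → proj₁ (v-multiple l l≤) ; v-free = v-free ; W-size = W-size }

module Consts where

  open import Data.Nat.Base
  open import Data.Nat.Properties

  -- Any larger values satisfying the inequalities below would do.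
  abstract
    β K₁ Ka m′ n₆₀ R′ : ℕ
    β   = 561392496
    K₁  = (β + 1) * 5 + 362
    Ka  = K₁ * 712
    m′  = Ka * 200 + 1100
    n₆₀ = 60 * suc m′
    R′  = n₆₀ * 4 + 258469

    β-big : 561392496 ≤ β
    β-big = ≤-refl

    K₁-big : (β + 1) * 5 + 362 ≤ K₁
    K₁-big = ≤-refl

    Ka-big : K₁ * 712 ≤ Ka
    Ka-big = ≤-refl

    m-big : Ka * 200 + 1100 ≤ suc m′
    m-big = n≤1+n _

    n₆₀-def : n₆₀ ≡ 60 * suc m′
    n₆₀-def = refl

    R-big₁ : n₆₀ * 4 ≤ suc R′
    R-big₁ = ≤-trans (m≤m+n (n₆₀ * 4) 258469) (n≤1+n _)

    R-big₂ : 258469 ≤ suc R′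
    R-big₂ = ≤-trans (m≤n+m 258469 (n₆₀ * 4)) (n≤1+n _)

module Near (G : FinAb) where

  open Sum
  open Grp
  open Conv G
  open Chain G
  open Iter G
  open Thin G
  open Coset G
  open Consts
  open import Data.Nat.DivMod

  ν-+ : ∀ X s t → ν X (s ⊕ t) ≤ ν X s + ν X t
  ν-+ X s t = ≤-trans (#-cover {λ x → X x ∧ not (X (x ⊕ (s ⊕ t)))} {λ x → X x ∧ not (X (x ⊕ s))} {λ x → X (x ⊕ s) ∧ not (X (x ⊕ s ⊕ t))}
      (λ x p q → ∧-not (not-false (∧-false q (∧-elimˡ p))) (trans (cong X (assoc x s t)) (∧-notʳ {X x} p))))
    (+-monoʳ-≤ (ν X s) (≤-reflexive (#-shift s (λ x → X x ∧ not (X (x ⊕ t))))))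

  ν-0 : ∀ X → ν X 𝟘 ≡ 0
  ν-0 X = trans (#-cong (λ x → trans (cong (λ y → X x ∧ not (X y)) (idʳ x)) (contra (X x)))) (trans (#-Σ _) Σ-zero)
    where
    contra : ∀ b → b ∧ not b ≡ false
    contra true  = refl
    contra false = refl

  ν-neg : ∀ X t → ν X (⊖ t) ≡ ν X t
  ν-neg X t = +-cancelˡ-≡ (r X X t) _ _ (trans (cong (_+ ν X (⊖ t)) (sym (r-neg X t)))
    (trans (sym (#-split X (λ x → X (x ⊕ ⊖ t)))) (#-split X (λ x → X (x ⊕ t)))))

  r+ν : ∀ X t → r X X t + ν X t ≡ # X
  r+ν X t = sym (#-split X (λ x → X (x ⊕ t)))

  ν-ball : ∀ X (S : Subset) → 0 < # X → (∀ t → S t ≡ true → 2 * ν X t ≤ # X) → # S ≤ 2 * # X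
  ν-ball X S X>0 h = *-cancelˡ-≤ (# X) ⦃ >-nonZero X>0 ⦄ (≤-trans (subst₂ _≤_
      (trans (Σ-*ˡ (# X) (λ t → ⟦ S t ⟧)) (cong (# X *_) (sym (#-Σ S)))) (trans (Σ-*ˡ 2 (r X X)) (cong (2 *_) (Σ-r X X)))
      (Σ-mono pointwise)) (≤-reflexive ((ring-≡ (# X ∷ []) (con 2 :* (x0 :* x0)) (x0 :* (con 2 :* x0))))))
    where
    pointwise : ∀ t → # X * ⟦ S t ⟧ ≤ 2 * r X X t
    pointwise t with bool (S t)
    ... | inj₂ p rewrite p | *-zeroʳ (# X) = z≤n
    ... | inj₁ p rewrite p = (farkas (# X ∷ r X X t ∷ ν X t ∷ []) ((x0 :≤ x1 :+ x2) ∷ (con 2 :* x2 :≤ x0) ∷ []) (x0 :* con 1) (con 2 :* x1) 0 (con 2 ∷ con 1 ∷ []) (≤-reflexive (sym (r+ν X t)) , h t p , tt))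

  ^-* : ∀ a b n → (a * b) ^ n ≡ a ^ n * b ^ n
  ^-* a b zero    = refl
  ^-* a b (suc n) = trans (cong (a * b *_) (^-* a b n)) ([m*n]*[o*p]≡[m*o]*[n*p] a b (a ^ n) (b ^ n))

  growth-scale : ∀ I (f : ℕ → ℕ) c → (∀ i → i < I → c * f i < f (suc i)) → c ^ I * f 0 ≤ f I
  growth-scale zero    f c h = ≤-reflexive (+-identityʳ (f 0))
  growth-scale (suc I) f c h = ≤-trans (≤-reflexive (*-assoc c (c ^ I) (f 0)))
    (≤-trans (*-monoʳ-≤ c (growth-scale I f c (λ i i<I → h i (m≤n⇒m≤1+n i<I)))) (<⇒≤ (h I ≤-refl)))

  some-scale : ∀ I (f : ℕ → ℕ) c → f I < c ^ I * f 0 → ∃[ i ] i < I × f (suc i) ≤ c * f i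
  some-scale I f c lt with bool (anyN I (λ i → f (suc i) ≤ᵇ c * f i))
  ... | inj₁ p = let i , i<I , q = anyN-elim I _ p in i , i<I , ≤ᵇ-true q
  ... | inj₂ p = ⊥-elim (<⇒≱ lt (growth-scale I f c (λ i i<I → ≰⇒> (λ q → true≢false (anyN-intro I _ i i<I (≤ᵇ-intro q)) p))))

  module Rescale (W : Subset) (W-0 : W 𝟘 ≡ true) (W-neg : ∀ x → W x ≡ true → W (⊖ x) ≡ true) (s : ℕ) where
    open Iterate W W-0 W-neg
    module I′ = Iterate (It s) (It-0 s) (λ x → It-neg)

    split : ∀ m n {x} → It (m + n) x ≡ true → ∃[ y ] It m y ≡ true × It n (x ⊝ y) ≡ true
    split m zero    {x} p rewrite +-identityʳ m = x , p , It-cast (sym ((group-≡ (x ∷ []) (gv 0 ⊟ gv 0) (g0)))) It-zero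
    split m (suc n) {x} p rewrite +-suc m n = let z , q , w = It-suc⁻ p ; y , u , v = split m n q in
      y , u , It-cast ((group-≡ (x ∷ y ∷ z ∷ []) (gv 2 ⊟ gv 1 ⊞ (gv 0 ⊟ gv 2)) (gv 0 ⊟ gv 1))) (It-step v w)

    from : ∀ k {x} → I′.It k x ≡ true → It (k * s) x ≡ true
    from zero    p = It-cast (sym (I′.It-zero⁻ p)) It-zero
    from (suc k) {x} p = let y , q , w = I′.It-suc⁻ p in
      It-mono (≤-reflexive (+-comm (k * s) s)) (It-cast ((group-≡ (x ∷ y ∷ []) (gv 1 ⊞ (gv 0 ⊟ gv 1)) (gv 0))) (It-+ (from k q) w))

    to : ∀ k {x} → It (k * s) x ≡ true → I′.It k x ≡ true
    to zero    p = I′.It-cast (sym (It-zero⁻ p)) I′.It-zero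
    to (suc k) {x} p = let y , q , w = split (k * s) s (It-mono (≤-reflexive (+-comm s (k * s))) p) in
      I′.It-cast ((group-≡ (x ∷ y ∷ []) (gv 1 ⊞ (gv 0 ⊟ gv 1)) (gv 0))) (I′.It-step (to k q) w)

  record NearProgression (X : Subset) (z lam C : ℕ) : Set where
    field
      H       : Subset
      H-group : Subgroup H
      v       : Carrier
      L′      : ℕ
      H-near  : ∀ t → H t ≡ true → lam * ν X t ≤ # X
      v-near  : ∀ l → l ≤ L′ → lam * ν X (mul l v) ≤ # X
      v-free  : ∀ l → 0 < l → l ≤ L′ → H (mul l v) ≡ false
      big     : z ≤ C * (suc L′ * # H)

  module NearPeriods (X : Subset) (X>0 : 0 < # X) (z lam′ I : ℕ) (z>0 : 0 < z)
    (lots : z ≤ # (λ t → ν X t ≤ᵇ 2 * z)) (I-big : 96 * suc lam′ < 2 ^ I)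
    (lam≥2 : 2 ≤ suc lam′)
    (X-big : suc lam′ * (2 * z) * (2 * K₁ * suc R′ ^ I) ≤ # X) where

    private
      lam c : ℕ
      lam = suc lam′
      c = 2 * z

      instance
        c≢0 : NonZero (lam * c)
        c≢0 = >-nonZero ((farkas (lam ∷ z ∷ []) ((con 2 :≤ x0) ∷ (con 1 :≤ x1) ∷ []) (con 1) (x0 :* (con 2 :* x1)) 1 (x1 ∷ con 2 ∷ []) (lam≥2 , z>0 , tt)))

    W : Subset
    W t = ν X t ≤ᵇ c

    W-0 : W 𝟘 ≡ true
    W-0 = ≤ᵇ-intro (≤-trans (≤-reflexive (ν-0 X)) z≤n)

    W-neg : ∀ x → W x ≡ true → W (⊖ x) ≡ true
    W-neg x p = trans (cong (_≤ᵇ c) (ν-neg X x)) p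

    open Iterate W W-0 W-neg

    It-ν : ∀ j t → It j t ≡ true → ν X t ≤ j * c
    It-ν zero    t p = ≤-reflexive (trans (cong (ν X) (It-zero⁻ p)) (ν-0 X))
    It-ν (suc j) t p = let y , q , w = It-suc⁻ p in
      ≤-trans (≤-reflexive (cong (ν X) ((group-≡ (t ∷ y ∷ []) (gv 0) ((gv 0 ⊟ gv 1) ⊞ gv 1))))) (≤-trans (ν-+ X (t ⊝ y) y) (+-mono-≤ (≤ᵇ-true w) (It-ν j y q)))

    j₁ : ℕ
    j₁ = # X / (lam * c)

    j₁-upper : # X < suc j₁ * (lam * c)
    j₁-upper = subst (_< suc j₁ * (lam * c)) (sym (m≡m%n+[m/n]*n (# X) (lam * c))) (+-monoˡ-< (j₁ * (lam * c)) (m%n<n (# X) (lam * c)))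

    j₁-lower : j₁ * (lam * c) ≤ # X
    j₁-lower = m/n*n≤m (# X) (lam * c)

    J₀≤j₁ : 2 * K₁ * suc R′ ^ I ≤ j₁
    J₀≤j₁ = ≤-trans (≤-reflexive (sym (m*n/n≡m (2 * K₁ * suc R′ ^ I) (lam * c))))
      (/-monoˡ-≤ (lam * c) (≤-trans (≤-reflexive (*-comm (2 * K₁ * suc R′ ^ I) (lam * c))) X-big))

    It-near : ∀ j t → j ≤ j₁ → It j t ≡ true → lam * ν X t ≤ # X
    It-near j t j≤ p = (farkas (lam ∷ ν X t ∷ j ∷ c ∷ j₁ ∷ # X ∷ []) ((x1 :≤ x2 :* x3) ∷ (x2 :≤ x4) ∷ (x4 :* (x0 :* x3) :≤ x5) ∷ []) (x0 :* x1) (x5) 0 (x0 ∷ x0 :* x3 ∷ con 1 ∷ []) (It-ν j t p , j≤ , j₁-lower , tt))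

    K₁>0 : 362 ≤ K₁
    K₁>0 = ≤-trans (m≤n+m 362 _) K₁-big

    R^>0 : ∀ i → 0 < suc R′ ^ i
    R^>0 i = n≢0⇒n>0 (m^n≢0⇒ i)
      where
      m^n≢0⇒ : ∀ i → suc R′ ^ i ≢ 0
      m^n≢0⇒ i e = ≢-nonZero⁻¹ (suc R′ ^ i) ⦃ m^n≢0 (suc R′) i ⦄ e

    j₁>1 : 2 ≤ j₁
    j₁>1 = ≤-trans ((farkas (K₁ ∷ suc R′ ^ I ∷ []) ((con 362 :≤ x0) ∷ (con 1 :≤ x1) ∷ []) (con 2) (con 2 :* x0 :* x1) 180 (x1 ∷ con 362 ∷ []) (K₁>0 , R^>0 I , tt))) J₀≤j₁

    It-size : ∀ j → 2 * j ≤ j₁ * lam → # (It j) ≤ 2 * # X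
    It-size j j≤ = ν-ball X (It j) X>0 (λ t p → (farkas (ν X t ∷ j ∷ c ∷ j₁ ∷ lam ∷ # X ∷ []) ((x0 :≤ x1 :* x2) ∷ (con 2 :* x1 :≤ x3 :* x4) ∷ (x3 :* (x4 :* x2) :≤ x5) ∷ []) (con 2 :* x0) (x5) 0 (con 2 ∷ x2 ∷ con 1 ∷ []) (It-ν j t p , j≤ , j₁-lower , tt)))

    private
      J′ : ℕ
      J′ = j₁ ∸ 1

      J′-def : suc J′ ≡ j₁
      J′-def = m+[n∸m]≡n (≤-trans (s≤s z≤n) j₁>1)

      W⊆It : ∀ j → 1 ≤ j → # W ≤ # (It j)
      W⊆It j h = #-mono (λ x p → It-mono h (It-one p))

    module Wrapped (stop : ∀ x → It (suc J′) x ≡ true → It J′ x ≡ true) where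
      progression : NearProgression X z lam (2 * β)
      progression = record
        { H = It J′ ; H-group = stable J′ stop ; v = 𝟘 ; L′ = 0
        ; H-near = λ t → It-near J′ t (≤-trans (n≤1+n J′) (≤-reflexive J′-def))
        ; v-near = λ { zero _ → ≤-trans (≤-reflexive (trans (cong (lam *_) (ν-0 X)) (*-zeroʳ lam))) z≤n }
        ; v-free = λ { zero () _ ; (suc l) _ () }
        ; big = (farkas (z ∷ # W ∷ # (It J′) ∷ β ∷ []) ((x0 :≤ x1) ∷ (x1 :≤ x2) ∷ (con 561392496 :≤ x3) ∷ []) (x0) (con 2 :* x3 :* (con 1 :* x2)) 561392495 (con 561392496 ∷ con 561392496 ∷ x2 ∷ []) (lots , W⊆It J′ (s≤s⁻¹ (≤-trans j₁>1 (≤-reflexive (sym J′-def)))) , β-big , tt)) }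

    module Free (far : Carrier) (P : Path (suc J′) far) (far∉ : It J′ far ≡ false) where
      open Separated W W-0 W-neg J′ far P far∉ hiding (R)
      open Path P

      R : ℕ
      R = suc R′

      linear : ∀ k → 1 ≤ k → 2 * k + 1 ≤ suc J′ → # (It k) ≤ 48 * (k * (lam * z))
      linear k k≥1 k≤ = *-cancelˡ-≤ (suc J′) ((farkas (j₁ ∷ suc J′ ∷ k ∷ lam ∷ z ∷ # X ∷ # (It k) ∷ # (It (suc J′)) ∷ []) ((x1 :* x6 :≤ con 2 :* (con 2 :* x2 :+ con 1) :* x7) ∷ (x7 :≤ con 2 :* x5) ∷ (con 1 :+ x5 :≤ (con 1 :+ x0) :* (x3 :* (con 2 :* x4))) ∷ (con 2 :≤ x0) ∷ (con 1 :≤ x2) ∷ (x0 :≤ x1) ∷ []) (x1 :* x6) (x1 :* (con 48 :* (x2 :* (x3 :* x4)))) 0 (con 1 ∷ con 2 :* (con 2 :* x2 :+ con 1) ∷ con 4 :* (con 2 :* x2 :+ con 1) ∷ con 8 :* (x2 :* (x3 :* x4)) :+ con 4 :* (x3 :* x4) ∷ con 12 :* (x0 :* (x3 :* x4)) ∷ con 36 :* (x2 :* (x3 :* x4)) ∷ []) (packing k k≤ , It-size (suc J′) ((farkas (j₁ ∷ suc J′ ∷ lam ∷ []) ((x1 :≤ x0) ∷ (con 2 :≤ x2) ∷ []) (con 2 :* x1) (x0 :* x2) 0 (con 2 ∷ x0 ∷ []) (≤-reflexive J′-def , lam≥2 , tt))) , j₁-upper , j₁>1 , k≥1 , ≤-reflexive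 (sym J′-def) , tt)))

      private
        f : ℕ → ℕ
        f i = # (It (R ^ i))

        R^I≤ : 2 * (R ^ I) + 1 ≤ suc J′
        R^I≤ = (farkas (K₁ ∷ R ^ I ∷ suc J′ ∷ j₁ ∷ []) ((con 362 :≤ x0) ∷ (con 1 :≤ x1) ∷ (con 2 :* x0 :* x1 :≤ x3) ∷ (x3 :≤ x2) ∷ []) (con 2 :* x1 :+ con 1) (x2) 723 (con 6 :* x1 ∷ con 724 ∷ con 3 ∷ con 3 ∷ []) (K₁>0 , R^>0 I , J₀≤j₁ , ≤-reflexive (sym J′-def) , tt))

        f-small : f I < (2 * R) ^ I * f 0
        f-small = subst (λ q → f I < q * f 0) (sym (^-* 2 R I))
          ((farkas (f I ∷ f 0 ∷ R ^ I ∷ 2 ^ I ∷ lam ∷ z ∷ # W ∷ []) ((x0 :≤ con 48 :* (x2 :* (x4 :* x5))) ∷ (x5 :≤ x6) ∷ (x6 :≤ x1) ∷ (con 1 :+ con 96 :* x4 :≤ x3) ∷ (con 1 :≤ x1) ∷ (con 1 :≤ x2) ∷ []) (con 1 :+ x0) (x3 :* x2 :* x1) 0 (con 2 ∷ con 96 :* (x2 :* x4) ∷ con 96 :* (x2 :* x4) ∷ x2 :* x1 ∷ x2 ∷ con 1 ∷ []) (linear (R ^ I) (R^>0 I) R^I≤ , lots , W⊆It 1 ≤-refl , I-big , f0>0 , R^>0 I , tt)))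
          where
          f0>0 : 0 < f 0
          f0>0 = ≤-trans z>0 (≤-trans lots (W⊆It 1 ≤-refl))

      abstract
        scale : ∃[ i ] i < I × f (suc i) ≤ (2 * R) * f i
        scale = some-scale I f (2 * R) f-small

      i : ℕ
      i = proj₁ scale

      s : ℕ
      s = R ^ i

      open Rescale W W-0 W-neg s

      R*s≤ : R * s ≤ suc J′
      R*s≤ = ≤-trans (^-monoʳ-≤ R (proj₁ (proj₂ scale))) (≤-trans (≤-trans (m≤m+n (R ^ I) _) (m≤m+n _ 1)) R^I≤)

      far∉′ : I′.It R′ (p (R * s)) ≡ false
      far∉′ with bool (I′.It R′ (p (R * s)))
      ... | inj₂ q = q
      ... | inj₁ q = ⊥-elim (<⇒≱ (m<n+m (R′ * s) (R^>0 i))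
              (geodesic 0 (R * s) (R′ * s) R*s≤ (It-cast (trans ((group-≡ (p (R * s) ∷ []) (gv 0) (gv 0 ⊟ g0))) (cong (p (R * s) ⊝_) (sym p-0))) (from R′ q))))

      s≤ : K₁ * s ≤ j₁
      s≤ = ≤-trans (*-monoʳ-≤ K₁ (^-monoʳ-≤ R (<⇒≤ (proj₁ (proj₂ scale))))) (≤-trans ((farkas (K₁ ∷ R ^ I ∷ []) ([]) (x0 :* x1) (con 2 :* x0 :* x1) 0 ([]) (tt))) J₀≤j₁)

      abstract
        coset : CosetProgression (It s) (I′.It K₁) (2 * β)
        coset = Extract.coset-progression (It s) (It-0 s) (λ x → It-neg) R′ (p (R * s)) (I′.path R (to R (p-It (R * s) R*s≤))) far∉′
          (≤-trans (#-mono (λ x → from R)) (≤-trans (proj₂ (proj₂ scale)) (≤-reflexive (*-assoc 2 R (f i)))))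
          m′ n₆₀ n₆₀-def R-big₁ R-big₂ β K₁ Ka β-big K₁-big Ka-big m-big

      module C = CosetProgression coset

      progression : NearProgression X z lam (2 * β)
      progression = record
        { H = C.H ; H-group = C.H-group ; v = C.v ; L′ = C.L′
        ; H-near = λ t h → It-near (K₁ * s) t s≤ (from K₁ (C.H-near t h))
        ; v-near = λ l l≤ → It-near (K₁ * s) _ s≤ (from K₁ (C.v-near l l≤))
        ; v-free = C.v-free
        ; big = ≤-trans lots (≤-trans (W⊆It s (R^>0 i)) C.W-size) }

    abstract
      progression : NearProgression X z lam (2 * β)
      progression with search (λ x → It (suc J′) x ∧ not (It J′ x))
      ... | inj₁ (far , q) = Free.progression far (path (suc J′) (∧-elimˡ q)) (∧-notʳ {It (suc J′) far} q)
      ... | inj₂ none      = Wrapped.progression (λ x q → not-false (∧-false (none x) q))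

-- Cyclic groups and lattice reduction

module Cyc (G : FinAb) where

  open Sum
  open Grp
  open Conv G
  open Chain G
  open Iter G
  open import Data.Nat.DivMod
  open import Data.Nat.Divisibility using (_∣_; divides; m%n≡0⇒n∣m)
  open import Data.Integer.Base as ℤ using (ℤ; +_; -[1+_])
  import Data.Integer.Properties as ℤ
  open import Algebra.Bundles using (module AbelianGroup)
  open import Algebra.Properties.Group (AbelianGroup.group ℤ.+-0-abelianGroup) using () renaming (∙-cancelˡ to ℤ-cancelˡ)
  import Data.Fin.Base as Fin
  import Data.Fin.Properties as Fin
  open import Relation.Binary.Definitions using (Tri; tri<; tri≈; tri>)

  module Cyclic (e : Carrier) (enum-mul : ∀ n → enum n ≡ mul n e) (size>0 : 0 < size) (period : mul size e ≡ 𝟘) where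

    zmul : ℤ → Carrier
    zmul (+ n)    = mul n e
    zmul -[1+ n ] = ⊖ mul (suc n) e

    zmul-⊖ : ∀ m n → zmul (m ℤ.⊖ n) ≡ mul m e ⊝ mul n e
    zmul-⊖ m n with m <? n
    ... | yes m<n = trans (cong zmul (ℤ.⊖-< m<n)) (trans (neg (n ∸ m)) (trans (cong ⊖_ (sym (mul-∸ e (<⇒≤ m<n)))) ((group-≡ (mul n e ∷ mul m e ∷ []) (⊟ (gv 0 ⊟ gv 1)) (gv 1 ⊟ gv 0)))))
      where
      neg : ∀ k → zmul (ℤ.- + k) ≡ ⊖ mul k e
      neg zero    = (group-≡ ([]) (g0) (⊟ g0))
      neg (suc k) = refl
    ... | no m≮n = trans (cong zmul (ℤ.⊖-≥ (≮⇒≥ m≮n))) (sym (mul-∸ e (≮⇒≥ m≮n)))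

    zmul-+ : ∀ a b → zmul (a ℤ.+ b) ≡ zmul a ⊕ zmul b
    zmul-+ (+ m)    (+ n)    = mul-+ m n e
    zmul-+ (+ m)    -[1+ n ] = zmul-⊖ m (suc n)
    zmul-+ -[1+ m ] (+ n)    = trans (zmul-⊖ n (suc m)) (comm (mul n e) _)
    zmul-+ -[1+ m ] -[1+ n ] = trans (cong ⊖_ (trans (cong (λ k → mul k e) (cong suc (sym (+-suc m n)))) (mul-+ (suc m) (suc n) e)))
      ((group-≡ (mul (suc m) e ∷ mul (suc n) e ∷ []) (⊟ (gv 0 ⊞ gv 1)) (⊟ gv 0 ⊞ ⊟ gv 1)))

    zmul-* : ∀ i a → zmul (+ i ℤ.* a) ≡ mul i (zmul a)
    zmul-* zero    a = refl
    zmul-* (suc i) a = trans (cong zmul (trans (ℤ.*-distribʳ-+ a (+ 1) (+ i)) (cong (ℤ._+ + i ℤ.* a) (ℤ.*-identityˡ a))))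
      (trans (zmul-+ a (+ i ℤ.* a)) (trans (cong (zmul a ⊕_) (zmul-* i a)) (comm (zmul a) _)))

    mul-mul : ∀ i k g → mul i (mul k g) ≡ mul (i * k) g
    mul-mul zero    k g = refl
    mul-mul (suc i) k g = trans (cong (_⊕ mul k g) (mul-mul i k g)) (trans (comm _ _) (sym (mul-+ k (i * k) g)))

    mul-index : ∀ x → mul (index x) e ≡ x
    mul-index x = trans (sym (enum-mul (index x))) (enum-index x)

    mul-⊕ : ∀ i x y → mul i (x ⊕ y) ≡ mul i x ⊕ mul i y
    mul-⊕ zero    x y = sym (idˡ 𝟘)
    mul-⊕ (suc i) x y = trans (cong (_⊕ (x ⊕ y)) (mul-⊕ i x y)) ((group-≡ (x ∷ y ∷ mul i x ∷ mul i y ∷ []) (gv 2 ⊞ gv 3 ⊞ (gv 0 ⊞ gv 1)) (gv 2 ⊞ gv 0 ⊞ (gv 3 ⊞ gv 1))))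

    module Multiples (H : Subset) (H-group : Subgroup H) where
      open Subgroup H-group

      has-mul : ∀ k {t} → H t ≡ true → H (mul k t) ≡ true
      has-mul zero    p = has-0
      has-mul (suc k) p = has-+ (has-mul k p) p

      abstract
        least-multiple : ∃[ d ] d ≤ size ∸ 1 × H (mul (suc d) e) ≡ true × (∀ c → c < d → H (mul (suc c) e) ≡ false)
        least-multiple = least (λ d → H (mul (suc d) e)) (size ∸ 1) (trans (cong H (trans (cong (λ k → mul k e) (m+[n∸m]≡n size>0)) period)) has-0)

      q : ℕ
      q = suc (proj₁ least-multiple)

      H-q : H (mul q e) ≡ true
      H-q = proj₁ (proj₂ (proj₂ least-multiple))

      ∣⇒H : ∀ {n} → q ∣ n → H (mul n e) ≡ true
      ∣⇒H (divides k refl) = trans (cong H (sym (mul-mul k q e))) (has-mul k H-q)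

      H⇒∣ : ∀ {n} → H (mul n e) ≡ true → q ∣ n
      H⇒∣ {n} p = m%n≡0⇒n∣m n q (zero? (n % q) (m%n<n n q) (trans (cong H (trans (cong (λ k → mul k e) (m%n≡m∸m/n*n n q)) (sym (mul-∸ e (m/n*n≤m n q)))))
          (has-+ p (has-neg (∣⇒H (divides (n / q) refl))))))
        where
        zero? : ∀ k → k < q → H (mul k e) ≡ true → k ≡ 0
        zero? zero    _   _ = refl
        zero? (suc k) k<q h = true≢false h (proj₂ (proj₂ (proj₂ least-multiple)) k (s≤s⁻¹ k<q))

      q∣size : q ∣ size
      q∣size = H⇒∣ (trans (cong H period) has-0)

      k : ℕ
      k = _∣_.quotient q∣size

      size-kq : size ≡ k * q
      size-kq = _∣_.equality q∣size

      #H : # H ≡ k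
      #H = trans (#-Σ H) (trans (Σ-∑ _) (trans (cong (λ n → ∑ n (λ i → ⟦ H (enum i) ⟧)) size-kq)
        (trans (∑-blocks k q _) (trans (∑-cong k (λ j _ → one j)) (trans (∑-const k 1) (*-identityʳ k))))))
        where
        one : ∀ j → ∑ q (λ r → ⟦ H (enum (j * q + r)) ⟧) ≡ 1
        one j = trans (∑-cong q (λ r r<q → trans (cong ⟦_⟧ (iff-≡ {b = r ≡ᵇ 0} (λ p → trans (cong (_≡ᵇ 0) (zero? r r<q p)) refl)
                  (λ p → trans (cong (λ i → H (enum (j * q + i))) (δ-≡ p)) (trans (cong H (enum-mul _)) (∣⇒H (divides j (+-identityʳ _)))))))
                  (sym (*-identityʳ _)))) (∑-δ q 0 (s≤s z≤n) (λ _ → 1))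
          where
          zero? : ∀ r → r < q → H (enum (j * q + r)) ≡ true → r ≡ 0
          zero? r r<q p = trans (sym (m<n⇒m%n≡m r<q)) (trans (sym ([m+kn]%n≡m%n r j q)) (trans (cong (_% q) (+-comm r (j * q))) (n∣m⇒m%n≡0 (j * q + r) q (H⇒∣ (trans (cong H (sym (enum-mul (j * q + r)))) p)))))
            where open import Data.Nat.Divisibility using (n∣m⇒m%n≡0)

    record Box (H : Subset) (v : Carrier) (L R : ℕ) : Set where
      field
        a b   : ℤ
        la lb : ℕ
        l₁ l₂ : ℕ
        near   : ∀ i j → H (zmul (+ i ℤ.* a ℤ.+ + j ℤ.* b) ⊝ mul (i * la + j * lb) v) ≡ true
        la-small : ∀ i j → i ≤ 2 * l₁ → j ≤ 2 * l₂ → i * la + j * lb < L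
        small  : ∀ i j → i ≤ 2 * l₁ → j ≤ 2 * l₂ → i * ℤ.∣ a ∣ + j * ℤ.∣ b ∣ ≤ R
        proper : ∀ i j i′ j′ → i ≤ l₁ → j ≤ l₂ → i′ ≤ l₁ → j′ ≤ l₂ →
                 + i ℤ.* a ℤ.+ + j ℤ.* b ≡ + i′ ℤ.* a ℤ.+ + j′ ℤ.* b → i ≡ i′ × j ≡ j′
        large  : (H-index : ℕ) → size ≡ # H * H-index → R * L ≤ 128 * (H-index * (suc l₁ * suc l₂))

    -- Lagrange reduction of the lattice {(x, l) : x ≡ l v mod H}: the two basis
    -- vectors come from consecutive best approximations, one of them short in
    -- the x-direction and the other in the l-direction.
    module Lattice (H : Subset) (H-group : Subgroup H) (v : Carrier) (L′ R : ℕ) (R>0 : 0 < R)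
      (free : ∀ l → 0 < l → l ≤ L′ → H (mul l v) ≡ false) where
      open Subgroup H-group
      open Multiples H H-group

      L : ℕ
      L = suc L′

      w : ℕ
      w = index v

      y : ℕ → ℕ
      y l = (l * w) % q

      y<q : ∀ l → y l < q
      y<q l = m%n<n (l * w) q

      y-cong : ∀ l → H (mul (y l) e ⊝ mul l v) ≡ true
      y-cong l = trans (cong H (trans (cong₂ _⊝_ (cong (λ k → mul k e) (m%n≡m∸m/n*n (l * w) q)) (trans (cong (mul l) (sym (mul-index v))) (mul-mul l w e)))
        (trans (cong (_⊝ mul (l * w) e) (sym (mul-∸ e (m/n*n≤m (l * w) q)))) ((group-≡ (mul (l * w) e ∷ mul (l * w / q * q) e ∷ []) (gv 0 ⊟ gv 1 ⊟ gv 0) (⊟ gv 1))))))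
        (has-neg (∣⇒H (divides (l * w / q) refl)))

      y-+ : ∀ l d → (y l + y d ≡ y (l + d)) ⊎ (y l + y d ≡ y (l + d) + q)
      y-+ l d with y l + y d <? q
      ... | yes h = inj₁ (sym (trans sum (m<n⇒m%n≡m h)))
        where
        sum : y (l + d) ≡ (y l + y d) % q
        sum = trans (cong (_% q) (*-distribʳ-+ w l d)) (%-distribˡ-+ (l * w) (d * w) q)
      ... | no h = inj₂ (trans (sym (m∸n+n≡m (≮⇒≥ h))) (cong (_+ q) (sym (trans sum (trans (m≤n⇒n∸m%m≡n%m′ (≮⇒≥ h)) (m<n⇒m%n≡m small))))))
        where
        sum : y (l + d) ≡ (y l + y d) % q
        sum = trans (cong (_% q) (*-distribʳ-+ w l d)) (%-distribˡ-+ (l * w) (d * w) q)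
        small : y l + y d ∸ q < q
        small = +-cancelʳ-< q (y l + y d ∸ q) q (≤-<-trans (≤-reflexive (m∸n+n≡m (≮⇒≥ h))) (+-mono-< (y<q l) (y<q d)))
        m≤n⇒n∸m%m≡n%m′ : q ≤ y l + y d → (y l + y d) % q ≡ (y l + y d ∸ q) % q
        m≤n⇒n∸m%m≡n%m′ p = trans (cong (_% q) (sym (m∸n+n≡m p))) ([m+n]%n≡m%n (y l + y d ∸ q) q)

      y>0 : ∀ l → 0 < l → l ≤ L′ → 0 < y l
      y>0 l l>0 l≤ = n≢0⇒n>0 λ z → true≢false (trans (cong H ((group-≡ (mul l v ∷ []) (gv 0) (⊟ (g0 ⊟ gv 0)))))
        (has-neg (trans (cong (λ k → H (mul k e ⊝ mul l v)) (sym z)) (y-cong l)))) (free l l>0 l≤)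

      dist : ℕ → ℕ
      dist l = y l ⊓ (q ∸ y l)

      rep : ℕ → ℤ
      rep l = if y l ≤ᵇ q ∸ y l then + y l else ℤ.- (+ (q ∸ y l))

      rep-dist : ∀ l → ℤ.∣ rep l ∣ ≡ dist l
      rep-dist l with bool (y l ≤ᵇ q ∸ y l)
      ... | inj₁ p rewrite p = sym (m≤n⇒m⊓n≡m (≤ᵇ-true p))
      ... | inj₂ p rewrite p = trans (ℤ.∣-i∣≡∣i∣ (+ (q ∸ y l))) (sym (m≥n⇒m⊓n≡n (<⇒≤ (≤ᵇ-false p))))

      rep-cong : ∀ l → H (zmul (rep l) ⊝ mul l v) ≡ true
      rep-cong l with bool (y l ≤ᵇ q ∸ y l)
      ... | inj₁ p rewrite p = y-cong l
      ... | inj₂ p rewrite p = trans (cong H (trans (cong (_⊝ mul l v) (trans (zneg (q ∸ y l)) (cong ⊖_ (sym (mul-∸ e (<⇒≤ (y<q l)))))))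
          ((group-≡ (mul q e ∷ mul (y l) e ∷ mul l v ∷ []) (⊟ (gv 0 ⊟ gv 1) ⊟ gv 2) (gv 1 ⊟ gv 2 ⊞ ⊟ gv 0))))) (has-+ (y-cong l) (has-neg H-q))
        where
        zneg : ∀ k → zmul (ℤ.- + k) ≡ ⊖ mul k e
        zneg zero    = (group-≡ ([]) (g0) (⊟ g0))
        zneg (suc k) = refl

      dist>0 : ∀ l → 0 < l → l ≤ L′ → 0 < dist l
      dist>0 l l>0 l≤ = ⊓-glb (y>0 l l>0 l≤) (m<n⇒0<n∸m (y<q l))

      dist-diff : ∀ l d x → y l < y (l + d) + x → y (l + d) < y l + x → dist d < x
      dist-diff l d x h₁ h₂ with y-+ l d
      ... | inj₁ s = ≤-<-trans (m⊓n≤m (y d) _) ((farkas (y l ∷ y (l + d) ∷ y d ∷ x ∷ []) ((x0 :+ x2 :≤ x1) ∷ (con 1 :+ x1 :≤ x0 :+ x3) ∷ []) (con 1 :+ x2) (x3) 0 (con 1 ∷ con 1 ∷ []) (≤-reflexive s , h₂ , tt)))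
      ... | inj₂ s = ≤-<-trans (m⊓n≤n (y d) _) (+-cancelʳ-< (y d) (q ∸ y d) x (≤-<-trans (≤-reflexive (m∸n+n≡m (<⇒≤ (y<q d))))
          ((farkas (y l ∷ y (l + d) ∷ y d ∷ x ∷ q ∷ []) ((x1 :+ x4 :≤ x0 :+ x2) ∷ (con 1 :+ x0 :≤ x1 :+ x3) ∷ []) (con 1 :+ x4) (x3 :+ x2) 0 (con 1 ∷ con 1 ∷ []) (≤-reflexive (sym s) , h₁ , tt)))))

      dirichlet : ∀ l′ x → 0 < x → x ≤ q → (∀ l → 0 < l → l < l′ → x ≤ dist l) → l′ * x ≤ 2 * q
      dirichlet l′ x x>0 x≤q sep = ≤-trans (*-monoˡ-≤ x bins) (≤-trans ((farkas (q / x * x ∷ x ∷ q ∷ []) ((x0 :≤ x2) ∷ (x1 :≤ x2) ∷ []) (x1 :+ x0) (con 2 :* x2) 0 (con 1 ∷ con 1 ∷ []) (m/n*n≤m q x , x≤q , tt))) ≤-refl)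
        where
        instance
          x≢0 : NonZero x
          x≢0 = >-nonZero x>0
        N : ℕ
        N = suc (q / x)
        bin : Fin.Fin l′ → Fin.Fin N
        bin i = Fin.fromℕ< {y (Fin.toℕ i) / x} (s≤s (/-monoˡ-≤ x (<⇒≤ (y<q (Fin.toℕ i)))))
        near : ∀ a b → a / x ≡ b / x → a < b + x
        near a b h = (farkas (a ∷ b ∷ x ∷ a % x ∷ b % x ∷ a / x ∷ b / x ∷ []) ((x0 :≤ x3 :+ x5 :* x2) ∷ (x4 :+ x6 :* x2 :≤ x1) ∷ (con 1 :+ x3 :≤ x2) ∷ (x5 :≤ x6) ∷ []) (con 1 :+ x0) (x1 :+ x2) 0 (con 1 ∷ con 1 ∷ con 1 ∷ x2 ∷ []) (≤-reflexive (m≡m%n+[m/n]*n a x) , ≤-reflexive (sym (m≡m%n+[m/n]*n b x)) , m%n<n a x , ≤-reflexive h , tt))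
        bins : l′ ≤ N
        bins with l′ ≤? N
        ... | yes p = p
        ... | no ¬p =
          let i , j , i<j , same = Fin.pigeonhole (≰⇒> ¬p) bin
              eq : y (Fin.toℕ i) / x ≡ y (Fin.toℕ j) / x
              eq = trans (sym (Fin.toℕ-fromℕ< _)) (trans (cong Fin.toℕ same) (Fin.toℕ-fromℕ< _))
              d = Fin.toℕ j ∸ Fin.toℕ i
              j≡ : Fin.toℕ i + d ≡ Fin.toℕ j
              j≡ = m+[n∸m]≡n (<⇒≤ i<j)
          in ⊥-elim (<⇒≱ (dist-diff (Fin.toℕ i) d x
               (subst (λ k → y (Fin.toℕ i) < y k + x) (sym j≡) (near _ _ eq))
               (subst (λ k → y k < y (Fin.toℕ i) + x) (sym j≡) (near _ _ (sym eq))))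
               (sep d (m<n⇒0<n∸m i<j) (≤-<-trans (m∸n≤m (Fin.toℕ j) (Fin.toℕ i)) (Fin.toℕ<n j))))

      -- Index 0 stands for the lattice vector (q, 0).
      val : ℕ → ℕ
      val zero    = q
      val (suc l) = dist (suc l)

      argmin : ∀ n → ∃[ l ] l ≤ n × (∀ m → m ≤ n → val l ≤ val m)
      argmin zero    = 0 , z≤n , λ { zero _ → ≤-refl }
      argmin (suc n) with argmin n
      ... | l , l≤ , best with val l ≤? val (suc n)
      ...   | yes p = l , m≤n⇒m≤1+n l≤ , λ m m≤ → [ (λ m< → best m (s≤s⁻¹ m<)) , (λ e → ≤-trans p (≤-reflexive (cong val (sym e)))) ]′ (m≤n⇒m<n∨m≡n m≤)
      ...   | no ¬p = suc n , ≤-refl , λ m m≤ → [ (λ m< → ≤-trans (<⇒≤ (≰⇒> ¬p)) (best m (s≤s⁻¹ m<))) , (λ e → ≤-reflexive (cong val (sym e))) ]′ (m≤n⇒m<n∨m≡n m≤)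

      Good : ℕ → Bool
      Good l = L * dist l ≤ᵇ R * l

      stop : ∃[ p ] p ≤ L′ × (Good (suc p) ∨ (p ≡ᵇ L′)) ≡ true × (∀ c → c < p → Good (suc c) ∨ (c ≡ᵇ L′) ≡ false)
      stop = least (λ p → Good (suc p) ∨ (p ≡ᵇ L′)) L′ (∨-introʳ (Good (suc L′)) (δ-eq L′))

      mul-neg : ∀ i x → mul i (⊖ x) ≡ ⊖ mul i x
      mul-neg zero    x = (group-≡ ([]) (g0) (⊟ g0))
      mul-neg (suc i) x = trans (cong (_⊝ x) (mul-neg i x)) ((group-≡ (mul i x ∷ x ∷ []) (⊟ gv 0 ⊟ gv 1) (⊟ (gv 0 ⊞ gv 1))))

      mul-⊝ : ∀ i x z → mul i (x ⊝ z) ≡ mul i x ⊝ mul i z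
      mul-⊝ i x z = trans (mul-⊕ i x (⊖ z)) (cong (mul i x ⊕_) (mul-neg i z))

      p₀ l′ lu x : ℕ
      p₀ = proj₁ stop
      l′ = suc p₀
      lu = proj₁ (argmin p₀)
      x = val lu

      signed : ℕ → ℤ
      signed zero    = + q
      signed (suc l) = rep (suc l)

      signed-val : ∀ l → ℤ.∣ signed l ∣ ≡ val l
      signed-val zero    = refl
      signed-val (suc l) = rep-dist (suc l)

      signed-cong : ∀ l → H (zmul (signed l) ⊝ mul l v) ≡ true
      signed-cong zero    = trans (cong H ((group-≡ (mul q e ∷ []) (gv 0 ⊟ g0) (gv 0)))) H-q
      signed-cong (suc l) = rep-cong (suc l)

      p₀≤L′ : p₀ ≤ L′
      p₀≤L′ = proj₁ (proj₂ stop)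

      lu≤p₀ : lu ≤ p₀
      lu≤p₀ = proj₁ (proj₂ (argmin p₀))

      val>0 : ∀ l → l ≤ L′ → 0 < val l
      val>0 zero    _  = s≤s z≤n
      val>0 (suc l) l≤ = dist>0 (suc l) (s≤s z≤n) l≤

      x>0 : 0 < x
      x>0 = val>0 lu (≤-trans lu≤p₀ p₀≤L′)

      not-good : ∀ l → 0 < l → l ≤ p₀ → R * l < L * val l
      not-good (suc l) _ l≤ = ≤ᵇ-false (∨-falseˡ (proj₂ (proj₂ (proj₂ stop)) l l≤))

      good : l′ < L → L * dist l′ ≤ R * l′
      good h with ∨-elim {Good l′} (proj₁ (proj₂ (proj₂ stop)))
      ... | inj₁ g = ≤ᵇ-true g
      ... | inj₂ g = ⊥-elim (<-irrefl (cong suc (δ-≡ g)) h)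

      l′x≤2q : l′ * x ≤ 2 * q
      l′x≤2q = dirichlet l′ x x>0 (proj₂ (proj₂ (argmin p₀)) 0 z≤n) sep
        where
        sep : ∀ l → 0 < l → l < l′ → x ≤ dist l
        sep (suc l) _ l< = proj₂ (proj₂ (argmin p₀)) (suc l) (s≤s⁻¹ l<)

      instance
        4x≢0 : NonZero (4 * x)
        4x≢0 = >-nonZero (≤-trans x>0 (m≤m+n x _))

      l₁ l₂ : ℕ
      l₁ = R / (4 * x) ∸ 1
      l₂ = L / (4 * l′) ∸ 1

      room : ∀ n d .⦃ _ : NonZero d ⦄ → n ≤ 2 * d * suc (n / d ∸ 1)
      room n d = (farkas (n ∷ d ∷ n % d ∷ n / d ∷ n / d ∸ 1 ∷ []) ((x0 :≤ x2 :+ x3 :* x1) ∷ (x2 :≤ x1) ∷ (x3 :≤ con 1 :+ x4) ∷ []) (x0) (con 2 :* x1 :* (con 1 :+ x4)) 0 (con 1 ∷ con 1 ∷ x1 ∷ []) (≤-reflexive (m≡m%n+[m/n]*n n d) , <⇒≤ (m%n<n n d) , pred≤ (n / d) , tt))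
        where
        pred≤ : ∀ t → t ≤ 1 + (t ∸ 1)
        pred≤ zero    = z≤n
        pred≤ (suc t) = ≤-refl

      fits : ∀ n d .⦃ _ : NonZero d ⦄ → d * (n / d ∸ 1) ≤ n
      fits n d = ≤-trans (*-monoʳ-≤ d (m∸n≤m (n / d) 1)) (≤-trans (≤-reflexive (*-comm d (n / d))) (m/n*n≤m n d))

      fits< : ∀ n d .⦃ _ : NonZero d ⦄ → 0 < n / d ∸ 1 → d * (n / d ∸ 1) + d ≤ n
      fits< n d h = (farkas (n ∷ d ∷ n / d ∷ n / d ∸ 1 ∷ []) ((x2 :* x1 :≤ x0) ∷ (x3 :+ con 1 :≤ x2) ∷ []) (x1 :* x3 :+ x1) (x0) 0 (con 1 ∷ x1 ∷ []) (m/n*n≤m n d , ≤-reflexive (m∸n+n≡m (≤-trans (s≤s z≤n) (<⇒≤ (m<n∸o⇒o+m<n h)))) , tt))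
        where
        m<n∸o⇒o+m<n : 0 < n / d ∸ 1 → 1 < n / d
        m<n∸o⇒o+m<n h = m<n∸o⇒ (n / d) h
          where
          m<n∸o⇒ : ∀ t → 0 < t ∸ 1 → 1 < t
          m<n∸o⇒ (suc t) h = s≤s h

      i-small : ∀ i → i ≤ 2 * l₁ → 2 * (i * x) ≤ R
      i-small i i≤ = (farkas (i ∷ l₁ ∷ x ∷ R ∷ []) ((x0 :≤ con 2 :* x1) ∷ (con 4 :* x2 :* x1 :≤ x3) ∷ []) (con 2 :* (x0 :* x2)) (x3) 0 (con 2 :* x2 ∷ con 1 ∷ []) (i≤ , fits R (4 * x) , tt))

      j-small : ∀ j → j ≤ 2 * l₂ → 2 * (j * l′) < L
      j-small j j≤ with l₂ ≟ 0
      ... | yes z = ≤-trans (s≤s (≤-reflexive (cong (λ n → 2 * (n * l′)) (n≤0⇒n≡0 (≤-trans j≤ (≤-reflexive (cong (2 *_) z))))))) (s≤s z≤n)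
      ... | no ¬z = (farkas (j ∷ l₂ ∷ l′ ∷ L ∷ []) ((x0 :≤ con 2 :* x1) ∷ (con 4 :* x2 :* x1 :+ con 4 :* x2 :≤ x3) ∷ (con 1 :≤ x2) ∷ []) (con 1 :+ con 2 :* (x0 :* x2)) (x3) 0 (con 2 :* x2 ∷ con 1 ∷ con 1 ∷ []) (j≤ , fits< L (4 * l′) (n≢0⇒n>0 ¬z) , s≤s {0} {p₀} z≤n , tt))

      j-good : ∀ j → 0 < j → j ≤ 2 * l₂ → L * dist l′ ≤ R * l′
      j-good j j>0 j≤ = good ((farkas (j ∷ l′ ∷ L ∷ []) ((con 1 :+ con 2 :* (x0 :* x1) :≤ x2) ∷ (con 1 :≤ x0) ∷ []) (con 1 :+ x1) (x2) 0 (con 1 ∷ x1 ∷ []) (j-small j j≤ , j>0 , tt)))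

      i-lu : ∀ i → i ≤ 2 * l₁ → 2 * (i * lu) ≤ L
      i-lu i i≤ = by lu refl
        where
        by : ∀ n → lu ≡ n → 2 * (i * lu) ≤ L
        by zero    e = ≤-trans (≤-reflexive (trans (cong (λ n → 2 * (i * n)) e) (cong (2 *_) (*-zeroʳ i)))) z≤n
        by (suc n) e = *-cancelˡ-≤ R ⦃ >-nonZero R>0 ⦄ ((farkas (i ∷ lu ∷ R ∷ L ∷ x ∷ []) ((con 1 :+ x2 :* x1 :≤ x3 :* x4) ∷ (con 2 :* (x0 :* x4) :≤ x2) ∷ []) (x2 :* (con 2 :* (x0 :* x1))) (x2 :* x3) 0 (con 2 :* x0 ∷ x3 ∷ []) (not-good lu (≤-trans (s≤s z≤n) (≤-reflexive (sym e))) lu≤p₀ , i-small i i≤ , tt)))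

      j-dist : ∀ j → j ≤ 2 * l₂ → 2 * (j * dist l′) ≤ R
      j-dist zero    _  = z≤n
      j-dist (suc j) j≤ = *-cancelˡ-≤ L ((farkas (suc j ∷ dist l′ ∷ l′ ∷ R ∷ L ∷ []) ((x4 :* x1 :≤ x3 :* x2) ∷ (con 1 :+ con 2 :* (x0 :* x2) :≤ x4) ∷ []) (x4 :* (con 2 :* (x0 :* x1))) (x4 :* x3) 0 (con 2 :* x0 ∷ x3 ∷ []) (j-good (suc j) (s≤s z≤n) j≤ , j-small (suc j) j≤ , tt)))

      combo : ∀ i j → H (zmul (+ i ℤ.* signed lu ℤ.+ + j ℤ.* rep l′) ⊝ mul (i * lu + j * l′) v) ≡ true
      combo i j = trans (cong H (trans (cong₂ _⊝_ (trans (zmul-+ (+ i ℤ.* signed lu) (+ j ℤ.* rep l′)) (cong₂ _⊕_ (zmul-* i (signed lu)) (zmul-* j (rep l′))))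
            (trans (mul-+ (i * lu) (j * l′) v) (cong₂ _⊕_ (sym (mul-mul i lu v)) (sym (mul-mul j l′ v)))))
          (trans ((group-≡ (mul i (zmul (signed lu)) ∷ mul j (zmul (rep l′)) ∷ mul i (mul lu v) ∷ mul j (mul l′ v) ∷ []) (gv 0 ⊞ gv 1 ⊟ (gv 2 ⊞ gv 3)) (gv 0 ⊟ gv 2 ⊞ (gv 1 ⊟ gv 3))))
            (cong₂ _⊕_ (sym (mul-⊝ i _ _)) (sym (mul-⊝ j _ _))))))
        (has-+ (has-mul i (signed-cong lu)) (has-mul j (rep-cong l′)))

      same-v : ∀ n n′ → n < L → n′ < L → H (mul n v ⊝ mul n′ v) ≡ true → n ≡ n′
      same-v n n′ n< n′< h with <-cmp n n′
      ... | tri≈ _ e _   = e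
      ... | tri> _ _ n′<n = true≢false (trans (cong H (sym (mul-∸ v (<⇒≤ n′<n)))) h) (free (n ∸ n′) (m<n⇒0<n∸m n′<n) (≤-trans (m∸n≤m n n′) (s≤s⁻¹ n<)))
      ... | tri< n<n′ _ _ = true≢false (trans (cong H (trans (sym (mul-∸ v (<⇒≤ n<n′))) ((group-≡ (mul n v ∷ mul n′ v ∷ []) (gv 1 ⊟ gv 0) (⊟ (gv 0 ⊟ gv 1)))))) (has-neg h)) (free (n′ ∸ n) (m<n⇒0<n∸m n<n′) (≤-trans (m∸n≤m n′ n) (s≤s⁻¹ n′<)))

      box : Box H v L R
      box = record
        { a = signed lu ; b = rep l′ ; la = lu ; lb = l′ ; l₁ = l₁ ; l₂ = l₂
        ; near = combo
        ; la-small = la-small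
        ; small = λ i j i≤ j≤ → *-cancelˡ-≤ 2 (subst₂ (λ u w → 2 * (i * u + j * w) ≤ 2 * R) (sym (signed-val lu)) (sym (rep-dist l′))
            ((farkas (i ∷ j ∷ x ∷ dist l′ ∷ R ∷ []) ((con 2 :* (x0 :* x2) :≤ x4) ∷ (con 2 :* (x1 :* x3) :≤ x4) ∷ []) (con 2 :* (x0 :* x2 :+ x1 :* x3)) (con 2 :* x4) 0 (con 1 ∷ con 1 ∷ []) (i-small i i≤ , j-dist j j≤ , tt))))
        ; proper = proper
        ; large = λ ix e → subst (λ z → R * L ≤ 128 * (z * (suc l₁ * suc l₂))) (q≡ ix e)
            ((farkas (R ∷ L ∷ x ∷ q ∷ l′ ∷ suc l₁ ∷ suc l₂ ∷ []) ((x0 :* x1 :≤ con 2 :* (con 4 :* x2) :* x5 :* (con 2 :* (con 4 :* x4) :* x6)) ∷ (x4 :* x2 :≤ con 2 :* x3) ∷ []) (x0 :* x1) (con 128 :* (x3 :* (x5 :* x6))) 0 (con 1 ∷ con 64 :* (x5 :* x6) ∷ []) (*-mono-≤ (room R (4 * x)) (room L (4 * l′)) , l′x≤2q , tt))) }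
        where
        la-small : ∀ i j → i ≤ 2 * l₁ → j ≤ 2 * l₂ → i * lu + j * l′ < L
        la-small i j i≤ j≤ = *-cancelˡ-< 2 (i * lu + j * l′) L ((farkas (i ∷ j ∷ lu ∷ l′ ∷ L ∷ []) ((con 2 :* (x0 :* x2) :≤ x4) ∷ (con 1 :+ con 2 :* (x1 :* x3) :≤ x4) ∷ []) (con 1 :+ con 2 :* (x0 :* x2 :+ x1 :* x3)) (con 2 :* x4) 0 (con 1 ∷ con 1 ∷ []) (i-lu i i≤ , j-small j j≤ , tt)))
        q≡ : ∀ ix → size ≡ # H * ix → q ≡ ix
        q≡ ix e = *-cancelˡ-≡ q ix (# H) ⦃ >-nonZero (#>0 H 𝟘 has-0) ⦄ (trans (trans (cong (_* q) #H) (sym size-kq)) e)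
        clash : ∀ i p j′ s → 0 < p → j′ + s ≤ l₂ → + i ℤ.* signed lu ℤ.+ + (j′ + s) ℤ.* rep l′ ≡ + (i + p) ℤ.* signed lu ℤ.+ + j′ ℤ.* rep l′ →
                i * lu + (j′ + s) * l′ ≡ (i + p) * lu + j′ * l′ → ⊥
        clash i p j′ s p>0 j≤ e₁ e₂ = by lu refl
          where
          sb≡pa : + s ℤ.* rep l′ ≡ + p ℤ.* signed lu
          sb≡pa = ℤ-cancelˡ (+ i ℤ.* signed lu ℤ.+ + j′ ℤ.* rep l′) _ _ (trans (trans (arrange (signed lu) (rep l′) (+ i) (+ j′) (+ s)) e₁) (sym (arrange′ (signed lu) (rep l′) (+ i) (+ j′) (+ p))))
            where
            arrange : ∀ a b i j s → i ℤ.* a ℤ.+ j ℤ.* b ℤ.+ s ℤ.* b ≡ i ℤ.* a ℤ.+ (j ℤ.+ s) ℤ.* b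
            arrange a b i j s = trans (ℤ.+-assoc (i ℤ.* a) _ _) (cong (λ z → i ℤ.* a ℤ.+ z) (sym (ℤ.*-distribʳ-+ b j s)))
            arrange′ : ∀ a b i j p → i ℤ.* a ℤ.+ j ℤ.* b ℤ.+ p ℤ.* a ≡ (i ℤ.+ p) ℤ.* a ℤ.+ j ℤ.* b
            arrange′ a b i j p = trans (ℤ.+-assoc (i ℤ.* a) _ _) (trans (cong (λ z → i ℤ.* a ℤ.+ z) (ℤ.+-comm (j ℤ.* b) (p ℤ.* a)))
              (trans (sym (ℤ.+-assoc (i ℤ.* a) _ _)) (cong (λ z → z ℤ.+ j ℤ.* b) (sym (ℤ.*-distribʳ-+ a i p)))))
          sd≡px : s * dist l′ ≡ p * x
          sd≡px = trans (cong (s *_) (sym (rep-dist l′))) (trans (sym (ℤ.abs-* (+ s) (rep l′))) (trans (cong ℤ.∣_∣ sb≡pa) (trans (ℤ.abs-* (+ p) (signed lu)) (cong (p *_) (signed-val lu)))))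
          sl≡pl : s * l′ ≡ p * lu
          sl≡pl = (≤-antisym (farkas (i ∷ j′ ∷ s ∷ p ∷ lu ∷ l′ ∷ []) ((x0 :* x4 :+ (x1 :+ x2) :* x5 :≤ (x0 :+ x3) :* x4 :+ x1 :* x5) ∷ []) (x2 :* x5) (x3 :* x4) 0 (con 1 ∷ []) (≤-reflexive e₂ , tt)) (farkas (i ∷ j′ ∷ s ∷ p ∷ lu ∷ l′ ∷ []) (((x0 :+ x3) :* x4 :+ x1 :* x5 :≤ x0 :* x4 :+ (x1 :+ x2) :* x5) ∷ []) (x3 :* x4) (x2 :* x5) 0 (con 1 ∷ []) (≤-reflexive (sym e₂) , tt)))
          by : ∀ n → lu ≡ n → ⊥
          by zero e = <⇒≱ x>0 (≤-trans ((farkas (s ∷ p ∷ x ∷ lu ∷ dist l′ ∷ p₀ ∷ []) ((con 1 :≤ x1) ∷ (x1 :* x2 :≤ x0 :* x4) ∷ (x0 :≤ con 0) ∷ []) (x2) (con 0) 0 (x2 ∷ con 1 ∷ x4 ∷ []) (p>0 , ≤-reflexive (sym sd≡px) , n≤0 , tt))) ≤-refl)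
            where
            n≤0 : s ≤ 0
            n≤0 = (farkas (s ∷ p ∷ lu ∷ p₀ ∷ []) ((x0 :* (con 1 :+ x3) :≤ x1 :* x2) ∷ (x2 :≤ con 0) ∷ []) (x0) (con 0) 0 (con 1 ∷ x1 ∷ []) (≤-reflexive sl≡pl , ≤-reflexive e , tt))
          by (suc n) e = 1+n≰n {0} ((farkas (s ∷ p ∷ x ∷ R ∷ L ∷ lu ∷ dist l′ ∷ l′ ∷ []) ((con 1 :+ x3 :* x5 :≤ x4 :* x2) ∷ (x1 :* x2 :≤ x0 :* x6) ∷ (x0 :* x7 :≤ x1 :* x5) ∷ (x4 :* x6 :≤ x3 :* x7) ∷ (con 1 :≤ x1) ∷ []) (con 1) (con 0) 0 (x1 ∷ x4 ∷ x3 ∷ x0 ∷ con 1 ∷ []) (not-good lu (≤-trans (s≤s z≤n) (≤-reflexive (sym e))) lu≤p₀ , ≤-reflexive (sym sd≡px) , ≤-reflexive sl≡pl , j-good s s>0 (≤-trans (m≤n+m s j′) (≤-trans j≤ (m≤m+n l₂ _))) , p>0 , tt)))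
            where
            s>0 : 0 < s
            s>0 = n≢0⇒n>0 λ z → 1+n≰n {0} ((farkas (s ∷ p ∷ lu ∷ l′ ∷ n ∷ []) ((x1 :* x2 :≤ x0 :* x3) ∷ (x0 :≤ con 0) ∷ (con 1 :+ x4 :≤ x2) ∷ (con 1 :≤ x1) ∷ []) (con 1) (con 0) 0 (con 1 ∷ x3 ∷ x1 ∷ con 1 ∷ []) (≤-reflexive (sym sl≡pl) , ≤-reflexive z , ≤-reflexive (sym e) , p>0 , tt)))
        proper : ∀ i j i′ j′ → i ≤ l₁ → j ≤ l₂ → i′ ≤ l₁ → j′ ≤ l₂ →
                 + i ℤ.* signed lu ℤ.+ + j ℤ.* rep l′ ≡ + i′ ℤ.* signed lu ℤ.+ + j′ ℤ.* rep l′ → i ≡ i′ × j ≡ j′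
        proper i j i′ j′ i≤ j≤ i′≤ j′≤ e₁ = go (<-cmp i i′)
          where
          dbl : ∀ {m n} → m ≤ n → m ≤ 2 * n
          dbl h = ≤-trans h (m≤m+n _ _)
          e₂ : i * lu + j * l′ ≡ i′ * lu + j′ * l′
          e₂ = same-v _ _ (la-small i j (dbl i≤) (dbl j≤)) (la-small i′ j′ (dbl i′≤) (dbl j′≤))
            (trans (cong H (trans ((group-≡ (zmul (+ i ℤ.* signed lu ℤ.+ + j ℤ.* rep l′) ∷ mul (i * lu + j * l′) v ∷ mul (i′ * lu + j′ * l′) v ∷ []) (gv 1 ⊟ gv 2) (gv 0 ⊟ gv 2 ⊞ (⊟ (gv 0 ⊟ gv 1)))))
              (cong (λ z → z ⊝ mul (i′ * lu + j′ * l′) v ⊕ ⊖ (zmul (+ i ℤ.* signed lu ℤ.+ + j ℤ.* rep l′) ⊝ mul (i * lu + j * l′) v)) (cong zmul e₁))))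
              (has-+ (combo i′ j′) (has-neg (combo i j))))
          above : ∀ {i i′ j j′} → i < i′ → i * lu + j * l′ ≡ i′ * lu + j′ * l′ → j′ ≤ j
          above {i} {i′} {j} {j′} i<i′ e = *-cancelʳ-≤ j′ j l′ ((farkas (i ∷ i′ ∷ j ∷ j′ ∷ lu ∷ l′ ∷ []) ((x1 :* x4 :+ x3 :* x5 :≤ x0 :* x4 :+ x2 :* x5) ∷ (x0 :≤ x1) ∷ []) (x3 :* x5) (x2 :* x5) 0 (con 1 ∷ x4 ∷ []) (≤-reflexive (sym e) , <⇒≤ i<i′ , tt)))
          go : Tri (i < i′) (i ≡ i′) (i′ < i) → i ≡ i′ × j ≡ j′
          go (tri≈ _ refl _) = refl , *-cancelʳ-≡ j j′ l′ (+-cancelˡ-≡ (i * lu) _ _ e₂)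
          go (tri< i<i′ _ _) = ⊥-elim (clash i (i′ ∸ i) j′ (j ∸ j′) (m<n⇒0<n∸m i<i′) (≤-trans (≤-reflexive (m+[n∸m]≡n j′≤j)) j≤)
              (subst₂ (λ u w → + i ℤ.* signed lu ℤ.+ + u ℤ.* rep l′ ≡ + w ℤ.* signed lu ℤ.+ + j′ ℤ.* rep l′) (sym (m+[n∸m]≡n j′≤j)) (sym (m+[n∸m]≡n (<⇒≤ i<i′))) e₁)
              (subst₂ (λ u w → i * lu + u * l′ ≡ w * lu + j′ * l′) (sym (m+[n∸m]≡n j′≤j)) (sym (m+[n∸m]≡n (<⇒≤ i<i′))) e₂))
            where
            j′≤j = above {i} {i′} {j} {j′} i<i′ e₂
          go (tri> _ _ i′<i) = ⊥-elim (clash i′ (i ∸ i′) j (j′ ∸ j) (m<n⇒0<n∸m i′<i) (≤-trans (≤-reflexive (m+[n∸m]≡n j≤j′)) j′≤)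
              (subst₂ (λ u w → + i′ ℤ.* signed lu ℤ.+ + u ℤ.* rep l′ ≡ + w ℤ.* signed lu ℤ.+ + j ℤ.* rep l′) (sym (m+[n∸m]≡n j≤j′)) (sym (m+[n∸m]≡n (<⇒≤ i′<i))) (sym e₁))
              (subst₂ (λ u w → i′ * lu + u * l′ ≡ w * lu + j * l′) (sym (m+[n∸m]≡n j≤j′)) (sym (m+[n∸m]≡n (<⇒≤ i′<i))) (sym e₂)))
            where
            j≤j′ = above {i′} {i} {j′} {j} i′<i (sym e₂)

module Params where

  open Lin
  open Consts
  open import Data.Nat.Base
  open import Data.Nat.Properties

  -- The number of doublings of the error made by the chain of transforms.
  fuel : ℕ → ℕ → ℕ
  fuel h B = suc (3 * (h * B))

  n<2^n : ∀ n → n < 2 ^ n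
  n<2^n zero    = s≤s z≤n
  n<2^n (suc n) = ≤-trans (s≤s (n<2^n n)) ((farkas (2 ^ n ∷ []) ((con 1 :≤ x0) ∷ []) (con 1 :+ x0) (con 2 :* x0) 0 (con 1 ∷ []) (≤-trans (s≤s z≤n) (n<2^n n) , tt)))

  module Constants (k : ℕ) where
    n : ℕ
    n = k + 2

    n≥2 : 2 ≤ n
    n≥2 = m≤n+m 2 k

    abstract
      g Γ lam′ lam I Q B h′ B₂ h₂′ e₁ e₂ : ℕ
      g    = 32 * n
      Γ    = 256 * (g * n)
      lam′ = 16 * Γ
      lam  = suc lam′
      I    = 96 * lam
      Q    = lam * (4 * (K₁ * suc R′ ^ I))
      B    = 4 * Γ * Q
      h′   = 1000 * (B * n)
      B₂   = 32 * n
      h₂′  = 1000 * (B₂ * n)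
      e₁   = 2 ^ fuel (suc h′) B
      e₂   = 2 ^ fuel (suc h₂′) B₂

      g-def : g ≡ 32 * n
      g-def = refl

      lam-def : lam ≡ suc lam′
      lam-def = refl

      lam-big : 16 * Γ ≤ lam
      lam-big = n≤1+n _

      Γ-def : Γ ≡ 256 * (g * n)
      Γ-def = refl

      I-big : 96 * suc lam′ < 2 ^ I
      I-big = n<2^n I

      Q-def : Q ≡ lam * (4 * (K₁ * suc R′ ^ I))
      Q-def = refl

      B-def : B ≡ 4 * Γ * Q
      B-def = refl

      h-def : h′ ≡ 1000 * (B * n)
      h-def = refl

      B₂-def : B₂ ≡ 32 * n
      B₂-def = refl

      h₂-def : h₂′ ≡ 1000 * (B₂ * n)
      h₂-def = refl

      e₁-def : 2 ^ fuel (suc h′) B ≡ e₁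
      e₁-def = refl

      e₂-def : 2 ^ fuel (suc h₂′) B₂ ≡ e₂
      e₂-def = refl

      Q>0 : 0 < Q
      Q>0 = *-mono-≤ {1} {lam} (s≤s z≤n) (*-mono-≤ {1} {4} (s≤s z≤n) (*-mono-≤ (≤-trans (≤-trans (s≤s z≤n) (m≤n+m 362 _)) K₁-big) (n≢0⇒n>0 (λ e → ≢-nonZero⁻¹ (suc R′ ^ I) ⦃ m^n≢0 (suc R′) I ⦄ e))))

      -- Bounds on 1 / (row error), 1 / (excess of D) and 1 / (relative size).
      κE κζ : ℕ
      κE = 8 * (B * (suc h′ * e₁)) + 100 * (n * (B₂ * (suc h₂′ * (e₂ * (2 * g)))))
      κζ = 4 * (suc h′ * B)
      κsize : ℕ → ℕ
      κsize w = 2 * B + (2 * B₂ + suc h′ * B * (2 * β * (128 * w)))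

      κE-def : κE ≡ 8 * (B * (suc h′ * e₁)) + 100 * (n * (B₂ * (suc h₂′ * (e₂ * (2 * g)))))
      κE-def = refl

      κζ-def : κζ ≡ 4 * (suc h′ * B)
      κζ-def = refl

      κsize-def : ∀ w → κsize w ≡ 2 * B + (2 * B₂ + suc h′ * B * (2 * β * (128 * w)))
      κsize-def w = refl

    n>0 : 0 < n
    n>0 = ≤-trans (n≤1+n 1) n≥2

    g>0 : 0 < g
    g>0 = (farkas (g ∷ n ∷ []) ((con 32 :* x1 :≤ x0) ∷ (con 2 :≤ x1) ∷ []) (con 1) (x0) 63 (con 1 ∷ con 32 ∷ []) (≤-reflexive (sym g-def) , n≥2 , tt))

    Γ-big : 32 * n ≤ Γ
    Γ-big = (farkas (Γ ∷ g ∷ n ∷ []) ((con 256 :* (x1 :* x2) :≤ x0) ∷ (con 1 :≤ x1) ∷ []) (con 32 :* x2) (x0) 7 (con 1 ∷ con 256 :* x2 ∷ []) (≤-reflexive (sym Γ-def) , g>0 , tt))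

    B>0 : 0 < B
    B>0 = (farkas (B ∷ Γ ∷ n ∷ Q ∷ []) ((con 4 :* x1 :* x3 :≤ x0) ∷ (con 32 :* x2 :≤ x1) ∷ (con 1 :≤ x2) ∷ (con 1 :≤ x3) ∷ []) (con 1) (x0) 127 (con 1 ∷ con 4 :* x3 ∷ con 128 :* x3 ∷ con 128 ∷ []) (≤-reflexive (sym B-def) , Γ-big , n>0 , Q>0 , tt))

    B₂>0 : 0 < B₂
    B₂>0 = (farkas (B₂ ∷ n ∷ []) ((con 32 :* x1 :≤ x0) ∷ (con 2 :≤ x1) ∷ []) (con 1) (x0) 63 (con 1 ∷ con 32 ∷ []) (≤-reflexive (sym B₂-def) , n≥2 , tt))

module Dyson (G : FinAb) where

  open Sum
  open Grp
  open Conv G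
  open Chain G
  open Gap G public
  open Params using (fuel)

  record Split (S D : Subset) (α B h′ K : ℕ) : Set where
    field
      X Z  : Subset
      S⊆X  : ∀ x → S x ≡ true → X x ≡ true
      size-sum : # X + # Z ≡ 2 * # S
      rowZ : ∀ z → Z z ≡ true → out z X D ≤ K
      small : B * # Z ≤ α
      large : α < suc h′ * (B * # Z)

  dyson : ∀ (S D : Subset) α B h′ E₀ → (∀ s → S s ≡ true → out s S D ≤ E₀) →
          0 < α → α ≤ 2 * # S → # S ≤ 3 * α → # D ≤ 3 * α → α < B * # S → 144 * B ≤ suc h′ →
          8 * (B * (suc h′ * (2 ^ fuel (suc h′) B * E₀))) ≤ α →
          Split S D α B h′ (2 ^ fuel (suc h′) B * E₀) ⊎ Periodic S D α B h′ (2 ^ fuel (suc h′) B * E₀)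
  dyson S D α B h′ E₀ rows α>0 S-big S-small D-small B-big h-big E-small
    with DysonChain.run S D α B h′ E₀ rows (fuel (suc h′) B) (DysonChain.start S D α B h′ E₀ rows) B-big
           ((farkas (# S ∷ α ∷ B ∷ suc h′ ∷ []) ((x0 :≤ con 3 :* x1) ∷ (con 1 :≤ x1) ∷ []) (con 1 :+ x3 :* (x2 :* (con 2 :* x0))) (x3 :* (x2 :* x0) :+ (con 1 :+ con 3 :* (x3 :* x2)) :* x1) 0 (x3 :* x2 ∷ con 1 ∷ []) (S-small , α>0 , tt)))
  ... | inj₂ P = inj₂ (GapCase.result S D α B h′ E₀ rows _ P S-big D-small h-big E-small α>0)
  ... | inj₁ P = inj₁ record
      { X = X ; Z = Z ; S⊆X = S⊆X ; size-sum = size-sum ; rowZ = rowZ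
      ; small = DysonChain.Small.small P ; large = DysonChain.Small.large P }
    where open DysonChain.Pair (DysonChain.Small.pair P)

  average≥ : ∀ (Z : Subset) (f : Carrier → ℕ) → 0 < # Z →
             ∃[ z ] Z z ≡ true × Σ (λ z → ⟦ Z z ⟧ * f z) ≤ # Z * f z
  average≥ Z f Z>0 = let z , p = Σ-< {λ z → ⟦ Z z ⟧ * T} {λ z → ⟦ Z z ⟧ * suc (# Z * f z)} lt in pick z p
    where
    T : ℕ
    T = Σ (λ z → ⟦ Z z ⟧ * f z)
    lt : Σ (λ z → ⟦ Z z ⟧ * T) < Σ (λ z → ⟦ Z z ⟧ * suc (# Z * f z))
    lt = subst₂ _<_ (sym (trans (Σ-*ʳ T (λ z → ⟦ Z z ⟧)) (cong (_* T) (sym (#-Σ Z)))))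
      (sym (trans (Σ-cong (λ z → (ring-≡ (⟦ Z z ⟧ ∷ # Z ∷ f z ∷ []) (x0 :* (con 1 :+ x1 :* x2)) (x0 :+ x1 :* (x0 :* x2)))))
        (trans (Σ-+ _ _) (cong₂ _+_ (sym (#-Σ Z)) (Σ-*ˡ (# Z) _)))))
      ((farkas (# Z ∷ T ∷ []) ((con 1 :+ con 0 :≤ x0) ∷ []) (con 1 :+ x0 :* x1) (x0 :+ x0 :* x1) 0 (con 1 ∷ []) (Z>0 , tt)))
    pick : ∀ z → ⟦ Z z ⟧ * T < ⟦ Z z ⟧ * suc (# Z * f z) → ∃[ z ] Z z ≡ true × T ≤ # Z * f z
    pick z p with bool (Z z)
    ... | inj₁ q rewrite q = z , q , s≤s⁻¹ (subst₂ _<_ (+-identityʳ T) (+-identityʳ (suc (# Z * f z))) p)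
    ... | inj₂ q rewrite q = ⊥-elim (n≮0 p)

  dense-coset : ∀ (S W H : Subset) k α q → Subgroup H → (∀ t → H t ≡ true → ∀ w → W (w ⊕ t) ≡ W w) →
                0 < # W → (k + 2) * # W ≤ (2 * k + 5) * α → (k + 1) * α ≤ (k + 2) * # (λ x → W x ∧ S (x ⊕ q)) →
                ∃[ u₀ ] (k + 2) * # H ≤ 2 * ((k + 2) * # (λ h → H h ∧ S (u₀ ⊕ q ⊕ h))) + 2 * # H
  dense-coset S W H k α q H-group inv W>0 W-small S-big =
    let u₀ , _ , found = average≥ W cnt W>0 in u₀ , *-cancelʳ-≤ _ _ (# W) ⦃ >-nonZero W>0 ⦄
        ((farkas (k ∷ # W ∷ # H ∷ cnt u₀ ∷ s ∷ []) ((x2 :* x4 :≤ x1 :* x3) ∷ ((x0 :+ con 2) :* x1 :≤ con 2 :* ((x0 :+ con 2) :* x4) :+ con 2 :* x1) ∷ []) ((x0 :+ con 2) :* x2 :* x1) ((con 2 :* ((x0 :+ con 2) :* x3) :+ con 2 :* x2) :* x1) 0 (con 2 :* (x0 :+ con 2) ∷ x2 ∷ []) (≤-trans (≤-reflexive (sym total)) found , key , tt)))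
    where
    cnt : Carrier → ℕ
    cnt x = # (λ h → H h ∧ S (x ⊕ q ⊕ h))
    s : ℕ
    s = # (λ x → W x ∧ S (x ⊕ q))
    instance
      k+2≢0 : NonZero (k + 2)
      k+2≢0 = >-nonZero (≤-trans (s≤s {0} {1} z≤n) (m≤n+m 2 k))
    key : (k + 2) * # W ≤ 2 * ((k + 2) * s) + 2 * # W
    key = *-cancelˡ-≤ (k + 2) ((farkas (k ∷ α ∷ # W ∷ s ∷ []) (((x0 :+ con 2) :* x2 :≤ (con 2 :* x0 :+ con 5) :* x1) ∷ ((x0 :+ con 1) :* x1 :≤ (x0 :+ con 2) :* x3) ∷ []) ((x0 :+ con 2) :* ((x0 :+ con 2) :* x2)) ((x0 :+ con 2) :* (con 2 :* ((x0 :+ con 2) :* x3) :+ con 2 :* x2)) 0 (x0 ∷ con 2 :* (x0 :+ con 2) ∷ []) (W-small , S-big , tt)))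
    total : Σ (λ x → ⟦ W x ⟧ * cnt x) ≡ # H * s
    total = trans (Σ-cong (λ x → trans (cong (⟦ W x ⟧ *_) (#-Σ _)) (sym (Σ-*ˡ ⟦ W x ⟧ _)))) (trans (Σ-swap _)
      (trans (Σ-cong (λ h → inner h (H h) refl)) (trans (Σ-*ʳ s (λ h → ⟦ H h ⟧)) (cong (_* s) (sym (#-Σ H))))))
      where
      inner : ∀ h b → H h ≡ b → Σ (λ x → ⟦ W x ⟧ * ⟦ b ∧ S (x ⊕ q ⊕ h) ⟧) ≡ ⟦ b ⟧ * s
      inner h false p = trans (Σ-cong (λ x → *-zeroʳ ⟦ W x ⟧)) Σ-zero
      inner h true  p = trans (sym (Σ-shift (⊖ h) _)) (trans (Σ-cong (λ x → trans (sym (⟦∧⟧ (W (x ⊝ h)) _))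
          (cong₂ (λ u v → ⟦ u ∧ S v ⟧) (inv (⊖ h) (Subgroup.has-neg H-group p) x) ((group-≡ (x ∷ h ∷ q ∷ []) (gv 0 ⊟ gv 1 ⊞ gv 2 ⊞ gv 1) (gv 0 ⊞ gv 2))))))
        (trans (sym (#-Σ _)) (sym (+-identityʳ s))))

module Smooth (G : FinAb) where

  open Sum
  open Grp
  open Conv G
  open Near G using (ν-neg)

  ∑-offset : ∀ l k (f : ℕ → ℕ) → k ≤ l → ∑ (suc l) (λ i → f (k + i)) ≤ ∑ (suc (2 * l)) f
  ∑-offset l k f k≤ = ≤-trans (≤-trans (m≤n+m _ (∑ k f)) (≤-reflexive (sym (∑-split k (suc l) f))))
    (∑-monoˡ f ((farkas (k ∷ l ∷ []) ((x0 :≤ x1) ∷ []) (x0 :+ (con 1 :+ x1)) (con 1 :+ con 2 :* x1) 0 (con 1 ∷ []) (k≤ , tt))))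

  abstract
    ∑² : ℕ → ℕ → (ℕ → ℕ → ℕ) → ℕ
    ∑² m n F = ∑ m (λ i → ∑ n (λ j → F i j))

    ∑²-∑ : ∀ m n F → ∑² m n F ≡ ∑ m (λ i → ∑ n (λ j → F i j))
    ∑²-∑ m n F = refl

    ∑²-mono : ∀ m n {F F′ : ℕ → ℕ → ℕ} → (∀ i j → i < m → j < n → F i j ≤ F′ i j) → ∑² m n F ≤ ∑² m n F′
    ∑²-mono m n h = ∑-mono m (λ i i< → ∑-mono n (λ j j< → h i j i< j<))

    ∑²-cong : ∀ m n {F F′ : ℕ → ℕ → ℕ} → (∀ i j → i < m → j < n → F i j ≡ F′ i j) → ∑² m n F ≡ ∑² m n F′
    ∑²-cong m n h = ∑-cong m (λ i i< → ∑-cong n (λ j j< → h i j i< j<))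

    ∑²-const : ∀ m n c → ∑² m n (λ _ _ → c) ≡ m * n * c
    ∑²-const m n c = trans (∑-cong m (λ i _ → ∑-const n c)) (trans (∑-const m (n * c)) (sym (*-assoc m n c)))

    ∑²-+ : ∀ m n (F F′ : ℕ → ℕ → ℕ) → ∑² m n (λ i j → F i j + F′ i j) ≡ ∑² m n F + ∑² m n F′
    ∑²-+ m n F F′ = trans (∑-cong m (λ i _ → ∑-+ n (F i) (F′ i))) (∑-+ m _ _)

    ∑²-*ˡ : ∀ m n c (F : ℕ → ℕ → ℕ) → ∑² m n (λ i j → c * F i j) ≡ c * ∑² m n F
    ∑²-*ˡ m n c F = trans (∑-cong m (λ i _ → ∑-*ˡ n c (F i))) (∑-*ˡ m c _)

    ∑²-exists : ∀ m n (F : ℕ → ℕ → ℕ) → 0 < ∑² m n F → ∃[ i ] ∃[ j ] i < m × j < n × 0 < F i j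
    ∑²-exists m n F h = let i , i< , p = ∑-exists m _ h ; j , j< , q = ∑-exists n _ p in i , j , i< , j< , q

    ∑²-< : ∀ m n {F F′ : ℕ → ℕ → ℕ} → ∑² m n F < ∑² m n F′ → ∃[ i ] ∃[ j ] i < m × j < n × F i j < F′ i j
    ∑²-< m n h = let i , i< , p = ∑-< m h ; j , j< , q = ∑-< n p in i , j , i< , j< , q

    Σ-∑²-swap : ∀ m n (F : Carrier → ℕ → ℕ → ℕ) → Σ (λ x → ∑² m n (F x)) ≡ ∑² m n (λ i j → Σ (λ x → F x i j))
    Σ-∑²-swap m n F = trans (Σ-∑-swap m _) (∑-cong m (λ i _ → Σ-∑-swap n _))

    ∑²-offset : ∀ l₁ l₂ i₀ j₀ (F : ℕ → ℕ → ℕ) → i₀ ≤ l₁ → j₀ ≤ l₂ →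
      ∑² (suc l₁) (suc l₂) (λ i j → F (i₀ + i) (j₀ + j)) ≤ ∑² (suc (2 * l₁)) (suc (2 * l₂)) F
    ∑²-offset l₁ l₂ i₀ j₀ F i≤ j≤ = ≤-trans (∑-mono (suc l₁) (λ i _ → ∑-offset l₂ j₀ (F (i₀ + i)) j≤))
      (∑-offset l₁ i₀ (λ i → ∑ (suc (2 * l₂)) (F i)) i≤)

  module Cells (q : ℕ → ℕ → Carrier) (q-+ : ∀ i j i′ j′ → q i j ⊕ q i′ j′ ≡ q (i + i′) (j + j′)) (l₁ l₂ : ℕ) where

    N : ℕ
    N = suc l₁ * suc l₂

    c c₂ : Subset → Carrier → ℕ
    c  S x = ∑² (suc l₁) (suc l₂) (λ i j → ⟦ S (x ⊕ q i j) ⟧)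
    c₂ S x = ∑² (suc (2 * l₁)) (suc (2 * l₂)) (λ i j → ⟦ S (x ⊕ q i j) ⟧)

    Σ-c : ∀ S → Σ (c S) ≡ N * # S
    Σ-c S = trans (Σ-∑²-swap (suc l₁) (suc l₂) _) (trans (∑²-cong (suc l₁) (suc l₂) (λ i j _ _ → trans (Σ-shift (q i j) (λ x → ⟦ S x ⟧)) (sym (#-Σ S)))) (∑²-const (suc l₁) (suc l₂) (# S)))

    module Dense (g : ℕ) (S D : Subset) where
      S₂ D₂ : Subset
      S₂ x = N ≤ᵇ g * c S x
      D₂ x = N ≤ᵇ 2 * g * c₂ D x

      rows₂ : ∀ E₀ → (∀ s → S s ≡ true → out s S D ≤ E₀) → ∀ x → S₂ x ≡ true → out x S₂ D₂ ≤ 2 * (g * E₀)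
      rows₂ E₀ rows x x∈ = *-cancelˡ-≤ N (≤-trans (subst₂ _≤_ (trans (Σ-*ˡ N _) (cong (N *_) (sym (#-Σ _)))) (Σ-*ˡ (2 * g) bad) (Σ-mono pointwise))
          ((farkas (N ∷ g ∷ E₀ ∷ Σ bad ∷ []) ((x3 :≤ x0 :* x2) ∷ []) (con 2 :* x1 :* x3) (x0 :* (con 2 :* (x1 :* x2))) 0 (con 2 :* x1 ∷ []) (total , tt))))
        where
        cx>0 : 0 < c S x
        cx>0 = n≢0⇒n>0 λ z → n≮0 (≤-trans (≤ᵇ-true {N} x∈) (≤-reflexive (trans (cong (g *_) z) (*-zeroʳ g))))
        pt : ∃[ i ] ∃[ j ] i < suc l₁ × j < suc l₂ × 0 < ⟦ S (x ⊕ q i j) ⟧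
        pt = ∑²-exists (suc l₁) (suc l₂) _ cx>0
        i₀ j₀ : ℕ
        i₀ = proj₁ pt
        j₀ = proj₁ (proj₂ pt)
        a : Carrier
        a = x ⊕ q i₀ j₀
        bad good : Carrier → ℕ
        bad  s = ∑² (suc l₁) (suc l₂) (λ i j → ⟦ S (s ⊕ q i j) ∧ not (D (a ⊕ (s ⊕ q i j))) ⟧)
        good s = ∑² (suc l₁) (suc l₂) (λ i j → ⟦ D (a ⊕ (s ⊕ q i j)) ⟧)
        total : Σ bad ≤ N * E₀
        total = ≤-trans (≤-reflexive (Σ-∑²-swap (suc l₁) (suc l₂) _)) (≤-trans (∑²-mono (suc l₁) (suc l₂) (λ i j _ _ →
            ≤-trans (≤-reflexive (trans (Σ-shift (q i j) (λ s → ⟦ S s ∧ not (D (a ⊕ s)) ⟧)) (sym (#-Σ _)))) (rows a (⟦⟧-true (proj₂ (proj₂ (proj₂ (proj₂ pt))))))))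
          (≤-reflexive (∑²-const (suc l₁) (suc l₂) E₀)))
        c≤ : ∀ s → c S s ≤ good s + bad s
        c≤ s = ≤-trans (∑²-mono (suc l₁) (suc l₂) (λ i j _ _ → ⟦⟧-cover (S (s ⊕ q i j)) (D (a ⊕ (s ⊕ q i j))) _ ∧-not)) (≤-reflexive (∑²-+ (suc l₁) (suc l₂) _ _))
        good≤ : ∀ s → good s ≤ c₂ D (x ⊕ s)
        good≤ s = ≤-trans (≤-reflexive (∑²-cong (suc l₁) (suc l₂) (λ i j _ _ → cong (λ z → ⟦ D z ⟧)
             (trans ((group-≡ (x ∷ s ∷ q i₀ j₀ ∷ q i j ∷ []) (gv 0 ⊞ gv 2 ⊞ (gv 1 ⊞ gv 3)) (gv 0 ⊞ gv 1 ⊞ (gv 2 ⊞ gv 3)))) (cong (x ⊕ s ⊕_) (q-+ i₀ j₀ i j))))))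
          (∑²-offset l₁ l₂ i₀ j₀ (λ i j → ⟦ D (x ⊕ s ⊕ q i j) ⟧) (s≤s⁻¹ (proj₁ (proj₂ (proj₂ pt)))) (s≤s⁻¹ (proj₁ (proj₂ (proj₂ (proj₂ pt))))))
        pointwise : ∀ s → N * ⟦ S₂ s ∧ not (D₂ (x ⊕ s)) ⟧ ≤ 2 * g * bad s
        pointwise s with bool (S₂ s) | bool (D₂ (x ⊕ s))
        ... | inj₂ p | _      rewrite p = ≤-trans (≤-reflexive (*-zeroʳ N)) z≤n
        ... | inj₁ p | inj₁ r rewrite p | r = ≤-trans (≤-reflexive (*-zeroʳ N)) z≤n
        ... | inj₁ p | inj₂ r rewrite p | r = (farkas (N ∷ g ∷ c S s ∷ bad s ∷ good s ∷ c₂ D (x ⊕ s) ∷ []) ((x0 :≤ x1 :* x2) ∷ (con 1 :+ con 2 :* x1 :* x5 :≤ x0) ∷ (x2 :≤ x4 :+ x3) ∷ (x4 :≤ x5) ∷ []) (x0 :* con 1) (con 2 :* x1 :* x3) 0 (con 2 ∷ con 1 ∷ con 2 :* x1 ∷ con 2 :* x1 ∷ []) (≤ᵇ-true {N} p , ≤ᵇ-false {N} r , c≤ s , good≤ s , tt))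

      D₂-size : ∀ (Y : Subset) δ νm → # (λ d → D d ∧ not (Y d)) ≤ δ → (∀ i j → i ≤ 2 * l₁ → j ≤ 2 * l₂ → ν Y (q i j) ≤ νm) →
                # D₂ ≤ # Y + 8 * (g * (δ + νm))
      D₂-size Y δ νm D∖Y near = *-cancelˡ-≤ N (≤-trans (subst₂ _≤_ (trans (Σ-*ˡ N _) (cong (N *_) (sym (#-Σ D₂))))
            (trans (Σ-+ _ _) (cong₂ _+_ (trans (Σ-*ˡ N _) (cong (N *_) (sym (#-Σ Y)))) (Σ-*ˡ (2 * g) new))) (Σ-mono pointwise))
          ((farkas (N ∷ g ∷ δ ∷ νm ∷ # Y ∷ Σ new ∷ suc (2 * l₁) * suc (2 * l₂) ∷ []) ((x5 :≤ x6 :* (x2 :+ x3)) ∷ (x6 :≤ con 4 :* x0) ∷ []) (x0 :* x4 :+ con 2 :* x1 :* x5) (x0 :* (x4 :+ con 8 :* (x1 :* (x2 :+ x3)))) 0 (con 2 :* x1 ∷ con 2 :* x1 :* (x2 :+ x3) ∷ []) (total , wide , tt))))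
        where
        new : Carrier → ℕ
        new d = ∑² (suc (2 * l₁)) (suc (2 * l₂)) (λ i j → ⟦ not (Y d) ∧ D (d ⊕ q i j) ⟧)
        wide : suc (2 * l₁) * suc (2 * l₂) ≤ 4 * N
        wide = (farkas (l₁ ∷ l₂ ∷ []) ([]) ((con 1 :+ con 2 :* x0) :* (con 1 :+ con 2 :* x1)) (con 4 :* ((con 1 :+ x0) :* (con 1 :+ x1))) 0 ([]) (tt))
        total : Σ new ≤ suc (2 * l₁) * suc (2 * l₂) * (δ + νm)
        total = ≤-trans (≤-reflexive (Σ-∑²-swap (suc (2 * l₁)) (suc (2 * l₂)) _)) (≤-trans (∑²-mono (suc (2 * l₁)) (suc (2 * l₂)) (λ i j i< j< →
            ≤-trans (≤-reflexive (sym (#-Σ _))) (≤-trans (#-cover {Y = λ d → D (d ⊕ q i j) ∧ not (Y (d ⊕ q i j))} {Z = λ d → Y (d ⊕ q i j) ∧ not (Y (d ⊕ q i j ⊝ q i j))}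
               (λ d p r → ∧-not (not-false (∧-false r (∧-elimʳ {not (Y d)} p))) (trans (cong Y ((group-≡ (d ∷ q i j ∷ []) (gv 0 ⊞ gv 1 ⊟ gv 1) (gv 0)))) (not-true (∧-elimˡ p)))))
             (+-mono-≤ (≤-trans (≤-reflexive (#-shift (q i j) (λ d → D d ∧ not (Y d)))) D∖Y)
               (≤-trans (≤-reflexive (trans (#-shift (q i j) (λ d → Y d ∧ not (Y (d ⊝ q i j)))) (ν-neg Y (q i j)))) (near i j (s≤s⁻¹ i<) (s≤s⁻¹ j<)))))))
          (≤-reflexive (∑²-const (suc (2 * l₁)) (suc (2 * l₂)) (δ + νm))))
        c₂≤ : ∀ d → Y d ≡ false → c₂ D d ≤ new d
        c₂≤ d p = ∑²-mono (suc (2 * l₁)) (suc (2 * l₂)) (λ i j _ _ → ⟦⟧-mono (λ r → ∧-intro (cong not p) r))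
        pointwise : ∀ d → N * ⟦ D₂ d ⟧ ≤ N * ⟦ Y d ⟧ + 2 * g * new d
        pointwise d with bool (D₂ d) | bool (Y d)
        ... | inj₂ p | _      rewrite p = ≤-trans (≤-reflexive (*-zeroʳ N)) z≤n
        ... | inj₁ p | inj₁ r rewrite p | r = m≤m+n (N * 1) _
        ... | inj₁ p | inj₂ r = ≤-trans (≤-trans (*-monoʳ-≤ N (⟦⟧≤1 (D₂ d))) (≤-trans (≤-reflexive (*-identityʳ N)) (≤-trans (≤ᵇ-true {N} p) (*-monoʳ-≤ (2 * g) (c₂≤ d r))))) (m≤n+m _ (N * ⟦ Y d ⟧))

      mass : ∀ (X : Subset) νm → (∀ x → S x ≡ true → X x ≡ true) → (∀ i j → i ≤ l₁ → j ≤ l₂ → ν X (q i j) ≤ νm) →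
             g * (N * # S) ≤ g * Σ (λ x → ⟦ S₂ x ⟧ * c S x) + (N * # X + g * (N * νm))
      mass X νm S⊆X near = ≤-trans (≤-reflexive (cong (g *_) (sym (Σ-c S)))) (≤-trans (subst₂ _≤_ (Σ-*ˡ g (c S))
            (trans (Σ-+ _ _) (cong₂ _+_ (Σ-*ˡ g _) (trans (Σ-+ _ _) (cong₂ _+_ (trans (Σ-*ˡ N _) (cong (N *_) (sym (#-Σ X)))) (Σ-*ˡ g stray))))) (Σ-mono pointwise))
          (+-monoʳ-≤ (g * Σ (λ x → ⟦ S₂ x ⟧ * c S x)) (+-monoʳ-≤ (N * # X) (*-monoʳ-≤ g total))))
        where
        stray : Carrier → ℕ
        stray x = ∑² (suc l₁) (suc l₂) (λ i j → ⟦ not (X x) ∧ S (x ⊕ q i j) ⟧)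
        total : Σ stray ≤ N * νm
        total = ≤-trans (≤-reflexive (Σ-∑²-swap (suc l₁) (suc l₂) _)) (≤-trans (∑²-mono (suc l₁) (suc l₂) (λ i j i< j< →
            ≤-trans (≤-reflexive (sym (#-Σ _))) (≤-trans (#-subst (q i j) (λ x p → ∧-not (S⊆X _ (∧-elimʳ {not (X x)} p)) (trans (cong X ((group-≡ (x ∷ q i j ∷ []) (gv 0 ⊞ gv 1 ⊟ gv 1) (gv 0)))) (not-true (∧-elimˡ p)))))
             (≤-trans (≤-reflexive (ν-neg X (q i j))) (near i j (s≤s⁻¹ i<) (s≤s⁻¹ j<))))))
          (≤-reflexive (∑²-const (suc l₁) (suc l₂) νm)))
        pointwise : ∀ x → g * c S x ≤ g * (⟦ S₂ x ⟧ * c S x) + (N * ⟦ X x ⟧ + g * stray x)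
        pointwise x with bool (S₂ x) | bool (X x)
        ... | inj₁ p | _      rewrite p = ≤-trans (≤-reflexive (cong (g *_) (sym (+-identityʳ (c S x))))) (m≤m+n _ _)
        ... | inj₂ p | inj₁ r rewrite r = ≤-trans (<⇒≤ (≤ᵇ-false {N} p)) (≤-trans (≤-reflexive (sym (*-identityʳ N))) (≤-trans (m≤m+n (N * 1) _) (m≤n+m _ (g * (⟦ S₂ x ⟧ * c S x)))))
        ... | inj₂ p | inj₂ r = ≤-trans (*-monoʳ-≤ g (∑²-mono (suc l₁) (suc l₂) (λ i j _ _ → ⟦⟧-mono (λ s → ∧-intro (cong not r) s))))
                                  (≤-trans (m≤n+m _ (N * ⟦ X x ⟧)) (m≤n+m _ (g * (⟦ S₂ x ⟧ * c S x))))

-- The dichotomy in a cyclic group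

module Core (G : FinAb) where

  open Sum
  open Grp
  open Conv G
  open Chain G
  open Iter G using (mul; mul-+)
  open Near G
  open Cyc G
  open Dyson G
  open Smooth G
  open Consts
  open Params
  open import Data.Nat.DivMod
  open import Data.Integer.Base as ℤ using (ℤ; +_)
  import Data.Integer.Properties as ℤ

  ν-rows : ∀ X D K z₁ z₂ → out z₁ X D ≤ K → out z₂ X D ≤ K → ν X (z₁ ⊝ z₂) + # X ≤ # D + (K + K)
  ν-rows X D K z₁ z₂ h₁ h₂ = (farkas (ν X (z₁ ⊝ z₂) ∷ # X ∷ # D ∷ K ∷ # U ∷ # (λ y → X (y ⊝ z₂)) ∷ []) ((x4 :≤ x2 :+ (x3 :+ x3)) ∷ (x0 :+ x5 :≤ x4) ∷ (x1 :≤ x5) ∷ []) (x0 :+ x1) (x2 :+ (x3 :+ x3)) 0 (con 1 ∷ con 1 ∷ con 1 ∷ []) (cover , ≤-reflexive (sym split) , ≤-reflexive (sym (#-shift (⊖ z₂) X)) , tt))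
    where
    U : Subset
    U y = (X (y ⊝ z₂) ∨ X (y ⊝ z₁))
    cover : # U ≤ # D + (K + K)
    cover = ≤-trans (#-cover₃ {U} {D} {λ y → X (y ⊝ z₂) ∧ not (D (z₂ ⊕ (y ⊝ z₂)))} {λ y → X (y ⊝ z₁) ∧ not (D (z₁ ⊕ (y ⊝ z₁)))} rest)
      (+-monoʳ-≤ (# D) (+-mono-≤ (≤-trans (≤-reflexive (#-shift (⊖ z₂) (λ x → X x ∧ not (D (z₂ ⊕ x))))) h₂) (≤-trans (≤-reflexive (#-shift (⊖ z₁) (λ x → X x ∧ not (D (z₁ ⊕ x))))) h₁)))
      where
      rest : ∀ y → U y ≡ true → D y ≡ false → X (y ⊝ z₂) ∧ not (D (z₂ ⊕ (y ⊝ z₂))) ≡ false → X (y ⊝ z₁) ∧ not (D (z₁ ⊕ (y ⊝ z₁))) ≡ true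
      rest y u d v with ∨-elim {X (y ⊝ z₂)} u
      ... | inj₂ p = ∧-not p (trans (cong D ((group-≡ (y ∷ z₁ ∷ []) (gv 1 ⊞ (gv 0 ⊟ gv 1)) (gv 0)))) d)
      ... | inj₁ p = true≢false (∧-not p (trans (cong D ((group-≡ (y ∷ z₂ ∷ []) (gv 1 ⊞ (gv 0 ⊟ gv 1)) (gv 0)))) d)) v
    split : # U ≡ ν X (z₁ ⊝ z₂) + # (λ y → X (y ⊝ z₂))
    split = trans (#-split U (λ y → X (y ⊝ z₂))) (trans (+-comm (# (λ y → U y ∧ X (y ⊝ z₂))) _)
      (cong₂ _+_ (trans (#-cong (λ y → left (X (y ⊝ z₂)) (X (y ⊝ z₁)))) (trans (sym (#-shift z₁ _)) (trans (#-cong (λ x → cong₂ (λ a b → X a ∧ not (X b)) ((group-≡ (x ∷ z₁ ∷ []) (gv 0 ⊞ gv 1 ⊟ gv 1) (gv 0))) ((group-≡ (x ∷ z₁ ∷ z₂ ∷ []) (gv 0 ⊞ gv 1 ⊟ gv 2) (gv 0 ⊞ (gv 1 ⊟ gv 2)))))) refl)))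
        (#-cong (λ y → right (X (y ⊝ z₂)) (X (y ⊝ z₁))))))
      where
      left : ∀ a b → (a ∨ b) ∧ not a ≡ b ∧ not a
      left true  b = sym (lem b)
        where
        lem : ∀ b → b ∧ false ≡ false
        lem true  = refl
        lem false = refl
      left false b = refl
      right : ∀ a b → (a ∨ b) ∧ a ≡ a
      right true  b = refl
      right false b with b
      ... | true  = refl
      ... | false = refl

  ν-shift : ∀ X z t → ν (λ x → X (x ⊝ z)) t ≡ ν X t
  ν-shift X z t = trans (#-cong (λ x → cong (λ y → X (x ⊝ z) ∧ not (X y)) (⊕-swapʳ x t (⊖ z)))) (#-shift (⊖ z) (λ x → X x ∧ not (X (x ⊕ t))))

  module PeriodicEnd (S D : Subset) (α B h′ K n : ℕ) (P : Periodic S D α B h′ K)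
    (B>0 : 0 < B) (n>0 : 0 < n) (h-def : h′ ≡ 1000 * (B * n)) (D-small : 2 * (n * (# D + K)) ≤ (4 * n + 1) * α) where
    open Periodic P

    stray : 50 * (n * # (λ s → S s ∧ not (W s))) ≤ α
    stray = *-cancelˡ-≤ (18 * B) ⦃ >-nonZero (*-mono-≤ {1} {18} (s≤s z≤n) B>0) ⦄
      ((farkas (B ∷ n ∷ α ∷ h′ ∷ # (λ s → S s ∧ not (W s)) ∷ []) (((con 1 :+ x3) :* x4 :≤ con 18 :* (x0 :* x2)) ∷ (con 1000 :* (x0 :* x1) :≤ x3) ∷ []) (con 18 :* x0 :* (con 50 :* (x1 :* x4))) (con 18 :* x0 :* x2) 9 (con 9 ∷ con 9 :* x4 ∷ []) (S∖W-size , ≤-reflexive (sym h-def) , tt)))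

    W-small : n * # W ≤ (2 * n + 1) * α
    W-small = *-cancelˡ-≤ h′ ⦃ >-nonZero h>0 ⦄ ((farkas (n ∷ α ∷ h′ ∷ # W ∷ # D + K ∷ []) ((x2 :* x3 :≤ (con 1 :+ x2) :* x4) ∷ (con 2 :* (x0 :* x4) :≤ (con 4 :* x0 :+ con 1) :* x1) ∷ (con 10 :* x0 :≤ x2) ∷ (con 1 :≤ x0) ∷ []) (x2 :* (x0 :* x3)) (x2 :* ((con 2 :* x0 :+ con 1) :* x1)) 3 (con 4 :* x0 ∷ con 2 :* x2 :+ con 2 ∷ x1 ∷ con 2 :* x1 ∷ []) (W-size , D-small , h>n , n>0 , tt)))
      where
      h>n : 10 * n ≤ h′
      h>n = (farkas (h′ ∷ B ∷ n ∷ []) ((con 1000 :* (x1 :* x2) :≤ x0) ∷ (con 1 :≤ x1) ∷ []) (con 10 :* x2) (x0) 99 (con 1 ∷ con 1000 :* x2 ∷ []) (≤-reflexive (sym h-def) , B>0 , tt))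
      h>0 : 0 < h′
      h>0 = (farkas (h′ ∷ n ∷ []) ((con 10 :* x1 :≤ x0) ∷ (con 1 :≤ x1) ∷ []) (con 1) (x0) 9 (con 1 ∷ con 10 ∷ []) (h>n , n>0 , tt))

  module Theorem (k w : ℕ) (e : Carrier) (enum-mul : ∀ n → enum n ≡ mul n e) (size>0 : 0 < size) (period : mul size e ≡ 𝟘) where
    open Constants k
    open Cyclic e enum-mul size>0 period

    κC : ℕ
    κC = κsize w

    κC-def : κC ≡ 2 * B + (2 * B₂ + suc h′ * B * (2 * β * (128 * w)))
    κC-def = κsize-def w

    record DenseBox (S : Subset) (α R : ℕ) : Set where
      field
        a b    : ℤ
        l₁ l₂  : ℕ
        corner : Carrier
        small  : ∀ i j → i ≤ l₁ → j ≤ l₂ → i * ℤ.∣ a ∣ + j * ℤ.∣ b ∣ ≤ R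
        proper : ∀ i j i′ j′ → i ≤ l₁ → j ≤ l₂ → i′ ≤ l₁ → j′ ≤ l₂ →
                 + i ℤ.* a ℤ.+ + j ℤ.* b ≡ + i′ ℤ.* a ℤ.+ + j′ ℤ.* b → i ≡ i′ × j ≡ j′
        dense  : n * (suc l₁ * suc l₂) ≤ n * ∑² (suc l₁) (suc l₂) (λ i j → ⟦ S (corner ⊕ zmul (+ i ℤ.* a ℤ.+ + j ℤ.* b)) ⟧) + suc l₁ * suc l₂
        large  : α ≤ κC * (suc l₁ * suc l₂)

    record DenseCoset (S : Subset) (α : ℕ) : Set where
      field
        H       : Subset
        H-group : Subgroup H
        corner  : Carrier
        dense   : n * # H ≤ 2 * (n * # (λ h → H h ∧ S (corner ⊕ h))) + 2 * # H
        large   : α ≤ κC * # H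

    module Run (S D Edge : Subset) (ζ E₀ R : ℕ) (S>0 : 0 < # S) (rows : ∀ s → S s ≡ true → out s S D ≤ E₀)
      (D-size : # D ≤ 2 * # S + ζ) (ζ-small : κζ * ζ ≤ # S) (E-small : κE * E₀ ≤ # S)
      (R>0 : 0 < R) (R-big : size ≤ w * R) (edge : 8 * (n * # (λ x → S x ∧ Edge x)) ≤ # S) where

      α : ℕ
      α = # S

      ζ-small′ : 4 * (suc h′ * (B * ζ)) ≤ α
      ζ-small′ = (farkas (κζ ∷ suc h′ ∷ B ∷ ζ ∷ α ∷ []) ((x0 :* x3 :≤ x4) ∷ (con 4 :* (x1 :* x2) :≤ x0) ∷ []) (con 4 :* (x1 :* (x2 :* x3))) (x4) 0 (con 1 ∷ x3 ∷ []) (ζ-small , ≤-reflexive (sym κζ-def) , tt))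

      E-small′ : 8 * (B * (suc h′ * (e₁ * E₀))) ≤ α
      E-small′ = (farkas (κE ∷ suc h′ ∷ B ∷ E₀ ∷ α ∷ e₁ ∷ n * (B₂ * (suc h₂′ * (e₂ * (2 * g)))) ∷ []) ((x0 :* x3 :≤ x4) ∷ (con 8 :* (x2 :* (x1 :* x5)) :+ con 100 :* x6 :≤ x0) ∷ []) (con 8 :* (x2 :* (x1 :* (x5 :* x3)))) (x4) 0 (con 1 ∷ x3 ∷ []) (E-small , ≤-reflexive (sym κE-def) , tt))

      E-small₂ : 100 * (n * (B₂ * (suc h₂′ * (e₂ * (2 * (g * E₀)))))) ≤ α
      E-small₂ = (farkas (κE ∷ suc h₂′ ∷ B₂ ∷ E₀ ∷ α ∷ e₂ ∷ g ∷ n ∷ B * (suc h′ * e₁) ∷ []) ((x0 :* x3 :≤ x4) ∷ (con 8 :* x8 :+ con 100 :* (x7 :* (x2 :* (x1 :* (x5 :* (con 2 :* x6))))) :≤ x0) ∷ []) (con 100 :* (x7 :* (x2 :* (x1 :* (x5 :* (con 2 :* (x6 :* x3))))))) (x4) 0 (con 1 ∷ x3 ∷ []) (E-small , ≤-reflexive (sym κE-def) , tt))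

      K : ℕ
      K = e₁ * E₀

      h*B : 100 * (n * B) ≤ suc h′ * B
      h*B = (farkas (h′ ∷ B ∷ n ∷ []) ((con 1000 :* (x1 :* x2) :≤ x0) ∷ (con 1 :≤ x1) ∷ []) (con 100 :* (x2 :* x1)) ((con 1 :+ x0) :* x1) 9 (x1 ∷ con 1000 :* (x1 :* x2) ∷ []) (≤-reflexive (sym h-def) , B>0 , tt))

      K-small : 800 * (n * (B * K)) ≤ α
      K-small = (farkas (suc h′ ∷ B ∷ K ∷ n ∷ α ∷ []) ((con 8 :* (x1 :* (x0 :* x2)) :≤ x4) ∷ (con 100 :* (x3 :* x1) :≤ x0 :* x1) ∷ []) (con 800 :* (x3 :* (x1 :* x2))) (x4) 0 (con 1 ∷ con 8 :* x2 ∷ []) (E-small′ , h*B , tt))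

      ζ-small″ : 400 * (n * (B * ζ)) ≤ α
      ζ-small″ = (farkas (suc h′ ∷ B ∷ ζ ∷ n ∷ α ∷ []) ((con 4 :* (x0 :* (x1 :* x2)) :≤ x4) ∷ (con 100 :* (x3 :* x1) :≤ x0 :* x1) ∷ []) (con 400 :* (x3 :* (x1 :* x2))) (x4) 0 (con 1 ∷ con 4 :* x2 ∷ []) (ζ-small′ , h*B , tt))

      K-n : 800 * (n * K) ≤ α
      K-n = (farkas (B ∷ K ∷ n ∷ α ∷ []) ((con 800 :* (x2 :* (x0 :* x1)) :≤ x3) ∷ (con 1 :≤ x0) ∷ []) (con 800 :* (x2 :* x1)) (x3) 0 (con 1 ∷ con 800 :* (x2 :* x1) ∷ []) (K-small , B>0 , tt))

      ζ-n : 400 * (n * ζ) ≤ α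
      ζ-n = (farkas (B ∷ ζ ∷ n ∷ α ∷ []) ((con 400 :* (x2 :* (x0 :* x1)) :≤ x3) ∷ (con 1 :≤ x0) ∷ []) (con 400 :* (x2 :* x1)) (x3) 0 (con 1 ∷ con 400 :* (x2 :* x1) ∷ []) (ζ-small″ , B>0 , tt))

      D≤3 : # D ≤ 3 * α
      D≤3 = (farkas (# D ∷ ζ ∷ n ∷ α ∷ []) ((x0 :≤ con 2 :* x3 :+ x1) ∷ (con 400 :* (x2 :* x1) :≤ x3) ∷ (con 2 :≤ x2) ∷ []) (x0) (con 3 :* x3) 799 (con 800 ∷ con 1 ∷ con 400 :* x1 ∷ []) (D-size , ζ-n , n≥2 , tt))

      to-coset : ∀ {S₁ D₁ B₁ h₁ K₁′} (P : Periodic S₁ D₁ α B₁ h₁ K₁′) q → n * # (Periodic.W P) ≤ (2 * n + 1) * α →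
                 (k + 1) * α ≤ n * # (λ x → Periodic.W P x ∧ S (x ⊕ q)) → 2 * B₁ ≤ κC → DenseCoset S α
      to-coset {B₁ = B₁} P q W-small S-big κ-big =
        let u₀ , dense = dense-coset S W H k α q H-group W-inv W>0 (≤-trans W-small (≤-reflexive (cong (_* α) ((ring-≡ (k ∷ []) (con 2 :* (x0 :+ con 2) :+ con 1) (con 2 :* x0 :+ con 5)))))) S-big in record
        { H = H ; H-group = H-group ; corner = u₀ ⊕ q ; dense = dense
        ; large = ≤-trans H-size (≤-trans (≤-reflexive (sym (*-assoc 2 B₁ (# H)))) (*-monoˡ-≤ (# H) κ-big)) }
        where
        open Periodic P
        meets : 0 < # (λ x → W x ∧ S (x ⊕ q))
        meets = n≢0⇒n>0 λ z → <⇒≱ S>0 (≤-trans ((farkas (k ∷ α ∷ []) ([]) (x1) ((x0 :+ con 1) :* x1) 0 ([]) (tt))) (≤-trans S-big (≤-reflexive (trans (cong (n *_) z) (*-zeroʳ n)))))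
        W>0 : 0 < # W
        W>0 = ≤-trans meets (#-mono (λ x → ∧-elimˡ))

      periodic₁ : Periodic S D α B h′ K → DenseCoset S α
      periodic₁ P = to-coset P 𝟘 W-small
        ((farkas (k ∷ α ∷ # (λ x → S x ∧ not (W x)) ∷ # (λ x → W x ∧ S (x ⊕ 𝟘)) ∷ []) ((x1 :≤ x3 :+ x2) ∷ (con 50 :* ((x0 :+ con 2) :* x2) :≤ x1) ∷ []) ((x0 :+ con 1) :* x1) ((x0 :+ con 2) :* x3) 49 (con 50 :* x0 :+ con 100 ∷ con 1 ∷ []) (≤-reflexive split , stray , tt)))
        ((farkas (κC ∷ B ∷ 2 * B₂ + suc h′ * B * (2 * β * (128 * w)) ∷ []) ((con 2 :* x1 :+ x2 :≤ x0) ∷ []) (con 2 :* x1) (x0) 0 (con 1 ∷ []) (≤-reflexive (sym κC-def) , tt)))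
        where
        open Periodic P
        open PeriodicEnd S D α B h′ K n P B>0 n>0 h-def
          ((farkas (# D ∷ K ∷ ζ ∷ n ∷ α ∷ []) ((x0 :≤ con 2 :* x4 :+ x2) ∷ (con 400 :* (x3 :* x2) :≤ x4) ∷ (con 800 :* (x3 :* x1) :≤ x4) ∷ []) (con 2 :* (x3 :* (x0 :+ x1))) ((con 4 :* x3 :+ con 1) :* x4) 399 (con 800 :* x3 ∷ con 2 ∷ con 1 ∷ []) (D-size , ζ-n , K-n , tt)))
        split : α ≡ # (λ x → W x ∧ S (x ⊕ 𝟘)) + # (λ s → S s ∧ not (W s))
        split = trans (#-split S W) (cong (_+ # (λ s → S s ∧ not (W s))) (#-cong (λ x → trans (∧-comm (S x) (W x)) (cong (λ y → W x ∧ S y) (sym (idʳ x))))))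
          where open import Data.Bool.Properties using (∧-comm)

      -- The differences of Z are almost periods of X.  They contain a box, and the
      -- chain is run again on the set S₂ of points whose box meets S densely.
      module Split₁ (P : Split S D α B h′ K) where
        open Split P

        z : ℕ
        z = # Z

        z>0 : 0 < z
        z>0 = n≢0⇒n>0 λ e → n≮0 (subst (α <_) (trans (cong (suc h′ *_) (trans (cong (B *_) e) (*-zeroʳ B))) (*-zeroʳ (suc h′))) large)

        z₀ : Carrier
        z₀ = proj₁ (#-witness Z z>0)

        Zz₀ : Z z₀ ≡ true
        Zz₀ = proj₂ (#-witness Z z>0)

        ζ<z : 4 * ζ < z
        ζ<z = *-cancelˡ-< (suc h′ * B) (4 * ζ) z ((farkas (suc h′ ∷ B ∷ ζ ∷ α ∷ z ∷ []) ((con 4 :* (x0 :* (x1 :* x2)) :≤ x3) ∷ (con 1 :+ x3 :≤ x0 :* (x1 :* x4)) ∷ []) (con 1 :+ x0 :* x1 :* (con 4 :* x2)) (x0 :* x1 :* x4) 0 (con 1 ∷ con 1 ∷ []) (ζ-small′ , large , tt)))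

        K<z : 8 * K < z
        K<z = *-cancelˡ-< (suc h′ * B) (8 * K) z ((farkas (suc h′ ∷ B ∷ K ∷ α ∷ z ∷ []) ((con 8 :* (x1 :* (x0 :* x2)) :≤ x3) ∷ (con 1 :+ x3 :≤ x0 :* (x1 :* x4)) ∷ []) (con 1 :+ x0 :* x1 :* (con 8 :* x2)) (x0 :* x1 :* x4) 0 (con 1 ∷ con 1 ∷ []) (E-small′ , large , tt)))

        ν-Z : ∀ z₁ z₂ → Z z₁ ≡ true → Z z₂ ≡ true → ν X (z₁ ⊝ z₂) ≤ 2 * z
        ν-Z z₁ z₂ p₁ p₂ = (farkas (ν X (z₁ ⊝ z₂) ∷ # X ∷ # D ∷ K ∷ ζ ∷ z ∷ α ∷ []) ((x0 :+ x1 :≤ x2 :+ (x3 :+ x3)) ∷ (x2 :≤ con 2 :* x6 :+ x4) ∷ (con 2 :* x6 :≤ x1 :+ x5) ∷ (con 1 :+ con 4 :* x4 :≤ x5) ∷ (con 1 :+ con 8 :* x3 :≤ x5) ∷ []) (x0) (con 2 :* x5) 3 (con 4 ∷ con 4 ∷ con 4 ∷ con 1 ∷ con 1 ∷ []) (ν-rows X D K z₁ z₂ (rowZ z₁ p₁) (rowZ z₂ p₂) , D-size , ≤-reflexive (sym size-sum) , ζ<z , K<z , tt))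

        lots : z ≤ # (λ t → ν X t ≤ᵇ 2 * z)
        lots = #-subst (⊖ z₀) (λ y p → ≤ᵇ-intro (ν-Z y z₀ p Zz₀))

        α≤X : α ≤ # X
        α≤X = #-mono S⊆X

        X≤2α : # X ≤ 2 * α
        X≤2α = ≤-trans (m≤m+n (# X) z) (≤-reflexive size-sum)

        near : NearProgression X z (suc lam′) (2 * β)
        near = NearPeriods.progression X (≤-trans S>0 α≤X) z lam′ I z>0 lots I-big
          (≤-trans ((farkas (Γ ∷ n ∷ suc lam′ ∷ []) ((con 16 :* x0 :≤ x2) ∷ (con 32 :* x1 :≤ x0) ∷ (con 1 :≤ x1) ∷ []) (con 2) (x2) 255 (con 1 ∷ con 16 ∷ con 512 ∷ []) (lam-big′ , Γ-big , n>0 , tt))) ≤-refl)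
          (≤-trans ((farkas (suc lam′ ∷ z ∷ K₁ ∷ suc R′ ^ I ∷ Q ∷ B ∷ n ∷ Γ ∷ α ∷ []) ((x5 :* x1 :≤ x8) ∷ (con 4 :* x7 :* x4 :≤ x5) ∷ (con 32 :* x6 :≤ x7) ∷ (con 1 :≤ x6) ∷ (x0 :* (con 4 :* (x2 :* x3)) :≤ x4) ∷ []) (x0 :* (con 2 :* x1) :* (con 2 :* x2 :* x3)) (x8) 127 (con 1 ∷ x1 ∷ con 4 :* (x1 :* x4) ∷ con 128 :* (x1 :* x4) ∷ con 128 :* x1 ∷ []) (small , ≤-reflexive (sym B-def) , Γ-big , n>0 , ≤-reflexive (sym Q-def′) , tt))) α≤X)
          where
          lam-big′ : 16 * Γ ≤ suc lam′
          lam-big′ = subst (16 * Γ ≤_) lam-def lam-big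
          Q-def′ : Q ≡ suc lam′ * (4 * (K₁ * suc R′ ^ I))
          Q-def′ = trans Q-def (cong (_* (4 * (K₁ * suc R′ ^ I))) lam-def)

        open NearProgression near public

        abstract
          box : Box H v (suc L′) R
          box = Lattice.box H H-group v L′ R R>0 v-free

        open Box box public using (a; b; l₁; l₂)

        cell : ℕ → ℕ → Carrier
        cell i j = zmul (+ i ℤ.* a ℤ.+ + j ℤ.* b)

        cell-+ : ∀ i j i′ j′ → cell i j ⊕ cell i′ j′ ≡ cell (i + i′) (j + j′)
        cell-+ i j i′ j′ = trans (sym (zmul-+ (+ i ℤ.* a ℤ.+ + j ℤ.* b) (+ i′ ℤ.* a ℤ.+ + j′ ℤ.* b))) (cong zmul (rearrange a b (+ i) (+ j) (+ i′) (+ j′)))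
          where
          rearrange : ∀ a b i j i′ j′ → (i ℤ.* a ℤ.+ j ℤ.* b) ℤ.+ (i′ ℤ.* a ℤ.+ j′ ℤ.* b) ≡ (i ℤ.+ i′) ℤ.* a ℤ.+ (j ℤ.+ j′) ℤ.* b
          rearrange a b i j i′ j′ = trans (interchange (i ℤ.* a) (j ℤ.* b) (i′ ℤ.* a) (j′ ℤ.* b))
            (sym (cong₂ ℤ._+_ (ℤ.*-distribʳ-+ a i i′) (ℤ.*-distribʳ-+ b j j′)))
            where open import Algebra.Properties.CommutativeSemigroup ℤ.+-commutativeSemigroup using (interchange)

        open Cells cell cell-+ l₁ l₂

        lam≢0 : NonZero lam
        lam≢0 = subst NonZero (sym lam-def) _

        νm : ℕ
        νm = _/_ (4 * α) lam ⦃ lam≢0 ⦄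

        lam-νm : lam * νm ≤ 4 * α
        lam-νm = ≤-trans (≤-reflexive (*-comm lam νm)) (m/n*n≤m (4 * α) lam ⦃ lam≢0 ⦄)

        ν-cell : ∀ i j → i ≤ 2 * l₁ → j ≤ 2 * l₂ → ν X (cell i j) ≤ νm
        ν-cell i j i≤ j≤ = ≤-trans (≤-reflexive (sym (m*n/n≡m (ν X (cell i j)) lam ⦃ lam≢0 ⦄))) (/-monoˡ-≤ lam ⦃ lam≢0 ⦄ (≤-trans (≤-reflexive (*-comm (ν X (cell i j)) lam)) bound))
          where
          l : ℕ
          l = i * Box.la box + j * Box.lb box
          bound : lam * ν X (cell i j) ≤ 4 * α
          bound = (farkas (lam ∷ ν X (cell i j) ∷ ν X (cell i j ⊝ mul l v) ∷ ν X (mul l v) ∷ # X ∷ α ∷ []) ((x1 :≤ x2 :+ x3) ∷ (x0 :* x2 :≤ x4) ∷ (x0 :* x3 :≤ x4) ∷ (x4 :≤ con 2 :* x5) ∷ []) (x0 :* x1) (con 4 :* x5) 0 (x0 ∷ con 1 ∷ con 1 ∷ con 2 ∷ []) (subst (λ y → ν X y ≤ ν X (cell i j ⊝ mul l v) + ν X (mul l v)) ((group-≡ (cell i j ∷ mul l v ∷ []) (gv 0 ⊟ gv 1 ⊞ gv 1) (gv 0))) (ν-+ X (cell i j ⊝ mul l v) (mul l v)) , subst (λ c → c * ν X (cell i j ⊝ mul l v) ≤ # X) (sym lam-def) (H-near _ (Box.near box i j)) , subst (λ c → c * ν X (mul l v) ≤ # X) (sym lam-def) (v-near l (s≤s⁻¹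 (Box.la-small box i j i≤ j≤))) , X≤2α , tt))

        νm-small : 4 * (Γ * νm) ≤ α
        νm-small = *-cancelˡ-≤ 4 ((farkas (lam ∷ Γ ∷ νm ∷ α ∷ []) ((x0 :* x2 :≤ con 4 :* x3) ∷ (con 16 :* x1 :≤ x0) ∷ []) (con 4 :* (con 4 :* (x1 :* x2))) (con 4 :* x3) 0 (con 1 ∷ x2 ∷ []) (lam-νm , lam-big , tt)))

        Y : Subset
        Y x = X (x ⊝ z₀)

        #Y : # Y ≡ # X
        #Y = #-shift (⊖ z₀) X

        D∖Y : # (λ d → D d ∧ not (Y d)) ≤ 2 * z
        D∖Y = (farkas (# D ∷ # (λ d → D d ∧ Y d) ∷ # (λ d → D d ∧ not (Y d)) ∷ # X ∷ K ∷ ζ ∷ z ∷ α ∷ []) ((x1 :+ x2 :≤ x0) ∷ (x3 :≤ x1 :+ x4) ∷ (x0 :≤ con 2 :* x7 :+ x5) ∷ (con 2 :* x7 :≤ x3 :+ x6) ∷ (con 1 :+ con 4 :* x5 :≤ x6) ∷ (con 1 :+ con 8 :* x4 :≤ x6) ∷ []) (x2) (con 2 :* x6) 7 (con 8 ∷ con 8 ∷ con 8 ∷ con 8 ∷ con 2 ∷ con 1 ∷ []) (≤-reflexive (sym (#-split D Y)) , meet , D-size , ≤-reflexive (sym size-sum) , ζ<z , K<z , tt))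
          where
          meet : # X ≤ # (λ d → D d ∧ Y d) + K
          meet = ≤-trans (#-cover {X} {λ x → D (x ⊕ z₀) ∧ Y (x ⊕ z₀)} {λ x → X x ∧ not (D (z₀ ⊕ x))}
              (λ x p q → ∧-not p (out-D x (trans (cong D (comm z₀ x)) refl) p q)))
            (+-mono-≤ (≤-reflexive (#-shift z₀ (λ d → D d ∧ Y d))) (rowZ z₀ Zz₀))
            where
            out-D : ∀ x {y} → y ≡ D (x ⊕ z₀) → X x ≡ true → D (x ⊕ z₀) ∧ Y (x ⊕ z₀) ≡ false → y ≡ false
            out-D x refl p q with bool (D (x ⊕ z₀))
            ... | inj₂ r = r
            ... | inj₁ r = true≢false (trans (cong X ((group-≡ (x ∷ z₀ ∷ []) (gv 0 ⊞ gv 1 ⊟ gv 1) (gv 0)))) p) (∧-false q r)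

        open Dense g S D

        z-small : 4 * (Γ * z) ≤ α
        z-small = (farkas (B ∷ Γ ∷ z ∷ Q ∷ α ∷ []) ((x0 :* x2 :≤ x4) ∷ (con 4 :* x1 :* x3 :≤ x0) ∷ (con 1 :≤ x3) ∷ []) (con 4 :* (x1 :* x2)) (x4) 0 (con 1 ∷ x2 ∷ con 4 :* (x1 :* x2) ∷ []) (small , ≤-reflexive (sym B-def) , Q>0 , tt))

        D₂-small : 32 * (n * # D₂) ≤ 64 * (n * α) + α
        D₂-small = (farkas (# D₂ ∷ # Y ∷ # X ∷ g ∷ n ∷ z ∷ α ∷ Γ ∷ νm ∷ []) ((x0 :≤ x1 :+ con 8 :* (x3 :* (con 2 :* x5 :+ x8))) ∷ (x1 :≤ x2) ∷ (x2 :≤ con 2 :* x6) ∷ (con 256 :* (x3 :* x4) :≤ x7) ∷ (con 4 :* (x7 :* x5) :≤ x6) ∷ (con 4 :* (x7 :* x8) :≤ x6) ∷ []) (con 32 :* (x4 :* x0)) (con 64 :* (x4 :* x6) :+ x6) 3 (con 128 :* x4 ∷ con 128 :* x4 ∷ con 128 :* x4 ∷ con 8 :* x5 :+ con 4 :* x8 ∷ con 2 ∷ con 1 ∷ []) (D₂-size Y (2 * z) νm D∖Y (λ i j i≤ j≤ → ≤-trans (≤-reflexive (ν-shift X z₀ (cell i j))) (ν-cell i j i≤ j≤)) , ≤-reflexive #Y , X≤2α , ≤-reflexive (sym Γ-def) , z-small , νm-small , tt))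

        T : ℕ
        T = Σ (λ x → ⟦ S₂ x ⟧ * c S x)

        dbl : ∀ {i l} → i ≤ l → i ≤ 2 * l
        dbl h = ≤-trans h (m≤m+n _ _)

        T-big : 8 * (n * (N * α)) ≤ 8 * (n * T) + N * α
        T-big = *-cancelˡ-≤ 4 ((farkas (g ∷ n ∷ N ∷ T ∷ α ∷ Γ ∷ # X ∷ νm ∷ []) ((x0 :* (x2 :* x4) :≤ x0 :* x3 :+ (x2 :* x6 :+ x0 :* (x2 :* x7))) ∷ (x0 :≤ con 32 :* x1) ∷ (con 32 :* x1 :≤ x0) ∷ (x6 :≤ con 2 :* x4) ∷ (con 4 :* (x5 :* x7) :≤ x4) ∷ (con 32 :* x1 :≤ x5) ∷ []) (con 4 :* (con 8 :* (x1 :* (x2 :* x4)))) (con 4 :* (con 8 :* (x1 :* x3) :+ x2 :* x4)) 3 (con 4 ∷ con 4 :* x3 :+ con 4 :* (x2 :* x7) ∷ con 4 :* (x2 :* x4) ∷ con 4 :* x2 ∷ x2 ∷ con 4 :* (x2 :* x7) ∷ []) (mass X νm S⊆X (λ i j i≤ j≤ → ν-cell i j (dbl i≤) (dbl j≤)) , ≤-reflexive g-def , ≤-reflexive (sym g-def) , X≤2α , νm-small , Γ-big , tt)))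

        c≤N : ∀ x → c S x ≤ N
        c≤N x = ≤-trans (∑²-mono (suc l₁) (suc l₂) (λ i j _ _ → ⟦⟧≤1 _)) (≤-reflexive (trans (∑²-const (suc l₁) (suc l₂) 1) (*-identityʳ N)))

        T≤ : ∀ (W : Subset) → Σ (λ x → ⟦ S₂ x ⟧ * c S x) ≤ Σ (λ x → ⟦ W x ⟧ * c S x) + N * # (λ x → S₂ x ∧ not (W x))
        T≤ W = ≤-trans (Σ-mono pointwise) (≤-reflexive (trans (Σ-+ _ _) (cong (λ y → Σ (λ x → ⟦ W x ⟧ * c S x) + y) (trans (Σ-*ˡ N _) (cong (N *_) (sym (#-Σ _)))))))
          where
          pointwise : ∀ x → ⟦ S₂ x ⟧ * c S x ≤ ⟦ W x ⟧ * c S x + N * ⟦ S₂ x ∧ not (W x) ⟧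
          pointwise x with S₂ x | W x
          ... | false | _     = z≤n
          ... | true  | true  = m≤m+n _ _
          ... | true  | false = ≤-trans (≤-reflexive (+-identityʳ _)) (≤-trans (c≤N x) (≤-reflexive (sym (*-identityʳ N))))

        S₂-big : α ≤ 2 * # S₂
        S₂-big = *-cancelˡ-≤ (8 * (n * N)) ⦃ >-nonZero (*-mono-≤ {1} {8} (s≤s z≤n) (*-mono-≤ n>0 N>0)) ⦄
          ((farkas (n ∷ N ∷ T ∷ α ∷ # S₂ ∷ []) ((con 8 :* (x0 :* (x1 :* x3)) :≤ con 8 :* (x0 :* x2) :+ x1 :* x3) ∷ (x2 :≤ x1 :* x4) ∷ (con 2 :≤ x0) ∷ []) (con 8 :* (x0 :* x1) :* x3) (con 8 :* (x0 :* x1) :* (con 2 :* x4)) 14 (con 16 ∷ con 128 :* x0 ∷ con 8 :* (x1 :* x3) ∷ []) (T-big , T≤N , n≥2 , tt)))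
          where
          N>0 : 0 < N
          N>0 = s≤s z≤n
          T≤N : T ≤ N * # S₂
          T≤N = ≤-trans (T≤ (λ _ → false)) (≤-reflexive (cong₂ _+_ Σ-zero (cong (N *_) (#-cong (λ x → ∧-identityʳ (S₂ x))))))
            where open import Data.Bool.Properties using (∧-identityʳ)

        E₂ : ℕ
        E₂ = 2 * (g * E₀)

        K₂ : ℕ
        K₂ = e₂ * E₂

        e₂>0 : 0 < e₂
        e₂>0 = subst (0 <_) e₂-def (n≢0⇒n>0 (λ e → ≢-nonZero⁻¹ (2 ^ fuel (suc h₂′) B₂) ⦃ m^n≢0 2 (fuel (suc h₂′) B₂) ⦄ e))

        E₂-small : 100 * (n * (B₂ * (suc h₂′ * K₂))) ≤ α
        E₂-small = E-small₂

        K₂-small : 100 * (n * K₂) ≤ α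
        K₂-small = (farkas (n ∷ K₂ ∷ h₂′ ∷ B₂ ∷ α ∷ []) ((con 100 :* (x0 :* (x3 :* ((con 1 :+ x2) :* x1))) :≤ x4) ∷ (con 1 :≤ x3) ∷ []) (con 100 :* (x0 :* x1)) (x4) 0 (con 1 ∷ con 100 :* (x0 :* x1) ∷ []) (E₂-small , B₂>0 , tt))

        E₂≤α : 100 * (n * E₂) ≤ α
        E₂≤α = (farkas (n ∷ K₂ ∷ E₂ ∷ e₂ ∷ α ∷ []) ((con 100 :* (x0 :* (x3 :* x2)) :≤ x4) ∷ (con 1 :≤ x3) ∷ []) (con 100 :* (x0 :* x2)) (x4) 0 (con 1 ∷ con 100 :* (x0 :* x2) ∷ []) (K₂-small , e₂>0 , tt))

        rows₂′ : ∀ x → S₂ x ≡ true → out x S₂ D₂ ≤ E₂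
        rows₂′ = rows₂ E₀ rows

        D₂≤3 : # D₂ ≤ 3 * α
        D₂≤3 = *-cancelˡ-≤ (32 * n) ⦃ >-nonZero (*-mono-≤ {1} {32} (s≤s z≤n) n>0) ⦄ ((farkas (n ∷ α ∷ # D₂ ∷ []) ((con 32 :* (x0 :* x2) :≤ con 64 :* (x0 :* x1) :+ x1) ∷ (con 2 :≤ x0) ∷ []) (con 32 :* x0 :* x2) (con 32 :* x0 :* (con 3 :* x1)) 1 (con 2 ∷ x1 ∷ []) (D₂-small , n≥2 , tt)))

        S₂>0 : 0 < # S₂
        S₂>0 = n≢0⇒n>0 λ e → <⇒≱ S>0 (≤-trans S₂-big (≤-reflexive (cong (2 *_) e)))

        S₂-small : # S₂ ≤ 3 * α
        S₂-small = *-cancelˡ-≤ (32 * n) ⦃ >-nonZero (*-mono-≤ {1} {32} (s≤s z≤n) n>0) ⦄ ((farkas (n ∷ α ∷ # D₂ ∷ # S₂ ∷ out y S₂ D₂ ∷ E₂ ∷ []) ((con 32 :* (x0 :* x2) :≤ con 64 :* (x0 :* x1) :+ x1) ∷ (x3 :≤ x2 :+ x4) ∷ (x4 :≤ x5) ∷ (con 100 :* (x0 :* x5) :≤ x1) ∷ (con 2 :≤ x0) ∷ []) (con 32 :* x0 :* x3) (con 32 :* x0 :* (con 3 :* x1)) 49 (con 50 ∷ con 1600 :* x0 ∷ con 1600 :* x0 ∷ con 16 ∷ con 33 :* x1 ∷ []) (D₂-small , out-bound y S₂ D₂ , rows₂′ y y∈ , E₂≤α , n≥2 , tt)))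
          where
          y : Carrier
          y = proj₁ (#-witness S₂ S₂>0)
          y∈ : S₂ y ≡ true
          y∈ = proj₂ (#-witness S₂ S₂>0)

        second : Split S₂ D₂ α B₂ h₂′ K₂ ⊎ Periodic S₂ D₂ α B₂ h₂′ K₂
        second = subst (λ t → Split S₂ D₂ α B₂ h₂′ (t * E₂) ⊎ Periodic S₂ D₂ α B₂ h₂′ (t * E₂)) e₂-def
          (dyson S₂ D₂ α B₂ h₂′ E₂ rows₂′ S>0 S₂-big S₂-small D₂≤3
            ((farkas (B₂ ∷ n ∷ α ∷ # S₂ ∷ []) ((con 32 :* x1 :≤ x0) ∷ (con 2 :≤ x1) ∷ (x2 :≤ con 2 :* x3) ∷ (con 1 :≤ x2) ∷ []) (con 1 :+ x2) (x0 :* x3) 15 (x3 ∷ con 32 :* x3 ∷ con 32 ∷ con 16 ∷ []) (≤-reflexive (sym B₂-def) , n≥2 , S₂-big , S>0 , tt)))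
            ((farkas (B₂ ∷ h₂′ ∷ n ∷ []) ((con 1000 :* (x0 :* x2) :≤ x1) ∷ (con 2 :≤ x2) ∷ []) (con 144 :* x0) (con 1 :+ x1) 124 (con 9 ∷ con 9000 :* x0 ∷ []) (≤-reflexive (sym h₂-def) , n≥2 , tt)))
            (subst (λ t → 8 * (B₂ * (suc h₂′ * (t * E₂))) ≤ α) (sym e₂-def)
              ((farkas (n ∷ α ∷ B₂ * (suc h₂′ * K₂) ∷ []) ((con 100 :* (x0 :* x2) :≤ x1) ∷ (con 1 :≤ x0) ∷ []) (con 8 :* x2) (x1) 24 (con 2 ∷ con 200 :* x2 ∷ []) (E₂-small , n>0 , tt)))))

        periodic₂ : Periodic S₂ D₂ α B₂ h₂′ K₂ → DenseCoset S α
        periodic₂ P = let i , j , _ , _ , lt = found in to-coset P (cell i j) W-small (≤-trans (≤-pred lt) (≤-reflexive refl))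
            ((farkas (κC ∷ B₂ ∷ 2 * B ∷ suc h′ * B * (2 * β * (128 * w)) ∷ []) ((x2 :+ (con 2 :* x1 :+ x3) :≤ x0) ∷ []) (con 2 :* x1) (x0) 0 (con 1 ∷ []) (≤-reflexive (sym κC-def) , tt)))
          where
          open Periodic P
          open PeriodicEnd S₂ D₂ α B₂ h₂′ K₂ n P B₂>0 n>0 h₂-def
            ((farkas (# D₂ ∷ K₂ ∷ n ∷ α ∷ []) ((con 32 :* (x2 :* x0) :≤ con 64 :* (x2 :* x3) :+ x3) ∷ (con 100 :* (x2 :* x1) :≤ x3) ∷ []) (con 2 :* (x2 :* (x0 :+ x1))) ((con 4 :* x2 :+ con 1) :* x3) 399 (con 25 ∷ con 8 ∷ []) (D₂-small , K₂-small , tt)))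
          m : ℕ → ℕ → ℕ
          m i j = # (λ x → W x ∧ S (x ⊕ cell i j))
          sum : Σ (λ x → ⟦ W x ⟧ * c S x) ≡ ∑² (suc l₁) (suc l₂) m
          sum = trans (Σ-cong (λ x → trans (sym (∑²-*ˡ (suc l₁) (suc l₂) ⟦ W x ⟧ _)) (∑²-cong (suc l₁) (suc l₂) (λ i j _ _ → sym (⟦∧⟧ (W x) _)))))
            (trans (Σ-∑²-swap (suc l₁) (suc l₂) _) (∑²-cong (suc l₁) (suc l₂) (λ i j _ _ → sym (#-Σ _))))
          found : ∃[ i ] ∃[ j ] i < suc l₁ × j < suc l₂ × (k + 1) * α < suc (n * m i j)
          found = ∑²-< (suc l₁) (suc l₂) (subst₂ _<_ (sym (∑²-const (suc l₁) (suc l₂) ((k + 1) * α)))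
            (sym (trans (∑²-cong (suc l₁) (suc l₂) (λ i j _ _ → +-comm 1 (n * m i j))) (trans (∑²-+ (suc l₁) (suc l₂) _ _) (cong₂ _+_ (trans (∑²-*ˡ (suc l₁) (suc l₂) n m) (cong (n *_) (sym sum))) (trans (∑²-const (suc l₁) (suc l₂) 1) (*-identityʳ N))))))
            (*-cancelˡ-< 8 (N * ((k + 1) * α)) (n * Σ (λ x → ⟦ W x ⟧ * c S x) + N)
              ((farkas (k ∷ N ∷ T ∷ α ∷ Σ (λ x → ⟦ W x ⟧ * c S x) ∷ # (λ x → S₂ x ∧ not (W x)) ∷ []) ((con 8 :* ((x0 :+ con 2) :* (x1 :* x3)) :≤ con 8 :* ((x0 :+ con 2) :* x2) :+ x1 :* x3) ∷ (x2 :≤ x4 :+ x1 :* x5) ∷ (con 50 :* ((x0 :+ con 2) :* x5) :≤ x3) ∷ (con 1 :≤ x1) ∷ []) (con 1 :+ con 8 :* (x1 :* ((x0 :+ con 1) :* x3))) (con 8 :* ((x0 :+ con 2) :* x4 :+ x1)) 0 (con 1 ∷ con 8 :* (x0 :+ con 2) ∷ con 7 :* x1 ∷ con 1 ∷ []) (T-big , T≤ W , stray , s≤s {0} z≤n , tt)))))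

        module _ (P₂ : Split S₂ D₂ α B₂ h₂′ K₂) where
          private module P₂ = Split P₂

          S° : Subset
          S° x = S x ∧ not (Edge x)

          z₂>0 : 0 < # P₂.Z
          z₂>0 = n≢0⇒n>0 λ e → n≮0 (subst (α <_) (trans (cong (suc h₂′ *_) (trans (cong (B₂ *_) e) (*-zeroʳ B₂))) (*-zeroʳ (suc h₂′))) P₂.large)

          S₂-tight : 64 * (n * # S₂) ≤ 64 * (n * α) + 3 * α
          S₂-tight = (farkas (n ∷ α ∷ # S₂ ∷ # P₂.X ∷ # P₂.Z ∷ # D₂ ∷ out z₂ P₂.X D₂ ∷ K₂ ∷ B₂ ∷ []) ((con 2 :* x2 :≤ x3 :+ x4) ∷ (x3 :≤ x5 :+ x6) ∷ (x6 :≤ x7) ∷ (con 100 :* (x0 :* x7) :≤ x1) ∷ (x8 :* x4 :≤ x1) ∷ (con 32 :* x0 :≤ x8) ∷ (con 32 :* (x0 :* x5) :≤ con 64 :* (x0 :* x1) :+ x1) ∷ []) (con 64 :* (x0 :* x2)) (con 64 :* (x0 :* x1) :+ con 3 :* x1) 24 (con 25 :* (con 32 :* x0) ∷ con 25 :* (con 32 :* x0) ∷ con 25 :* (con 32 :* x0) ∷ con 8 ∷ con 25 ∷ con 25 :* x4 ∷ con 25 ∷ []) (≤-reflexive (sym P₂.size-sum) , out-bound z₂ P₂.X D₂ , P₂.rowZ z₂ z₂∈ , K₂-small , P₂.small , ≤-reflexive (sym B₂-def) , D₂-small , tt))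
            where
            z₂ : Carrier
            z₂ = proj₁ (#-witness P₂.Z z₂>0)
            z₂∈ : P₂.Z z₂ ≡ true
            z₂∈ = proj₂ (#-witness P₂.Z z₂>0)

          T° : ℕ
          T° = Σ (λ x → ⟦ S₂ x ⟧ * c S° x)

          T≤T° : T ≤ T° + N * # (λ x → S x ∧ Edge x)
          T≤T° = ≤-trans (Σ-mono pointwise) (≤-reflexive (trans (Σ-+ _ _) (cong (λ y → T° + y) (Σ-c (λ x → S x ∧ Edge x)))))
            where
            split : ∀ x → c S x ≤ c S° x + c (λ x → S x ∧ Edge x) x
            split x = ≤-trans (∑²-mono (suc l₁) (suc l₂) (λ i j _ _ → ⟦⟧-cover (S (x ⊕ cell i j)) (S° (x ⊕ cell i j)) (S (x ⊕ cell i j) ∧ Edge (x ⊕ cell i j))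
                (λ p q → ∧-intro p (not-false (∧-false q p))))) (≤-reflexive (∑²-+ (suc l₁) (suc l₂) _ _))
            pointwise : ∀ x → ⟦ S₂ x ⟧ * c S x ≤ ⟦ S₂ x ⟧ * c S° x + c (λ x → S x ∧ Edge x) x
            pointwise x with S₂ x
            ... | false = z≤n
            ... | true  = ≤-trans (≤-reflexive (+-identityʳ _)) (≤-trans (split x) (+-monoˡ-≤ (c (λ x → S x ∧ Edge x) x) (≤-reflexive (sym (+-identityʳ (c S° x))))))

          corner : ∃[ x ] S₂ x ≡ true × T° ≤ # S₂ * c S° x
          corner = average≥ S₂ (c S°) S₂>0

          c°≤N : ∀ x → c S° x ≤ N
          c°≤N x = ≤-trans (∑²-mono (suc l₁) (suc l₂) (λ i j _ _ → ⟦⟧≤1 _)) (≤-reflexive (trans (∑²-const (suc l₁) (suc l₂) 1) (*-identityʳ N)))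

          dense : n * N ≤ n * c S° (proj₁ corner) + N
          dense = *-cancelˡ-≤ (64 * α) ⦃ >-nonZero (*-mono-≤ {1} {64} (s≤s z≤n) S>0) ⦄
            ((farkas (n ∷ N ∷ T ∷ α ∷ T° ∷ # (λ x → S x ∧ Edge x) ∷ # S₂ ∷ c S° (proj₁ corner) ∷ []) ((con 8 :* (x0 :* (x1 :* x3)) :≤ con 8 :* (x0 :* x2) :+ x1 :* x3) ∷ (x2 :≤ x4 :+ x1 :* x5) ∷ (con 8 :* (x0 :* x5) :≤ x3) ∷ (x4 :≤ x6 :* x7) ∷ (con 64 :* (x0 :* x6) :≤ con 64 :* (x0 :* x3) :+ con 3 :* x3) ∷ (x7 :≤ x1) ∷ []) (con 64 :* x3 :* (x0 :* x1)) (con 64 :* x3 :* (x0 :* x7 :+ x1)) 0 (con 8 ∷ con 64 :* x0 ∷ con 8 :* x1 ∷ con 64 :* x0 ∷ x7 ∷ con 3 :* x3 ∷ []) (T-big , T≤T° , edge , proj₂ (proj₂ corner) , S₂-tight , c°≤N (proj₁ corner) , tt)))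

          box-size : α ≤ κC * N
          box-size = *-cancelˡ-≤ R ⦃ >-nonZero R>0 ⦄ ((farkas (α ∷ N ∷ R ∷ w ∷ x ∷ κC ∷ suc h′ ∷ B ∷ z ∷ β ∷ suc L′ ∷ # H ∷ size ∷ 2 * B + 2 * B₂ ∷ []) ((x0 :≤ x6 :* (x7 :* x8)) ∷ (x8 :≤ con 2 :* x9 :* (var 10 :* var 11)) ∷ (x2 :* var 10 :≤ con 128 :* (x4 :* x1)) ∷ (var 11 :* x4 :≤ var 12) ∷ (var 12 :≤ x3 :* x2) ∷ (var 13 :+ x6 :* x7 :* (con 2 :* x9 :* (con 128 :* x3)) :≤ x5) ∷ []) (x2 :* x0) (x2 :* (x5 :* x1)) 0 (x2 ∷ x6 :* x7 :* x2 ∷ con 2 :* x6 :* x7 :* x9 :* var 11 ∷ con 256 :* x6 :* x7 :* x9 :* x1 ∷ con 256 :* x6 :* x7 :* x9 :* x1 ∷ x2 :* x1 ∷ []) (<⇒≤ large , big , Box.large box x size-xH , ≤-reflexive (sym size-xH) , R-big , ≤-reflexive (sym κ-def) , tt)))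
            where
            open Multiples H H-group using (q; size-kq; #H)
            x : ℕ
            x = q
            size-xH : size ≡ # H * x
            size-xH = trans size-kq (cong (_* q) (sym #H))
            κ-def : κC ≡ 2 * B + 2 * B₂ + suc h′ * B * (2 * β * (128 * w))
            κ-def = trans κC-def (sym (+-assoc (2 * B) (2 * B₂) _))

          dense-box : DenseBox S° α R
          dense-box = record { a = a ; b = b ; l₁ = l₁ ; l₂ = l₂ ; corner = proj₁ corner
            ; small = λ i j i≤ j≤ → Box.small box i j (dbl i≤) (dbl j≤) ; proper = Box.proper box ; dense = dense ; large = box-size }

        outcome : DenseCoset S α ⊎ DenseBox (λ x → S x ∧ not (Edge x)) α R
        outcome = [ (λ P → inj₂ (dense-box P)) , (λ P → inj₁ (periodic₂ P)) ]′ second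

      abstract
        outcome : DenseCoset S α ⊎ DenseBox (λ x → S x ∧ not (Edge x)) α R
        outcome = [ Split₁.outcome , (λ P → inj₁ (periodic₁ P)) ]′
          (subst (λ t → Split S D α B h′ (t * E₀) ⊎ Periodic S D α B h′ (t * E₀)) e₁-def
            (dyson S D α B h′ E₀ rows S>0 (m≤m+n α _) (m≤m+n α _) D≤3 α<B*α
              ((farkas (B ∷ h′ ∷ n ∷ []) ((con 1000 :* (x0 :* x2) :≤ x1) ∷ (con 2 :≤ x2) ∷ []) (con 144 :* x0) (con 1 :+ x1) 124 (con 9 ∷ con 9000 :* x0 ∷ []) (≤-reflexive (sym h-def) , n≥2 , tt)))
              (subst (λ t → 8 * (B * (suc h′ * (t * E₀))) ≤ α) (sym e₁-def) E-small′)))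
          where
          α<B*α : α < B * α
          α<B*α = (farkas (B ∷ Γ ∷ n ∷ Q ∷ α ∷ []) ((con 4 :* x1 :* x3 :≤ x0) ∷ (con 1 :≤ x3) ∷ (con 32 :* x2 :≤ x1) ∷ (con 1 :≤ x2) ∷ (con 1 :≤ x4) ∷ []) (con 1 :+ x4) (x0 :* x4) 63 (x4 ∷ con 4 :* x1 :* x4 ∷ con 4 :* x4 ∷ con 128 :* x4 ∷ con 64 ∷ []) (≤-reflexive (sym B-def) , Q>0 , Γ-big , n>0 , S>0 , tt))

module ZMod where

  open Grp
  open Iter using (mul)
  open import Data.Fin.Base using (Fin; toℕ; fromℕ<)
  open import Data.Fin.Properties using (toℕ-injective; toℕ<n; toℕ-fromℕ<)
  open import Data.Nat.Base
  open import Data.Nat.DivMod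
  open import Data.Nat.Properties

  module _ (m′ : ℕ) where
    private
      m : ℕ
      m = suc m′

      res : ℕ → Fin m
      res i = fromℕ< (m%n<n i m)

      toℕ-res : ∀ i → toℕ (res i) ≡ i % m
      toℕ-res i = toℕ-fromℕ< (m%n<n i m)

      res-cong : ∀ i j → i % m ≡ j % m → res i ≡ res j
      res-cong i j h = toℕ-injective (trans (toℕ-res i) (trans h (sym (toℕ-res j))))

      res-toℕ : ∀ x → res (toℕ x) ≡ x
      res-toℕ x = toℕ-injective (trans (toℕ-res (toℕ x)) (m<n⇒m%n≡m (toℕ<n x)))

      res-+ˡ : ∀ i j → res (toℕ (res i) + j) ≡ res (i + j)
      res-+ˡ i j = res-cong (toℕ (res i) + j) (i + j) (trans (cong (λ k → (k + j) % m) (toℕ-res i)) (%-remove-mod i j))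
        where
        %-remove-mod : ∀ i j → (i % m + j) % m ≡ (i + j) % m
        %-remove-mod i j = trans (%-distribˡ-+ (i % m) j m) (trans (cong (λ k → (k + j % m) % m) (m%n%n≡m%n i m)) (sym (%-distribˡ-+ i j m)))

      res-+ʳ : ∀ i j → res (i + toℕ (res j)) ≡ res (i + j)
      res-+ʳ i j = trans (cong res (+-comm i _)) (trans (res-+ˡ j i) (cong res (+-comm j i)))

    ℤ/ : FinAb
    ℤ/ = record
      { Carrier = Fin m
      ; _⊕_     = λ x y → res (toℕ x + toℕ y)
      ; ⊖_      = λ x → res (m ∸ toℕ x)
      ; 𝟘       = res 0
      ; assoc   = λ x y z → trans (res-+ˡ (toℕ x + toℕ y) (toℕ z)) (trans (cong res (+-assoc (toℕ x) (toℕ y) (toℕ z))) (sym (res-+ʳ (toℕ x) (toℕ y + toℕ z))))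
      ; comm    = λ x y → cong res (+-comm (toℕ x) (toℕ y))
      ; idˡ     = λ x → trans (res-+ˡ 0 (toℕ x)) (res-toℕ x)
      ; invˡ    = λ x → trans (res-+ˡ (m ∸ toℕ x) (toℕ x)) (res-cong (m ∸ toℕ x + toℕ x) 0 (trans (cong (_% m) (m∸n+n≡m (<⇒≤ (toℕ<n x)))) (n%n≡0 m)))
      ; size    = m
      ; enum    = res
      ; index   = toℕ
      ; index<  = toℕ<n
      ; enum-index = res-toℕ
      ; index-enum = λ i i<m → trans (toℕ-res i) (m<n⇒m%n≡m i<m)
      }

    open FinAb ℤ/

    enum-+ : ∀ i j → enum i ⊕ enum j ≡ enum (i + j)
    enum-+ i j = trans (res-+ˡ i _) (res-+ʳ i j)

    index-% : ∀ i → index (enum i) ≡ i % m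
    index-% = toℕ-res

    enum-mul : ∀ n → enum n ≡ mul ℤ/ n (enum 1)
    enum-mul zero    = refl
    enum-mul (suc n) = trans (cong enum (+-comm 1 n)) (trans (sym (enum-+ n 1)) (cong (_⊕ enum 1) (enum-mul n)))

    period : mul ℤ/ m (enum 1) ≡ 𝟘
    period = trans (sym (enum-mul m)) (res-cong m 0 (n%n≡0 m))

module Bounds where

  open import Data.Nat.Base
  open import Data.Nat.Properties

  -- The parameters k and c after t levels of saturation, and the maximum of f over them.
  module Levelwise (Pr Γ : ℕ → ℕ → ℕ) where
    k⁺ c⁺ : ℕ → ℕ → ℕ
    k⁺ k c = k + 6 * Γ k c
    c⁺ k c = c * Pr k c ^ (6 * Γ k c)

    k-max : ℕ → ℕ → ℕ → ℕ
    k-max zero    k c = k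
    k-max (suc t) k c = k-max t (k⁺ k c) (c⁺ k c)

    f-max : (ℕ → ℕ → ℕ) → ℕ → ℕ → ℕ → ℕ
    f-max f zero    k c = 0
    f-max f (suc t) k c = f k c ⊔ f-max f t (k⁺ k c) (c⁺ k c)

    k≤k-max : ∀ t k c → k ≤ k-max t k c
    k≤k-max zero    k c = ≤-refl
    k≤k-max (suc t) k c = ≤-trans (m≤m+n k _) (k≤k-max t (k⁺ k c) (c⁺ k c))

-- Almost periods of a sumset

module Levels (G : FinAb) where

  open Sum
  open Grp
  open Conv G
  open Chain G
  open import Data.Nat.DivMod
  open Bounds using (module Levelwise)

  module Setup (A D : Subset) (E₀ : ℕ) (A>0 : 0 < # A) (rows : ∀ a → A a ≡ true → out a A D ≤ E₀)
    (D-small : # D ≤ 5 * # A) (E-small : 4 * E₀ ≤ # A) where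

    N : ℕ
    N = # A

    Sums : Carrier → Set
    Sums u = ∃[ a ] ∃[ a′ ] A a ≡ true × A a′ ≡ true × u ≡ a ⊕ a′

    -- X is A + F and Y is the set of y with y + F ⊆ A, for a set F ∋ 0 of at most
    -- k elements.
    record State (k c : ℕ) : Set where
      field
        X Y    : Subset
        Y⊆A    : ∀ y → Y y ≡ true → A y ≡ true
        Y-size : N ≤ c * # Y
        X>0    : 0 < # X
        sums   : ∀ y x → Y y ≡ true → X x ≡ true → Sums (y ⊕ x)
        absorb : ∀ (Bad W : Subset) ρ → (∀ a → A a ≡ true → Bad a ≡ false → out a A W ≤ ρ) →
                 # (λ y → Y y ∧ (suc (k * ρ) ≤ᵇ out y X W)) ≤ k * # Bad

      Y>0 : 0 < # Y
      Y>0 = n≢0⇒n>0 λ e → <⇒≱ A>0 (≤-trans Y-size (≤-reflexive (trans (cong (c *_) e) (*-zeroʳ c))))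

      rowsY : ∀ y → Y y ≡ true → out y X D ≤ k * E₀
      rowsY y p = ≮⇒≥ λ lt → <⇒≱ (#>0 _ y (∧-intro p (≤ᵇ-intro lt)))
        (≤-trans (absorb (λ _ → false) D E₀ (λ a p _ → rows a p)) (≤-reflexive (trans (cong (k *_) (trans (#-Σ _) Σ-zero)) (*-zeroʳ k))))

      X-small : # X ≤ # D + k * E₀
      X-small = let y , p = #-witness Y Y>0 in ≤-trans (out-bound y X D) (+-monoʳ-≤ (# D) (rowsY y p))

    weaken : ∀ {k k′ c c′} → k ≤ k′ → c ≤ c′ → State k c → State k′ c′
    weaken {k} k≤ c≤ S = record
      { X = X ; Y = Y ; Y⊆A = Y⊆A ; Y-size = ≤-trans Y-size (*-monoˡ-≤ (# Y) c≤) ; X>0 = X>0 ; sums = sums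
      ; absorb = λ Bad W ρ h → ≤-trans (#-mono (λ y p → ∧-intro {Y y} {suc (k * ρ) ≤ᵇ out y X W} (∧-elimˡ {Y y} p) (≤ᵇ-intro {suc (k * ρ)} (≤-trans (s≤s (*-monoˡ-≤ ρ k≤)) (≤ᵇ-true {_} {out y X W} (∧-elimʳ {Y y} p))))))
          (≤-trans (absorb Bad W ρ h) (*-monoˡ-≤ (# Bad) k≤)) }
      where open State S

    start : State 1 1
    start = record
      { X = A ; Y = A ; Y⊆A = λ _ p → p ; Y-size = ≤-reflexive (sym (+-identityʳ N)) ; X>0 = A>0
      ; sums = λ y x p q → y , x , p , q , refl
      ; absorb = λ Bad W ρ h → ≤-trans (#-mono (λ y p → bad Bad W ρ h y (∧-elimˡ p) (≤ᵇ-true (∧-elimʳ {A y} p)))) (≤-reflexive (sym (+-identityʳ _))) }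
      where
      bad : ∀ (Bad W : Subset) ρ → (∀ a → A a ≡ true → Bad a ≡ false → out a A W ≤ ρ) → ∀ y → A y ≡ true → 1 * ρ < out y A W → Bad y ≡ true
      bad Bad W ρ h y p lt with bool (Bad y)
      ... | inj₁ q = q
      ... | inj₂ q = ⊥-elim (<⇒≱ lt (≤-trans (h y p q) (≤-reflexive (sym (+-identityʳ ρ)))))

    module Step {k c} (S : State k c) (e : Carrier) (P : ℕ) (popular : # (State.Y S) ≤ P * r (State.Y S) A e) where
      open State S

      X′ Y′ : Subset
      X′ x = X x ∨ A (x ⊝ e)
      Y′ y = Y y ∧ A (y ⊕ e)

      next : State (suc k) (c * P)
      next = record
        { X = X′ ; Y = Y′ ; Y⊆A = λ y p → Y⊆A y (∧-elimˡ p)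
        ; Y-size = (farkas (N ∷ c ∷ # Y ∷ # Y′ ∷ P ∷ []) ((x0 :≤ x1 :* x2) ∷ (x2 :≤ x4 :* x3) ∷ []) (x0) (x1 :* x4 :* x3) 0 (con 1 ∷ x1 ∷ []) (Y-size , popular , tt))
        ; X>0 = ≤-trans X>0 (#-mono (λ x p → ∨-introˡ (A (x ⊝ e)) p))
        ; sums = sums′ ; absorb = absorb′ }
        where
        sums′ : ∀ y x → Y′ y ≡ true → X′ x ≡ true → Sums (y ⊕ x)
        sums′ y x p q with ∨-elim {X x} q
        ... | inj₁ u = sums y x (∧-elimˡ p) u
        ... | inj₂ u = y ⊕ e , x ⊝ e , ∧-elimʳ {Y y} p , u , (group-≡ (y ∷ x ∷ e ∷ []) (gv 0 ⊞ gv 1) (gv 0 ⊞ gv 2 ⊞ (gv 1 ⊟ gv 2)))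
        out-X′ : ∀ y W → out y X′ W ≤ out y X W + out (y ⊕ e) A W
        out-X′ y W = ≤-trans (#-cover {Z = λ x → A (x ⊝ e) ∧ not (W (y ⊕ e ⊕ (x ⊝ e)))} split)
            (+-monoʳ-≤ (out y X W) (≤-reflexive (#-shift (⊖ e) (λ x → A x ∧ not (W (y ⊕ e ⊕ x))))))
          where
          split : ∀ x → X′ x ∧ not (W (y ⊕ x)) ≡ true → X x ∧ not (W (y ⊕ x)) ≡ false → A (x ⊝ e) ∧ not (W (y ⊕ e ⊕ (x ⊝ e))) ≡ true
          split x p q with ∨-elim {X x} (∧-elimˡ p)
          ... | inj₁ u = true≢false (∧-intro u (∧-elimʳ {X′ x} p)) q
          ... | inj₂ u = ∧-intro u (trans (cong (λ z → not (W z)) ((group-≡ (y ∷ x ∷ e ∷ []) (gv 0 ⊞ gv 2 ⊞ (gv 1 ⊟ gv 2)) (gv 0 ⊞ gv 1)))) (∧-elimʳ {X′ x} p))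
        absorb′ : ∀ (Bad W : Subset) ρ → (∀ a → A a ≡ true → Bad a ≡ false → out a A W ≤ ρ) →
                  # (λ y → Y′ y ∧ (suc (suc k * ρ) ≤ᵇ out y X′ W)) ≤ suc k * # Bad
        absorb′ Bad W ρ h = ≤-trans (#-cover {Z = λ y → Bad (y ⊕ e)} split)
            (≤-trans (+-mono-≤ (absorb Bad W ρ h) (≤-reflexive (#-shift e Bad))) (≤-reflexive (+-comm (k * # Bad) (# Bad))))
          where
          split : ∀ y → Y′ y ∧ (suc (suc k * ρ) ≤ᵇ out y X′ W) ≡ true → Y y ∧ (suc (k * ρ) ≤ᵇ out y X W) ≡ false → Bad (y ⊕ e) ≡ true
          split y p q with bool (Bad (y ⊕ e))
          ... | inj₁ b = b
          ... | inj₂ b = ⊥-elim (1+n≰n {0} ((farkas (k ∷ ρ ∷ out y X′ W ∷ out y X W ∷ out (y ⊕ e) A W ∷ []) ((con 1 :+ (con 1 :+ x0) :* x1 :≤ x2) ∷ (x2 :≤ x3 :+ x4) ∷ (x4 :≤ x1) ∷ (x3 :≤ x0 :* x1) ∷ []) (con 1) (con 0) 0 (con 1 ∷ con 1 ∷ con 1 ∷ con 1 ∷ []) (≤ᵇ-true (∧-elimʳ {Y′ y} p) , out-X′ y W , h (y ⊕ e) (∧-elimʳ {Y y} (∧-elimˡ p)) b , s≤s⁻¹ (≤ᵇ-false (∧-false q (∧-elimˡ (∧-elimˡ p)))) , tt))))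

    Saturated : ∀ {k c} → ℕ → ℕ → State k c → Set
    Saturated P Γ S = ∀ e → # Y ≤ P * r Y A e → Γ * # (λ x → A x ∧ not (X (x ⊕ e))) ≤ N
      where open State S

    saturate : ∀ P Γ → 0 < P → 0 < Γ → ∀ s {k c} (S : State k c) → (k + s) * E₀ ≤ N → 6 * (Γ * N) < Γ * # (State.X S) + s * N →
               ∃[ S′ ] Saturated {k + s} {c * P ^ s} P Γ S′
    saturate P Γ P>0 Γ>0 s {k} {c} S k-small grown
      with search (λ e → (# (State.Y S) ≤ᵇ P * r (State.Y S) A e) ∧ (suc N ≤ᵇ Γ * # (λ x → A x ∧ not (State.X S (x ⊕ e)))))
    ... | inj₂ none = weaken (m≤m+n k s) (m≤m*n c (P ^ s) ⦃ m^n≢0 P s ⦃ >-nonZero P>0 ⦄ ⦄) S , λ e p → ≮⇒≥ (λ q → true≢false (∧-intro (≤ᵇ-intro p) (≤ᵇ-intro q)) (none e))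
    saturate P Γ P>0 Γ>0 zero    {k} {c} S k-small grown | inj₁ (e , p) = ⊥-elim (1+n≰n {0} ((farkas (Γ ∷ N ∷ # X ∷ # D ∷ E₀ ∷ k ∷ []) ((con 1 :+ con 6 :* (x0 :* x1) :≤ x0 :* x2 :+ con 0 :* x1) ∷ (x2 :≤ x3 :+ x5 :* x4) ∷ ((x5 :+ con 0) :* x4 :≤ x1) ∷ (x3 :≤ con 5 :* x1) ∷ []) (con 1) (con 0) 0 (con 1 ∷ x0 ∷ x0 ∷ x0 ∷ []) (grown , X-small , k-small , D-small , tt))))
      where open State S
    saturate P Γ P>0 Γ>0 (suc s) {k} {c} S k-small grown | inj₁ (e , p) =
      subst₂ (λ a b → ∃[ S′ ] Saturated {a} {b} P Γ S′) (sym (+-suc k s)) (*-assoc c P (P ^ s))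
        (saturate P Γ P>0 Γ>0 s next (≤-trans (≤-reflexive (cong (_* E₀) (sym (+-suc k s)))) k-small)
          ((farkas (Γ ∷ N ∷ # X ∷ # X′ ∷ # (λ x → A x ∧ not (X (x ⊕ e))) ∷ s ∷ []) ((con 1 :+ con 6 :* (x0 :* x1) :≤ x0 :* x2 :+ (con 1 :+ x5) :* x1) ∷ (x2 :+ x4 :≤ x3) ∷ (con 1 :+ x1 :≤ x0 :* x4) ∷ []) (con 1 :+ con 6 :* (x0 :* x1)) (x0 :* x3 :+ x5 :* x1) 0 (con 1 ∷ x0 ∷ con 1 ∷ []) (grown , gain , ≤ᵇ-true {suc N} (∧-elimʳ {# Y ≤ᵇ P * r Y A e} p) , tt))))
      where
      open State S
      open Step S e P (≤ᵇ-true (∧-elimˡ p))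
      gain : # X + # (λ x → A x ∧ not (X (x ⊕ e))) ≤ # X′
      gain = ≤-reflexive (sym (trans (#-split X′ X) (cong₂ _+_ (#-cong (λ x → absorb-∧ (X x) (A (x ⊝ e))))
          (trans (sym (#-shift e _)) (#-cong (λ x → trans (rest (X (x ⊕ e)) (A (x ⊕ e ⊝ e))) (cong (λ y → A y ∧ not (X (x ⊕ e))) ((group-≡ (x ∷ e ∷ []) (gv 0 ⊞ gv 1 ⊟ gv 1) (gv 0))))))))))
        where
        absorb-∧ : ∀ a b → (a ∨ b) ∧ a ≡ a
        absorb-∧ true  b     = refl
        absorb-∧ false true  = refl
        absorb-∧ false false = refl
        rest : ∀ a b → (a ∨ b) ∧ not a ≡ b ∧ not a
        rest true  true  = refl
        rest true  false = refl
        rest false true  = refl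
        rest false false = refl

    Dif-small : ∀ Y → (∀ y → Y y ≡ true → A y ≡ true) → # (Dif Y A) ≤ 50 * N
    Dif-small Y Y⊆A = *-cancelˡ-≤ N ⦃ >-nonZero A>0 ⦄ ((farkas (N ∷ # (Dif Y A) ∷ # D ∷ E₀ ∷ []) ((x0 :* x1 :≤ x2 :* x2 :+ (x3 :+ x3) :* x1) ∷ (x2 :* x2 :≤ con 5 :* x0 :* (con 5 :* x0)) ∷ (con 4 :* x3 :≤ x0) ∷ []) (x0 :* x1) (x0 :* (con 50 :* x0)) 0 (con 2 ∷ con 2 ∷ x1 ∷ []) (Dif-bound A Y A D E₀ E₀ rows (λ y p → rows y (Y⊆A y p)) , *-mono-≤ D-small D-small , E-small , tt)))

    module _ {k c} (S : State k c) (P Γ : ℕ) (sat : Saturated P Γ S) where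
      open State S

      rare : Carrier → Bool
      rare e = not (# Y ≤ᵇ P * r Y A e)

      rare-at : Carrier → Subset
      rare-at y a = A a ∧ rare (a ⊝ y)

      -- Fewer than |Y| |A − Y| / P pairs (y, a) have an unpopular difference a − y.
      base-point : ∃[ y ] Y y ≡ true × P * # (rare-at y) ≤ 50 * N
      base-point = average Y (λ y → P * # (rare-at y)) (50 * N) (≤-trans (≤-reflexive total) (≤-trans (Σ-mono pointwise)
          (≤-trans (≤-reflexive (trans (Σ-*ˡ (# Y) _) (cong (# Y *_) (sym (#-Σ (Dif Y A)))))) (*-monoʳ-≤ (# Y) (Dif-small Y Y⊆A))))) Y>0
        where
        total : Σ (λ y → ⟦ Y y ⟧ * (P * # (rare-at y))) ≡ Σ (λ e → ⟦ rare e ⟧ * (P * r Y A e))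
        total = trans (Σ-cong (λ y → trans (cong (λ m → ⟦ Y y ⟧ * (P * m)) (trans (sym (#-shift y (rare-at y))) (#-Σ _)))
                  (trans (sym (*-assoc ⟦ Y y ⟧ P _)) (sym (Σ-*ˡ (⟦ Y y ⟧ * P) _))))) (trans (Σ-swap _)
                (Σ-cong (λ e → trans (Σ-cong (λ y → trans (cong (λ b → ⟦ Y y ⟧ * P * ⟦ A b ∧ rare (e ⊕ y ⊝ y) ⟧) (comm e y)) (trans (cong (λ b → ⟦ Y y ⟧ * P * ⟦ A (y ⊕ e) ∧ rare b ⟧) ((group-≡ (e ∷ y ∷ []) (gv 0 ⊞ gv 1 ⊟ gv 1) (gv 0)))) (factor (Y y) (A (y ⊕ e)) (rare e)))))
                  (trans (Σ-*ˡ (⟦ rare e ⟧ * P) _) (trans (*-assoc ⟦ rare e ⟧ P _) (cong (λ m → ⟦ rare e ⟧ * (P * m)) (sym (#-Σ _))))))))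
          where
          factor : ∀ a b c → ⟦ a ⟧ * P * ⟦ b ∧ c ⟧ ≡ ⟦ c ⟧ * P * ⟦ a ∧ b ⟧
          factor a b c = trans (cong (⟦ a ⟧ * P *_) (⟦∧⟧ b c)) (trans ((ring-≡ (⟦ a ⟧ ∷ ⟦ b ⟧ ∷ ⟦ c ⟧ ∷ P ∷ []) (x0 :* x3 :* (x1 :* x2)) (x2 :* x3 :* (x0 :* x1)))) (cong (⟦ c ⟧ * P *_) (sym (⟦∧⟧ a b))))
        pointwise : ∀ e → ⟦ rare e ⟧ * (P * r Y A e) ≤ # Y * ⟦ Dif Y A e ⟧
        pointwise e with bool (# Y ≤ᵇ P * r Y A e) | bool (Dif Y A e)
        ... | inj₁ p | _      rewrite p = z≤n
        ... | inj₂ p | inj₁ q rewrite p | q = ≤-trans (≤-reflexive (+-identityʳ _)) (≤-trans (<⇒≤ (≤ᵇ-false {# Y} p)) (≤-reflexive (sym (*-identityʳ (# Y)))))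
        ... | inj₂ p | inj₂ q = ≤-trans (*-monoʳ-≤ ⟦ rare e ⟧ (≤-reflexive (trans (cong (P *_) (r-Dif Y A e q)) (*-zeroʳ P)))) (≤-trans (≤-reflexive (*-zeroʳ ⟦ rare e ⟧)) z≤n)

      y₀ : Carrier
      y₀ = proj₁ base-point

      Hull Exceptions : Subset
      Hull u = X (u ⊝ y₀)
      Exceptions = rare-at y₀

      hull-rows : ∀ a → A a ≡ true → Exceptions a ≡ false → Γ * out a A Hull ≤ N
      hull-rows a p q = ≤-trans (≤-reflexive (cong (Γ *_) (#-cong (λ x → cong (λ z → A x ∧ not (X z)) ((group-≡ (a ∷ x ∷ y₀ ∷ []) (gv 0 ⊞ gv 1 ⊟ gv 2) (gv 1 ⊞ (gv 0 ⊟ gv 2))))))))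
        (sat (a ⊝ y₀) (≤ᵇ-true (not-false (∧-false q p))))

      hull-sums : ∀ u → Hull u ≡ true → Sums u
      hull-sums u p = subst Sums ((group-≡ (u ∷ y₀ ∷ []) (gv 1 ⊞ (gv 0 ⊟ gv 1)) (gv 0))) (sums y₀ (u ⊝ y₀) (proj₁ (proj₂ base-point)) p)

      #-Hull : # Hull ≡ # X
      #-Hull = #-shift (⊖ y₀) X

    record Outcome (Pr Γ f : ℕ → ℕ → ℕ) (γ fmax Kmax : ℕ) : Set where
      field
        k c       : ℕ
        cost      : f k c ≤ fmax
        U Bad P   : Subset
        U-sums    : ∀ u → U u ≡ true → Sums u
        U-size    : # U ≤ # D + Kmax * E₀
        U-rows    : ∀ a → A a ≡ true → Bad a ≡ false → Γ k c * out a A U ≤ N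
        Bad-size  : Pr k c * # Bad ≤ 50 * N
        P⊆A       : ∀ y → P y ≡ true → A y ≡ true
        P-size    : N ≤ 2 * (c * # P)
        P-periods : ∀ y y′ → P y ≡ true → P y′ ≡ true → γ * ν U (y′ ⊝ y) ≤ 3 * N

    module Pigeonhole (Pr Γ f : ℕ → ℕ → ℕ) (γ : ℕ) (Pr>0 : ∀ k c → 0 < Pr k c) (Γ>0 : ∀ k c → 0 < Γ k c)
      (Pr-big : ∀ k c → 100 * (k * c) ≤ Pr k c) (Γ-big : ∀ k c → γ * k ≤ Γ k c) where
      open Levelwise Pr Γ

      outcome : ∀ {k c} (S : State k c) (S′ : State (k⁺ k c) (c⁺ k c)) → Saturated (Pr k c) (Γ k c) S′ →
                γ * # (State.X S′) ≤ γ * # (State.X S) + N → ∀ {b K} → f k c ≤ b → k⁺ k c ≤ K → Outcome Pr Γ f γ b K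
      outcome {k} {c} S S′ sat close {b} {K} f≤ k≤ = record
        { k = k ; c = c ; cost = f≤ ; U = U ; Bad = Bad ; P = P
        ; U-sums = hull-sums S′ p g sat
        ; U-size = ≤-trans (≤-reflexive (#-Hull S′ p g sat)) (≤-trans (X-small S′) (+-monoʳ-≤ (# D) (*-monoˡ-≤ E₀ k≤)))
        ; U-rows = hull-rows S′ p g sat
        ; Bad-size = proj₂ (proj₂ (base-point S′ p g sat))
        ; P⊆A = λ y q → Y⊆A y (∧-elimˡ q)
        ; P-size = P-size
        ; P-periods = periods }
        where
        open State using (X-small)
        open State S hiding (X-small)
        p g : ℕ
        p = Pr k c
        g = Γ k c
        U Bad P : Subset
        U = Hull S′ p g sat
        Bad = Exceptions S′ p g sat
        instance
          g≢0 : NonZero g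
          g≢0 = >-nonZero (Γ>0 k c)
        ρ : ℕ
        ρ = N / g
        gρ≤N : g * ρ ≤ N
        gρ≤N = ≤-trans (≤-reflexive (*-comm g ρ)) (m/n*n≤m N g)
        P y = Y y ∧ not (suc (k * ρ) ≤ᵇ out y X U)
        rejected : # (λ y → Y y ∧ (suc (k * ρ) ≤ᵇ out y X U)) ≤ k * # Bad
        rejected = absorb Bad U ρ (λ a q r → ≤-trans (≤-reflexive (sym (m*n/n≡m (out a A U) g)))
          (/-monoˡ-≤ g (≤-trans (≤-reflexive (*-comm (out a A U) g)) (hull-rows S′ p g sat a q r))))
        P-size : N ≤ 2 * (c * # P)
        P-size = *-cancelˡ-≤ 50 ((farkas (N ∷ k ∷ c ∷ # P ∷ # Y ∷ # Bad ∷ # (λ y → Y y ∧ (suc (k * ρ) ≤ᵇ out y X U)) ∷ p ∷ []) ((x0 :≤ x2 :* x4) ∷ (x4 :≤ x6 :+ x3) ∷ (x6 :≤ x1 :* x5) ∷ (x7 :* x5 :≤ con 50 :* x0) ∷ (con 100 :* (x1 :* x2) :≤ x7) ∷ []) (con 50 :* x0) (con 50 :* (con 2 :* (x2 :* x3))) 0 (con 100 ∷ con 100 :* x2 ∷ con 100 :* x2 ∷ con 1 ∷ x5 ∷ []) (Y-size , ≤-reflexive (#-split Y (λ y → suc (k * ρ) ≤ᵇ out y X U)) , rejected , proj₂ (proj₂ (base-point S′ p g sat)) , Pr-big k c , tt)))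
        periods : ∀ y y′ → P y ≡ true → P y′ ≡ true → γ * ν U (y′ ⊝ y) ≤ 3 * N
        periods y y′ q q′ = (farkas (γ ∷ N ∷ k ∷ ρ ∷ g ∷ ν U (y′ ⊝ y) ∷ # (λ u → U u ∧ not (X (u ⊝ y))) ∷ # (λ u → U u ∧ X (u ⊝ y)) ∷ out y X U ∷ out y′ X U ∷ # U ∷ # X ∷ # (State.X S′) ∷ []) ((x5 :≤ x6 :+ x9) ∷ (x9 :≤ x2 :* x3) ∷ (x8 :≤ x2 :* x3) ∷ (x7 :+ x6 :≤ var 10) ∷ (var 11 :≤ x7 :+ x8) ∷ (var 10 :≤ var 12) ∷ (x0 :* var 12 :≤ x0 :* var 11 :+ x1) ∷ (x0 :* x2 :≤ x4) ∷ (x4 :* x3 :≤ x1) ∷ []) (x0 :* x5) (con 3 :* x1) 0 (x0 ∷ x0 ∷ x0 ∷ x0 ∷ x0 ∷ x0 ∷ con 1 ∷ con 2 :* x3 ∷ con 2 ∷ []) (near , ≮⇒≥ (λ lt → true≢false (≤ᵇ-intro lt) (∧-notʳ {Y y′} q′)) , ≮⇒≥ (λ lt → true≢false (≤ᵇ-intro lt) (∧-notʳ {Y y} q)) , ≤-reflexive (sym (#-split U (λ u → X (u ⊝ y)))) , inside , ≤-reflexive (#-Hull S′ p g sat) , close , Γ-big k c , gρ≤N , tt))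
          where
          inside : # X ≤ # (λ u → U u ∧ X (u ⊝ y)) + out y X U
          inside = ≤-reflexive (trans (#-split X (λ x → U (y ⊕ x))) (cong (_+ out y X U) (trans (#-cong (λ x → trans (∧-comm (X x) (U (y ⊕ x))) (cong₂ (λ a b → U a ∧ X b) (comm y x) ((group-≡ (x ∷ y ∷ []) (gv 0) (gv 0 ⊞ gv 1 ⊟ gv 1)))))) (#-shift y (λ u → U u ∧ X (u ⊝ y))))))
            where open import Data.Bool.Properties using (∧-comm)
          near : ν U (y′ ⊝ y) ≤ # (λ u → U u ∧ not (X (u ⊝ y))) + out y′ X U
          near = ≤-trans (#-cover {Z = λ u → X (u ⊝ y) ∧ not (U (y′ ⊕ (u ⊝ y)))} split) (+-monoʳ-≤ _ (≤-reflexive (#-shift (⊖ y) (λ x → X x ∧ not (U (y′ ⊕ x))))))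
            where
            split : ∀ u → U u ∧ not (U (u ⊕ (y′ ⊝ y))) ≡ true → U u ∧ not (X (u ⊝ y)) ≡ false → X (u ⊝ y) ∧ not (U (y′ ⊕ (u ⊝ y))) ≡ true
            split u h i = ∧-intro (not-false (∧-false i (∧-elimˡ h))) (trans (cong (λ z → not (U z)) ((group-≡ (u ∷ y ∷ y′ ∷ []) (gv 2 ⊞ (gv 0 ⊟ gv 1)) (gv 0 ⊞ (gv 2 ⊟ gv 1))))) (∧-elimʳ {U u} h))

      levels : ∀ t {k c b} (S : State k c) → f-max f t k c ≤ b → k-max t k c * E₀ ≤ N → 6 * (γ * N) < γ * # (State.X S) + t * N →
               Outcome Pr Γ f γ b (k-max t k c)
      levels zero {k} {c} S f≤b K-small grown = ⊥-elim (1+n≰n {0} ((farkas (γ ∷ N ∷ # X ∷ # D ∷ k * E₀ ∷ []) ((con 1 :+ con 6 :* (x0 :* x1) :≤ x0 :* x2 :+ con 0 :* x1) ∷ (x2 :≤ x3 :+ x4) ∷ (x4 :≤ x1) ∷ (x3 :≤ con 5 :* x1) ∷ []) (con 1) (con 0) 0 (con 1 ∷ x0 ∷ x0 ∷ x0 ∷ []) (grown , X-small , K-small , D-small , tt))))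
        where open State S
      levels (suc t) {k} {c} {b} S f≤b K-small grown = go (saturate (Pr k c) (Γ k c) (Pr>0 k c) (Γ>0 k c) (6 * Γ k c) S
          (≤-trans (*-monoˡ-≤ E₀ (k≤k-max t (k⁺ k c) (c⁺ k c))) K-small)
          (≤-trans (s≤s (≤-reflexive (sym (*-assoc 6 (Γ k c) N)))) (+-monoˡ-≤ (6 * Γ k c * N) (*-mono-≤ (Γ>0 k c) (State.X>0 S)))))
        where
        go : ∃[ S′ ] Saturated {k⁺ k c} {c⁺ k c} (Pr k c) (Γ k c) S′ → Outcome Pr Γ f γ b (k-max (suc t) k c)
        go (S′ , sat) with γ * # (State.X S′) ≤? γ * # (State.X S) + N
        ... | yes close = outcome S S′ sat close (≤-trans (m≤m⊔n (f k c) _) f≤b) (k≤k-max t (k⁺ k c) (c⁺ k c))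
        ... | no ¬close = levels t S′ (≤-trans (m≤n⊔m (f k c) _) f≤b) K-small
          ((farkas (γ ∷ N ∷ # (State.X S) ∷ # (State.X S′) ∷ t ∷ []) ((con 1 :+ con 6 :* (x0 :* x1) :≤ x0 :* x2 :+ (con 1 :+ x4) :* x1) ∷ (x0 :* x2 :+ x1 :≤ x0 :* x3) ∷ []) (con 1 :+ con 6 :* (x0 :* x1)) (x0 :* x3 :+ x4 :* x1) 0 (con 1 ∷ con 1 ∷ []) (grown , <⇒≤ (≰⇒> ¬close) , tt)))

      find : ∀ {b} → 0 < γ → f-max f (6 * γ) 1 1 ≤ b → k-max (6 * γ) 1 1 * E₀ ≤ N → Outcome Pr Γ f γ b (k-max (6 * γ) 1 1)
      find γ>0 f≤b K-small = levels (6 * γ) start f≤b K-small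
        (≤-trans (s≤s (≤-reflexive (sym (*-assoc 6 γ N)))) (+-monoˡ-≤ (6 * γ * N) (*-mono-≤ γ>0 A>0)))

-- Windows

module Window where

  open Sum

  count : ℕ → (ℕ → Bool) → ℕ
  count n f = ∑ n (λ x → ⟦ f x ⟧)

  ∑-drop : ∀ o n f → ∑ n (λ i → f (o + i)) ≤ ∑ (o + n) f
  ∑-drop o n f = ≤-trans (m≤n+m _ (∑ o f)) (≤-reflexive (sym (∑-split o n f)))

  ∑-tile : ∀ o m K f → ∑ K (λ k → ∑ m (λ r → f (o + k * m + r))) ≤ ∑ (o + K * m) f
  ∑-tile o m K f = ≤-trans (≤-reflexive (trans (∑-cong K (λ k _ → ∑-cong m (λ r _ → cong f (+-assoc o (k * m) r)))) (sym (∑-blocks K m (λ i → f (o + i))))))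
    (∑-drop o (K * m) f)

  ∑-+₃ : ∀ n f g h → ∑ n (λ i → f i + g i + h i) ≡ ∑ n f + ∑ n g + ∑ n h
  ∑-+₃ n f g h = trans (∑-+ n (λ i → f i + g i) h) (cong (_+ ∑ n h) (∑-+ n f g))

  module Select (A Bad U Q : ℕ → Bool) (M L N q u e₀ ν bad : ℕ) (M>0 : 0 < M)
    (A-low : ∀ x → A x ≡ true → M ≤ x) (A-all : N ≤ count L A) (A-count : ∀ n → count n A ≤ N)
    (U-count : ∀ n → count n U ≤ u) (Q-count : q ≡ count (suc M) Q)
    (Q-period : ∀ t → Q t ≡ true → ∀ n → count n (λ x → U x ∧ not (U (x + t))) ≤ ν)
    (M-period : ∀ n → count n (λ x → U x ∧ not (U (x + M))) ≤ ν)
    (M-period′ : ∀ n → count n (λ x → U (x + M) ∧ not (U x)) ≤ ν)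
    (a₀ : ℕ) (a₀-row : ∀ n → count n (λ x → A x ∧ not (U (a₀ + x))) ≤ e₀)
    (Bad-count : ∀ n → count n (λ x → A x ∧ Bad x) ≤ bad)
    (c s Cb Ce n₀ R : ℕ) (c>0 : 0 < c) (s>0 : 0 < s) (N>0 : 0 < N) (q-big : N ≤ 2 * (c * q)) (R-fits : n₀ * (2 * R) ≤ M) (n₀>0 : 0 < n₀)
    (u-small : 8 * (s * u) ≤ (32 * s + 1) * N) (e₀-small : 160 * (s * e₀) ≤ N) (ν-small : 160 * (s * ν) ≤ N)
    (bad-small : 8 * (s * (Cb * bad)) ≤ N) (n₀-big : 16 * (s * Ce) ≤ n₀) where

    H₀ : ℕ
    H₀ = 1600 * s

    mass shadow near₂ defect spoilt border : ℕ → ℕ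
    mass b   = ∑ M (λ r → ⟦ A (b + r) ⟧)
    shadow b = ∑ (2 * M) (λ r → ⟦ U (2 * b + r) ⟧)
    near₂ b  = ∑ (2 * M) (λ r → ⟦ U (a₀ + b + r) ⟧)
    defect b = ∑ M (λ r → ⟦ U (2 * b + r) ∧ not (U (2 * b + r + M)) ⟧) + ∑ M (λ r → ⟦ U (2 * b + r + M) ∧ not (U (2 * b + r)) ⟧)
    spoilt b = ∑ M (λ r → ⟦ A (b + r) ∧ Bad (b + r) ⟧)
    border b = ∑ R (λ r → ⟦ A (b + r) ⟧) + ∑ R (λ r → ⟦ A (b + (M ∸ R) + r) ⟧)

    heavy : ℕ → Bool
    heavy b = N ≤ᵇ c * (H₀ * mass b)

    start : ℕ → ℕ → ℕ
    start o k = o + k * M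

    mass-total : ∀ o → o ≤ M → N ≤ ∑ L (λ k → mass (start o k))
    mass-total o o≤M = begin
      N                                        ≤⟨ A-all ⟩
      count L A                                ≤⟨ ∑-monoˡ _ (≤-trans (m≤m*n L M ⦃ >-nonZero M>0 ⦄) (m≤n+m (L * M) o)) ⟩
      count (o + L * M) A                      ≡⟨ ∑-split o (L * M) _ ⟩
      count o A + ∑ (L * M) (λ i → ⟦ A (o + i) ⟧) ≡⟨ cong (_+ ∑ (L * M) (λ i → ⟦ A (o + i) ⟧)) (trans (∑-cong o (λ i i<o → low i i<o)) (∑-zero o)) ⟩
      ∑ (L * M) (λ i → ⟦ A (o + i) ⟧)          ≡⟨ ∑-blocks L M _ ⟩
      ∑ L (λ k → ∑ M (λ r → ⟦ A (o + (k * M + r)) ⟧)) ≡⟨ ∑-cong L (λ k _ → ∑-cong M (λ r _ → cong (λ x → ⟦ A x ⟧) (sym (+-assoc o (k * M) r)))) ⟩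
      ∑ L (λ k → mass (start o k))             ∎
      where
      open ≤-Reasoning hiding (start)
      low : ∀ i → i < o → ⟦ A i ⟧ ≡ 0
      low i i<o with A i in eq
      ... | false = refl
      ... | true  = ⊥-elim (<⇒≱ i<o (≤-trans o≤M (A-low i eq)))

    tile≤ : ∀ o m (f : ℕ → Bool) b → (∀ n → count n f ≤ b) → ∑ L (λ k → ∑ m (λ r → ⟦ f (o + k * m + r) ⟧)) ≤ b
    tile≤ o m f b h = ≤-trans (∑-tile o m L (λ x → ⟦ f x ⟧)) (h (o + L * m))

    double : ∀ o k → 2 * start o k ≡ 2 * o + k * (2 * M)
    double o k = (ring-≡ (o ∷ k ∷ M ∷ []) (con 2 :* (x0 :+ x1 :* x2)) (con 2 :* x0 :+ x1 :* (con 2 :* x2)))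

    shadow-total : ∀ o → ∑ L (λ k → shadow (start o k)) ≤ u
    shadow-total o = ≤-trans (≤-reflexive (∑-cong L (λ k _ → ∑-cong (2 * M) (λ r _ → cong (λ x → ⟦ U (x + r) ⟧) (double o k))))) (tile≤ (2 * o) (2 * M) U u U-count)

    halves : ∀ o (f : ℕ → Bool) b → (∀ n → count n f ≤ b) → ∑ L (λ k → ∑ M (λ r → ⟦ f (2 * start o k + r) ⟧)) ≤ b
    halves o f b h = ≤-trans (∑-mono L (λ k _ → ≤-trans (∑-monoˡ _ (m≤m+n M _)) (≤-reflexive (∑-cong (2 * M) (λ r _ → cong (λ x → ⟦ f (x + r) ⟧) (double o k)))))) (tile≤ (2 * o) (2 * M) f b h)

    defect-total : ∀ o → ∑ L (λ k → defect (start o k)) ≤ ν + ν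
    defect-total o = ≤-trans (≤-reflexive (∑-+ L _ _)) (+-mono-≤ (halves o (λ x → U x ∧ not (U (x + M))) ν M-period) (halves o (λ x → U (x + M) ∧ not (U x)) ν M-period′))

    spoilt-total : ∀ o → ∑ L (λ k → spoilt (start o k)) ≤ bad
    spoilt-total o = tile≤ o M (λ x → A x ∧ Bad x) bad Bad-count

    near₂-total : ∀ o → ∑ L (λ k → near₂ (start o k)) ≤ u + u
    near₂-total o = ≤-trans (≤-reflexive (trans (∑-cong L (λ k _ → trans (cong (λ n → ∑ n (λ r → ⟦ U (a₀ + start o k + r) ⟧)) ((ring-≡ (M ∷ []) (con 2 :* x0) (x0 :+ x0)))) (trans (∑-split M M _)
        (cong₂ _+_ (∑-cong M (λ r _ → cong (λ x → ⟦ U x ⟧) ((ring-≡ (a₀ ∷ o ∷ k * M ∷ r ∷ []) (x0 :+ (x1 :+ x2) :+ x3) (x0 :+ x1 :+ x2 :+ x3)))))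
          (∑-cong M (λ r _ → cong (λ x → ⟦ U x ⟧) ((ring-≡ (a₀ ∷ o ∷ k * M ∷ r ∷ M ∷ []) (x0 :+ (x1 :+ x2) :+ (x4 :+ x3)) (x0 :+ x1 :+ x4 :+ x2 :+ x3))))))))) (∑-+ L _ _)))
      (+-mono-≤ (tile≤ (a₀ + o) M U u U-count) (tile≤ (a₀ + o + M) M U u U-count))

    light : ℕ → ℕ
    light b = ⟦ not (heavy b) ⟧ * mass b

    private
      pairs : (ℕ → ℕ → Bool) → ℕ → ℕ
      pairs f b = ∑ M (λ r → ∑ (suc M) (λ t → ⟦ Q t ⟧ * ⟦ f (b + r) t ⟧))

      lost stray caught : ℕ → ℕ → Bool
      lost   x t = A x ∧ not (U (a₀ + x))
      stray  x t = U (a₀ + x) ∧ not (U (a₀ + x + t))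
      caught x t = A x ∧ U (a₀ + x + t)

      pairs-swap : ∀ f b → pairs f b ≡ ∑ (suc M) (λ t → ⟦ Q t ⟧ * ∑ M (λ r → ⟦ f (b + r) t ⟧))
      pairs-swap f b = trans (∑-swap M (suc M) _) (∑-cong (suc M) (λ t _ → ∑-*ˡ M ⟦ Q t ⟧ _))

      pairs-total : ∀ f m o → (∀ t → Q t ≡ true → ∀ n → count n (λ x → f x t) ≤ m) → ∑ L (λ k → pairs f (start o k)) ≤ q * m
      pairs-total f m o h = ≤-trans (≤-reflexive (trans (∑-cong L (λ k _ → pairs-swap f (start o k))) (∑-swap L (suc M) _)))
        (≤-trans (∑-mono (suc M) (λ t _ → column t)) (≤-reflexive (trans (∑-cong (suc M) (λ t _ → *-comm ⟦ Q t ⟧ m)) (trans (∑-*ˡ (suc M) m _) (trans (cong (m *_) (sym Q-count)) (*-comm m q))))))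
        where
        column : ∀ t → ∑ L (λ k → ⟦ Q t ⟧ * ∑ M (λ r → ⟦ f (start o k + r) t ⟧)) ≤ ⟦ Q t ⟧ * m
        column t with Q t in eq
        ... | false = ≤-reflexive (∑-zero L)
        ... | true  = ≤-trans (≤-reflexive (∑-*ˡ L 1 _)) (*-monoʳ-≤ 1 (tile≤ o M (λ x → f x t) m (h t eq)))

      lost-total : ∀ o → ∑ L (λ k → pairs lost (start o k)) ≤ q * e₀
      lost-total o = pairs-total lost e₀ o (λ t _ n → a₀-row n)

      stray-total : ∀ o → ∑ L (λ k → pairs stray (start o k)) ≤ q * ν
      stray-total o = pairs-total stray ν o (λ t p n → ≤-trans (∑-drop a₀ n (λ x → ⟦ U x ∧ not (U (x + t)) ⟧)) (Q-period t p (a₀ + n)))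

      caught-small : ∀ b → heavy b ≡ false → c * H₀ * pairs caught b ≤ N * near₂ b
      caught-small b p = (farkas (c ∷ H₀ ∷ N ∷ pairs caught b ∷ mass b ∷ near₂ b ∷ []) ((x3 :≤ x4 :* x5) ∷ (x0 :* (x1 :* x4) :≤ x2) ∷ []) (x0 :* x1 :* x3) (x2 :* x5) 0 (x0 :* x1 ∷ x5 ∷ []) (inner , <⇒≤ (≰⇒> (λ le → true≢false (≤ᵇ-intro le) p)) , tt))
        where
        inner : pairs caught b ≤ mass b * near₂ b
        inner = ≤-trans (∑-mono M (λ r r<M → row r r<M)) (≤-reflexive (trans (∑-cong M (λ r _ → *-comm ⟦ A (b + r) ⟧ (near₂ b))) (trans (∑-*ˡ M (near₂ b) _) (*-comm (near₂ b) (mass b)))))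
          where
          row : ∀ r → r < M → ∑ (suc M) (λ t → ⟦ Q t ⟧ * ⟦ caught (b + r) t ⟧) ≤ ⟦ A (b + r) ⟧ * near₂ b
          row r r<M with A (b + r)
          ... | false = ≤-reflexive (trans (∑-cong (suc M) (λ t _ → *-zeroʳ ⟦ Q t ⟧)) (∑-zero (suc M)))
          ... | true  = ≤-trans (∑-mono (suc M) (λ t _ → drop-Q t)) (≤-trans (∑-drop r (suc M) (λ v → ⟦ U (a₀ + b + v) ⟧)) (≤-trans (∑-monoˡ _ ((farkas (r ∷ M ∷ []) ((con 1 :+ x0 :≤ x1) ∷ []) (x0 :+ (con 1 :+ x1)) (con 2 :* x1) 0 (con 1 ∷ []) (r<M , tt)))) (≤-reflexive (sym (+-identityʳ (near₂ b))))))
            where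
            drop-Q : ∀ t → ⟦ Q t ⟧ * ⟦ U (a₀ + (b + r) + t) ⟧ ≤ ⟦ U (a₀ + b + (r + t)) ⟧
            drop-Q t = ≤-trans (*-monoˡ-≤ _ (⟦⟧≤1 (Q t))) (≤-reflexive (trans (+-identityʳ _) (cong (λ x → ⟦ U x ⟧) ((ring-≡ (a₀ ∷ b ∷ r ∷ t ∷ []) (x0 :+ (x1 :+ x2) :+ x3) (x0 :+ x1 :+ (x2 :+ x3)))))))

      light-split : ∀ b → light b * q ≤ pairs lost b + pairs stray b + ⟦ not (heavy b) ⟧ * pairs caught b
      light-split b with heavy b
      ... | true  = z≤n
      ... | false = ≤-trans (≤-reflexive (trans (cong (_* q) (+-identityʳ (mass b))) expand)) (≤-trans (∑-mono M (λ r _ → ∑-mono (suc M) (λ t _ → three r t)))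
          (≤-reflexive (trans (∑-cong M (λ r _ → ∑-+₃ (suc M) (cell lost r) (cell stray r) (cell caught r)))
            (trans (∑-+₃ M (λ r → ∑ (suc M) (cell lost r)) (λ r → ∑ (suc M) (cell stray r)) (λ r → ∑ (suc M) (cell caught r))) (cong (pairs lost b + pairs stray b +_) (sym (+-identityʳ (pairs caught b))))))))
        where
        cell : (ℕ → ℕ → Bool) → ℕ → ℕ → ℕ
        cell f r t = ⟦ Q t ⟧ * ⟦ f (b + r) t ⟧
        expand : mass b * q ≡ ∑ M (λ r → ∑ (suc M) (λ t → ⟦ Q t ⟧ * ⟦ A (b + r) ⟧))
        expand = trans (*-comm (mass b) q) (trans (sym (∑-*ˡ M q _)) (∑-cong M (λ r _ → trans (cong (_* ⟦ A (b + r) ⟧) Q-count) (trans (*-comm _ ⟦ A (b + r) ⟧) (trans (sym (∑-*ˡ (suc M) ⟦ A (b + r) ⟧ _)) (∑-cong (suc M) (λ t _ → *-comm ⟦ A (b + r) ⟧ ⟦ Q t ⟧)))))))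
        three : ∀ r t → ⟦ Q t ⟧ * ⟦ A (b + r) ⟧ ≤ ⟦ Q t ⟧ * ⟦ lost (b + r) t ⟧ + ⟦ Q t ⟧ * ⟦ stray (b + r) t ⟧ + ⟦ Q t ⟧ * ⟦ caught (b + r) t ⟧
        three r t with Q t | A (b + r) | U (a₀ + (b + r)) | U (a₀ + (b + r) + t)
        ... | false | _     | _     | _     = z≤n
        ... | true  | false | _     | _     = z≤n
        ... | true  | true  | false | _     = s≤s z≤n
        ... | true  | true  | true  | true  = s≤s z≤n
        ... | true  | true  | true  | false = s≤s z≤n

    -- Double counting of the pairs (x, t) with x in a light window and t ∈ Q:
    -- almost always a₀ + x + t lies in U, and there it is close to the window.
    light-total : ∀ o → H₀ * ∑ L (λ k → light (start o k)) ≤ H₀ * (e₀ + ν) + 4 * u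
    light-total o = *-cancelˡ-≤ (c * q) ⦃ >-nonZero cq>0 ⦄ ((farkas (c ∷ q ∷ H₀ ∷ N ∷ u ∷ e₀ ∷ ν ∷ ∑ L (λ k → light (start o k)) ∷ ∑ L (λ k → near₂ (start o k)) ∷ ∑ L (λ k → pairs lost (start o k)) ∷ ∑ L (λ k → pairs stray (start o k)) ∷ ∑ L (λ k → ⟦ not (heavy (start o k)) ⟧ * pairs caught (start o k)) ∷ []) ((x1 :* x7 :≤ x9 :+ var 10 :+ var 11) ∷ (x0 :* x2 :* var 11 :≤ x3 :* x8) ∷ (x8 :≤ x4 :+ x4) ∷ (x9 :≤ x1 :* x5) ∷ (var 10 :≤ x1 :* x6) ∷ (x3 :≤ con 2 :* (x0 :* x1)) ∷ []) (x0 :* x1 :* (x2 :* x7)) (x0 :* x1 :* (x2 :* (x5 :+ x6) :+ con 4 :* x4)) 0 (x0 :* x2 ∷ con 1 ∷ x3 ∷ x0 :* x2 ∷ x0 :* x2 ∷ con 2 :* x4 ∷ []) (split , caught-total , near₂-total o , lost-total o , stray-total o , q-big , tt)))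
      where
      cq>0 : 0 < c * q
      cq>0 = n≢0⇒n>0 λ z → <⇒≱ N>0 (≤-trans q-big (≤-reflexive (cong (2 *_) z)))
      split : q * ∑ L (λ k → light (start o k)) ≤ ∑ L (λ k → pairs lost (start o k)) + ∑ L (λ k → pairs stray (start o k)) + ∑ L (λ k → ⟦ not (heavy (start o k)) ⟧ * pairs caught (start o k))
      split = ≤-trans (≤-reflexive (sym (∑-*ˡ L q _))) (≤-trans (∑-mono L (λ k _ → ≤-trans (≤-reflexive (*-comm q _)) (light-split (start o k)))) (≤-reflexive (∑-+₃ L (λ k → pairs lost (start o k)) (λ k → pairs stray (start o k)) (λ k → ⟦ not (heavy (start o k)) ⟧ * pairs caught (start o k)))))
      caught-total : c * H₀ * ∑ L (λ k → ⟦ not (heavy (start o k)) ⟧ * pairs caught (start o k)) ≤ N * ∑ L (λ k → near₂ (start o k))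
      caught-total = ≤-trans (≤-reflexive (sym (∑-*ˡ L (c * H₀) _))) (≤-trans (∑-mono L (λ k _ → one (start o k))) (≤-reflexive (∑-*ˡ L N _)))
        where
        one : ∀ b → c * H₀ * (⟦ not (heavy b) ⟧ * pairs caught b) ≤ N * near₂ b
        one b with heavy b in eq
        ... | true  = ≤-trans (≤-reflexive (*-zeroʳ (c * H₀))) z≤n
        ... | false = ≤-trans (≤-reflexive (cong (c * H₀ *_) (+-identityʳ _))) (caught-small b eq)

    offset : ℕ → ℕ
    offset i = i * (2 * R)

    offset≤ : ∀ i → i < n₀ → offset i ≤ M
    offset≤ i i< = ≤-trans (*-monoˡ-≤ (2 * R) (<⇒≤ i<)) R-fits

    strip-total : ∀ δ → ∑ n₀ (λ i → ∑ L (λ k → ∑ R (λ r → ⟦ A (start (offset i) k + δ + r) ⟧))) ≤ N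
    strip-total δ = ≤-trans (≤-reflexive (∑-swap n₀ L _)) (≤-trans (∑-mono L (λ k _ → column k)) (tile≤ δ M A N A-count))
      where
      column : ∀ k → ∑ n₀ (λ i → ∑ R (λ r → ⟦ A (start (offset i) k + δ + r) ⟧)) ≤ ∑ M (λ r → ⟦ A (δ + k * M + r) ⟧)
      column k = ≤-trans (∑-mono n₀ (λ i _ → ≤-trans (∑-monoˡ _ (m≤m+n R _)) (≤-reflexive (∑-cong (2 * R) (λ r _ → cong (λ x → ⟦ A x ⟧) ((ring-≡ (offset i ∷ k * M ∷ δ ∷ r ∷ []) (x0 :+ x1 :+ x2 :+ x3) (x2 :+ x1 :+ (x0 :+ x3)))))))))
        (≤-trans (≤-reflexive (sym (∑-blocks n₀ (2 * R) (λ y → ⟦ A (δ + k * M + y) ⟧)))) (∑-monoˡ _ R-fits))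

    border-total : ∑ n₀ (λ i → ∑ L (λ k → border (start (offset i) k))) ≤ N + N
    border-total = ≤-trans (≤-reflexive (trans (∑-cong n₀ (λ i _ → ∑-+ L _ _)) (∑-+ n₀ _ _)))
      (+-mono-≤ (≤-trans (≤-reflexive (∑-cong n₀ (λ i _ → ∑-cong L (λ k _ → ∑-cong R (λ r _ → cong (λ x → ⟦ A (x + r) ⟧) (sym (+-identityʳ _))))))) (strip-total 0)) (strip-total (M ∸ R)))

    penalty gain : ℕ → ℕ
    penalty b = s * (shadow b + defect b + Cb * spoilt b) + s * (Ce * border b)
    gain b    = (4 * s + 1) * (⟦ heavy b ⟧ * mass b)

    penalty-total : ∑ n₀ (λ i → ∑ L (λ k → penalty (start (offset i) k))) ≤ n₀ * (s * (u + (ν + ν) + Cb * bad)) + s * (Ce * (N + N))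
    penalty-total = ≤-trans (≤-reflexive (trans (∑-cong n₀ (λ i _ → ∑-+ L _ _)) (∑-+ n₀ _ _)))
      (+-mono-≤ (≤-trans (∑-mono n₀ (λ i _ → ≤-trans (≤-reflexive (trans (∑-*ˡ L s _) (cong (s *_) (trans (∑-+₃ L (λ k → shadow (start (offset i) k)) (λ k → defect (start (offset i) k)) (λ k → Cb * spoilt (start (offset i) k))) (cong (∑ L (λ k → shadow (start (offset i) k)) + ∑ L (λ k → defect (start (offset i) k)) +_) (∑-*ˡ L Cb (λ k → spoilt (start (offset i) k))))))))
            (*-monoʳ-≤ s (+-mono-≤ (+-mono-≤ (shadow-total (offset i)) (defect-total (offset i))) (*-monoʳ-≤ Cb (spoilt-total (offset i))))))) (≤-reflexive (∑-const n₀ _)))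
        (≤-trans (≤-reflexive (trans (∑-cong n₀ (λ i _ → trans (∑-*ˡ L s _) (cong (s *_) (∑-*ˡ L Ce _)))) (trans (∑-*ˡ n₀ s _) (cong (s *_) (∑-*ˡ n₀ Ce _)))))
          (*-monoʳ-≤ s (*-monoʳ-≤ Ce border-total))))

    gain-total : ∀ i → i < n₀ → (32 * s + 5) * N ≤ 8 * ∑ L (λ k → gain (start (offset i) k))
    gain-total i i< = (farkas (s ∷ N ∷ ∑ L (λ k → ⟦ heavy (start (offset i) k) ⟧ * mass (start (offset i) k)) ∷ ∑ L (λ k → light (start (offset i) k)) ∷ ∑ L (λ k → mass (start (offset i) k)) ∷ ∑ L (λ k → gain (start (offset i) k)) ∷ []) ((x1 :≤ x4) ∷ (x4 :≤ x2 :+ x3) ∷ ((con 4 :* x0 :+ con 1) :* x2 :≤ x5) ∷ (con 40 :* (x0 :* x3) :≤ x1) ∷ (con 1 :≤ x0) ∷ []) ((con 32 :* x0 :+ con 5) :* x1) (con 8 :* x5) 0 (con 8 :* (con 4 :* x0 :+ con 1) ∷ con 8 :* (con 4 :* x0 :+ con 1) ∷ con 8 ∷ con 3 ∷ con 8 :* x3 ∷ []) (mass-total (offset i) (offset≤ i i<) , ≤-reflexive parts , ≤-reflexive (sym (∑-*ˡ L (4 * s + 1) (λ k → ⟦ heavy (start (offset i) k) ⟧ * mass (start (offset i) k)))) , little , s>0 , tt))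
      where
      u≤ : u ≤ 5 * N
      u≤ = *-cancelˡ-≤ (8 * s) ⦃ >-nonZero (*-mono-≤ {1} {8} (s≤s z≤n) s>0) ⦄ ((farkas (s ∷ u ∷ N ∷ []) ((con 8 :* (x0 :* x1) :≤ (con 32 :* x0 :+ con 1) :* x2) ∷ (con 1 :≤ x0) ∷ []) (con 8 :* x0 :* x1) (con 8 :* x0 :* (con 5 :* x2)) 0 (con 1 ∷ x2 ∷ []) (u-small , s>0 , tt)))
      little : 40 * (s * ∑ L (λ k → light (start (offset i) k))) ≤ N
      little = *-cancelˡ-≤ 40 ((farkas (s ∷ u ∷ N ∷ e₀ ∷ ν ∷ ∑ L (λ k → light (start (offset i) k)) ∷ []) ((con 1600 :* x0 :* x5 :≤ con 1600 :* x0 :* (x3 :+ x4) :+ con 4 :* x1) ∷ (x1 :≤ con 5 :* x2) ∷ (con 160 :* (x0 :* x3) :≤ x2) ∷ (con 160 :* (x0 :* x4) :≤ x2) ∷ []) (con 40 :* (con 40 :* (x0 :* x5))) (con 40 :* x2) 0 (con 1 ∷ con 4 ∷ con 10 ∷ con 10 ∷ []) (light-total (offset i) , u≤ , e₀-small , ν-small , tt)))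
      parts : ∑ L (λ k → mass (start (offset i) k)) ≡ ∑ L (λ k → ⟦ heavy (start (offset i) k) ⟧ * mass (start (offset i) k)) + ∑ L (λ k → light (start (offset i) k))
      parts = trans (∑-cong L (λ k _ → part (heavy (start (offset i) k)) (mass (start (offset i) k)))) (∑-+ L _ _)
        where
        part : ∀ b m → m ≡ ⟦ b ⟧ * m + ⟦ not b ⟧ * m
        part true  m = sym (trans (+-identityʳ _) (+-identityʳ m))
        part false m = sym (+-identityʳ m)

    selected : ∃[ b ] penalty b < gain b
    selected = let i , _ , p = ∑-< n₀ total ; k , _ , q = ∑-< L p in start (offset i) k , q
      where
      gains : n₀ * ((32 * s + 5) * N) ≤ 8 * ∑ n₀ (λ i → ∑ L (λ k → gain (start (offset i) k)))
      gains = ≤-trans (≤-reflexive (sym (∑-const n₀ _))) (≤-trans (∑-mono n₀ gain-total) (≤-reflexive (∑-*ˡ n₀ 8 _)))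
      total : ∑ n₀ (λ i → ∑ L (λ k → penalty (start (offset i) k))) < ∑ n₀ (λ i → ∑ L (λ k → gain (start (offset i) k)))
      total = *-cancelˡ-< 8 _ _ ((farkas (∑ n₀ (λ i → ∑ L (λ k → penalty (start (offset i) k))) ∷ ∑ n₀ (λ i → ∑ L (λ k → gain (start (offset i) k))) ∷ n₀ ∷ s ∷ u ∷ N ∷ Cb ∷ Ce ∷ bad ∷ ν ∷ []) ((x0 :≤ x2 :* (x3 :* (x4 :+ (x9 :+ x9) :+ x6 :* x8)) :+ x3 :* (x7 :* (x5 :+ x5))) ∷ (con 8 :* (x3 :* x4) :≤ (con 32 :* x3 :+ con 1) :* x5) ∷ (con 160 :* (x3 :* x9) :≤ x5) ∷ (con 8 :* (x3 :* (x6 :* x8)) :≤ x5) ∷ (con 16 :* (x3 :* x7) :≤ x2) ∷ (x2 :* ((con 32 :* x3 :+ con 5) :* x5) :≤ con 8 :* x1) ∷ (con 1 :* con 1 :≤ x2 :* x5) ∷ []) (con 1 :+ con 8 :* x0) (con 8 :* x1) 9 (con 80 ∷ con 10 :* x2 ∷ x2 ∷ con 10 :* x2 ∷ con 10 :* x5 ∷ con 10 ∷ con 10 ∷ []) (penalty-total , u-small , ν-small , bad-small , n₀-big , gains , *-mono-≤ n₀>0 N>0 , tt)))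

module Fold where

  open Sum
  open Grp
  open ZMod
  open Window using (count; ∑-drop)
  open Params using (module Constants)
  open Core using (module Theorem)
  open import Data.Nat.DivMod
  open import Data.Nat.Divisibility using (_∣_)
  open import Data.Integer.Base as ℤ using (ℤ; +_; -[1+_])
  import Data.Integer.Properties as ℤ

  ∑² : ℕ → ℕ → (ℕ → ℕ → ℕ) → ℕ
  ∑² m n F = ∑ m (λ i → ∑ n (λ j → F i j))

  extend : (ℕ → Bool) → ℤ → Bool
  extend A (+ x)    = A x
  extend A -[1+ _ ] = false

  record DenseLine (A : ℕ → Bool) (n C α : ℕ) : Set where
    field
      base step len : ℕ
      step>0 : 0 < step
      dense  : n * len ≤ 2 * (n * ∑ len (λ l → ⟦ A (base + l * step) ⟧)) + 2 * len
      large  : α ≤ C * len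

  record DensePlane (A : ℕ → Bool) (n C α : ℕ) : Set where
    field
      base a b : ℤ
      l₁ l₂    : ℕ
      proper : ∀ i j i′ j′ → i ≤ l₁ → j ≤ l₂ → i′ ≤ l₁ → j′ ≤ l₂ →
               + i ℤ.* a ℤ.+ + j ℤ.* b ≡ + i′ ℤ.* a ℤ.+ + j′ ℤ.* b → i ≡ i′ × j ≡ j′
      dense  : n * (suc l₁ * suc l₂) ≤ n * ∑² (suc l₁) (suc l₂) (λ i j → ⟦ extend A (base ℤ.+ (+ i ℤ.* a ℤ.+ + j ℤ.* b)) ⟧) + suc l₁ * suc l₂
      large  : α ≤ C * (suc l₁ * suc l₂)

  ⟦⟧-both : ∀ {x y z} → (x ≡ true → y ≡ true × z ≡ true) → ⟦ x ⟧ ≤ ⟦ y ⟧ * ⟦ z ⟧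
  ⟦⟧-both {false} f = z≤n
  ⟦⟧-both {true} {y} {z} f with y | z | f refl
  ... | true | true | _ = ≤-refl

  module Residues (M′ : ℕ) where
    private
      G : FinAb
      G = ℤ/ M′
    open Conv G public hiding (r)
    open Chain G public using (Subgroup)
    open Iter G public using (mul)

    abstract
      #-count : ∀ (S : Subset) → # S ≡ count (suc M′) (λ i → S (enum i))
      #-count S = trans (#-Σ S) (Σ-∑ (λ x → ⟦ S x ⟧))

    index-< : ∀ i → i < suc M′ → index (enum i) ≡ i
    index-< = index-enum

    pull : ∀ (f : ℕ → Bool) → # (λ x → f (index x)) ≡ count (suc M′) f
    pull f = trans (#-count (λ x → f (index x))) (∑-cong (suc M′) (λ i i< → cong (λ j → ⟦ f j ⟧) (index-< i i<)))

    ⊕-index : ∀ x i → x ⊕ enum i ≡ enum (index x + i)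
    ⊕-index x i = trans (cong (_⊕ enum i) (sym (enum-index x))) (enum-+ M′ (index x) i)

  module Wrap (k w M′ : ℕ) (A Bad U : ℕ → Bool) (b R e₀ ζ : ℕ) where
    open Residues M′
    open Constants k
    open Theorem (ℤ/ M′) k w (enum 1) (enum-mul M′) (s≤s z≤n) (period M′)

    open Cyc.Cyclic (ℤ/ M′) (enum 1) (enum-mul M′) (s≤s z≤n) (period M′) using (zmul; zmul-+)

    private
      M : ℕ
      M = suc M′

    good : ℕ → Bool
    good i = A (b + i) ∧ not (Bad (b + i))

    edge : ℕ → Bool
    edge i = (suc i ≤ᵇ R) ∨ (M ≤ᵇ i + R)

    -- The sums of two elements of [b, b + M) lie in [2b, 2b + 2M), so that each
    -- residue has two lifts.
    doubled : ℕ → Bool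
    doubled i = U (b + b + i) ∨ U (b + b + i + M)

    S D Edge : Subset
    S x = good (index x)
    D x = doubled (index x)
    Edge x = edge (index x)

    module Apply (rows : ∀ x → A x ≡ true → Bad x ≡ false → ∀ n → count n (λ y → A y ∧ not (U (x + y))) ≤ e₀)
      (S>0 : 0 < count M good) (D-size : count M doubled ≤ 2 * count M good + ζ) (ζ-small : κζ * ζ ≤ count M good)
      (e-small : κE * e₀ ≤ count M good) (R>0 : 0 < R) (R-big : M ≤ w * R)
      (edge-small : 8 * (n * count M (λ i → good i ∧ edge i)) ≤ count M good) where

      private
        N : ℕ
        N = count M good

        #S : # S ≡ N
        #S = pull good

      rowsS : ∀ x → S x ≡ true → out x S D ≤ e₀
      rowsS x p = ≤-trans (≤-reflexive (#-count _)) (≤-trans (∑-mono M (λ i i< → ⟦⟧-mono (step i i<)))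
          (≤-trans (∑-drop b M (λ y → ⟦ A y ∧ not (U (b + j + y)) ⟧)) (rows (b + j) (∧-elimˡ p) (∧-notʳ {A (b + j)} p) (b + M))))
        where
        j : ℕ
        j = index x
        step : ∀ i → i < M → S (enum i) ∧ not (D (x ⊕ enum i)) ≡ true → A (b + i) ∧ not (U (b + j + (b + i))) ≡ true
        step i i< q = ∧-not (trans (cong (λ l → A (b + l)) (sym (index-< i i<))) (∧-elimˡ (∧-elimˡ {S (enum i)} q)))
            (trans (cong U ((ring-≡ (b ∷ i ∷ j ∷ []) (x0 :+ x2 :+ (x0 :+ x1)) (x0 :+ x0 :+ (x2 :+ x1))))) (outside (j + i) (+-mono-< (index< x) i<) (trans (cong doubled (sym (trans (cong index (⊕-index x i)) (index-% M′ (j + i))))) (∧-notʳ {S (enum i)} q))))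
          where
          outside : ∀ y → y < M + M → doubled (y % M) ≡ false → U (b + b + y) ≡ false
          outside y y< h with y <? M
          ... | yes y<M = ∨-falseˡ (trans (cong doubled (sym (m<n⇒m%n≡m y<M))) h)
          ... | no y≮M = trans (cong U (trans (cong (λ z → b + b + z) (sym (m∸n+n≡m (≮⇒≥ y≮M)))) (sym (+-assoc (b + b) (y ∸ M) M))))
              (∨-falseʳ {U (b + b + (y ∸ M))} (trans (cong doubled (sym wrap)) h))
            where
            wrap : y % M ≡ y ∸ M
            wrap = trans (cong (_% M) (sym (m∸n+n≡m (≮⇒≥ y≮M)))) (trans ([m+n]%n≡m%n (y ∸ M) M) (m<n⇒m%n≡m (+-cancelʳ-< M (y ∸ M) M (≤-<-trans (≤-reflexive (m∸n+n≡m (≮⇒≥ y≮M))) y<))))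

      #D : # D ≡ count M doubled
      #D = pull doubled

      outcome′ : DenseCoset S (# S) ⊎ DenseBox (λ x → S x ∧ not (Edge x)) (# S) R
      outcome′ = Run.outcome S D Edge ζ e₀ R (subst (0 <_) (sym #S) S>0) rowsS
        (subst₂ (λ d s → d ≤ 2 * s + ζ) (sym #D) (sym #S) D-size) (subst (κζ * ζ ≤_) (sym #S) ζ-small) (subst (κE * e₀ ≤_) (sym #S) e-small) R>0 R-big
        (subst₂ (λ d s → 8 * (n * d) ≤ s) (sym (pull (λ i → good i ∧ edge i))) (sym #S) edge-small)

      module Line (P : DenseCoset S (# S)) where
        open DenseCoset P
        open Cyc.Cyclic.Multiples (ℤ/ M′) (enum 1) (enum-mul M′) (s≤s z≤n) (period M′) H H-group using (q; size-kq; #H; H⇒∣) renaming (k to k′)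
        open Subgroup H-group
        c ρ : ℕ
        c = index corner
        ρ = c % q
        ρ<q : ρ < q
        ρ<q = m%n<n c q
        H-enum : ∀ i → H (enum i) ≡ true → q ∣ i
        H-enum i h = H⇒∣ (trans (cong H (sym (enum-mul M′ i))) h)
        class : ∀ i → H (enum i ⊝ corner) ≡ true → i % q ≡ ρ
        class i h with c ≤? i
        ... | yes c≤i = trans (cong (_% q) (trans (sym (m∸n+n≡m c≤i)) (cong (_+ c) (_∣_.equality d)))) (trans (cong (_% q) (+-comm (_∣_.quotient d * q) c)) ([m+kn]%n≡m%n c (_∣_.quotient d) q))
          where
          d : q ∣ i ∸ c
          d = H-enum (i ∸ c) (trans (cong H (trans ((group-≡ (enum (i ∸ c) ∷ corner ∷ []) (gv 0) (gv 0 ⊞ gv 1 ⊟ gv 1))) (cong (_⊝ corner) (trans (comm (enum (i ∸ c)) corner) (trans (⊕-index corner (i ∸ c)) (cong enum (m+[n∸m]≡n c≤i))))))) h)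
        ... | no c≰i = sym (trans (cong (_% q) (trans (sym (m∸n+n≡m (<⇒≤ (≰⇒> c≰i)))) (cong (_+ i) (_∣_.equality d)))) (trans (cong (_% q) (+-comm (_∣_.quotient d * q) i)) ([m+kn]%n≡m%n i (_∣_.quotient d) q)))
          where
          d : q ∣ c ∸ i
          d = H-enum (c ∸ i) (trans (cong H (trans (trans ((group-≡ (enum (c ∸ i) ∷ enum i ∷ []) (gv 0) (⊟ (gv 1 ⊟ (gv 1 ⊞ gv 0)))))
                (cong (λ z → ⊖ (enum i ⊝ z)) (trans (enum-+ M′ i (c ∸ i)) (trans (cong enum (m+[n∸m]≡n (<⇒≤ (≰⇒> c≰i)))) (enum-index corner))))) refl)) (has-neg h))
        covered : # (λ h → H h ∧ S (corner ⊕ h)) ≤ ∑ k′ (λ l → ⟦ A (b + ρ + l * q) ⟧)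
        covered = ≤-trans (#-subst corner (λ h p → ∧-intro (trans (cong H ((group-≡ (h ∷ corner ∷ []) (gv 0 ⊞ gv 1 ⊟ gv 1) (gv 0)))) (∧-elimˡ p)) (trans (cong S (comm h corner)) (∧-elimʳ {H h} p))))
          (≤-trans (≤-reflexive (trans (#-count (λ x → H (x ⊝ corner) ∧ S x)) (trans (cong (λ m → count m (λ i → H (enum i ⊝ corner) ∧ S (enum i))) size-kq) (∑-blocks k′ q _))))
            (∑-mono k′ (λ l l< → ≤-trans (∑-mono q (λ ρ′ ρ′< → cell l ρ′ l< ρ′<)) (≤-reflexive (∑-δ q ρ ρ<q (λ ρ′ → ⟦ A (b + ρ′ + l * q) ⟧))))))
          where
          cell : ∀ l ρ′ → l < k′ → ρ′ < q → ⟦ H (enum (l * q + ρ′) ⊝ corner) ∧ S (enum (l * q + ρ′)) ⟧ ≤ ⟦ ρ′ ≡ᵇ ρ ⟧ * ⟦ A (b + ρ′ + l * q) ⟧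
          cell l ρ′ l< ρ′< = ⟦⟧-both (λ p → subst (λ z → (ρ′ ≡ᵇ z) ≡ true) (same p) (δ-eq ρ′) , inA p)
            where
            Meets : Set
            Meets = H (enum (l * q + ρ′) ⊝ corner) ∧ S (enum (l * q + ρ′)) ≡ true
            same : Meets → ρ′ ≡ ρ
            same p = trans (sym (trans (cong (_% q) (+-comm (l * q) ρ′)) (trans ([m+kn]%n≡m%n ρ′ l q) (m<n⇒m%n≡m ρ′<)))) (class (l * q + ρ′) (∧-elimˡ p))
            i<M : l * q + ρ′ < M
            i<M = ≤-trans (+-monoʳ-< (l * q) ρ′<) (≤-trans (≤-reflexive (+-comm (l * q) q)) (≤-trans (*-monoˡ-≤ q l<) (≤-reflexive (sym size-kq))))
            inA : Meets → A (b + ρ′ + l * q) ≡ true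
            inA p = trans (cong A (trans ((ring-≡ (b ∷ ρ′ ∷ l * q ∷ []) (x0 :+ x1 :+ x2) (x0 :+ (x2 :+ x1)))) (cong (λ z → b + z) (sym (index-< (l * q + ρ′) i<M))))) (∧-elimˡ (∧-elimʳ {H (enum (l * q + ρ′) ⊝ corner)} p))

        line : DenseLine A n κC N
        line = record
          { base = b + ρ ; step = q ; len = k′ ; step>0 = s≤s z≤n
          ; dense = subst (λ l → n * l ≤ 2 * (n * ∑ k′ (λ l → ⟦ A (b + ρ + l * q) ⟧)) + 2 * l) #H (≤-trans dense (+-monoˡ-≤ (2 * # H) (*-monoʳ-≤ 2 (*-monoʳ-≤ n covered))))
          ; large = subst₂ (λ s l → s ≤ κC * l) #S #H large }

      module Plane (P : DenseBox (λ x → S x ∧ not (Edge x)) (# S) R) where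
        open DenseBox P renaming (a to u; b to v)

        S° : Subset
        S° x = S x ∧ not (Edge x)

        vec : ℕ → ℕ → ℤ
        vec i j = + i ℤ.* u ℤ.+ + j ℤ.* v

        size-N : ℕ
        size-N = suc l₁ * suc l₂

        hits : ℕ
        hits = Smooth.∑² (ℤ/ M′) (suc l₁) (suc l₂) (λ i j → ⟦ S° (corner ⊕ zmul (vec i j)) ⟧)

        hit : ∃[ i ] ∃[ j ] i < suc l₁ × j < suc l₂ × 0 < ⟦ S° (corner ⊕ zmul (vec i j)) ⟧
        hit = Smooth.∑²-exists (ℤ/ M′) (suc l₁) (suc l₂) _ (n≢0⇒n>0 λ z → 1+n≰n {0} ((farkas (n ∷ size-N ∷ hits ∷ []) ((x0 :* x1 :≤ x0 :* x2 :+ x1) ∷ (x2 :≤ con 0) ∷ (con 2 :≤ x0) ∷ (con 1 :≤ x1) ∷ []) (con 1) (con 0) 0 (con 1 ∷ x0 ∷ x1 ∷ con 1 ∷ []) (dense , ≤-reflexive z , n≥2 , s≤s {0} z≤n , tt))))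

        i₀ j₀ p₀ : ℕ
        i₀ = proj₁ hit
        j₀ = proj₁ (proj₂ hit)
        p₀ = index (corner ⊕ zmul (vec i₀ j₀))

        p₀-edge : edge p₀ ≡ false
        p₀-edge = ∧-notʳ {S (corner ⊕ zmul (vec i₀ j₀))} (⟦⟧-true (proj₂ (proj₂ (proj₂ (proj₂ hit)))))

        p₀-low : R ≤ p₀
        p₀-low = s≤s⁻¹ (≤ᵇ-false (∨-falseˡ p₀-edge))

        p₀-high : p₀ + R < M
        p₀-high = ≤ᵇ-false (∨-falseʳ {suc p₀ ≤ᵇ R} p₀-edge)

        origin : ℤ
        origin = + (b + p₀) ℤ.- vec i₀ j₀

        δ : ℕ → ℕ → ℤ
        δ i j = (i ℤ.⊖ i₀) ℤ.* u ℤ.+ (j ℤ.⊖ j₀) ℤ.* v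

        vec-δ : ∀ i j → vec i j ≡ vec i₀ j₀ ℤ.+ δ i j
        vec-δ i j = sym (trans (interchange (+ i₀ ℤ.* u) (+ j₀ ℤ.* v) ((i ℤ.⊖ i₀) ℤ.* u) ((j ℤ.⊖ j₀) ℤ.* v))
            (cong₂ ℤ._+_ (merge i i₀ u) (merge j j₀ v)))
          where
          open import Algebra.Properties.CommutativeSemigroup ℤ.+-commutativeSemigroup using (interchange)
          merge : ∀ m n z → + n ℤ.* z ℤ.+ (m ℤ.⊖ n) ℤ.* z ≡ + m ℤ.* z
          merge m n z = trans (sym (ℤ.*-distribʳ-+ z (+ n) (m ℤ.⊖ n))) (cong (ℤ._* z) (trans (ℤ.+-comm (+ n) (m ℤ.⊖ n)) (trans (ℤ.distribˡ-⊖-+-pos n m n)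
            (trans (cong₂ ℤ._⊖_ (+-comm m n) (sym (+-identityʳ n))) (ℤ.+-cancelˡ-⊖ n m 0)))))

        δ-small : ∀ i j → i < suc l₁ → j < suc l₂ → ℤ.∣ δ i j ∣ ≤ R
        δ-small i j i< j< = ≤-trans (ℤ.∣i+j∣≤∣i∣+∣j∣ ((i ℤ.⊖ i₀) ℤ.* u) ((j ℤ.⊖ j₀) ℤ.* v))
          (≤-trans (≤-reflexive (cong₂ _+_ (ℤ.abs-* (i ℤ.⊖ i₀) u) (ℤ.abs-* (j ℤ.⊖ j₀) v)))
            (small ℤ.∣ i ℤ.⊖ i₀ ∣ ℤ.∣ j ℤ.⊖ j₀ ∣ (close i i₀ (s≤s⁻¹ i<) (s≤s⁻¹ (proj₁ (proj₂ (proj₂ hit))))) (close j j₀ (s≤s⁻¹ j<) (s≤s⁻¹ (proj₁ (proj₂ (proj₂ (proj₂ hit))))))))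
          where
          close : ∀ m n {l} → m ≤ l → n ≤ l → ℤ.∣ m ℤ.⊖ n ∣ ≤ l
          close m n m≤ n≤ = ≤-trans (ℤ.∣m⊝n∣≤m⊔n m n) (⊔-lub m≤ n≤)

        moved : ∀ d → ℤ.∣ d ∣ ≤ R → S° (corner ⊕ zmul (vec i₀ j₀) ⊕ zmul d) ≡ true → extend A (+ (b + p₀) ℤ.+ d) ≡ true
        moved (+ d) d≤ p = trans (cong A (trans (+-assoc b p₀ d) (cong (λ z → b + z) (sym at)))) (∧-elimˡ (∧-elimˡ {S (corner ⊕ zmul (vec i₀ j₀) ⊕ zmul (+ d))} p))
          where
          at : index (corner ⊕ zmul (vec i₀ j₀) ⊕ zmul (+ d)) ≡ p₀ + d
          at = trans (cong (λ z → index (corner ⊕ zmul (vec i₀ j₀) ⊕ z)) (sym (enum-mul M′ d))) (trans (cong index (⊕-index (corner ⊕ zmul (vec i₀ j₀)) d)) (index-< (p₀ + d) (≤-<-trans (+-monoʳ-≤ p₀ d≤) p₀-high)))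
        moved -[1+ d ] d≤ p = trans (cong (extend A) (trans (ℤ.⊖-≥ (≤-trans (≤-trans d≤ p₀-low) (m≤n+m p₀ b))) (cong +_ (trans (+-∸-assoc b (≤-trans d≤ p₀-low)) (cong (λ z → b + z) (sym at))))))
            (∧-elimˡ (∧-elimˡ {S (corner ⊕ zmul (vec i₀ j₀) ⊕ zmul -[1+ d ])} p))
          where
          base : Carrier
          base = corner ⊕ zmul (vec i₀ j₀)
          at : index (base ⊕ zmul -[1+ d ]) ≡ p₀ ∸ suc d
          at = trans (cong index (trans (cong₂ (λ y z → y ⊕ (⊖ z)) (trans (sym (enum-index base)) (trans (cong enum (sym (m∸n+n≡m (≤-trans d≤ p₀-low)))) (sym (enum-+ M′ (p₀ ∸ suc d) (suc d))))) (sym (enum-mul M′ (suc d))))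
              ((group-≡ (enum (p₀ ∸ suc d) ∷ enum (suc d) ∷ []) (gv 0 ⊞ gv 1 ⊟ gv 1) (gv 0)))))
            (index-< (p₀ ∸ suc d) (≤-<-trans (m∸n≤m p₀ (suc d)) (index< base)))

        inside : ∀ i j → i < suc l₁ → j < suc l₂ → S° (corner ⊕ zmul (vec i j)) ≡ true → extend A (origin ℤ.+ vec i j) ≡ true
        inside i j i< j< p = trans (cong (extend A) (trans (cong (λ t → origin ℤ.+ t) (vec-δ i j)) (cancel (+ (b + p₀)) (vec i₀ j₀) (δ i j))))
            (moved (δ i j) (δ-small i j i< j<) (trans (cong S° (trans (assoc corner (zmul (vec i₀ j₀)) (zmul (δ i j))) (cong (corner ⊕_) (trans (sym (zmul-+ (vec i₀ j₀) (δ i j))) (cong zmul (sym (vec-δ i j))))))) p))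
          where
          cancel : ∀ x y z → (x ℤ.- y) ℤ.+ (y ℤ.+ z) ≡ x ℤ.+ z
          cancel x y z = trans (ℤ.+-assoc x (ℤ.- y) (y ℤ.+ z)) (cong (λ t → x ℤ.+ t) (trans (sym (ℤ.+-assoc (ℤ.- y) y z)) (trans (cong (ℤ._+ z) (ℤ.+-inverseˡ y)) (ℤ.+-identityˡ z))))

        plane : DensePlane A n κC N
        plane = record
          { base = origin ; a = u ; b = v ; l₁ = l₁ ; l₂ = l₂ ; proper = proper
          ; dense = ≤-trans dense (+-monoˡ-≤ size-N (*-monoʳ-≤ n hits≤))
          ; large = subst (_≤ κC * size-N) #S large }
          where
          hits≤ : hits ≤ ∑² (suc l₁) (suc l₂) (λ i j → ⟦ extend A (origin ℤ.+ vec i j) ⟧)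
          hits≤ = ≤-trans (Smooth.∑²-mono (ℤ/ M′) (suc l₁) (suc l₂) (λ i j i< j< → ⟦⟧-mono (inside i j i< j<))) (≤-reflexive (Smooth.∑²-∑ (ℤ/ M′) (suc l₁) (suc l₂) _))

      conclusion : DenseLine A n κC N ⊎ DensePlane A n κC N
      conclusion = [ (λ P → inj₁ (Line.line P)) , (λ P → inj₂ (Plane.plane P)) ]′ outcome′

module Assemble where

  open Sum
  open Grp
  open ZMod
  open Bounds using (module Levelwise)
  open Window
  open Params using (module Constants)
  open Fold
  open import Data.Nat.DivMod

  count-support : ∀ m (f : ℕ → Bool) → (∀ x → f x ≡ true → x < m) → ∀ n → count n f ≤ count m f
  count-support m f h n with ≤-total n m
  ... | inj₁ n≤m = ∑-monoˡ _ n≤m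
  ... | inj₂ m≤n = ≤-reflexive (trans (cong (λ l → count l f) (sym (m+[n∸m]≡n m≤n))) (trans (∑-split m (n ∸ m) _)
      (trans (cong (count m f +_) (trans (∑-cong (n ∸ m) (λ i _ → vanish i)) (∑-zero (n ∸ m)))) (+-identityʳ (count m f)))))
    where
    vanish : ∀ i → ⟦ f (m + i) ⟧ ≡ 0
    vanish i with f (m + i) in eq
    ... | false = refl
    ... | true  = ⊥-elim (<⇒≱ (h (m + i) eq) (m≤m+n m i))

  module Choice (k : ℕ) where
    open Constants k using (n; n≥2; n>0; κE; κζ; κsize; κζ-def; B; h′; B>0) public

    s Cb Ce n₀ w H : ℕ
    s  = κζ
    Cb = 50 * s
    Ce = 80 * n
    n₀ = 16 * (s * Ce)
    w  = 4 * n₀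
    H  = 1600 * s

    s>0 : 0 < s
    s>0 = (farkas (s ∷ h′ ∷ B ∷ []) ((con 4 :* ((con 1 :+ x1) :* x2) :≤ x0) ∷ (con 1 :≤ x2) ∷ []) (con 1) (x0) 3 (con 1 ∷ con 4 ∷ []) (≤-reflexive (sym κζ-def) , B>0 , tt))

    abstract
      γ : ℕ
      γ = 480 * s

      γ-def : γ ≡ 480 * s
      γ-def = refl

      Pr Γ f : ℕ → ℕ → ℕ
      Pr j c = 100 * (j * c) + 400 * (s * Cb)
      Γ  j c = γ * j + (160 * s + 2 * (c * (H * κE)))
      f  j c = 4 * (c * n₀) + 2 * (c * (H * κsize w))

      Pr-def : ∀ j c → Pr j c ≡ 100 * (j * c) + 400 * (s * Cb)
      Pr-def j c = refl

      Γ-def : ∀ j c → Γ j c ≡ γ * j + (160 * s + 2 * (c * (H * κE)))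
      Γ-def j c = refl

      f-def : ∀ j c → f j c ≡ 4 * (c * n₀) + 2 * (c * (H * κsize w))
      f-def j c = refl

      -- Bounds on 1 / (row error) and 1 / (relative size).
      K F : ℕ
      K = Levelwise.k-max Pr Γ (6 * γ) 1 1
      F = Levelwise.f-max Pr Γ f (6 * γ) 1 1

      K-def : Levelwise.k-max Pr Γ (6 * γ) 1 1 ≡ K
      K-def = refl

      F-def : Levelwise.f-max Pr Γ f (6 * γ) 1 1 ≡ F
      F-def = refl

      K>0 : 0 < K
      K>0 = Levelwise.k≤k-max Pr Γ (6 * γ) 1 1

  module Structure (k T : ℕ) (A D : ℕ → Bool) (E₀ d N : ℕ)
    (A-low : ∀ x → A x ≡ true → T ≤ x) (A-high : ∀ x → A x ≡ true → x < T + T)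
    (A-all : N ≤ count (T + T) A) (A-count : ∀ n → count n A ≤ N) (D-count : ∀ n → count n D ≤ d)
    (rows : ∀ a → A a ≡ true → ∀ n → count n (λ x → A x ∧ not (D (a + x))) ≤ E₀)
    (d-small : 16 * (Choice.s k * d) ≤ (64 * Choice.s k + 1) * N)
    (E-small : 16 * (Choice.s k * (Choice.K k * E₀)) ≤ N) (N-big : Choice.F k < N) where
    open Choice k

    m′ m : ℕ
    m′ = 8 * T
    m  = suc m′

    open Residues m′

    Â D̂ : Subset
    Â x = A (index x)
    D̂ x = D (index x)

    #Â : # Â ≡ N
    #Â = trans (pull A) (≤-antisym (A-count m) (≤-trans A-all (∑-monoˡ _ ((farkas (T ∷ []) ([]) (x0 :+ x0) (con 1 :+ con 8 :* x0) 0 ([]) (tt))))))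

    index-⊕ : ∀ x i → index x + i < m → index (x ⊕ enum i) ≡ index x + i
    index-⊕ x i h = trans (cong index (⊕-index x i)) (index-< (index x + i) h)

    rowsG : ∀ a → Â a ≡ true → out a Â D̂ ≤ E₀
    rowsG a p = ≤-trans (≤-reflexive (#-count _)) (≤-trans (∑-mono m (λ i i< → ⟦⟧-mono (step i i<))) (rows (index a) p m))
      where
      step : ∀ i → i < m → Â (enum i) ∧ not (D̂ (a ⊕ enum i)) ≡ true → A i ∧ not (D (index a + i)) ≡ true
      step i i< q = ∧-not Ai (trans (cong D (sym (index-⊕ a i ((farkas (index a ∷ i ∷ T ∷ []) ((con 1 :+ x0 :≤ x2 :+ x2) ∷ (con 1 :+ x1 :≤ x2 :+ x2) ∷ []) (con 1 :+ (x0 :+ x1)) (con 1 :+ con 8 :* x2) 0 (con 1 ∷ con 1 ∷ []) (A-high (index a) p , A-high i Ai , tt)))))) (∧-notʳ {Â (enum i)} q))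
        where
        Ai : A i ≡ true
        Ai = trans (cong A (sym (index-< i i<))) (∧-elimˡ q)

    N>0 : 0 < N
    N>0 = ≤-trans (s≤s z≤n) N-big

    d≤5N : d ≤ 5 * N
    d≤5N = *-cancelˡ-≤ (16 * s) ⦃ >-nonZero (*-mono-≤ {1} {16} (s≤s z≤n) s>0) ⦄ ((farkas (s ∷ d ∷ N ∷ []) ((con 16 :* (x0 :* x1) :≤ (con 64 :* x0 :+ con 1) :* x2) ∷ (con 1 :≤ x0) ∷ []) (con 16 :* x0 :* x1) (con 16 :* x0 :* (con 5 :* x2)) 0 (con 1 ∷ x2 ∷ []) (d-small , s>0 , tt)))

    KE-small : 16 * (K * E₀) ≤ N
    KE-small = (farkas (s ∷ N ∷ K * E₀ ∷ []) ((con 16 :* (x0 :* x2) :≤ x1) ∷ (con 1 :≤ x0) ∷ []) (con 16 :* x2) (x1) 0 (con 1 ∷ con 16 :* x2 ∷ []) (E-small , s>0 , tt))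

    E₀-small : 4 * E₀ ≤ N
    E₀-small = (farkas (K ∷ N ∷ E₀ ∷ []) ((con 16 :* (x0 :* x2) :≤ x1) ∷ (con 1 :≤ x0) ∷ []) (con 4 :* x2) (x1) 3 (con 1 ∷ con 16 :* x2 ∷ []) (KE-small , K>0 , tt))

    module Set = Levels.Setup (ℤ/ m′) Â D̂ E₀ (subst (0 <_) (sym #Â) N>0) rowsG
      (subst₂ (λ x y → x ≤ 5 * y) (sym (pull D)) (sym #Â) (≤-trans (D-count m) d≤5N)) (subst (4 * E₀ ≤_) (sym #Â) E₀-small)

    module Pig = Set.Pigeonhole Pr Γ f γ
      (λ j c → (farkas (Pr j c ∷ j * c ∷ s ∷ []) ((con 100 :* x1 :+ con 400 :* (x2 :* (con 50 :* x2)) :≤ x0) ∷ (con 1 :* con 1 :≤ x2 :* x2) ∷ []) (con 1) (x0) 19999 (con 1 ∷ con 20000 ∷ []) (≤-reflexive (sym (Pr-def j c)) , *-mono-≤ s>0 s>0 , tt)))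
      (λ j c → (farkas (Γ j c ∷ γ * j ∷ s ∷ c * (H * κE) ∷ []) ((x1 :+ (con 160 :* x2 :+ con 2 :* x3) :≤ x0) ∷ (con 1 :≤ x2) ∷ []) (con 1) (x0) 159 (con 1 ∷ con 160 ∷ []) (≤-reflexive (sym (Γ-def j c)) , s>0 , tt)))
      (λ j c → (farkas (Pr j c ∷ j * c ∷ s ∷ Cb ∷ []) ((con 100 :* x1 :+ con 400 :* (x2 :* x3) :≤ x0) ∷ []) (con 100 :* x1) (x0) 0 (con 1 ∷ []) (≤-reflexive (sym (Pr-def j c)) , tt)))
      (λ j c → (farkas (Γ j c ∷ γ * j ∷ s ∷ c * (H * κE) ∷ []) ((x1 :+ (con 160 :* x2 :+ con 2 :* x3) :≤ x0) ∷ []) (x1) (x0) 0 (con 1 ∷ []) (≤-reflexive (sym (Γ-def j c)) , tt)))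

    abstract
      found : Set.Outcome Pr Γ f γ F K
      found = subst (Set.Outcome Pr Γ f γ F) K-def (Pig.find ((farkas (s ∷ γ ∷ []) ((con 480 :* x0 :≤ x1) ∷ (con 1 :≤ x0) ∷ []) (con 1) (x1) 479 (con 1 ∷ con 480 ∷ []) (≤-reflexive (sym γ-def) , s>0 , tt))) (≤-reflexive F-def)
        (subst₂ (λ x y → x * E₀ ≤ y) (sym K-def) (sym #Â) ((farkas (K ∷ N ∷ K * E₀ ∷ []) ((con 16 :* x2 :≤ x1) ∷ []) (x2) (x1) 15 (con 1 ∷ []) (KE-small , tt)))))

    open Set.Outcome found renaming (k to j) public

    V Bad′ : ℕ → Bool
    V x    = (suc x ≤ᵇ m) ∧ U (enum x)
    Bad′ x = Bad (enum x)

    V-range : ∀ x → V x ≡ true → x < 4 * T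
    V-range x p with U-sums (enum x) (∧-elimʳ {suc x ≤ᵇ m} p)
    ... | a , a′ , pa , pa′ , e = ≤-trans (s≤s (≤-reflexive (trans (sym (index-< x (≤ᵇ-true (∧-elimˡ p))))
        (trans (cong index (trans e (cong (a ⊕_) (sym (enum-index a′))))) (index-⊕ a (index a′) (≤-trans sum< ((farkas (T ∷ []) ([]) (con 4 :* x0) (con 1 :+ con 8 :* x0) 0 ([]) (tt))))))))) sum<
      where
      sum< : index a + index a′ < 4 * T
      sum< = (farkas (index a ∷ index a′ ∷ T ∷ []) ((con 1 :+ x0 :≤ x2 :+ x2) ∷ (con 1 :+ x1 :≤ x2 :+ x2) ∷ []) (con 1 :+ (x0 :+ x1)) (con 4 :* x2) 0 (con 1 ∷ con 1 ∷ []) (A-high (index a) pa , A-high (index a′) pa′ , tt))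

    V-U : ∀ x → V x ≡ true → U (enum x) ≡ true
    V-U x p = ∧-elimʳ {suc x ≤ᵇ m} p

    V-false : ∀ x → x < m → V x ≡ false → U (enum x) ≡ false
    V-false x x<m p = ∧-false p (≤ᵇ-intro x<m)

    4T<m : 4 * T < m
    4T<m = (farkas (T ∷ []) ([]) (con 1 :+ con 4 :* x0) (con 1 :+ con 8 :* x0) 0 ([]) (tt))

    V-count : ∀ i → count i V ≤ # U
    V-count i = ≤-trans (count-support m V (λ x p → <-trans (V-range x p) 4T<m) i)
      (≤-trans (∑-mono m (λ x _ → ⟦⟧-mono (V-U x))) (≤-reflexive (sym (#-count U))))

    instance
      g≢0 : NonZero (Γ j c)
      g≢0 = >-nonZero ((farkas (Γ j c ∷ γ * j ∷ s ∷ c * (H * κE) ∷ []) ((x1 :+ (con 160 :* x2 :+ con 2 :* x3) :≤ x0) ∷ (con 1 :≤ x2) ∷ []) (con 1) (x0) 159 (con 1 ∷ con 160 ∷ []) (≤-reflexive (sym (Γ-def j c)) , s>0 , tt)))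
      160s≢0 : NonZero (160 * s)
      160s≢0 = >-nonZero (*-mono-≤ {1} {160} (s≤s z≤n) s>0)

    e₀ ν₀ : ℕ
    e₀ = N / Γ j c
    ν₀ = N / (160 * s)

    below : ∀ g .⦃ _ : NonZero g ⦄ x → g * x ≤ N → x ≤ N / g
    below g x h = ≤-trans (≤-reflexive (sym (m*n/n≡m x g))) (/-monoˡ-≤ g (≤-trans (≤-reflexive (*-comm x g)) h))

    ge₀ : Γ j c * e₀ ≤ N
    ge₀ = ≤-trans (≤-reflexive (*-comm (Γ j c) e₀)) (m/n*n≤m N (Γ j c))

    V-rows : ∀ x → A x ≡ true → Bad′ x ≡ false → ∀ i → count i (λ y → A y ∧ not (V (x + y))) ≤ e₀
    V-rows x p b i = below (Γ j c) _ (≤-trans (*-monoʳ-≤ (Γ j c) inner) (≤-trans (U-rows (enum x) (trans (cong A ix) p) b) (≤-reflexive #Â)))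
      where
      x< : x < m
      x< = ≤-trans (A-high x p) ((farkas (T ∷ []) ([]) (x0 :+ x0) (con 1 :+ con 8 :* x0) 0 ([]) (tt)))
      ix : index (enum x) ≡ x
      ix = index-< x x<
      inner : count i (λ y → A y ∧ not (V (x + y))) ≤ out (enum x) Â U
      inner = ≤-trans (count-support m _ (λ y q → ≤-trans (A-high y (∧-elimˡ q)) ((farkas (T ∷ []) ([]) (x0 :+ x0) (con 1 :+ con 8 :* x0) 0 ([]) (tt)))) i)
          (≤-trans (∑-mono m (λ y y< → ⟦⟧-mono (step y y<))) (≤-reflexive (sym (#-count _))))
        where
        step : ∀ y → y < m → A y ∧ not (V (x + y)) ≡ true → Â (enum y) ∧ not (U (enum x ⊕ enum y)) ≡ true
        step y y< q = ∧-not (trans (cong A (index-< y y<)) (∧-elimˡ q)) (trans (cong U (enum-+ m′ x y))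
          (V-false (x + y) ((farkas (x ∷ y ∷ T ∷ []) ((con 1 :+ x0 :≤ x2 :+ x2) ∷ (con 1 :+ x1 :≤ x2 :+ x2) ∷ []) (con 1 :+ (x0 :+ x1)) (con 1 :+ con 8 :* x2) 0 (con 1 ∷ con 1 ∷ []) (A-high x p , A-high y (∧-elimˡ q) , tt))) (∧-notʳ {A y} q)))

    V-period : ∀ x t → x + t < T + T → P (enum x) ≡ true → P (enum (x + t)) ≡ true → ∀ i → count i (λ y → V y ∧ not (V (y + t))) ≤ ν₀
    V-period x t t< p q i = below (160 * s) _ (*-cancelˡ-≤ 3 ((farkas (s ∷ N ∷ γ ∷ ν U (enum (x + t) ⊝ enum x) ∷ count i (λ y → V y ∧ not (V (y + t))) ∷ []) ((x2 :* x3 :≤ con 3 :* x1) ∷ (con 480 :* x0 :≤ x2) ∷ (x4 :≤ x3) ∷ []) (con 3 :* (con 160 :* x0 :* x4)) (con 3 :* x1) 0 (con 1 ∷ x3 ∷ con 480 :* x0 ∷ []) (subst (λ z → γ * ν U (enum (x + t) ⊝ enum x) ≤ 3 * z) #Â (P-periods (enum x) (enum (x + t)) p q) , ≤-reflexive (sym γ-def) , inner , tt))))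
      where
      inner : count i (λ y → V y ∧ not (V (y + t))) ≤ ν U (enum (x + t) ⊝ enum x)
      inner = ≤-trans (count-support m _ (λ y r → <-trans (V-range y (∧-elimˡ r)) 4T<m) i)
          (≤-trans (∑-mono m (λ y _ → ⟦⟧-mono (step y))) (≤-reflexive (sym (#-count _))))
        where
        step : ∀ y → V y ∧ not (V (y + t)) ≡ true → U (enum y) ∧ not (U (enum y ⊕ (enum (x + t) ⊝ enum x))) ≡ true
        step y r = ∧-not (V-U y (∧-elimˡ r)) (trans (cong U (trans (cong (λ z → enum y ⊕ (z ⊝ enum x)) (sym (enum-+ m′ x t)))
            (trans ((group-≡ (enum y ∷ enum x ∷ enum t ∷ []) (gv 0 ⊞ (gv 1 ⊞ gv 2 ⊟ gv 1)) (gv 0 ⊞ gv 2))) (enum-+ m′ y t))))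
          (V-false (y + t) ((farkas (x ∷ y ∷ t ∷ T ∷ []) ((con 1 :+ x1 :≤ con 4 :* x3) ∷ (con 1 :+ (x0 :+ x2) :≤ x3 :+ x3) ∷ []) (con 1 :+ (x1 :+ x2)) (con 1 :+ con 8 :* x3) 0 (con 1 ∷ con 1 ∷ []) (V-range y (∧-elimˡ r) , t< , tt))) (∧-notʳ {V y} r)))

    V-period′ : ∀ x t → x + t < T + T → P (enum x) ≡ true → P (enum (x + t)) ≡ true → ∀ i → count i (λ y → V (y + t) ∧ not (V y)) ≤ ν₀
    V-period′ x t t< p q i = below (160 * s) _ (*-cancelˡ-≤ 3 ((farkas (s ∷ N ∷ γ ∷ ν U (enum x ⊝ enum (x + t)) ∷ count i (λ y → V (y + t) ∧ not (V y)) ∷ []) ((x2 :* x3 :≤ con 3 :* x1) ∷ (con 480 :* x0 :≤ x2) ∷ (x4 :≤ x3) ∷ []) (con 3 :* (con 160 :* x0 :* x4)) (con 3 :* x1) 0 (con 1 ∷ x3 ∷ con 480 :* x0 ∷ []) (subst (λ z → γ * ν U (enum x ⊝ enum (x + t)) ≤ 3 * z) #Â (P-periods (enum (x + t)) (enum x) q p) , ≤-reflexive (sym γ-def) , inner , tt))))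
      where
      inner : count i (λ y → V (y + t) ∧ not (V y)) ≤ ν U (enum x ⊝ enum (x + t))
      inner = ≤-trans (count-support m _ (λ y r → ≤-trans (s≤s (m≤m+n y t)) (<-trans (V-range (y + t) (∧-elimˡ r)) 4T<m)) i)
          (≤-trans (∑-mono m (λ y y< → ⟦⟧-mono (step y y<))) (≤-trans (≤-reflexive (sym (#-count (λ z → U (z ⊕ enum t) ∧ not (U z)))))
            (≤-trans (#-subst (enum t) (λ z r → ∧-intro (∧-elimˡ r) (trans (cong (λ a → not (U a)) (trans (cong (λ a → z ⊕ enum t ⊕ (enum x ⊝ a)) (sym (enum-+ m′ x t)))
                ((group-≡ (z ∷ enum t ∷ enum x ∷ []) (gv 0 ⊞ gv 1 ⊞ (gv 2 ⊟ (gv 2 ⊞ gv 1))) (gv 0))))) (∧-elimʳ {U (z ⊕ enum t)} r)))) ≤-refl)))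
        where
        step : ∀ y → y < m → V (y + t) ∧ not (V y) ≡ true → U (enum y ⊕ enum t) ∧ not (U (enum y)) ≡ true
        step y y< r = ∧-not (trans (cong U (enum-+ m′ y t)) (V-U (y + t) (∧-elimˡ r))) (V-false y y< (∧-notʳ {V (y + t)} r))

    #P>0 : 0 < # P
    #P>0 = n≢0⇒n>0 λ z → <⇒≱ (subst (0 <_) (sym #Â) N>0) (≤-trans P-size (≤-reflexive (trans (cong (λ p → 2 * (c * p)) z) (trans (cong (2 *_) (*-zeroʳ c)) refl))))

    y₀ : ℕ
    y₀ = index (proj₁ (#-witness P #P>0))

    P-y₀ : P (enum y₀) ≡ true
    P-y₀ = trans (cong P (enum-index (proj₁ (#-witness P #P>0)))) (proj₂ (#-witness P #P>0))

    abstract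
      first : ∃[ p ] p ≤ y₀ × P (enum p) ≡ true × (∀ e → e < p → P (enum e) ≡ false)
      first = least (λ i → P (enum i)) y₀ P-y₀

      last : ∃[ p ] p ≤ m′ × P (enum p) ≡ true × (∀ e → p < e → e ≤ m′ → P (enum e) ≡ false)
      last = let t , t≤ , p , none = least (λ i → P (enum (m′ ∸ i))) (m′ ∸ y₀) (trans (cong (λ z → P (enum z)) (m∸[m∸n]≡n (s≤s⁻¹ (index< (proj₁ (#-witness P #P>0)))))) P-y₀) in
        m′ ∸ t , m∸n≤m m′ t , p , λ e e> e≤ → trans (cong (λ z → P (enum z)) (sym (m∸[m∸n]≡n e≤)))
          (none (m′ ∸ e) (+-cancelʳ-< e (m′ ∸ e) t (≤-<-trans (≤-reflexive (m∸n+n≡m e≤)) (≤-<-trans (≤-trans (≤-reflexive (sym (m∸n+n≡m (≤-trans t≤ (m∸n≤m m′ y₀))))) (≤-reflexive (+-comm (m′ ∸ t) t))) (+-monoʳ-< t e>)))))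

    lo hi : ℕ
    lo = proj₁ first
    hi = proj₁ last

    P-lo : P (enum lo) ≡ true
    P-lo = proj₁ (proj₂ (proj₂ first))

    P-hi : P (enum hi) ≡ true
    P-hi = proj₁ (proj₂ (proj₂ last))

    A-P : ∀ i → i ≤ m′ → P (enum i) ≡ true → A i ≡ true
    A-P i i≤ p = trans (cong A (sym (index-< i (s≤s i≤)))) (P⊆A (enum i) p)

    hi≤m′ : hi ≤ m′
    hi≤m′ = proj₁ (proj₂ last)

    lo≤m′ : lo ≤ m′
    lo≤m′ = ≤-trans (proj₁ (proj₂ first)) (s≤s⁻¹ (index< (proj₁ (#-witness P #P>0))))

    lo≤hi : lo ≤ hi
    lo≤hi = ≮⇒≥ λ h → true≢false P-hi (proj₂ (proj₂ (proj₂ first)) hi h)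

    spread : # P ≤ count (suc (hi ∸ lo)) (λ t → P (enum (lo + t)))
    spread = ≤-reflexive (trans (#-count P) (trans (cong (λ z → count z (λ i → P (enum i))) whole)
        (trans (∑-split (lo + suc (hi ∸ lo)) (m′ ∸ hi) _) (trans (cong₂ _+_ (trans (∑-split lo (suc (hi ∸ lo)) _) (cong (_+ count (suc (hi ∸ lo)) (λ t → P (enum (lo + t)))) (trans (∑-cong lo (λ i i< → cong ⟦_⟧ (proj₂ (proj₂ (proj₂ first)) i i<))) (∑-zero lo))))
          (trans (∑-cong (m′ ∸ hi) (λ i i< → cong ⟦_⟧ (proj₂ (proj₂ (proj₂ last)) (lo + suc (hi ∸ lo) + i) (≤-trans (≤-reflexive (sym top)) (m≤m+n _ i)) (≤-trans (≤-trans (≤-reflexive (cong (_+ i) top)) (≤-trans (≤-reflexive (sym (+-suc hi i))) (+-monoʳ-≤ hi i<))) (≤-reflexive (m+[n∸m]≡n hi≤m′)))))) (∑-zero (m′ ∸ hi)))) (+-identityʳ _)))))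
      where
      top : lo + suc (hi ∸ lo) ≡ suc hi
      top = trans (+-suc lo (hi ∸ lo)) (cong suc (m+[n∸m]≡n lo≤hi))
      whole : m ≡ lo + suc (hi ∸ lo) + (m′ ∸ hi)
      whole = sym (trans (cong (_+ (m′ ∸ hi)) top) (cong suc (m+[n∸m]≡n hi≤m′)))

    P-spread : N ≤ 2 * (c * # P)
    P-spread = subst (_≤ 2 * (c * # P)) #Â P-size

    far-apart : 2 * n₀ ≤ hi ∸ lo
    far-apart = ≮⇒≥ λ h → 1+n≰n {0} ((farkas (c ∷ N ∷ F ∷ n₀ ∷ # P ∷ hi ∸ lo ∷ f j c ∷ c * (H * κsize w) ∷ []) ((x1 :≤ con 2 :* (x0 :* x4)) ∷ (x4 :≤ con 1 :+ x5) ∷ (con 1 :+ x5 :≤ con 2 :* x3) ∷ (con 4 :* (x0 :* x3) :+ con 2 :* x7 :≤ x6) ∷ (x6 :≤ x2) ∷ (con 1 :+ x2 :≤ x1) ∷ []) (con 1) (con 0) 0 (con 1 ∷ con 2 :* x0 ∷ con 2 :* x0 ∷ con 1 ∷ con 1 ∷ con 1 ∷ []) (P-spread , (≤-trans spread (≤-trans (∑-mono (suc (hi ∸ lo)) (λ t _ → ⟦⟧≤1 _)) (≤-reflexive (trans (∑-const (suc (hi ∸ lo)) 1) (*-identityʳ _))))) , h , ≤-reflexive (sym (f-def j c)) , cost , N-big , tt)))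

    n₀>0 : 0 < n₀
    n₀>0 = (farkas (s ∷ n ∷ []) ((con 1 :* con 1 :≤ x0 :* x1) ∷ []) (con 1) (con 16 :* (x0 :* (con 80 :* x1))) 0 (con 1 ∷ []) (*-mono-≤ s>0 n>0 , tt))

    2n₀≢0 : NonZero (2 * n₀)
    2n₀≢0 = >-nonZero (*-mono-≤ {1} {2} (s≤s z≤n) n₀>0)

    R : ℕ
    R = _/_ (hi ∸ lo) (2 * n₀) ⦃ 2n₀≢0 ⦄

    R-fits : n₀ * (2 * R) ≤ hi ∸ lo
    R-fits = ≤-trans ((farkas (n₀ ∷ R ∷ []) ([]) (x0 :* (con 2 :* x1)) (x1 :* (con 2 :* x0)) 0 ([]) (tt))) (m/n*n≤m (hi ∸ lo) (2 * n₀) ⦃ 2n₀≢0 ⦄)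

    R>0 : 0 < R
    R>0 = ≤-trans (≤-reflexive (sym (n/n≡1 (2 * n₀) ⦃ 2n₀≢0 ⦄))) (/-monoˡ-≤ (2 * n₀) ⦃ 2n₀≢0 ⦄ far-apart)

    R-big : hi ∸ lo ≤ w * R
    R-big = (farkas (hi ∸ lo ∷ n₀ ∷ R ∷ _%_ (hi ∸ lo) (2 * n₀) ⦃ 2n₀≢0 ⦄ ∷ []) ((x0 :≤ x3 :+ x2 :* (con 2 :* x1)) ∷ (x3 :≤ con 2 :* x1) ∷ (con 1 :≤ x2) ∷ []) (x0) (con 4 :* x1 :* x2) 0 (con 1 ∷ con 1 ∷ con 2 :* x1 ∷ []) (≤-reflexive (m≡m%n+[m/n]*n (hi ∸ lo) (2 * n₀) ⦃ 2n₀≢0 ⦄) , <⇒≤ (m%n<n (hi ∸ lo) (2 * n₀) ⦃ 2n₀≢0 ⦄) , R>0 , tt))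

    c>0 : 0 < c
    c>0 = n≢0⇒n>0 λ z → <⇒≱ N>0 (≤-trans P-spread (≤-reflexive (cong (λ y → 2 * (y * # P)) z)))

    u-small : 8 * (s * # U) ≤ (32 * s + 1) * N
    u-small = *-cancelˡ-≤ 2 ((farkas (s ∷ N ∷ d ∷ # U ∷ # D̂ ∷ K * E₀ ∷ []) ((x3 :≤ x4 :+ x5) ∷ (x4 :≤ x2) ∷ (con 16 :* (x0 :* x2) :≤ (con 64 :* x0 :+ con 1) :* x1) ∷ (con 16 :* (x0 :* x5) :≤ x1) ∷ []) (con 2 :* (con 8 :* (x0 :* x3))) (con 2 :* ((con 32 :* x0 :+ con 1) :* x1)) 0 (con 16 :* x0 ∷ con 16 :* x0 ∷ con 1 ∷ con 1 ∷ []) (U-size , ≤-trans (≤-reflexive (pull D)) (D-count m) , d-small , E-small , tt)))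

    e₀-small : 160 * (s * e₀) ≤ N
    e₀-small = (farkas (Γ j c ∷ γ * j ∷ s ∷ N ∷ e₀ ∷ c * (H * κE) ∷ []) ((x1 :+ (con 160 :* x2 :+ con 2 :* x5) :≤ x0) ∷ (x0 :* x4 :≤ x3) ∷ []) (con 160 :* (x2 :* x4)) (x3) 0 (x4 ∷ con 1 ∷ []) (≤-reflexive (sym (Γ-def j c)) , ge₀ , tt))

    ν₀-small : 160 * (s * ν₀) ≤ N
    ν₀-small = ≤-trans (≤-reflexive (trans (sym (*-assoc 160 s ν₀)) (*-comm (160 * s) ν₀))) (m/n*n≤m N (160 * s))

    bad-small : 8 * (s * (Cb * # Bad)) ≤ N
    bad-small = *-cancelˡ-≤ 50 ((farkas (Pr j c ∷ j * c ∷ s ∷ Cb ∷ # Bad ∷ N ∷ []) ((con 100 :* x1 :+ con 400 :* (x2 :* x3) :≤ x0) ∷ (x0 :* x4 :≤ con 50 :* x5) ∷ []) (con 50 :* (con 8 :* (x2 :* (x3 :* x4)))) (con 50 :* x5) 0 (x4 ∷ con 1 ∷ []) (≤-reflexive (sym (Pr-def j c)) , subst (λ z → Pr j c * # Bad ≤ 50 * z) #Â Bad-size , tt)))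

    clean : 0 < # (λ x → Â x ∧ not (Bad x))
    clean = n≢0⇒n>0 λ z → 1+n≰n {0} ((farkas (N ∷ s ∷ # Bad ∷ # (λ x → Â x ∧ Bad x) ∷ # (λ x → Â x ∧ not (Bad x)) ∷ []) ((x0 :≤ x3 :+ x4) ∷ (x4 :≤ con 0) ∷ (x3 :≤ x2) ∷ (con 8 :* (x1 :* (con 50 :* x1 :* x2)) :≤ x0) ∷ (con 1 :* con 1 :* x2 :≤ x1 :* x1 :* x2) ∷ (con 1 :≤ x0) ∷ []) (con 1) (con 0) 398 (con 400 ∷ con 400 ∷ con 400 ∷ con 1 ∷ con 400 ∷ con 399 ∷ []) (≤-reflexive (trans (sym #Â) (#-split Â Bad)) , ≤-reflexive z , #-mono {λ x → Â x ∧ Bad x} (λ x → ∧-elimʳ {Â x}) , bad-small , *-mono-≤ (*-mono-≤ s>0 s>0) (≤-refl {# Bad}) , N>0 , tt)))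

    module Folded (M′ : ℕ) (M-def : suc M′ ≡ hi ∸ lo) where
      M : ℕ
      M = suc M′

      lo+M : lo + M ≡ hi
      lo+M = trans (cong (lo +_) M-def) (m+[n∸m]≡n lo≤hi)

      hi<2T : hi < T + T
      hi<2T = A-high hi (A-P hi hi≤m′ P-hi)

      M≤T : M ≤ T
      M≤T = (farkas (M ∷ T ∷ lo ∷ hi ∷ []) ((x2 :+ x0 :≤ x3) ∷ (con 1 :+ x3 :≤ x1 :+ x1) ∷ (x1 :≤ x2) ∷ []) (x0) (x1) 0 (con 1 ∷ con 1 ∷ con 1 ∷ []) (≤-reflexive lo+M , hi<2T , A-low lo (A-P lo lo≤m′ P-lo) , tt))

      Q : ℕ → Bool
      Q t = (t ≤ᵇ M) ∧ P (enum (lo + t))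

      #P≤Q : # P ≤ count (suc M) Q
      #P≤Q = ≤-trans spread (≤-trans (≤-reflexive (cong (λ z → count (suc z) (λ t → P (enum (lo + t)))) (sym M-def))) (∑-mono (suc M) (λ t t< → ⟦⟧-mono (λ p → ∧-intro (≤ᵇ-intro (s≤s⁻¹ t<)) p))))

      a₀ : Carrier
      a₀ = proj₁ (#-witness (λ x → Â x ∧ not (Bad x)) clean)

      clean-a₀ : Â a₀ ∧ not (Bad a₀) ≡ true
      clean-a₀ = proj₂ (#-witness (λ x → Â x ∧ not (Bad x)) clean)

      open Select A Bad′ V Q M (T + T) N (count (suc M) Q) (# U) e₀ ν₀ (# Bad) (s≤s z≤n)
        (λ x p → ≤-trans M≤T (A-low x p)) A-all A-count V-count refl
        (λ t p → V-period lo t (≤-<-trans (≤-trans (+-monoʳ-≤ lo (≤ᵇ-true (∧-elimˡ p))) (≤-reflexive lo+M)) hi<2T) P-lo (∧-elimʳ {t ≤ᵇ M} p))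
        (V-period lo M (≤-<-trans (≤-reflexive lo+M) hi<2T) P-lo (trans (cong (λ z → P (enum z)) lo+M) P-hi))
        (V-period′ lo M (≤-<-trans (≤-reflexive lo+M) hi<2T) P-lo (trans (cong (λ z → P (enum z)) lo+M) P-hi))
        (index a₀) (V-rows (index a₀) (∧-elimˡ clean-a₀) (trans (cong Bad (enum-index a₀)) (∧-notʳ {Â a₀} clean-a₀)))
        (λ i → ≤-trans (count-support m _ (λ x p → ≤-trans (A-high x (∧-elimˡ p)) ((farkas (T ∷ []) ([]) (x0 :+ x0) (con 1 :+ con 8 :* x0) 0 ([]) (tt)))) i) (≤-trans (∑-mono m (λ x _ → ⟦⟧-mono (∧-elimʳ {A x}))) (≤-reflexive (sym (#-count Bad)))))
        c s Cb Ce n₀ R c>0 s>0 N>0 (≤-trans P-spread (*-monoʳ-≤ 2 (*-monoʳ-≤ c #P≤Q))) (≤-trans R-fits (≤-reflexive (sym M-def))) n₀>0 u-small e₀-small ν₀-small bad-small ≤-refl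

      abstract
        window : ∃[ b ] penalty b < gain b
        window = selected

      b : ℕ
      b = proj₁ window

      α ζ : ℕ
      α = count M (λ i → A (b + i) ∧ not (Bad′ (b + i)))
      ζ = count M (λ i → V (b + b + i) ∨ V (b + b + i + M)) ∸ 2 * α

      open Wrap k w M′ A Bad′ V b R e₀ ζ

      mass-split : mass b ≡ spoilt b + α
      mass-split = trans (∑-cong M (λ i _ → ⟦⟧-split (A (b + i)) (Bad′ (b + i)))) (∑-+ M (λ i → ⟦ A (b + i) ∧ Bad′ (b + i) ⟧) (λ i → ⟦ A (b + i) ∧ not (Bad′ (b + i)) ⟧))

      heavy-b : heavy b ≡ true
      heavy-b with bool (heavy b)
      ... | inj₁ p = p
      ... | inj₂ p = ⊥-elim (n≮0 (≤-trans (proj₂ window) (≤-reflexive (trans (cong (λ z → (4 * s + 1) * (⟦ z ⟧ * mass b)) p) (*-zeroʳ (4 * s + 1))))))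

      chosen : s * (shadow b + defect b + Cb * spoilt b) + s * (Ce * border b) < (4 * s + 1) * mass b
      chosen = subst (penalty b <_) (cong ((4 * s + 1) *_) (trans (cong (λ z → ⟦ z ⟧ * mass b) heavy-b) (+-identityʳ (mass b)))) (proj₂ window)

      heavy-mass : N ≤ c * (H * mass b)
      heavy-mass = ≤ᵇ-true heavy-b

      few-spoilt : Cb * spoilt b ≤ 5 * mass b
      few-spoilt = *-cancelˡ-≤ s ⦃ >-nonZero s>0 ⦄ ((farkas (s ∷ mass b ∷ shadow b ∷ defect b ∷ Cb * spoilt b ∷ Ce * border b ∷ []) ((con 1 :+ (x0 :* (x2 :+ x3 :+ x4) :+ x0 :* x5) :≤ (con 4 :* x0 :+ con 1) :* x1) ∷ (con 1 :≤ x0) ∷ []) (x0 :* x4) (x0 :* (con 5 :* x1)) 0 (con 1 ∷ x1 ∷ []) (chosen , s>0 , tt)))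

      few-border : Ce * border b ≤ 5 * mass b
      few-border = *-cancelˡ-≤ s ⦃ >-nonZero s>0 ⦄ ((farkas (s ∷ mass b ∷ shadow b ∷ defect b ∷ Cb * spoilt b ∷ Ce * border b ∷ []) ((con 1 :+ (x0 :* (x2 :+ x3 :+ x4) :+ x0 :* x5) :≤ (con 4 :* x0 :+ con 1) :* x1) ∷ (con 1 :≤ x0) ∷ []) (x0 :* x5) (x0 :* (con 5 :* x1)) 0 (con 1 ∷ x1 ∷ []) (chosen , s>0 , tt)))

      mass≤ : mass b ≤ 2 * α
      mass≤ = (farkas (s ∷ mass b ∷ spoilt b ∷ α ∷ []) ((x1 :≤ x2 :+ x3) ∷ (con 50 :* x0 :* x2 :≤ con 5 :* x1) ∷ (con 1 :≤ x0) ∷ []) (x1) (con 2 :* x3) 44 (con 50 ∷ con 1 ∷ con 50 :* x2 ∷ []) (≤-reflexive mass-split , few-spoilt , s>0 , tt))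

      α>0 : 0 < α
      α>0 = n≢0⇒n>0 λ z → 1+n≰n {0} ((farkas (c ∷ H ∷ N ∷ α ∷ mass b ∷ []) ((x2 :≤ x0 :* (x1 :* x4)) ∷ (x4 :≤ con 2 :* x3) ∷ (x3 :≤ con 0) ∷ (con 1 :≤ x2) ∷ []) (con 1) (con 0) 0 (con 1 ∷ x0 :* x1 ∷ con 2 :* x0 :* x1 ∷ con 1 ∷ []) (heavy-mass , mass≤ , ≤-reflexive z , N>0 , tt)))

      D-total : 2 * count M (λ i → V (b + b + i) ∨ V (b + b + i + M)) ≡ shadow b + defect b
      D-total = trans (sym (∑-*ˡ M 2 (λ i → ⟦ V (b + b + i) ∨ V (b + b + i + M) ⟧))) (trans (∑-cong M (λ i _ → trans (cong (λ x → 2 * ⟦ V x ∨ V (x + M) ⟧) (left i)) (union (V (2 * b + i)) (V (2 * b + i + M)))))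
          (trans (∑-+ M (λ i → v₁ i + v₂ i) (λ i → d₁ i + d₂ i)) (cong₂ _+_ shadow≡ (∑-+ M d₁ d₂))))
        where
        v₁ v₂ d₁ d₂ : ℕ → ℕ
        v₁ i = ⟦ V (2 * b + i) ⟧
        v₂ i = ⟦ V (2 * b + i + M) ⟧
        d₁ i = ⟦ V (2 * b + i) ∧ not (V (2 * b + i + M)) ⟧
        d₂ i = ⟦ V (2 * b + i + M) ∧ not (V (2 * b + i)) ⟧
        union : ∀ x y → 2 * ⟦ x ∨ y ⟧ ≡ ⟦ x ⟧ + ⟦ y ⟧ + (⟦ x ∧ not y ⟧ + ⟦ y ∧ not x ⟧)
        union true  true  = refl
        union true  false = refl
        union false true  = refl
        union false false = refl
        left : ∀ i → b + b + i ≡ 2 * b + i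
        left i = (ring-≡ (b ∷ i ∷ []) (x0 :+ x0 :+ x1) (con 2 :* x0 :+ x1))
        shadow≡ : ∑ M (λ i → v₁ i + v₂ i) ≡ shadow b
        shadow≡ = trans (∑-+ M v₁ v₂) (sym (trans (cong (λ z → ∑ z v₁) ((ring-≡ (M ∷ []) (con 2 :* x0) (x0 :+ x0)))) (trans (∑-split M M v₁)
          (cong (λ z → ∑ M v₁ + z) (∑-cong M (λ i _ → cong (λ x → ⟦ V x ⟧) ((ring-≡ (b ∷ i ∷ M ∷ []) (con 2 :* x0 :+ (x2 :+ x1)) (con 2 :* x0 :+ x1 :+ x2)))))))))

      ζ-bound : κζ * ζ ≤ α
      ζ-bound = ≤-trans (≤-reflexive (*-distribˡ-∸ s _ (2 * α))) (m≤n+o⇒m∸n≤o (s * count M (λ i → V (b + b + i) ∨ V (b + b + i + M))) (s * (2 * α))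
        (*-cancelˡ-≤ 2 ((farkas (s ∷ mass b ∷ count M (λ i → V (b + b + i) ∨ V (b + b + i + M)) ∷ shadow b ∷ defect b ∷ spoilt b ∷ Cb * spoilt b ∷ Ce * border b ∷ α ∷ []) ((con 1 :+ (x0 :* (x3 :+ x4 :+ x6) :+ x0 :* x7) :≤ (con 4 :* x0 :+ con 1) :* x1) ∷ (con 2 :* x2 :≤ x3 :+ x4) ∷ (x1 :≤ x5 :+ x8) ∷ (con 50 :* x0 :* x5 :≤ con 5 :* x1) ∷ (x1 :≤ con 2 :* x8) ∷ (con 1 :≤ x0) ∷ []) (con 2 :* (x0 :* x2)) (con 2 :* (x0 :* (con 2 :* x8) :+ x8)) 9 (con 10 ∷ con 10 :* x0 ∷ con 10 :* (con 4 :* x0) :+ con 10 ∷ con 1 ∷ con 5 ∷ con 10 :* x5 ∷ []) (chosen , ≤-reflexive D-total , ≤-reflexive mass-split , few-spoilt , mass≤ , s>0 , tt)))))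

      e-bound : κE * e₀ ≤ α
      e-bound = *-cancelˡ-≤ (2 * (c * H)) ⦃ >-nonZero (*-mono-≤ {1} {2} (s≤s z≤n) (*-mono-≤ c>0 (*-mono-≤ {1} {1600} (s≤s z≤n) s>0))) ⦄
        ((farkas (c ∷ H ∷ N ∷ α ∷ mass b ∷ Γ j c ∷ γ * j ∷ s ∷ e₀ ∷ κE ∷ []) ((x6 :+ (con 160 :* x7 :+ con 2 :* (x0 :* (x1 :* x9))) :≤ x5) ∷ (x5 :* x8 :≤ x2) ∷ (x2 :≤ x0 :* (x1 :* x4)) ∷ (x4 :≤ con 2 :* x3) ∷ []) (con 2 :* (x0 :* x1) :* (x9 :* x8)) (con 2 :* (x0 :* x1) :* x3) 0 (x8 ∷ con 1 ∷ con 1 ∷ x0 :* x1 ∷ []) (≤-reflexive (sym (Γ-def j c)) , ge₀ , heavy-mass , mass≤ , tt)))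

      R≤M : R ≤ M
      R≤M = (farkas (n₀ ∷ R ∷ M ∷ hi ∸ lo ∷ []) ((x0 :* (con 2 :* x1) :≤ x3) ∷ (x3 :≤ x2) ∷ (con 1 :≤ x0) ∷ []) (x1) (x2) 1 (con 1 ∷ con 1 ∷ con 2 :* x1 ∷ []) (R-fits , ≤-reflexive (sym M-def) , n₀>0 , tt))

      edge-border : count M (λ i → good i ∧ edge i) ≤ border b
      edge-border = ≤-trans (∑-mono M (λ i _ → pointwise i)) (≤-trans (≤-reflexive (∑-+ M (λ i → ⟦ low i ⟧) (λ i → ⟦ high i ⟧))) (+-mono-≤ low≤ high≤))
        where
        low high : ℕ → Bool
        low i  = A (b + i) ∧ (suc i ≤ᵇ R)
        high i = A (b + i) ∧ (M ≤ᵇ i + R)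
        pointwise : ∀ i → ⟦ good i ∧ edge i ⟧ ≤ ⟦ low i ⟧ + ⟦ high i ⟧
        pointwise i = cases (A (b + i)) (not (Bad′ (b + i))) (suc i ≤ᵇ R) (M ≤ᵇ i + R)
          where
          cases : ∀ a g x y → ⟦ (a ∧ g) ∧ (x ∨ y) ⟧ ≤ ⟦ a ∧ x ⟧ + ⟦ a ∧ y ⟧
          cases false _     _     _     = z≤n
          cases true  false _     _     = z≤n
          cases true  true  true  _     = s≤s z≤n
          cases true  true  false true  = s≤s z≤n
          cases true  true  false false = z≤n
        low≤ : count M low ≤ ∑ R (λ r → ⟦ A (b + r) ⟧)
        low≤ = ≤-trans (count-support R low (λ i p → ≤ᵇ-true {suc i} (∧-elimʳ {A (b + i)} p)) M) (∑-mono R (λ i _ → ⟦⟧-mono (∧-elimˡ {A (b + i)})))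
        high≤ : count M high ≤ ∑ R (λ r → ⟦ A (b + (M ∸ R) + r) ⟧)
        high≤ = ≤-trans (≤-reflexive (trans (cong (λ z → count z high) (sym (m∸n+n≡m R≤M))) (trans (∑-split (M ∸ R) R (λ i → ⟦ high i ⟧))
            (cong (_+ ∑ R (λ i → ⟦ high (M ∸ R + i) ⟧)) (trans (∑-cong (M ∸ R) (λ i i< → none i i<)) (∑-zero (M ∸ R)))))))
          (∑-mono R (λ i _ → ⟦⟧-mono (λ p → trans (cong A (+-assoc b (M ∸ R) i)) (∧-elimˡ {A (b + (M ∸ R + i))} p))))
          where
          none : ∀ i → i < M ∸ R → ⟦ high i ⟧ ≡ 0
          none i i< = off (bool (high i))
            where
            off : (high i ≡ true) ⊎ (high i ≡ false) → ⟦ high i ⟧ ≡ 0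
            off (inj₂ p) = cong ⟦_⟧ p
            off (inj₁ p) = ⊥-elim (<⇒≱ (≤-trans (+-monoˡ-< R i<) (≤-reflexive (m∸n+n≡m R≤M))) (≤ᵇ-true (∧-elimʳ {A (b + i)} p)))

      edge-bound : 8 * (n * count M (λ i → good i ∧ edge i)) ≤ α
      edge-bound = *-cancelˡ-≤ 10 ((farkas (n ∷ count M (λ i → good i ∧ edge i) ∷ border b ∷ mass b ∷ α ∷ []) ((x1 :≤ x2) ∷ (con 80 :* x0 :* x2 :≤ con 5 :* x3) ∷ (x3 :≤ con 2 :* x4) ∷ []) (con 10 :* (con 8 :* (x0 :* x1))) (con 10 :* x4) 0 (con 80 :* x0 ∷ con 1 ∷ con 5 ∷ []) (edge-border , few-border , mass≤ , tt)))

      size-bound : ∀ l → α ≤ κsize w * l → N ≤ F * l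
      size-bound l h = (farkas (c ∷ H ∷ N ∷ F ∷ α ∷ l ∷ mass b ∷ κsize w ∷ f j c ∷ c * n₀ ∷ []) ((x2 :≤ x0 :* (x1 :* x6)) ∷ (x6 :≤ con 2 :* x4) ∷ (x4 :≤ x7 :* x5) ∷ (con 4 :* x9 :+ con 2 :* (x0 :* (x1 :* x7)) :≤ x8) ∷ (x8 :≤ x3) ∷ []) (x2) (x3 :* x5) 0 (con 1 ∷ x0 :* x1 ∷ con 2 :* x0 :* x1 ∷ x5 ∷ x5 ∷ []) (heavy-mass , mass≤ , h , ≤-reflexive (sym (f-def j c)) , cost , tt))

      conclude : DenseLine A n F N ⊎ DensePlane A n F N
      conclude = [ (λ P → inj₁ (let open DenseLine P in record { base = base ; step = step ; len = len ; step>0 = step>0 ; dense = dense ; large = size-bound len large }))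
                 , (λ P → inj₂ (let open DensePlane P renaming (a to u; b to v) in record { base = base ; a = u ; b = v ; l₁ = l₁ ; l₂ = l₂ ; proper = proper ; dense = dense ; large = size-bound (suc l₁ * suc l₂) large })) ]′
        (Apply.conclusion V-rows α>0 (m≤n+m∸n _ (2 * α)) ζ-bound e-bound R>0 (≤-trans (≤-reflexive M-def) R-big) edge-bound)

    abstract
      structure : DenseLine A n F N ⊎ DensePlane A n F N
      structure = Folded.conclude ((hi ∸ lo) ∸ 1) (m+[n∸m]≡n (≤-trans n₀>0 (≤-trans (m≤m+n n₀ _) far-apart)))

-- Finite sets of integers

module Lists where

  open Sum
  open import Data.List.Base using (length; map; cartesianProduct; _++_; filter)
  open import Data.List.Membership.Propositional using (_∈_)
  open import Data.List.Relation.Unary.Any using (here; there)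
  open import Data.List.Relation.Unary.All as All using (All; []; _∷_)
  open import Data.List.Relation.Unary.AllPairs using ([]; _∷_)
  open import Data.List.Relation.Unary.Unique.Propositional using (Unique)
  open import Relation.Binary.Definitions using (DecidableEquality)
  open import Relation.Nullary using (does)
  open import Relation.Unary using (Pred; Decidable)

  cnt : {X : Set} → (X → Bool) → List X → ℕ
  cnt p []       = 0
  cnt p (x ∷ xs) = ⟦ p x ⟧ + cnt p xs

  cnt-mono : ∀ {X : Set} {p q : X → Bool} xs → (∀ x → x ∈ xs → p x ≡ true → q x ≡ true) → cnt p xs ≤ cnt q xs
  cnt-mono []       h = z≤n
  cnt-mono (x ∷ xs) h = +-mono-≤ (⟦⟧-mono (h x (here refl))) (cnt-mono xs (λ y y∈ → h y (there y∈)))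

  cnt-split : ∀ {X : Set} (p : X → Bool) xs → cnt p xs + cnt (λ x → not (p x)) xs ≡ length xs
  cnt-split p []       = refl
  cnt-split p (x ∷ xs) with p x
  ... | true  = cong suc (cnt-split p xs)
  ... | false = trans (+-suc (cnt p xs) _) (cong suc (cnt-split p xs))

  cnt≤length : ∀ {X : Set} (p : X → Bool) xs → cnt p xs ≤ length xs
  cnt≤length p xs = ≤-trans (m≤m+n (cnt p xs) _) (≤-reflexive (cnt-split p xs))

  cnt-+ : ∀ {X : Set} (p q : X → Bool) xs → (∀ x → p x ≡ true → q x ≡ true → ⊥) → cnt p xs + cnt q xs ≡ cnt (λ x → p x ∨ q x) xs
  cnt-+ p q []       h = refl
  cnt-+ p q (x ∷ xs) h = trans ((ring-≡ (⟦ p x ⟧ ∷ cnt p xs ∷ ⟦ q x ⟧ ∷ cnt q xs ∷ []) (x0 :+ x1 :+ (x2 :+ x3)) (x0 :+ x2 :+ (x1 :+ x3))))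
    (cong₂ _+_ (bits (p x) (q x) (h x)) (cnt-+ p q xs h))
    where
    bits : ∀ a b → (a ≡ true → b ≡ true → ⊥) → ⟦ a ⟧ + ⟦ b ⟧ ≡ ⟦ a ∨ b ⟧
    bits true  true  f = ⊥-elim (f refl refl)
    bits true  false f = refl
    bits false b     f = refl

  cnt-filter : ∀ {X : Set} {ℓ} {P : Pred X ℓ} (P? : Decidable P) xs → length (filter P? xs) ≡ cnt (λ x → does (P? x)) xs
  cnt-filter P? []       = refl
  cnt-filter P? (x ∷ xs) with P? x
  ... | yes _ = cong suc (cnt-filter P? xs)
  ... | no  _ = cnt-filter P? xs

  cnt-++ : ∀ {X : Set} (p : X → Bool) xs ys → cnt p (xs ++ ys) ≡ cnt p xs + cnt p ys
  cnt-++ p []       ys = refl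
  cnt-++ p (x ∷ xs) ys = trans (cong (⟦ p x ⟧ +_) (cnt-++ p xs ys)) (sym (+-assoc ⟦ p x ⟧ (cnt p xs) (cnt p ys)))

  cnt-map : ∀ {X Y : Set} (p : Y → Bool) (f : X → Y) xs → cnt p (map f xs) ≡ cnt (λ x → p (f x)) xs
  cnt-map p f []       = refl
  cnt-map p f (x ∷ xs) = cong (⟦ p (f x) ⟧ +_) (cnt-map p f xs)

  -- Markov's inequality for the rows of a relation.
  cnt-product : ∀ {X Y : Set} (p : X × Y → Bool) c (xs : List X) (ys : List Y) →
                cnt (λ x → suc c ≤ᵇ cnt (λ y → p (x , y)) ys) xs * suc c ≤ cnt p (cartesianProduct xs ys)
  cnt-product p c []       ys = z≤n
  cnt-product p c (x ∷ xs) ys = ≤-trans (≤-reflexive (*-distribʳ-+ (suc c) ⟦ suc c ≤ᵇ cnt (λ y → p (x , y)) ys ⟧ (cnt (λ x → suc c ≤ᵇ cnt (λ y → p (x , y)) ys) xs)))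
    (≤-trans (+-mono-≤ row (cnt-product p c xs ys)) (≤-reflexive (sym (trans (cnt-++ p (map (x ,_) ys) _) (cong (_+ cnt p (cartesianProduct xs ys)) (cnt-map p (x ,_) ys))))))
    where
    row : ⟦ suc c ≤ᵇ cnt (λ y → p (x , y)) ys ⟧ * suc c ≤ cnt (λ y → p (x , y)) ys
    row with suc c ≤ᵇ cnt (λ y → p (x , y)) ys in eq
    ... | false = z≤n
    ... | true  = ≤-trans (≤-reflexive (+-identityʳ (suc c))) (≤ᵇ-true eq)

  module Member {X : Set} (_≟_ : DecidableEquality X) where

    eqX : X → X → Bool
    eqX x y = does (x ≟ y)

    eqX-≡ : ∀ {x y} → eqX x y ≡ true → x ≡ y
    eqX-≡ {x} {y} p with x ≟ y
    ... | yes e = e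

    eqX-refl : ∀ x → eqX x x ≡ true
    eqX-refl x with x ≟ x
    ... | yes _ = refl
    ... | no ¬p = ⊥-elim (¬p refl)

    mem : List X → X → Bool
    mem []       z = false
    mem (x ∷ xs) z = eqX x z ∨ mem xs z

    mem-∈ : ∀ xs {z} → mem xs z ≡ true → z ∈ xs
    mem-∈ (x ∷ xs) {z} p with x ≟ z
    ... | yes e = here (sym e)
    ... | no _  = there (mem-∈ xs p)

    ∈-mem : ∀ {xs z} → z ∈ xs → mem xs z ≡ true
    ∈-mem {x ∷ xs} {z} (here refl) = cong (_∨ mem xs z) (eqX-refl z)
    ∈-mem {x ∷ xs} {z} (there p) with eqX x z
    ... | true  = refl
    ... | false = ∈-mem p

    cnt-∈ : ∀ x ys → x ∈ ys → 1 ≤ cnt (eqX x) ys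
    cnt-∈ x (y ∷ ys) (here refl) = ≤-trans (≤-reflexive (cong ⟦_⟧ (sym (eqX-refl x)))) (m≤m+n _ _)
    cnt-∈ x (y ∷ ys) (there p)   = ≤-trans (cnt-∈ x ys p) (m≤n+m _ _)

    length≤cnt : ∀ xs ys → Unique xs → (∀ {x} → x ∈ xs → x ∈ ys) → length xs ≤ cnt (mem xs) ys
    length≤cnt []       ys _        h = z≤n
    length≤cnt (x ∷ xs) ys (x∉ ∷ u) h = ≤-trans (+-mono-≤ (cnt-∈ x ys (h (here refl))) (length≤cnt xs ys u (λ p → h (there p))))
      (≤-reflexive (cnt-+ (eqX x) (mem xs) ys (λ y p q → All.lookup x∉ (mem-∈ xs q) (eqX-≡ p))))

    ∑²-atmost1 : ∀ m n (e : ℕ → ℕ → Bool) → (∀ i j i′ j′ → i < m → j < n → i′ < m → j′ < n → e i j ≡ true → e i′ j′ ≡ true → i ≡ i′ × j ≡ j′) →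
                 ∑ m (λ i → ∑ n (λ j → ⟦ e i j ⟧)) ≤ 1
    ∑²-atmost1 m n e u = ≤-trans (∑-mono m (λ i i< → row i i<)) (∑-atmost1 m (λ i → 1 ≤ᵇ ∑ n (λ j → ⟦ e i j ⟧)) same)
      where
      row : ∀ i → i < m → ∑ n (λ j → ⟦ e i j ⟧) ≤ ⟦ 1 ≤ᵇ ∑ n (λ j → ⟦ e i j ⟧) ⟧
      row i i< with ∑ n (λ j → ⟦ e i j ⟧) | ∑-atmost1 n (e i) (λ j j′ j< j′< p q → proj₂ (u i j i j′ i< j< i< j′< p q))
      ... | zero        | _ = z≤n
      ... | suc zero    | _ = s≤s z≤n
      ... | suc (suc _) | s≤s ()
      point : ∀ i → (1 ≤ᵇ ∑ n (λ j → ⟦ e i j ⟧)) ≡ true → ∃[ j ] j < n × e i j ≡ true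
      point i p = let j , j< , q = ∑-exists n (λ j → ⟦ e i j ⟧) (≤ᵇ-true p) in j , j< , ⟦⟧-true q
      same : ∀ i i′ → i < m → i′ < m → (1 ≤ᵇ ∑ n (λ j → ⟦ e i j ⟧)) ≡ true → (1 ≤ᵇ ∑ n (λ j → ⟦ e i′ j ⟧)) ≡ true → i ≡ i′
      same i i′ i< i′< p q = let j , j< , a = point i p ; j′ , j′< , b = point i′ q in proj₁ (u i j i′ j′ i< j< i′< j′< a b)

    module Family (m n : ℕ) (φ : ℕ → ℕ → X)
      (φ-injective : ∀ i j i′ j′ → i < m → j < n → i′ < m → j′ < n → φ i j ≡ φ i′ j′ → i ≡ i′ × j ≡ j′) where

      hits : ∀ xs (p : X → Bool) → ∑ m (λ i → ∑ n (λ j → ⟦ mem xs (φ i j) ∧ p (φ i j) ⟧)) ≤ cnt p xs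
      hits []       p = ≤-reflexive (trans (∑-cong m (λ _ _ → ∑-zero n)) (∑-zero m))
      hits (x ∷ xs) p = ≤-trans (∑-mono m (λ i _ → ≤-trans (∑-mono n (λ j _ → split (φ i j))) (≤-reflexive (∑-+ n (λ j → ⟦ eqX x (φ i j) ∧ p x ⟧) (λ j → ⟦ mem xs (φ i j) ∧ p (φ i j) ⟧)))))
          (≤-trans (≤-reflexive (∑-+ m (λ i → ∑ n (λ j → ⟦ eqX x (φ i j) ∧ p x ⟧)) (λ i → ∑ n (λ j → ⟦ mem xs (φ i j) ∧ p (φ i j) ⟧)))) (+-mono-≤ (first (p x)) (hits xs p)))
        where
        split : ∀ z → ⟦ (eqX x z ∨ mem xs z) ∧ p z ⟧ ≤ ⟦ eqX x z ∧ p x ⟧ + ⟦ mem xs z ∧ p z ⟧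
        split z with x ≟ z
        ... | yes refl = m≤m+n _ _
        ... | no _     = ≤-refl
        first : ∀ b → ∑ m (λ i → ∑ n (λ j → ⟦ eqX x (φ i j) ∧ b ⟧)) ≤ ⟦ b ⟧
        first false = ≤-reflexive (trans (∑-cong m (λ i _ → trans (∑-cong n (λ j _ → cong ⟦_⟧ (∧-zeroʳ (eqX x (φ i j))))) (∑-zero n))) (∑-zero m))
          where open import Data.Bool.Properties using (∧-zeroʳ)
        first true = ∑²-atmost1 m n (λ i j → eqX x (φ i j) ∧ true) (λ i j i′ j′ a b c d p q → φ-injective i j i′ j′ a b c d
            (trans (sym (eqX-≡ (drop p))) (eqX-≡ (drop q))))
          where
          drop : ∀ {b} → b ∧ true ≡ true → b ≡ true
          drop {true} _ = refl

    covered : ∀ (n : ℕ) (φ : ℕ → X) xs (p : X → Bool) → Unique xs → (∀ {x} → x ∈ xs → ∃[ i ] i < n × φ i ≡ x) →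
              cnt p xs ≤ ∑ n (λ i → ⟦ mem xs (φ i) ∧ p (φ i) ⟧)
    covered n φ []       p _        h = z≤n
    covered n φ (x ∷ xs) p (x∉ ∷ u) h = ≤-trans (+-mono-≤ first (covered n φ xs p u (λ q → h (there q))))
        (≤-trans (≤-reflexive (sym (∑-+ n (λ i → ⟦ eqX x (φ i) ∧ p x ⟧) (λ i → ⟦ mem xs (φ i) ∧ p (φ i) ⟧)))) (∑-mono n (λ i _ → join (φ i))))
      where
      first : ⟦ p x ⟧ ≤ ∑ n (λ i → ⟦ eqX x (φ i) ∧ p x ⟧)
      first = let i , i< , e = h (here refl) in ≤-trans (≤-reflexive (cong (λ b → ⟦ b ∧ p x ⟧) (sym (trans (cong (eqX x) e) (eqX-refl x))))) (∑-point n (λ i → ⟦ eqX x (φ i) ∧ p x ⟧) i i<)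
      join : ∀ z → ⟦ eqX x z ∧ p x ⟧ + ⟦ mem xs z ∧ p z ⟧ ≤ ⟦ (eqX x z ∨ mem xs z) ∧ p z ⟧
      join z with x ≟ z
      ... | no _ = ≤-refl
      ... | yes refl with mem xs x in eq
      ...   | false = ≤-reflexive (+-identityʳ _)
      ...   | true  = ⊥-elim (All.lookup x∉ (mem-∈ xs eq) refl)

module Convert where

  open Sum
  open Lists
  open import Defs using (FinSet; mkFinSet; Progression; Proper)
  open Fold using (DenseLine; DensePlane; extend)
  open import Data.Fin.Base as Fin using (Fin; toℕ; fromℕ<)
  import Data.Fin.Properties as Fin
  open import Data.List.Base using (length; applyUpTo; allFin; cartesianProductWith; map)
  import Data.List.Properties as List
  open import Data.List.Membership.Propositional using (_∈_)
  open import Data.List.Membership.Propositional.Properties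
  open import Data.List.Relation.Unary.Unique.Propositional using (Unique)
  import Data.List.Relation.Unary.Unique.Propositional.Properties as Unique
  open import Data.Integer.Base as ℤ using (ℤ; +_; -[1+_]; 1ℤ)
  import Data.Integer.Properties as ℤ
  import Data.Integer.Tactic.RingSolver as ℤR
  open import Function.Bundles using (mk⇔)

  size : ∀ {d} → Progression d → ℕ
  size P = length (FinSet.elements (Progression.set P))

  length-product : ∀ {X Y Z : Set} (f : X → Y → Z) xs ys → length (cartesianProductWith f xs ys) ≡ length xs * length ys
  length-product f []       ys = refl
  length-product f (x ∷ xs) ys = trans (List.length-++ (map (f x) ys)) (cong₂ _+_ (List.length-map (f x) ys) (length-product f xs ys))

  coordinate : ∀ n {l : ℤ} → 1ℤ ℤ.≤ l → l ℤ.≤ + n → ∃[ i ] i < n × l ≡ + suc i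
  coordinate n {+ suc i} _ (ℤ.+≤+ h) = i , h , refl
  coordinate n {+ zero}  (ℤ.+≤+ ()) _
  coordinate n { -[1+ _ ]} () _

  module LineOf (z : ℤ) (q n : ℕ) (q>0 : 0 < q) (n>0 : 0 < n) where
    point : ℕ → ℤ
    point i = z ℤ.+ + (i * q)

    point-injective : ∀ {i j} → point i ≡ point j → i ≡ j
    point-injective {i} {j} e = *-cancelʳ-≡ i j q ⦃ >-nonZero q>0 ⦄ (ℤ.+-injective (∙-cancelˡ z (+ (i * q)) (+ (j * q)) e))
      where
      open import Algebra.Bundles using (module AbelianGroup)
      open import Algebra.Properties.Group (AbelianGroup.group ℤ.+-0-abelianGroup) using (∙-cancelˡ)

    coords : ∀ i → point i ≡ (z ℤ.- + q) ℤ.+ (+ suc i ℤ.* + q ℤ.+ + 0)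
    coords i = trans (cong (λ t → z ℤ.+ t) (ℤ.pos-* i q)) (identity z (+ i) (+ q))
      where
      identity : ∀ z i q → z ℤ.+ i ℤ.* q ≡ (z ℤ.- q) ℤ.+ ((+ 1 ℤ.+ i) ℤ.* q ℤ.+ + 0)
      identity = ℤR.solve-∀

    line : Progression 1
    line = record
      { set  = mkFinSet (applyUpTo point n) (Unique.applyUpTo⁺₁ point n (λ i<j _ e → <⇒≢ i<j (point-injective e)))
      ; base = z ℤ.- + q ; step = λ _ → + q ; len = λ _ → n ; len≥1 = λ _ → n>0
      ; members = λ x → mk⇔
          (λ x∈ → let i , i< , e = ∈-applyUpTo⁻ point x∈ in (λ _ → + suc i) , (λ _ → ℤ.+≤+ (s≤s z≤n) , ℤ.+≤+ i<) , trans e (coords i))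
          (λ (l , range , e) → let i , i< , e′ = coordinate n (proj₁ (range Fin.zero)) (proj₂ (range Fin.zero)) in
            subst (_∈ applyUpTo point n) (sym (trans e (trans (cong (λ t → (z ℤ.- + q) ℤ.+ (t ℤ.* + q ℤ.+ + 0)) e′) (sym (coords i))))) (∈-applyUpTo⁺ point i<)) }

    size-line : size line ≡ n
    size-line = List.length-applyUpTo point n

  module PlaneOf (z a b : ℤ) (l₁ l₂ : ℕ)
    (proper : ∀ i j i′ j′ → i ≤ l₁ → j ≤ l₂ → i′ ≤ l₁ → j′ ≤ l₂ →
              + i ℤ.* a ℤ.+ + j ℤ.* b ≡ + i′ ℤ.* a ℤ.+ + j′ ℤ.* b → i ≡ i′ × j ≡ j′) where
    point : ℕ → ℕ → ℤ
    point i j = z ℤ.+ (+ i ℤ.* a ℤ.+ + j ℤ.* b)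

    point-injective : ∀ i j i′ j′ → i < suc l₁ → j < suc l₂ → i′ < suc l₁ → j′ < suc l₂ → point i j ≡ point i′ j′ → i ≡ i′ × j ≡ j′
    point-injective i j i′ j′ p q p′ q′ e = proper i j i′ j′ (s≤s⁻¹ p) (s≤s⁻¹ q) (s≤s⁻¹ p′) (s≤s⁻¹ q′) (∙-cancelˡ z _ _ e)
      where
      open import Algebra.Bundles using (module AbelianGroup)
      open import Algebra.Properties.Group (AbelianGroup.group ℤ.+-0-abelianGroup) using (∙-cancelˡ)

    coords : ∀ i j → point i j ≡ (z ℤ.- a ℤ.- b) ℤ.+ (+ suc i ℤ.* a ℤ.+ (+ suc j ℤ.* b ℤ.+ + 0))
    coords i j = identity z a b (+ i) (+ j)
      where
      identity : ∀ z a b i j → z ℤ.+ (i ℤ.* a ℤ.+ j ℤ.* b) ≡ (z ℤ.- a ℤ.- b) ℤ.+ ((+ 1 ℤ.+ i) ℤ.* a ℤ.+ ((+ 1 ℤ.+ j) ℤ.* b ℤ.+ + 0))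
      identity = ℤR.solve-∀

    pointF : Fin (suc l₁) → Fin (suc l₂) → ℤ
    pointF i j = point (toℕ i) (toℕ j)

    points : List ℤ
    points = cartesianProductWith pointF (allFin (suc l₁)) (allFin (suc l₂))

    point-∈ : ∀ i j → i < suc l₁ → j < suc l₂ → point i j ∈ points
    point-∈ i j i< j< = subst (_∈ points) (cong₂ point (Fin.toℕ-fromℕ< i<) (Fin.toℕ-fromℕ< j<)) (∈-cartesianProductWith⁺ pointF (∈-allFin (fromℕ< i<)) (∈-allFin (fromℕ< j<)))

    plane : Progression 2
    plane = record
      { set  = mkFinSet points (Unique.cartesianProductWith⁺ pointF
          (λ {w} {x} {y} {u} e → let p , q = point-injective (toℕ w) (toℕ y) (toℕ x) (toℕ u) (Fin.toℕ<n w) (Fin.toℕ<n y) (Fin.toℕ<n x) (Fin.toℕ<n u) e in Fin.toℕ-injective p , Fin.toℕ-injective q)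
          (Unique.allFin⁺ (suc l₁)) (Unique.allFin⁺ (suc l₂)))
      ; base = z ℤ.- a ℤ.- b ; step = steps ; len = lens ; len≥1 = λ { Fin.zero → s≤s z≤n ; (Fin.suc Fin.zero) → s≤s z≤n }
      ; members = λ x → mk⇔
          (λ x∈ → let i , j , _ , _ , e = ∈-cartesianProductWith⁻ pointF (allFin (suc l₁)) (allFin (suc l₂)) x∈ in
             (λ { Fin.zero → + suc (toℕ i) ; (Fin.suc Fin.zero) → + suc (toℕ j) })
           , (λ { Fin.zero → ℤ.+≤+ (s≤s z≤n) , ℤ.+≤+ (Fin.toℕ<n i) ; (Fin.suc Fin.zero) → ℤ.+≤+ (s≤s z≤n) , ℤ.+≤+ (Fin.toℕ<n j) })
           , trans e (coords (toℕ i) (toℕ j)))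
          (λ (l , range , e) →
            let i , i< , e₁ = coordinate (suc l₁) (proj₁ (range Fin.zero)) (proj₂ (range Fin.zero))
                j , j< , e₂ = coordinate (suc l₂) (proj₁ (range (Fin.suc Fin.zero))) (proj₂ (range (Fin.suc Fin.zero)))
            in subst (_∈ points) (sym (trans e (trans (cong₂ (λ s t → (z ℤ.- a ℤ.- b) ℤ.+ (s ℤ.* a ℤ.+ (t ℤ.* b ℤ.+ + 0))) e₁ e₂) (sym (coords i j))))) (point-∈ i j i< j<)) }
      where
      steps : Fin 2 → ℤ
      steps Fin.zero           = a
      steps (Fin.suc Fin.zero) = b
      lens : Fin 2 → ℕ
      lens Fin.zero           = suc l₁
      lens (Fin.suc Fin.zero) = suc l₂

    size-plane : size plane ≡ suc l₁ * suc l₂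
    size-plane = trans (length-product pointF (allFin (suc l₁)) (allFin (suc l₂))) (cong₂ _*_ (List.length-tabulate {n = suc l₁} (λ i → i)) (List.length-tabulate {n = suc l₂} (λ i → i)))

    proper-plane : Proper plane
    proper-plane = trans size-plane (cong (suc l₁ *_) (sym (*-identityʳ (suc l₂))))

  open Member ℤ._≟_

  meet : FinSet ℤ → ∀ {d} → Progression d → ℕ
  meet L P = length (FinSet.elements (L Defs.∩ Progression.set P))

  meet-cnt : ∀ L {d} (P : Progression d) → cnt (mem (FinSet.elements (Progression.set P))) (FinSet.elements L) ≤ meet L P
  meet-cnt L P = ≤-trans (cnt-mono (FinSet.elements L) (λ z _ p → true-does z (mem-∈ E p))) (≤-reflexive (sym (cnt-filter (λ z → z ∈? E) (FinSet.elements L))))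
    where
    open import Data.List.Membership.DecPropositional ℤ._≟_ using (_∈?_)
    open import Relation.Nullary using (does)
    E : List ℤ
    E = FinSet.elements (Progression.set P)
    true-does : ∀ z → z ∈ E → does (z ∈? E) ≡ true
    true-does z p with z ∈? E
    ... | yes _ = refl
    ... | no ¬p = ⊥-elim (¬p p)

  record Conclusion (L : FinSet ℤ) (n C : ℕ) {d} (P : Progression d) (c : ℕ) : Set where
    field
      large : length (FinSet.elements L) ≤ C * size P
      dense : n * size P ≤ c * (n * meet L P) + c * size P

  module Pull (L : FinSet ℤ) (σ : ℕ) (A : ℕ → Bool) (A-sound : ∀ x → A x ≡ true → (+ x ℤ.- + σ) ∈ FinSet.elements L) where

    extend-sound : ∀ z → extend A z ≡ true → (z ℤ.- + σ) ∈ FinSet.elements L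
    extend-sound (+ x) p = A-sound x p

    from-line : ∀ {n C N} C′ → 0 < N → (∀ l → N ≤ C * l → length (FinSet.elements L) ≤ C′ * l) → DenseLine A n C N → Σ[ P ∈ Progression 1 ] Conclusion L n C′ P 2
    from-line {n} {C} {N} C′ N>0 scale D = line , record
        { large = subst (λ s → length (FinSet.elements L) ≤ C′ * s) (sym size-line) (scale len large)
        ; dense = subst (λ s → n * s ≤ 2 * (n * meet L line) + 2 * s) (sym size-line) (≤-trans dense (+-monoˡ-≤ (2 * len) (*-monoʳ-≤ 2 (*-monoʳ-≤ n hit)))) }
      where
      open DenseLine D
      len>0 : 0 < len
      len>0 = n≢0⇒n>0 λ e → <⇒≱ N>0 (≤-trans large (≤-reflexive (trans (cong (C *_) e) (*-zeroʳ C))))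
      open LineOf (+ base ℤ.- + σ) step len step>0 len>0 hiding (line)
      line : Progression 1
      line = LineOf.line (+ base ℤ.- + σ) step len step>0 len>0
      E : List ℤ
      E = FinSet.elements (Progression.set line)
      at : ∀ l → A (base + l * step) ≡ true → point l ∈ FinSet.elements L
      at l p = subst (_∈ FinSet.elements L) (shift (+ base) (+ (l * step)) (+ σ)) (A-sound (base + l * step) p)
        where
        shift : ∀ x y s → (x ℤ.+ y) ℤ.- s ≡ (x ℤ.- s) ℤ.+ y
        shift = ℤR.solve-∀
      hit : ∑ len (λ l → ⟦ A (base + l * step) ⟧) ≤ meet L line
      hit = ≤-trans (∑-mono len (λ l l< → ⟦⟧-mono {A (base + l * step)} (λ p → both (∈-mem (at l p)) (∈-mem (∈-applyUpTo⁺ point l<)))))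
        (≤-trans (≤-reflexive (sym (+-identityʳ _))) (≤-trans (Family.hits 1 len (λ _ l → point l) (λ { zero l zero l′ _ _ _ _ e → refl , point-injective e ; (suc _) _ _ _ (s≤s ()) ; zero _ (suc _) _ _ _ (s≤s ()) }) (FinSet.elements L) (mem E)) (meet-cnt L line)))
        where
        both : ∀ {x y} → x ≡ true → y ≡ true → x ∧ y ≡ true
        both refl refl = refl

    from-plane : ∀ {n C N} C′ → (∀ l → N ≤ C * l → length (FinSet.elements L) ≤ C′ * l) → DensePlane A n C N → Σ[ P ∈ Progression 2 ] Proper P × Conclusion L n C′ P 1
    from-plane {n} {C} {N} C′ scale D = plane , proper-plane , record
        { large = subst (λ s → length (FinSet.elements L) ≤ C′ * s) (sym size-plane) (scale (suc l₁ * suc l₂) large)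
        ; dense = subst (λ s → n * s ≤ 1 * (n * meet L plane) + 1 * s) (sym size-plane) (≤-trans dense (+-mono-≤ (≤-trans (*-monoʳ-≤ n hit) (≤-reflexive (sym (+-identityʳ _)))) (≤-reflexive (sym (+-identityʳ _))))) }
      where
      open DensePlane D
      open PlaneOf (base ℤ.- + σ) a b l₁ l₂ proper
      E : List ℤ
      E = FinSet.elements (Progression.set plane)
      at : ∀ i j → extend A (base ℤ.+ (+ i ℤ.* a ℤ.+ + j ℤ.* b)) ≡ true → point i j ∈ FinSet.elements L
      at i j p = subst (_∈ FinSet.elements L) (shift base (+ i ℤ.* a ℤ.+ + j ℤ.* b) (+ σ)) (extend-sound (base ℤ.+ (+ i ℤ.* a ℤ.+ + j ℤ.* b)) p)
        where
        shift : ∀ x y s → (x ℤ.+ y) ℤ.- s ≡ (x ℤ.- s) ℤ.+ y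
        shift = ℤR.solve-∀
      hit : ∑ (suc l₁) (λ i → ∑ (suc l₂) (λ j → ⟦ extend A (base ℤ.+ (+ i ℤ.* a ℤ.+ + j ℤ.* b)) ⟧)) ≤ meet L plane
      hit = ≤-trans (∑-mono (suc l₁) (λ i i< → ∑-mono (suc l₂) (λ j j< → ⟦⟧-mono {extend A (base ℤ.+ (+ i ℤ.* a ℤ.+ + j ℤ.* b))} (λ p → both (∈-mem (at i j p)) (∈-mem (point-∈ i j i< j<))))))
        (≤-trans (Family.hits (suc l₁) (suc l₂) point point-injective (FinSet.elements L) (mem E)) (meet-cnt L plane))
        where
        both : ∀ {x y} → x ≡ true → y ≡ true → x ∧ y ≡ true
        both refl refl = refl

module Discrete where

  open Sum
  open Lists
  open Convert
  open import Defs using (FinSet; Progression; Proper; sumsetAlong)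
  open Window using (count)
  open Assemble using (module Choice; module Structure)
  open Fold using (DenseLine; DensePlane)
  open import Data.List.Base using (length; cartesianProduct; foldr)
  open import Data.List.Membership.Propositional using (_∈_)
  open import Data.List.Membership.Propositional.Properties
  open import Data.List.Relation.Unary.Any using (here; there)
  open import Data.Nat.DivMod
  open import Data.Integer.Base as ℤ using (ℤ; +_; -[1+_])
  import Data.Integer.Properties as ℤ
  import Data.Integer.Tactic.RingSolver as ℤR
  open import Data.Product.Properties using (≡-dec)

  open Member ℤ._≟_
  module Pairs = Member (≡-dec ℤ._≟_ ℤ._≟_)

  height : List ℤ → ℕ
  height = foldr (λ z h → ℤ.∣ z ∣ ⊔ h) 0

  ∈-height : ∀ {zs z} → z ∈ zs → ℤ.∣ z ∣ ≤ height zs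
  ∈-height {z ∷ zs} (here refl) = m≤m⊔n ℤ.∣ z ∣ (height zs)
  ∈-height {y ∷ zs} (there p)   = ≤-trans (∈-height p) (m≤n⊔m ℤ.∣ y ∣ (height zs))

  module Shift (σ : ℕ) where
    down : ℕ → ℤ
    down x = + x ℤ.- + σ

    down-⊖ : ∀ x → down x ≡ x ℤ.⊖ σ
    down-⊖ x = ℤ.m-n≡m⊖n x σ

    down-low : ∀ {h} x → ℤ.∣ down x ∣ ≤ h → σ ≤ x + h
    down-low {h} x p with ≤-total x σ
    ... | inj₁ x≤σ = ≤-trans (≤-reflexive (sym (m+[n∸m]≡n x≤σ))) (+-monoʳ-≤ x (≤-trans (≤-reflexive (sym (trans (cong ℤ.∣_∣ (down-⊖ x)) (ℤ.∣⊖∣-≤ x≤σ)))) p))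
    ... | inj₂ σ≤x = ≤-trans σ≤x (m≤m+n x h)

    down-high : ∀ {h} x → ℤ.∣ down x ∣ ≤ h → x ≤ σ + h
    down-high {h} x p with ≤-total x σ
    ... | inj₁ x≤σ = ≤-trans x≤σ (m≤m+n σ h)
    ... | inj₂ σ≤x = ≤-trans (≤-reflexive (sym (m+[n∸m]≡n σ≤x))) (+-monoʳ-≤ σ (≤-trans (≤-reflexive (sym (cong ℤ.∣_∣ (trans (down-⊖ x) (ℤ.⊖-≥ σ≤x))))) p))

    down-injective : ∀ {x y} → down x ≡ down y → x ≡ y
    down-injective e = ℤ.+-injective (∙-cancelʳ (ℤ.- + σ) _ _ e)
      where
      open import Algebra.Bundles using (module AbelianGroup)
      open import Algebra.Properties.Group (AbelianGroup.group ℤ.+-0-abelianGroup) using (∙-cancelʳ)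

    down-onto : ∀ z → ℤ.∣ z ∣ ≤ σ → ∃[ x ] down x ≡ z
    down-onto (+ u)    _ = u + σ , trans (down-⊖ (u + σ)) (trans (ℤ.⊖-≥ (m≤n+m σ u)) (cong +_ (m+n∸n≡m u σ)))
    down-onto -[1+ u ] h = σ ∸ suc u , trans (down-⊖ (σ ∸ suc u)) (trans (ℤ.⊖-≤ (m∸n≤m σ (suc u))) (cong (λ t → ℤ.- + t) (m∸[m∸n]≡n h)))

    hits₁ : ∀ i zs (p : ℤ → Bool) → count i (λ x → mem zs (down x) ∧ p (down x)) ≤ cnt p zs
    hits₁ i zs p = ≤-trans (≤-reflexive (sym (+-identityʳ _))) (Family.hits 1 i (λ _ x → down x) (λ { zero x zero y _ _ _ _ e → refl , down-injective e ; (suc _) _ _ _ (s≤s ()) ; zero _ (suc _) _ _ _ (s≤s ()) }) zs p)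

  module Finite (k : ℕ) where
    open Choice k using (n; s; K; F; s>0; K>0) public

    κ C : ℕ
    κ = 32 * (s * K)
    C = 100 * (s * κ) + (2 * F + 1)

    κ>0 : 0 < κ
    κ>0 = *-mono-≤ {1} {32} (s≤s z≤n) (*-mono-≤ s>0 K>0)

    instance
      κ≢0 : NonZero κ
      κ≢0 = >-nonZero κ>0

    small : (A : FinSet ℤ) → ∀ {x} → x ∈ FinSet.elements A → length (FinSet.elements A) ≤ 2 * F → Σ[ P ∈ Progression 1 ] Conclusion A n C P 2
    small A {x} x∈ few = line , record
        { large = ≤-trans few ((farkas (F ∷ 100 * (s * κ) ∷ []) ([]) (con 2 :* x0) ((x1 :+ (con 2 :* x0 :+ con 1)) :* con 1) 0 ([]) (tt)))
        ; dense = (farkas (n ∷ meet A line ∷ []) ((con 1 :≤ x1) ∷ []) (x0 :* con 1) (con 2 :* (x0 :* x1) :+ con 2 :* con 1) 0 (x0 ∷ []) (met , tt)) }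
      where
      open LineOf x 1 1 (s≤s z≤n) (s≤s z≤n)
      met : 1 ≤ meet A line
      met = ≤-trans (cnt-∈ x (FinSet.elements A) x∈) (≤-trans (cnt-mono (FinSet.elements A) (λ z _ p → ∈-mem {FinSet.elements (Progression.set line)} (here (trans (sym (eqX-≡ p)) (sym (ℤ.+-identityʳ x)))))) (meet-cnt A line))

    module _ (A : FinSet ℤ) (Γ : FinSet (ℤ × ℤ)) where
      private
        E : List ℤ
        E = FinSet.elements A
        a : ℕ
        a = length E
        S : List ℤ
        S = FinSet.elements (sumsetAlong Γ)

      module Dense (Γ⊆ : ∀ {p} → p ∈ FinSet.elements Γ → p ∈ cartesianProduct E E) (Γ-big : C * (a * a) ≤ C * length (FinSet.elements Γ) + a * a)
        (S-small : C * length S ≤ (4 * C + 1) * a) (a-big : 2 * F < a) where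

        outside : ℤ × ℤ → Bool
        outside p = not (Pairs.mem (FinSet.elements Γ) p)

        E₀ : ℕ
        E₀ = a / κ

        many few : ℤ → Bool
        many z = suc E₀ ≤ᵇ cnt (λ z′ → outside (z , z′)) E
        few z  = not (many z)

        N bad : ℕ
        N   = cnt few E
        bad = cnt many E

        bad+N : bad + N ≡ a
        bad+N = cnt-split many E

        bad-small : C * bad ≤ κ * a
        bad-small = *-cancelʳ-≤ (C * bad) (κ * a) a ⦃ >-nonZero a>0 ⦄ ((farkas (C ∷ κ ∷ a ∷ suc E₀ ∷ bad ∷ cnt outside (cartesianProduct E E) ∷ []) ((x4 :* x3 :≤ x5) ∷ (x0 :* x5 :≤ x2 :* x2) ∷ (x2 :≤ x1 :* x3) ∷ []) (x0 :* x4 :* x2) (x1 :* x2 :* x2) 0 (x0 :* x1 ∷ x1 ∷ x0 :* x4 ∷ []) (cnt-product outside E₀ E E , outside-small , <⇒≤ a<κ , tt)))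
          where
          a>0 : 0 < a
          a>0 = ≤-trans (s≤s z≤n) a-big
          a<κ : a < κ * suc E₀
          a<κ = (farkas (κ ∷ a ∷ E₀ ∷ a % κ ∷ []) ((x1 :≤ x3 :+ x2 :* x0) ∷ (con 1 :+ x3 :≤ x0) ∷ []) (con 1 :+ x1) (x0 :* (con 1 :+ x2)) 0 (con 1 ∷ con 1 ∷ []) (≤-reflexive (m≡m%n+[m/n]*n a κ) , m%n<n a κ , tt))
          outside-small : C * cnt outside (cartesianProduct E E) ≤ a * a
          outside-small = (farkas (C ∷ length (FinSet.elements Γ) ∷ cnt (Pairs.mem (FinSet.elements Γ)) (cartesianProduct E E) ∷ cnt outside (cartesianProduct E E) ∷ a ∷ []) ((x0 :* (x4 :* x4) :≤ x0 :* x1 :+ x4 :* x4) ∷ (x1 :≤ x2) ∷ (x2 :+ x3 :≤ x4 :* x4) ∷ []) (x0 :* x3) (x4 :* x4) 0 (con 1 ∷ x0 ∷ x0 ∷ []) (Γ-big , Pairs.length≤cnt (FinSet.elements Γ) (cartesianProduct E E) (FinSet.unique Γ) Γ⊆ , ≤-reflexive (trans (cnt-split (Pairs.mem (FinSet.elements Γ)) (cartesianProduct E E)) (length-product _,_ E E)) , tt))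

        a≤2N : a ≤ 2 * N
        a≤2N = *-cancelˡ-≤ κ ((farkas (κ ∷ s ∷ F ∷ a ∷ N ∷ bad ∷ []) (((con 100 :* (x1 :* x0) :+ (con 2 :* x2 :+ con 1)) :* x5 :≤ x0 :* x3) ∷ (x3 :≤ x5 :+ x4) ∷ (con 1 :≤ x1) ∷ []) (x0 :* x3) (x0 :* (con 2 :* x4)) 98 (con 1 ∷ con 100 :* x0 ∷ con 100 :* (x0 :* x5) ∷ []) (bad-small , ≤-reflexive (sym bad+N) , s>0 , tt)))

        h T σ d : ℕ
        h = height E
        T = suc (2 * h)
        σ = h + T
        d = length S

        open Shift σ
        module Double = Shift (σ + σ)

        A′ D′ : ℕ → Bool
        A′ x = mem E (down x) ∧ few (down x)
        D′ x = mem S (Double.down x)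

        A′-∈ : ∀ x → A′ x ≡ true → down x ∈ E
        A′-∈ x p = mem-∈ E (∧-elimˡ p)

        A′-few : ∀ x → A′ x ≡ true → few (down x) ≡ true
        A′-few x p = ∧-elimʳ {mem E (down x)} p

        A-low : ∀ x → A′ x ≡ true → T ≤ x
        A-low x p = +-cancelʳ-≤ h T x (≤-trans (≤-reflexive (+-comm T h)) (down-low x (∈-height (A′-∈ x p))))

        A-high : ∀ x → A′ x ≡ true → x < T + T
        A-high x p = ≤-trans (s≤s (down-high x (∈-height (A′-∈ x p)))) ((farkas (h ∷ []) ([]) (con 1 :+ (x0 :+ (con 1 :+ con 2 :* x0) :+ x0)) (con 1 :+ con 2 :* x0 :+ (con 1 :+ con 2 :* x0)) 0 ([]) (tt)))

        A-count : ∀ i → count i A′ ≤ N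
        A-count i = hits₁ i E few

        A-all : N ≤ count (T + T) A′
        A-all = covered (T + T) down E few (FinSet.unique A) (λ {z} z∈ → let x , e = down-onto z (≤-trans (∈-height z∈) (m≤m+n h T)) in
          x , ≤-trans (s≤s (down-high x (subst (λ y → ℤ.∣ y ∣ ≤ h) (sym e) (∈-height z∈)))) ((farkas (h ∷ []) ([]) (con 1 :+ (x0 :+ (con 1 :+ con 2 :* x0) :+ x0)) (con 1 :+ con 2 :* x0 :+ (con 1 :+ con 2 :* x0)) 0 ([]) (tt))) , e)

        D-count : ∀ i → count i D′ ≤ d
        D-count i = ≤-trans (∑-mono i (λ x _ → ⟦⟧-mono {D′ x} (λ p → trans (cong (_∧ true) p) refl))) (≤-trans (Double.hits₁ i S (λ _ → true)) (cnt≤length (λ _ → true) S))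

        sum-∈ : ∀ z z′ → (z , z′) ∈ FinSet.elements Γ → z ℤ.+ z′ ∈ S
        sum-∈ z z′ p = ∈-deduplicate⁺ ℤ._≟_ (∈-map⁺ (λ (a₁ , a₂) → a₁ ℤ.+ a₂) p)

        rows : ∀ x → A′ x ≡ true → ∀ i → count i (λ y → A′ y ∧ not (D′ (x + y))) ≤ E₀
        rows x p i = ≤-trans (∑-mono i (λ y _ → ⟦⟧-mono {A′ y ∧ not (D′ (x + y))} (step y))) (≤-trans (hits₁ i E (λ z′ → outside (down x , z′))) (≮⇒≥ (λ lt → contra (A′-few x p) (≤⇒≤ᵇ lt))))
          where
          contra : ∀ {b} → not b ≡ true → Data.Bool.Base.T b → ⊥
          contra {true} () _
          double : ∀ x y s → (x ℤ.+ y) ℤ.- (s ℤ.+ s) ≡ (x ℤ.- s) ℤ.+ (y ℤ.- s)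
          double = ℤR.solve-∀
          step : ∀ y → A′ y ∧ not (D′ (x + y)) ≡ true → mem E (down y) ∧ outside (down x , down y) ≡ true
          step y q = ∧-intro (∈-mem y∈) (absent (bool (Pairs.mem (FinSet.elements Γ) (down x , down y))))
            where
            y∈ : down y ∈ E
            y∈ = A′-∈ y (∧-elimˡ q)
            absent : (Pairs.mem (FinSet.elements Γ) (down x , down y) ≡ true) ⊎ (Pairs.mem (FinSet.elements Γ) (down x , down y) ≡ false) → outside (down x , down y) ≡ true
            absent (inj₂ r) = cong not r
            absent (inj₁ r) = true≢false (∈-mem (subst (_∈ S) (sym (double (+ x) (+ y) (+ σ))) (sum-∈ (down x) (down y) (Pairs.mem-∈ (FinSet.elements Γ) r)))) (∧-notʳ {A′ y} q)

        d-small : 16 * (s * d) ≤ (64 * s + 1) * N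
        d-small = *-cancelˡ-≤ C ⦃ C≢0 ⦄ ((farkas (C ∷ κ ∷ s ∷ F ∷ a ∷ N ∷ d ∷ bad ∷ []) ((x0 :* x6 :≤ (con 4 :* x0 :+ con 1) :* x4) ∷ (x4 :≤ x7 :+ x5) ∷ (x0 :* x7 :≤ x1 :* x4) ∷ (con 100 :* (x2 :* x1) :+ (con 2 :* x3 :+ con 1) :≤ x0) ∷ (con 1 :≤ x2) ∷ (con 1 :≤ x1) ∷ []) (x0 :* (con 16 :* (x2 :* x6))) (x0 :* ((con 64 :* x2 :+ con 1) :* x5)) 99 (con 100 :* (con 16 :* x2) ∷ con 100 :* (x0 :* (con 64 :* x2 :+ con 1)) ∷ con 100 :* (con 64 :* x2 :+ con 1) ∷ con 81 :* x4 ∷ con 100 :* (x1 :* x4) ∷ con 1600 :* (x2 :* x4) ∷ []) (S-small , ≤-reflexive (sym bad+N) , bad-small , ≤-reflexive (sym C-def) , s>0 , κ>0 , tt)))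
          where
          C-def : C ≡ 100 * (s * κ) + (2 * F + 1)
          C-def = refl
          C≢0 : NonZero C
          C≢0 = >-nonZero (≤-trans (m≤n+m 1 (2 * F)) (m≤n+m (2 * F + 1) (100 * (s * κ))))

        E-small : 16 * (s * (K * E₀)) ≤ N
        E-small = *-cancelˡ-≤ 2 ((farkas (s ∷ K ∷ E₀ ∷ a ∷ N ∷ []) ((con 32 :* (x0 :* x1) :* x2 :≤ x3) ∷ (x3 :≤ con 2 :* x4) ∷ []) (con 2 :* (con 16 :* (x0 :* (x1 :* x2)))) (con 2 :* x4) 0 (con 1 ∷ con 1 ∷ []) (≤-trans (≤-reflexive (*-comm κ E₀)) (m/n*n≤m a κ) , a≤2N , tt)))

        N-big : F < N
        N-big = *-cancelˡ-< 2 F N (≤-trans a-big a≤2N)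

        scale : ∀ l → N ≤ F * l → a ≤ C * l
        scale l p = (farkas (100 * (s * κ) ∷ F ∷ N ∷ a ∷ l ∷ []) ((x3 :≤ con 2 :* x2) ∷ (x2 :≤ x1 :* x4) ∷ []) (x3) ((x0 :+ (con 2 :* x1 :+ con 1)) :* x4) 0 (con 1 ∷ con 2 ∷ []) (a≤2N , p , tt))

        open Pull A σ A′ A′-∈

        dense : (Σ[ P ∈ Progression 1 ] Conclusion A n C P 2) ⊎ (Σ[ P ∈ Progression 2 ] Proper P × Conclusion A n C P 1)
        dense = [ (λ P → inj₁ (from-line C (≤-trans (s≤s z≤n) N-big) scale P)) , (λ P → inj₂ (from-plane C scale P)) ]′
          (Structure.structure k T A′ D′ E₀ d N A-low A-high A-all A-count D-count rows d-small E-small N-big)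

      theorem : (∀ {p} → p ∈ FinSet.elements Γ → p ∈ cartesianProduct E E) → C * (a * a) ≤ C * length (FinSet.elements Γ) + a * a →
                C * length S ≤ (4 * C + 1) * a → ∃[ x ] x ∈ E →
                (Σ[ P ∈ Progression 1 ] Conclusion A n C P 2) ⊎ (Σ[ P ∈ Progression 2 ] Proper P × Conclusion A n C P 1)
      theorem Γ⊆ Γ-big S-small (x , x∈) = [ (λ p → inj₁ (small A x∈ p)) , Dense.dense Γ⊆ Γ-big S-small ]′ (≤-<-connex a (2 * F))

-- The thresholds

module Rationals where

  open import Data.Integer.Base as ℤ using (+_; -[1+_])
  import Data.Integer.Properties as ℤ
  import Data.Integer.Tactic.RingSolver as ℤR
  open import Data.Nat.Base as ℕ using (ℕ; zero; suc)
  import Data.Nat.Properties as ℕ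
  open import Data.Rational.Base
  open import Data.Rational.Properties
  import Data.Rational.Unnormalised.Base as ℚᵘ
  import Data.Rational.Unnormalised.Properties as ℚᵘ

  ι : ℕ → ℚ
  ι n = + n / 1

  /-ᵘ : ∀ m d → toℚᵘ (+ m / suc d) ℚᵘ.≃ ℚᵘ.mkℚᵘ (+ m) d
  /-ᵘ m d = toℚᵘ-fromℚᵘ (ℚᵘ.mkℚᵘ (+ m) d)

  /-* : ∀ m s .⦃ _ : ℕ.NonZero s ⦄ → (+ m / s) * ι s ≡ ι m
  /-* m (suc d) = toℚᵘ-injective (ℚᵘ.≃-trans (toℚᵘ-homo-* (+ m / suc d) (ι (suc d)))
    (ℚᵘ.≃-trans (ℚᵘ.*-cong (/-ᵘ m d) (/-ᵘ (suc d) 0)) (ℚᵘ.≃-trans (ℚᵘ.*≡* (lemma (+ m) (+ suc d))) (ℚᵘ.≃-sym (/-ᵘ m 0)))))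
    where
    lemma : ∀ m d → (m ℤ.* d) ℤ.* + 1 ≡ m ℤ.* (d ℤ.* + 1)
    lemma = ℤR.solve-∀

  ι-+ : ∀ m n → ι (m ℕ.+ n) ≡ ι m + ι n
  ι-+ m n = toℚᵘ-injective (ℚᵘ.≃-trans (/-ᵘ (m ℕ.+ n) 0) (ℚᵘ.≃-sym (ℚᵘ.≃-trans (toℚᵘ-homo-+ (ι m) (ι n))
    (ℚᵘ.≃-trans (ℚᵘ.+-cong (/-ᵘ m 0) (/-ᵘ n 0)) (ℚᵘ.*≡* (lemma (+ m) (+ n)))))))
    where
    lemma : ∀ m n → (m ℤ.* + 1 ℤ.+ n ℤ.* + 1) ℤ.* + 1 ≡ (m ℤ.+ n) ℤ.* (+ 1 ℤ.* + 1)
    lemma = ℤR.solve-∀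

  ι-* : ∀ m n → ι (m ℕ.* n) ≡ ι m * ι n
  ι-* m n = toℚᵘ-injective (ℚᵘ.≃-trans (/-ᵘ (m ℕ.* n) 0) (ℚᵘ.≃-sym (ℚᵘ.≃-trans (toℚᵘ-homo-* (ι m) (ι n))
    (ℚᵘ.≃-trans (ℚᵘ.*-cong (/-ᵘ m 0) (/-ᵘ n 0)) (ℚᵘ.*≡* (trans (lemma (+ m) (+ n)) (cong (ℤ._* (+ 1 ℤ.* + 1)) (sym (ℤ.pos-* m n)))))))))
    where
    lemma : ∀ m n → (m ℤ.* n) ℤ.* + 1 ≡ (m ℤ.* n) ℤ.* (+ 1 ℤ.* + 1)
    lemma = ℤR.solve-∀

  ι-mono : ∀ {m n} → m ℕ.≤ n → ι m ≤ ι n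
  ι-mono {m} {n} m≤n = toℚᵘ-cancel-≤ (ℚᵘ.≤-respˡ-≃ (ℚᵘ.≃-sym (/-ᵘ m 0)) (ℚᵘ.≤-respʳ-≃ (ℚᵘ.≃-sym (/-ᵘ n 0))
    (ℚᵘ.*≤* (ℤ.*-monoʳ-≤-nonNeg (+ 1) (ℤ.+≤+ m≤n)))))

  0≤ι : ∀ n → 0ℚ ≤ ι n
  0≤ι n = ι-mono {0} {n} ℕ.z≤n

  ι-nonNeg : ∀ n → NonNegative (ι n)
  ι-nonNeg n = nonNegative (0≤ι n)

  ι-pos : ∀ n → Positive (ι (suc n))
  ι-pos n = positive (<-≤-trans (positive⁻¹ 1ℚ) (ι-mono {1} {suc n} (ℕ.s≤s ℕ.z≤n)))

  abstract
    inv : ℕ → ℚ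
    inv n = + 1 / suc n

    inv-* : ∀ n → inv n * ι (suc n) ≡ 1ℚ
    inv-* n = /-* 1 (suc n)

    inv>0 : ∀ n → 0ℚ < inv n
    inv>0 n = *-cancelʳ-<-nonNeg (ι (suc n)) ⦃ ι-nonNeg (suc n) ⦄ (subst₂ _<_ (sym (*-zeroˡ (ι (suc n)))) (sym (inv-* n)) (positive⁻¹ 1ℚ))

    inv-antitone : ∀ {m n} → m ℕ.≤ n → inv n ≤ inv m
    inv-antitone {m} {n} m≤n = *-cancelʳ-≤-pos (ι (suc n)) ⦃ ι-pos n ⦄ (*-cancelʳ-≤-pos (ι (suc m)) ⦃ ι-pos m ⦄
      (subst₂ _≤_ (sym (trans (cong (_* ι (suc m)) (inv-* n)) (*-identityˡ (ι (suc m)))))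
        (sym (trans (trans (*-assoc (inv m) (ι (suc n)) (ι (suc m))) (trans (cong (inv m *_) (*-comm (ι (suc n)) (ι (suc m)))) (sym (*-assoc (inv m) (ι (suc m)) (ι (suc n))))))
          (trans (cong (_* ι (suc n)) (inv-* m)) (*-identityˡ (ι (suc n))))))
        (ι-mono {suc m} {suc n} (ℕ.s≤s m≤n))))

  archimedean : ∀ ε → 0ℚ < ε → ∃[ n ] inv n ≤ ε
  archimedean ε@(mkℚ (+ zero) d c)   ε>0 with () ← positive ε>0
  archimedean ε@(mkℚ -[1+ p ] d c) ε>0 with () ← positive ε>0
  archimedean ε@(mkℚ (+ suc p) d c) ε>0 = d , *-cancelʳ-≤-pos (ι (suc d)) ⦃ ι-pos d ⦄
    (subst₂ _≤_ (sym (inv-* d)) (sym (trans (cong (_* ι (suc d)) (sym (↥p/↧p≡p ε))) (/-* (suc p) (suc d)))) (ι-mono {1} {suc p} (ℕ.s≤s ℕ.z≤n)))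

  half : ∀ ε → 0ℚ < ε → 0ℚ < ½ * ε
  half ε ε>0 = subst (_< ½ * ε) (*-zeroʳ ½) (*-monoʳ-<-pos ½ ε>0)

  halves : ∀ ε → ½ * ε + ½ * ε ≡ ε
  halves ε = trans (sym (*-distribʳ-+ ε ½ ½)) (*-identityˡ ε)

  ≤+ : ∀ {p e} → 0ℚ ≤ e → p ≤ p + e
  ≤+ {p} {e} h = subst (_≤ p + e) (+-identityʳ p) (+-monoʳ-≤ p h)

  ∣-∣≤ : ∀ {p q e} → ∣ p - q ∣ ≤ e → p ≤ q + e
  ∣-∣≤ {p} {q} {e} h = subst (_≤ q + e) (regroup p q) (+-monoʳ-≤ q (≤-trans (p≤∣p∣ (p - q)) h))
    where
    open import Data.Rational.Solver
    open +-*-Solver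
    regroup : ∀ p q → q + (p - q) ≡ p
    regroup = solve 2 (λ p q → q :+ (p :- q) := p) refl
    p≤∣p∣ : ∀ p → p ≤ ∣ p ∣
    p≤∣p∣ p with ≤-total 0ℚ p
    ... | inj₁ 0≤p = ≤-reflexive (sym (0≤p⇒∣p∣≡p 0≤p))
    ... | inj₂ p≤0 = ≤-trans p≤0 (0≤∣p∣ p)

  ∣-∣-bound : ∀ {p q e} → p ≤ q + e → q ≤ p + e → ∣ p - q ∣ ≤ e
  ∣-∣-bound {p} {q} {e} h₁ h₂ with ∣p∣≡p∨∣p∣≡-p (p - q)
  ... | inj₁ eq = subst (_≤ e) (sym eq) (subst₂ _≤_ (+-comm (- q) p) (cancel q e) (+-monoʳ-≤ (- q) h₁))
    where
    open import Data.Rational.Solver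
    open +-*-Solver
    cancel : ∀ q e → - q + (q + e) ≡ e
    cancel = solve 2 (λ q e → :- q :+ (q :+ e) := e) refl
  ... | inj₂ eq = subst (_≤ e) (sym eq) (subst₂ _≤_ (flip p q) (cancel p e) (+-monoʳ-≤ (- p) h₂))
    where
    open import Data.Rational.Solver
    open +-*-Solver
    cancel : ∀ q e → - q + (q + e) ≡ e
    cancel = solve 2 (λ q e → :- q :+ (q :+ e) := e) refl
    flip : ∀ p q → - p + q ≡ - (p - q)
    flip = solve 2 (λ p q → :- p :+ q := :- (p :- q)) refl

module Transfer where

  open Rationals
  open import Data.Integer.Base using (+_)
  open import Data.Nat.Base as ℕ using (ℕ; suc)
  import Data.Nat.Properties as ℕ
  open import Data.Rational.Base
  open import Data.Rational.Properties
  open import Data.Rational.Solver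

  ι>0 : ∀ n .⦃ _ : ℕ.NonZero n ⦄ → Positive (ι n)
  ι>0 (suc n) = ι-pos n

  *ι-mono : ∀ n {p q} → p ≤ q → p * ι n ≤ q * ι n
  *ι-mono n = *-monoʳ-≤-nonNeg (ι n) ⦃ ι-nonNeg n ⦄

  integral : ∀ m n {p} → ι m ≤ ι n + p → p < 1ℚ → m ℕ.≤ n
  integral m n {p} h p<1 = ℕ.≮⇒≥ λ n<m → <-irrefl refl (<-≤-trans (<-≤-trans (+-monoʳ-< (ι n) p<1)
    (≤-trans (≤-reflexive (trans (sym (ι-+ n 1)) (cong ι (ℕ.+-comm n 1)))) (ι-mono {suc n} {m} n<m))) h)

  inv-<1 : ∀ n → inv n * ι n < 1ℚ
  inv-<1 n = subst (inv n * ι n <_) (inv-* n) (*-monoʳ-<-pos (inv n) ⦃ positive (inv>0 n) ⦄ (subst₂ _<_ (+-identityʳ (ι n)) (trans (sym (ι-+ n 1)) (cong ι (ℕ.+-comm n 1))) (+-monoʳ-< (ι n) (positive⁻¹ 1ℚ))))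

  sum-bound : ∀ C a d v q → v * ι C ≤ 1ℚ → q ≤ v → ι d ≤ (ι 4 + q) * ι a + inv C → C ℕ.* d ℕ.≤ (4 ℕ.* C ℕ.+ 1) ℕ.* a
  sum-bound C a d v q vC q≤v h = integral (C ℕ.* d) ((4 ℕ.* C ℕ.+ 1) ℕ.* a) {inv C * ι C} chain (inv-<1 C)
    where
    open ≤-Reasoning
    expand : ∀ f v a e c → ((f + v) * a + e) * c ≡ (f * c) * a + (v * c) * a + e * c
    expand = solve 5 (λ f v a e c → ((f :+ v) :* a :+ e) :* c := (f :* c) :* a :+ (v :* c) :* a :+ e :* c) refl
      where open +-*-Solver
    chain : ι (C ℕ.* d) ≤ ι ((4 ℕ.* C ℕ.+ 1) ℕ.* a) + inv C * ι C
    chain = begin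
      ι (C ℕ.* d)                                         ≡⟨ trans (cong ι (ℕ.*-comm C d)) (ι-* d C) ⟩
      ι d * ι C                                           ≤⟨ *ι-mono C (≤-trans h (+-monoˡ-≤ (inv C) (*ι-mono a (+-monoʳ-≤ (ι 4) q≤v)))) ⟩
      ((ι 4 + v) * ι a + inv C) * ι C                     ≡⟨ expand (ι 4) v (ι a) (inv C) (ι C) ⟩
      (ι 4 * ι C) * ι a + (v * ι C) * ι a + inv C * ι C   ≤⟨ +-monoˡ-≤ (inv C * ι C) (+-monoʳ-≤ ((ι 4 * ι C) * ι a) (*ι-mono a vC)) ⟩
      (ι 4 * ι C) * ι a + 1ℚ * ι a + inv C * ι C          ≡⟨ cong (_+ inv C * ι C) (sym (trans (ι-* (4 ℕ.* C ℕ.+ 1) a) (trans (cong (_* ι a) (trans (ι-+ (4 ℕ.* C) 1) (cong (_+ 1ℚ) (ι-* 4 C)))) (*-distribʳ-+ (ι a) (ι 4 * ι C) 1ℚ)))) ⟩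
      ι ((4 ℕ.* C ℕ.+ 1) ℕ.* a) + inv C * ι C             ∎

  pair-bound : ∀ C b g v q → v * ι C ≤ 1ℚ → q ≤ v → (ι 1 - q) * ι b ≤ ι g + inv C → C ℕ.* b ℕ.≤ C ℕ.* g ℕ.+ b
  pair-bound C b g v q vC q≤v h = integral (C ℕ.* b) (C ℕ.* g ℕ.+ b) {inv C * ι C} chain (inv-<1 C)
    where
    open ≤-Reasoning
    expand : ∀ v b c → c * b ≡ (1ℚ - v) * b * c + (v * c) * b
    expand = solve 3 (λ v b c → c :* b := (con 1ℚ :- v) :* b :* c :+ (v :* c) :* b) refl
      where open +-*-Solver
    collect : ∀ g e c b → (g + e) * c + b ≡ (c * g + b) + e * c
    collect = solve 4 (λ g e c b → (g :+ e) :* c :+ b := (c :* g :+ b) :+ e :* c) refl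
      where open +-*-Solver
    chain : ι (C ℕ.* b) ≤ ι (C ℕ.* g ℕ.+ b) + inv C * ι C
    chain = begin
      ι (C ℕ.* b)                                  ≡⟨ ι-* C b ⟩
      ι C * ι b                                    ≡⟨ expand v (ι b) (ι C) ⟩
      (1ℚ - v) * ι b * ι C + (v * ι C) * ι b       ≤⟨ +-mono-≤ (*ι-mono C (≤-trans (*ι-mono b (+-monoʳ-≤ 1ℚ (neg-antimono-≤ q≤v))) h)) (≤-trans (*ι-mono b vC) (≤-reflexive (*-identityˡ (ι b)))) ⟩
      (ι g + inv C) * ι C + ι b                    ≡⟨ collect (ι g) (inv C) (ι C) (ι b) ⟩
      (ι C * ι g + ι b) + inv C * ι C              ≡⟨ cong (_+ inv C * ι C) (sym (trans (ι-+ (C ℕ.* g) b) (cong (_+ ι b) (ι-* C g)))) ⟩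
      ι (C ℕ.* g ℕ.+ b) + inv C * ι C              ∎

  size-bound : ∀ C a p v q → v * ι C ≤ 1ℚ → 0ℚ ≤ v → q ≤ v → a ℕ.≤ C ℕ.* p → q * ι a ≤ ι p
  size-bound C a p v q vC 0≤v q≤v h = begin
    q * ι a           ≤⟨ *ι-mono a q≤v ⟩
    v * ι a           ≤⟨ *-monoˡ-≤-nonNeg v ⦃ nonNegative 0≤v ⦄ (≤-trans (ι-mono {a} {C ℕ.* p} h) (≤-reflexive (ι-* C p))) ⟩
    v * (ι C * ι p)   ≡⟨ sym (*-assoc v (ι C) (ι p)) ⟩
    v * ι C * ι p     ≤⟨ *ι-mono p vC ⟩
    1ℚ * ι p          ≡⟨ *-identityˡ (ι p) ⟩
    ι p               ∎
    where open ≤-Reasoning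

  density-bound : ∀ c h k m s .⦃ _ : ℕ.NonZero s ⦄ .⦃ _ : ℕ.NonZero c ⦄ → h * ι c ≡ 1ℚ →
                  suc k ℕ.* s ℕ.≤ c ℕ.* (suc k ℕ.* m) ℕ.+ c ℕ.* s → h - inv k ≤ + m / s
  density-bound c h k m s hc dense = *-cancelʳ-≤-pos (ι s) ⦃ ι>0 s ⦄ (*-cancelʳ-≤-pos (ι c) ⦃ ι>0 c ⦄ (*-cancelʳ-≤-pos (ι (suc k)) ⦃ ι-pos k ⦄ chain))
    where
    open ≤-Reasoning
    expand : ∀ h v s c n → (h - v) * s * c * n ≡ (h * c) * (n * s) - (v * n) * (c * s)
    expand = solve 5 (λ h v s c n → (h :- v) :* s :* c :* n := (h :* c) :* (n :* s) :- (v :* n) :* (c :* s)) refl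
      where open +-*-Solver
    drop : ∀ x y → (x + y) - y ≡ x
    drop = solve 2 (λ x y → (x :+ y) :- y := x) refl
      where open +-*-Solver
    arrange : ∀ c n m → c * (n * m) ≡ m * c * n
    arrange = solve 3 (λ c n m → c :* (n :* m) := m :* c :* n) refl
      where open +-*-Solver
    N : ℕ
    N = suc k
    chain : (h - inv k) * ι s * ι c * ι N ≤ (+ m / s) * ι s * ι c * ι N
    chain = begin
      (h - inv k) * ι s * ι c * ι N                       ≡⟨ expand h (inv k) (ι s) (ι c) (ι N) ⟩
      (h * ι c) * (ι N * ι s) - (inv k * ι N) * (ι c * ι s) ≡⟨ cong₂ (λ x y → x * (ι N * ι s) - y * (ι c * ι s)) hc (inv-* k) ⟩
      1ℚ * (ι N * ι s) - 1ℚ * (ι c * ι s)                 ≡⟨ cong₂ _-_ (trans (*-identityˡ _) (sym (ι-* N s))) (trans (*-identityˡ _) (sym (ι-* c s))) ⟩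
      ι (N ℕ.* s) - ι (c ℕ.* s)                           ≤⟨ +-monoˡ-≤ (- ι (c ℕ.* s)) (≤-trans (ι-mono {N ℕ.* s} {c ℕ.* (N ℕ.* m) ℕ.+ c ℕ.* s} dense) (≤-reflexive (ι-+ (c ℕ.* (N ℕ.* m)) (c ℕ.* s)))) ⟩
      (ι (c ℕ.* (N ℕ.* m)) + ι (c ℕ.* s)) - ι (c ℕ.* s)   ≡⟨ drop (ι (c ℕ.* (N ℕ.* m))) (ι (c ℕ.* s)) ⟩
      ι (c ℕ.* (N ℕ.* m))                                 ≡⟨ trans (ι-* c (N ℕ.* m)) (trans (cong (ι c *_) (ι-* N m)) (arrange (ι c) (ι N) (ι m))) ⟩
      ι m * ι c * ι N                                     ≡⟨ cong (λ z → z * ι c * ι N) (sym (/-* m s)) ⟩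
      (+ m / s) * ι s * ι c * ι N                         ∎

module Threshold where

  import Defs
  open Defs using (ℝ; mkℝ; ℝ⁺; mkℝ⁺; value; ℝ⁺-setoid)
  open ℝ
  open Rationals
  open import Data.Nat.Base as ℕ using (ℕ; zero; suc)
  import Data.Nat.Properties as ℕ
  open import Data.Rational.Base
  open import Data.Rational.Properties
  open import Function.Bundles using (_⟶ₛ_)

  -- A 1-Lipschitz function below which C can be controlled: the supremum over k
  -- of min (x − 1/(k+2), u k), where u k ≤ 1 / (2 C k).
  module Envelope (C : ℕ → ℕ) where
    u θ : ℕ → ℚ
    u k = inv (2 ℕ.* C k ℕ.+ k)
    θ k = inv (suc k)

    t : ℕ → ℚ → ℚ
    t k q = (q - θ k) ⊓ u k

    F : ℕ → ℚ → ℚ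
    F zero    q = 0ℚ
    F (suc n) q = F n q ⊔ t n q

    F≥0 : ∀ n q → 0ℚ ≤ F n q
    F≥0 zero    q = ≤-refl
    F≥0 (suc n) q = ≤-trans (F≥0 n q) (p≤p⊔q (F n q) (t n q))

    +-shift : ∀ q e x → (q + e) - x ≡ (q - x) + e
    +-shift = solve 3 (λ q e x → (q :+ e) :- x := (q :- x) :+ e) refl
      where
      open import Data.Rational.Solver
      open +-*-Solver

    t-lipschitz : ∀ k {p q e} → 0ℚ ≤ e → p ≤ q + e → t k p ≤ t k q + e
    t-lipschitz k {p} {q} {e} 0≤e h with ⊓-sel (q - θ k) (u k)
    ... | inj₁ s = ≤-trans (p⊓q≤p (p - θ k) (u k)) (≤-trans (+-monoˡ-≤ (- θ k) h) (≤-reflexive (trans (+-shift q e (θ k)) (cong (_+ e) (sym s)))))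
    ... | inj₂ s = ≤-trans (p⊓q≤q (p - θ k) (u k)) (≤-trans (≤+ 0≤e) (≤-reflexive (cong (_+ e) (sym s))))

    F-lipschitz : ∀ n {p q e} → 0ℚ ≤ e → p ≤ q + e → F n p ≤ F n q + e
    F-lipschitz zero    0≤e h = ≤+ 0≤e
    F-lipschitz (suc n) {p} {q} {e} 0≤e h = ⊔-lub (≤-trans (F-lipschitz n {p} {q} 0≤e h) (+-monoˡ-≤ e (p≤p⊔q (F n q) (t n q))))
      (≤-trans (t-lipschitz n {p} {q} 0≤e h) (+-monoˡ-≤ e (p≤q⊔p (F n q) (t n q))))

    t≤F : ∀ {k n} q → k ℕ.< n → t k q ≤ F n q
    t≤F {k} {suc n} q k<1+n with ℕ.m≤n⇒m<n∨m≡n (ℕ.s≤s⁻¹ k<1+n)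
    ... | inj₁ k<n  = ≤-trans (t≤F q k<n) (p≤p⊔q (F n q) (t n q))
    ... | inj₂ refl = p≤q⊔p (F n q) (t n q)

    u≤ : ∀ {n m} → n ℕ.≤ m → u m ≤ inv n
    u≤ {n} {m} n≤m = inv-antitone (ℕ.≤-trans n≤m (ℕ.m≤n+m m (2 ℕ.* C m)))

    F-tail : ∀ m n q → F m q ≤ F n q + inv n
    F-tail zero    n q = ≤-trans (F≥0 n q) (≤+ (<⇒≤ (inv>0 n)))
    F-tail (suc m) n q = ⊔-lub (F-tail m n q) (last (ℕ.≤-<-connex n m))
      where
      last : n ℕ.≤ m ⊎ m ℕ.< n → t m q ≤ F n q + inv n
      last (inj₂ m<n) = ≤-trans (t≤F q m<n) (≤+ (<⇒≤ (inv>0 n)))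
      last (inj₁ n≤m) = ≤-trans (p⊓q≤q (q - θ m) (u m)) (≤-trans (u≤ n≤m) (subst (_≤ F n q + inv n) (+-identityˡ (inv n)) (+-monoˡ-≤ (inv n) (F≥0 n q))))

    attained : ∀ n q → 0ℚ < F n q → ∃[ k ] F n q ≤ t k q
    attained zero    q h = ⊥-elim (<-irrefl refl h)
    attained (suc n) q h with ⊔-sel (F n q) (t n q)
    ... | inj₁ s = let k , p = attained n q (subst (0ℚ <_) s h) in k , ≤-trans (≤-reflexive s) p
    ... | inj₂ s = n , ≤-reflexive s

    module At (x : ℝ) where
      almost : ∀ ε → 0ℚ < ε → ∃[ N ] ∀ m n → N ℕ.≤ m → N ℕ.≤ n → F m (seq x m) ≤ F n (seq x n) + ε
      almost ε ε>0 =
        let N₁ , p = cauchy x (½ * ε) (half ε ε>0)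
            N₂ , q = archimedean (½ * ε) (half ε ε>0)
        in N₁ ℕ.⊔ N₂ , λ m n m≥ n≥ → ≤-trans (F-tail m n (seq x m))
          (≤-trans (+-mono-≤ (F-lipschitz n (<⇒≤ (half ε ε>0)) (∣-∣≤ (p m n (ℕ.m⊔n≤o⇒m≤o N₁ N₂ m≥) (ℕ.m⊔n≤o⇒m≤o N₁ N₂ n≥)))) (≤-trans (inv-antitone (ℕ.m⊔n≤o⇒n≤o N₁ N₂ n≥)) q))
            (≤-reflexive (trans (+-assoc (F n (seq x n)) (½ * ε) (½ * ε)) (cong (F n (seq x n) +_) (halves ε)))))

      real : ℝ
      real = mkℝ (λ n → F n (seq x n)) λ ε ε>0 → let N , p = almost ε ε>0 in
        N , λ m n m≥ n≥ → ∣-∣-bound (p m n m≥ n≥) (p n m n≥ m≥)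

    ⊓-pos : ∀ {p q} → 0ℚ < p → 0ℚ < q → 0ℚ < p ⊓ q
    ⊓-pos {p} {q} h₁ h₂ with ⊓-sel p q
    ... | inj₁ s = subst (0ℚ <_) (sym s) h₁
    ... | inj₂ s = subst (0ℚ <_) (sym s) h₂

    real⁺ : ℝ⁺ → ℝ⁺
    real⁺ (mkℝ⁺ x (ε , ε>0 , N , p)) = mkℝ⁺ (At.real x)
      ((½ * ε) ⊓ u k , ⊓-pos (half ε ε>0) (inv>0 (2 ℕ.* C k ℕ.+ k)) , suc k ℕ.⊔ N , λ n n≥ →
        ≤-trans (≤-reflexive (+-identityˡ ((½ * ε) ⊓ u k))) (≤-trans (⊓-mono-≤ (away n (ℕ.m⊔n≤o⇒n≤o (suc k) N n≥)) ≤-refl) (t≤F (seq x n) (ℕ.m⊔n≤o⇒m≤o (suc k) N n≥))))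
      where
      k : ℕ
      k = proj₁ (archimedean (½ * ε) (half ε ε>0))
      k-small : inv k ≤ ½ * ε
      k-small = proj₂ (archimedean (½ * ε) (half ε ε>0))
      open import Data.Rational.Solver
      open +-*-Solver
      drop : ∀ h → (h + h) - h ≡ h
      drop = solve 1 (λ h → (h :+ h) :- h := h) refl
      away : ∀ n → N ℕ.≤ n → ½ * ε ≤ seq x n - θ k
      away n n≥ = ≤-trans (≤-reflexive (sym (drop (½ * ε)))) (+-mono-≤
        (≤-trans (≤-reflexive (trans (halves ε) (sym (+-identityˡ ε)))) (p n n≥)) (neg-antimono-≤ (≤-trans (inv-antitone (ℕ.n≤1+n k)) k-small)))

    threshold : ℝ⁺-setoid ⟶ₛ ℝ⁺-setoid
    threshold = record
      { to   = real⁺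
      ; cong = λ {x} {y} (p , q) → respects x y p , respects y x q }
      where
      respects : ∀ x y → value x Defs.≤ value y → value (real⁺ x) Defs.≤ value (real⁺ y)
      respects x y p ε ε>0 = let N , q = p ε ε>0 in N , λ n n≥ → F-lipschitz n {seq (value x) n} {seq (value y) n} (<⇒≤ ε>0) (q n n≥)

    module Attained (X Δ : ℕ → ℚ) (η : ℚ) (η>0 : 0ℚ < η) (N : ℕ) (Δ-big : η + (η + (η + η)) ≤ Δ N) (Δ≤F : Δ N ≤ F N (X N) + η)
      (Δ-close : ∀ n → N ℕ.≤ n → Δ n ≤ Δ N + η) (X-close : ∀ n → N ℕ.≤ n → X N ≤ X n + η) where
      cancel : ∀ {p q} e → p + e ≤ q + e → p ≤ q
      cancel {p} {q} e h = subst₂ _≤_ (undo p) (undo q) (+-monoˡ-≤ (- e) h)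
        where
        open import Data.Rational.Solver
        open +-*-Solver
        undo : ∀ p → (p + e) - e ≡ p
        undo p = solve 2 (λ p e → (p :+ e) :- e := p) refl p e

      F-big : η + (η + η) ≤ F N (X N)
      F-big = cancel η (≤-trans (≤-reflexive (+-comm (η + (η + η)) η)) (≤-trans Δ-big Δ≤F))

      η≤3η : η ≤ η + (η + η)
      η≤3η = ≤+ (<⇒≤ (+-mono-< η>0 η>0))

      found : ∃[ k ] F N (X N) ≤ t k (X N)
      found = attained N (X N) (<-≤-trans η>0 (≤-trans η≤3η F-big))

      k : ℕ
      k = proj₁ found

      F≤u : F N (X N) ≤ u k
      F≤u = ≤-trans (proj₂ found) (p⊓q≤p′)
        where
        p⊓q≤p′ : t k (X N) ≤ u k
        p⊓q≤p′ = p⊓q≤q (X N - θ k) (u k)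

      below : ∀ n → N ℕ.≤ n → Δ n ≤ u k + u k
      below n n≥ = ≤-trans (Δ-close n n≥) (≤-trans (+-monoˡ-≤ η (≤-trans Δ≤F (+-monoˡ-≤ η F≤u)))
        (≤-trans (≤-reflexive (+-assoc (u k) η η)) (+-monoʳ-≤ (u k) (≤-trans (≤-trans (≤+ (<⇒≤ η>0)) (≤-reflexive (+-comm (η + η) η))) (≤-trans F-big F≤u)))))

      above : ∀ n → N ℕ.≤ n → θ k ≤ X n
      above n n≥ = cancel η (≤-trans (≤-trans (+-monoʳ-≤ (θ k) (≤-trans (≤-trans η≤3η F-big) (≤-trans (proj₂ found) (p⊓q≤p (X N - θ k) (u k))))) (≤-reflexive (rejoin (θ k) (X N)))) (X-close n n≥))
        where
        open import Data.Rational.Solver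
        open +-*-Solver
        rejoin : ∀ a b → a + (b - a) ≡ b
        rejoin = solve 2 (λ a b → a :+ (b :- a) := b) refl

    level : ∀ (x δ : ℝ⁺) → value δ Defs.≤ value (real⁺ x) →
            ∃[ k ] ∃[ N ] ∀ n → N ℕ.≤ n → seq (value δ) n ≤ u k + u k × θ k ≤ seq (value x) n
    level x (mkℝ⁺ δ (ε , ε>0 , N₁ , big)) δ≤ = combine (½ * (½ * ε)) (half (½ * ε) (half ε ε>0))
        (trans (cong₂ _+_ (halves (½ * ε)) (halves (½ * ε))) (halves ε))
      where
      combine : ∀ η → 0ℚ < η → (η + η) + (η + η) ≡ ε → ∃[ k ] ∃[ N ] ∀ n → N ℕ.≤ n → seq δ n ≤ u k + u k × θ k ≤ seq (value x) n
      combine η η>0 four =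
        let N₂ , p = δ≤ η η>0
            N₃ , q = cauchy δ η η>0
            N₄ , r = cauchy (value x) η η>0
            N = (N₁ ℕ.⊔ N₂) ℕ.⊔ (N₃ ℕ.⊔ N₄)
            N₁₂≤ = ℕ.m≤m⊔n (N₁ ℕ.⊔ N₂) (N₃ ℕ.⊔ N₄)
            N₃₄≤ = ℕ.m≤n⊔m (N₁ ℕ.⊔ N₂) (N₃ ℕ.⊔ N₄)
            N₁≤ = ℕ.≤-trans (ℕ.m≤m⊔n N₁ N₂) N₁₂≤
            N₂≤ = ℕ.≤-trans (ℕ.m≤n⊔m N₁ N₂) N₁₂≤
            N₃≤ = ℕ.≤-trans (ℕ.m≤m⊔n N₃ N₄) N₃₄≤
            N₄≤ = ℕ.≤-trans (ℕ.m≤n⊔m N₃ N₄) N₃₄≤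
            open Attained (seq (value x)) (seq δ) η η>0 N
              (≤-trans (≤-reflexive (trans (sym (+-assoc η η (η + η))) (trans four (sym (+-identityˡ ε))))) (big N N₁≤)) (p N N₂≤)
              (λ n n≥ → ∣-∣≤ (q n N (ℕ.≤-trans N₃≤ n≥) N₃≤)) (λ n n≥ → ∣-∣≤ (r N n N₄≤ (ℕ.≤-trans N₄≤ n≥)))
        in k , N , λ n n≥ → below n n≥ , above n n≥

open import Defs
open import Data.Integer.Base using (ℤ)
open import Data.Nat.Base using (ℕ; _^_)
open import Data.Rational.Base using (½)
open import Function.Bundles using (Func; _⟶ₛ_; _⟨$⟩_)
open import Data.Nat.Base as ℕ using (suc)
import Data.Nat.Properties as ℕ
open import Data.Rational.Base as ℚ using (ℚ; 0ℚ; 1ℚ)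
import Data.Rational.Properties as ℚ
import Function.Construct.Identity as Identity
open Rationals
open Transfer
open Threshold using (module Envelope)
open Discrete using (module Finite)
open Convert using (Conclusion)

C : ℕ → ℕ
C = Finite.C

open Envelope C

v : ℕ → ℚ
v k = u k ℚ.+ u k

v≥0 : ∀ k → 0ℚ ℚ.≤ v k
v≥0 k = ℚ.<⇒≤ (ℚ.+-mono-< (inv>0 (2 ℕ.* C k ℕ.+ k)) (inv>0 (2 ℕ.* C k ℕ.+ k)))

v-C : ∀ k → v k ℚ.* ι (C k) ℚ.≤ 1ℚ
v-C k = begin
  v k ℚ.* ι (C k)                       ≡⟨ trans (ℚ.*-distribʳ-+ (ι (C k)) (u k) (u k)) (sym (ℚ.*-distribˡ-+ (u k) (ι (C k)) (ι (C k)))) ⟩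
  u k ℚ.* (ι (C k) ℚ.+ ι (C k))         ≡⟨ cong (u k ℚ.*_) (sym (ι-+ (C k) (C k))) ⟩
  u k ℚ.* ι (C k ℕ.+ C k)               ≤⟨ ℚ.*-monoˡ-≤-nonNeg (u k) ⦃ ℚ.nonNegative (ℚ.<⇒≤ (inv>0 (2 ℕ.* C k ℕ.+ k))) ⦄ (ι-mono {C k ℕ.+ C k} {suc (2 ℕ.* C k ℕ.+ k)} bigger) ⟩
  u k ℚ.* ι (suc (2 ℕ.* C k ℕ.+ k))     ≡⟨ inv-* (2 ℕ.* C k ℕ.+ k) ⟩
  1ℚ                                    ∎
  where
  open ℚ.≤-Reasoning
  bigger : C k ℕ.+ C k ℕ.≤ suc (2 ℕ.* C k ℕ.+ k)
  bigger = ℕ.≤-trans (ℕ.+-monoʳ-≤ (C k) (ℕ.≤-reflexive (sym (ℕ.+-identityʳ (C k))))) (ℕ.≤-trans (ℕ.m≤m+n (2 ℕ.* C k) k) (ℕ.n≤1+n _))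

module Given (ε' δ δ' : ℝ⁺) (δ>δ' : value δ > value δ') (k N : ℕ)
  (at : ∀ n → N ℕ.≤ n → ℝ.seq (value δ) n ℚ.≤ v k × θ k ℚ.≤ ℝ.seq (value ε') n)
  (A : FinSet ℤ) (Γ : FinSet (ℤ × ℤ)) where

  a g d : ℕ
  a = ∣ A ∣
  g = ∣ Γ ∣
  d = ∣ sumsetAlong Γ ∣

  sumset-small : fromℕ d ≤ (fromℕ 4 + value δ) * fromℕ a → C k ℕ.* d ℕ.≤ (4 ℕ.* C k ℕ.+ 1) ℕ.* a
  sumset-small h =
    let M , p = h (inv (C k)) (inv>0 (C k))
        δ≤ , _ = at (N ℕ.⊔ M) (ℕ.m≤m⊔n N M)
    in sum-bound (C k) a d (v k) (ℝ.seq (value δ) (N ℕ.⊔ M)) (v-C k) δ≤ (p (N ℕ.⊔ M) (ℕ.m≤n⊔m N M))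

  pairs-many : fromℕ g ≥ (fromℕ 1 - value δ') * fromℕ (a ^ 2) → C k ℕ.* (a ℕ.* a) ℕ.≤ C k ℕ.* g ℕ.+ a ℕ.* a
  pairs-many h =
    let M , p = h (inv (C k)) (inv>0 (C k))
        η , η>0 , L , q = δ>δ'
        m = (N ℕ.⊔ M) ℕ.⊔ L
        N≤m = ℕ.≤-trans (ℕ.m≤m⊔n N M) (ℕ.m≤m⊔n (N ℕ.⊔ M) L)
        M≤m = ℕ.≤-trans (ℕ.m≤n⊔m N M) (ℕ.m≤m⊔n (N ℕ.⊔ M) L)
        δ≤ , _ = at m N≤m
    in subst (λ b → C k ℕ.* b ℕ.≤ C k ℕ.* g ℕ.+ b) (cong (a ℕ.*_) (ℕ.*-identityʳ a))
         (pair-bound (C k) (a ^ 2) g (v k) (ℝ.seq (value δ') m) (v-C k)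
           (ℚ.≤-trans (≤+ (ℚ.<⇒≤ η>0)) (ℚ.≤-trans (q m (ℕ.m≤n⊔m (N ℕ.⊔ M) L)) δ≤)) (p m M≤m))

  module Finish {e : ℕ} (P : Progression e) where
    large : a ℕ.≤ C k ℕ.* ∣ set P ∣ → fromℕ ∣ set P ∣ ≥ value δ * fromℕ a
    large h ε ε>0 = N , λ n n≥ → let δ≤ , _ = at n n≥ in
      ℚ.≤-trans (size-bound (C k) a ∣ set P ∣ (v k) (ℝ.seq (value δ) n) (v-C k) (v≥0 k) δ≤ h) (≤+ (ℚ.<⇒≤ ε>0))

    dense : ∀ c h .⦃ _ : ℕ.NonZero c ⦄ → h ℚ.* ι c ≡ 1ℚ → (k ℕ.+ 2) ℕ.* ∣ set P ∣ ℕ.≤ c ℕ.* ((k ℕ.+ 2) ℕ.* ∣ A ∩ set P ∣) ℕ.+ c ℕ.* ∣ set P ∣ →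
            fromℚ (density A P) ≥ fromℚ h - value ε'
    dense c h hc p ε ε>0 = N , λ n n≥ → let _ , θ≤ = at n n≥ in
      ℚ.≤-trans (ℚ.+-monoʳ-≤ h (ℚ.neg-antimono-≤ θ≤)) (ℚ.≤-trans (density-bound c h (suc k) ∣ A ∩ set P ∣ ∣ set P ∣ ⦃ ∣set∣-nonZero P ⦄ hc
        (subst (λ n → n ℕ.* ∣ set P ∣ ℕ.≤ c ℕ.* (n ℕ.* ∣ A ∩ set P ∣) ℕ.+ c ℕ.* ∣ set P ∣) (ℕ.+-comm k 2) p)) (≤+ (ℚ.<⇒≤ ε>0)))

corollary1p3 :
  Σ[ τ₀ ∈ ℝ⁺ ] Σ[ τ₁ ∈ ℝ⁺-setoid ⟶ₛ ℝ⁺-setoid ] Σ[ τ₂ ∈ ℝ⁺-setoid ⟶ₛ ℝ⁺-setoid ]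
  Σ[ c ∈ ℝ⁺-setoid ⟶ₛ ℝ⁺-setoid ]
    ∀ (ε' δ δ' : ℝ⁺) →
    fromℕ 1 > value ε' → value ε' > value δ → value δ > value δ' →
    value ε' ≤ value τ₀ → value δ ≤ value (τ₁ ⟨$⟩ ε') → value δ' ≤ value (τ₂ ⟨$⟩ δ) →
    ∀ (A : FinSet ℤ) → Nonempty A →
    (∃[ Γ ] Γ ⊆ (A ⊗ A)
          × fromℕ ∣ Γ ∣ ≥ (fromℕ 1 - value δ') * fromℕ (∣ A ∣ ^ 2)
          × fromℕ ∣ sumsetAlong Γ ∣ ≤ (fromℕ 4 + value δ) * fromℕ ∣ A ∣) →
    (Σ[ P ∈ Progression 1 ]
        fromℕ ∣ set P ∣ ≥ value (c ⟨$⟩ δ) * fromℕ ∣ A ∣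
      × fromℚ (density A P) ≥ fromℚ ½ - value ε')
    ⊎
    (Σ[ Q ∈ Progression 2 ] Proper Q
      × fromℕ ∣ set Q ∣ ≥ value (c ⟨$⟩ δ) * fromℕ ∣ A ∣
      × fromℚ (density A Q) ≥ fromℕ 1 - value ε')
corollary1p3 = mkℝ⁺ (fromℕ 1) (1ℚ , ℚ.positive⁻¹ 1ℚ , 0 , λ _ _ → ℚ.≤-refl) , threshold , Identity.function ℝ⁺-setoid , Identity.function ℝ⁺-setoid ,
  λ { ε' δ δ' _ _ δ>δ' _ δ≤τ₁ _ A nonempty (Γ , Γ⊆ , Γ-big , S-small) →
    let k , N , at = level ε' δ δ≤τ₁
        open Given ε' δ δ' δ>δ' k N at A Γ
    in [ (λ (P , c) → inj₁ (P , Finish.large P (Conclusion.large c) , Finish.dense P 2 ½ refl (Conclusion.dense c)))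
       , (λ (Q , proper , c) → inj₂ (Q , proper , Finish.large Q (Conclusion.large c) , Finish.dense Q 1 1ℚ refl (Conclusion.dense c))) ]′
       (Finite.theorem k A Γ Γ⊆ (pairs-many Γ-big) (sumset-small S-small) nonempty) }
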